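{- Let $t$ be any finite rooted planar tree with at least one edge, let $q\ge1$ be an integer, and let $a$ be an integer coprime to $q$. Then there are infinitely many positive integers $n$ with $n\equiv a\pmod q$ and $t(n)=t$.
   Context: Every integer $n\ge 1$ is assigned a finite rooted planar tree $t(n)$: $t(1)$ is the single-vertex tree; if $n=p_1^{a_1}\cdots p_s^{a_s}$ with primes $p_1<\dots<p_s$ and $a_i\ge1$, then $t(n)$ consists of a root with $s$ edges to children, ordered left to right, the $i$-th edge leading to a copy of $t(a_i)$ rooted at that child. Every finite rooted planar tree arises as $t(n)$ for some $n$. -}

module Defs where

open import Data.Nat using (ℕ; _<_; _≤_; _^_; _*_)
open import Data.Nat.Primality using (Prime)
open import Data.List using (List; []; _∷_)

data Tree : Set where
  node : List Tree → Tree

data HasEdge : Tree → Set where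
  hasEdge : ∀ s ss → HasEdge (node (s ∷ ss))

mutual
  -- Factorization m b ts : m = p₁^a₁ ⋯ pₛ^aₛ with primes b < p₁ < ⋯ < pₛ,
  -- every aᵢ ≥ 1, and ts = [t(a₁), …, t(aₛ)] (in this order).
  data Factorization : ℕ → ℕ → List Tree → Set where
    [] : ∀ {b} → Factorization 1 b []
    cons : ∀ {b p a m s ts} → Prime p → b < p → 1 ≤ a →
           IsTreeOf a s → Factorization m p ts →
           Factorization (p ^ a * m) b (s ∷ ts)

  -- IsTreeOf n t  means  t(n) = t  (the tree assigned to n in the paper).
  -- Since prime factorization is unique, t(n) is well defined and this
  -- relation is the graph of the function n ↦ t(n) on n ≥ 1.
  data IsTreeOf : ℕ → Tree → Set where
    tree : ∀ {n ts} → Factorization n 0 ts → IsTreeOf n (node ts)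

{-# OPTIONS --safe #-}
{- Everything rests on Dirichlet's theorem: given primes in prescribed classes, the first prime of n is taken
≡ a with exponent ≡ 1 modulo the order of a, and all the other primes are taken ≡ 1.

Dirichlet's theorem is proved over ℚ with finite sums only. The logarithm is replaced by an exactly additive
rational approximation L of log₂, and Λ is defined from L by Möbius inversion. Chebyshev's and Mertens' estimates
and Selberg's formula Λ₂ = Λ L + Λ ∗ Λ = μ ∗ L² give in each class c coprime to q
    Σ_{n ≤ x, n ≡ c} Λ₂(n) / n = ν L(x)² + O(L(x)),   ν = 1 / φ(q).
Averaging over x = 2ʲ with weights rʲ / k, r = 1 − 1/k, replaces the sharp cutoff by the submultiplicative weight
r^⌊log₂ n⌋. For the weighted masses X c = Σ_{n ≡ c} r^⌊log₂ n⌋ Λ(n) / n this yields, up to errors small compared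
with k and k²: X c ≤ 2 ν k, Σ X c ≤ k, and Θ c = Σ_{ab ≡ c} X a X b ≥ 2 ν k² in every class c with X c small.

If the class l contains no prime beyond N, then X l ≈ 0, so the lower bound for Θ l forces, for ab ≡ l, that
X b ≈ 2 ν k unless X a ≈ 0. Hence every X a is close to 0 or to 2 ν k, and comparing with Θ in the other classes
the heavy ones are exactly those where some real character χ takes the value −1. Then Σ χ(n) Λ(n) / n is
unbounded; but it is O(1), since the explicit lower bound for Σ χ(n) / n obtained from the squares in
1 ∗ χ ≥ 0 gives Σ χ(n) Λ(n) / n · Σ χ(n) / n = O(1). -}
module Submission where

open import Data.Empty using (⊥; ⊥-elim)
import Data.Fin.Base as Fin
import Data.Fin.Properties as Finₚ
import Data.Integer.Base as ℤ
import Data.Integer.DivMod as ℤ÷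
import Data.Integer.Divisibility as ℤ∣
import Data.Integer.Divisibility.Signed as ℤ∣ₛ
import Data.Integer.Properties as ℤₚ
import Data.Integer.Tactic.RingSolver as ℤ-Solver
open import Data.List.Base using (List; []; _∷_; _++_; map)
import Data.List.Properties as Listₚ
import Data.List.Relation.Binary.Permutation.Propositional.Properties as ↭
open import Data.List.Relation.Unary.All as All using (All)
import Data.List.Relation.Unary.All.Properties as Allₚ
open import Data.Maybe.Base using (Maybe; just; nothing)
open import Data.Nat.Base as ℕ using (ℕ; zero; suc; z≤n; s≤s)
open import Data.Nat.Coprimality as Coprime using (Coprime; coprime?)
import Data.Nat.DivMod as ℕ÷
import Data.Nat.Divisibility as ∣
open import Data.Nat.Divisibility using (_∣_; _∣?_; divides)
open import Data.Nat.GCD using (module Bézout)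
open import Data.Nat.Induction using (<-rec)
open import Data.Nat.ListAction using (sum; product)
import Data.Nat.ListAction.Properties as ListAction
open import Data.Nat.Primality using (Prime; prime?; euclidsLemma; prime⇒irreducible; prime⇒nonZero; prime⇒nonTrivial; ¬prime[1]; prime[2])
open import Data.Nat.Primality.Factorisation using (PrimeFactorisation; factorise; factors; factorisationUnique)
import Data.Nat.Properties as ℕₚ
open import Data.Nat.Tactic.RingSolver using () renaming (solve-∀ to solve-ℕ)
open import Data.Product.Base using (Σ; ∃; _×_; _,_; proj₁; proj₂)
open import Data.Rational.Base
open import Data.Rational.Properties
import Data.Rational.Unnormalised.Base as ℚᵘ
import Data.Rational.Unnormalised.Properties as ℚᵘₚ
open import Data.Sum.Base using (_⊎_; inj₁; inj₂)
open import Defs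
open import Function.Base using (_∋_)
open import Level using (0ℓ)
open import Relation.Binary.PropositionalEquality hiding (J; [_])
open import Relation.Nullary using (¬_; Dec; yes; no)
open import Relation.Nullary.Decidable using (_→-dec_; _×-dec_)
open import Tactic.RingSolver using (solve; solve-∀)
open import Tactic.RingSolver.Core.AlmostCommutativeRing using (AlmostCommutativeRing; fromCommutativeRing)
open Bézout.Identity using (+-; -+)

-- The ceiling 2 ν k is twice the expected share ν k because Selberg's formula controls only the sum
-- of Λ L and Λ ∗ Λ: once the convolution is dropped, a class may carry double mass while another
-- carries none. This parity alternative is the whole obstruction. A real character is its exact
-- form, so complex characters never enter, and it can only be excluded by a quantitative lower
-- bound for Σ χ(n)/n. Exact additivity of L is indispensable since μ ∗ L and μ ∗ L² must be
-- arithmetic identities. Regularity of L matters only below B, because the contradiction is reached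
-- under one explicit bound; the same bound turns the existence of a prime into a decidable finite
-- search. The exponent of the first prime has to be ≡ 1 modulo the order of a: a leaf child admits
-- only the exponent 1, while any other child can be realised by an exponent ≡ 1 by applying the
-- theorem itself to the smaller tree.

ring : AlmostCommutativeRing 0ℓ 0ℓ
ring = fromCommutativeRing +-*-commutativeRing isZero
  where
  isZero : ∀ x → Maybe (0ℚ ≡ x)
  isZero x with 0ℚ ≟ x
  ... | yes p = just p
  ... | no _ = nothing

-- Ordered arithmetic in ℚ, the embedding of ℕ and reciprocals

infixl 6 _⊕_
infixr 7 _·≤_

_⊕_ : ∀ {a b c d} → a ≤ b → c ≤ d → a + c ≤ b + d
_⊕_ = +-mono-≤

_·≤_ : ∀ {a b c} → 0ℚ ≤ c → a ≤ b → c * a ≤ c * b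
_·≤_ {c = c} 0≤c = *-monoˡ-≤-nonNeg c {{nonNegative 0≤c}}

-- Linear arithmetic by certificate: A ≤ B is a combination of hypotheses whose difference is b − a, with terms moved so that a ring identity remains.
lin : ∀ {a b A B} → A ≤ B → b + A ≡ a + B → a ≤ b
lin {a} {b} {A} {B} A≤B eq = ≤-trans (≤-reflexive (((∀ a A → a ≡ a + A + - A) ∋ solve-∀ ring) a A))
  (≤-trans (+-monoˡ-≤ (- A) (+-monoʳ-≤ a A≤B))
  (≤-reflexive (trans (cong (_+ - A) (sym eq)) (((∀ b A → b + A + - A ≡ b) ∋ solve-∀ ring) b A))))

0≤-+ : ∀ {a b} → 0ℚ ≤ a → 0ℚ ≤ b → 0ℚ ≤ a + b
0≤-+ {a} {b} p q = lin (p ⊕ q) (solve (a ∷ b ∷ []) ring)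

0≤-* : ∀ {a b} → 0ℚ ≤ a → 0ℚ ≤ b → 0ℚ ≤ a * b
0≤-* {a} {b} p q = lin (p ·≤ q) (solve (a ∷ b ∷ []) ring)

*-mono : ∀ {a b c d} → 0ℚ ≤ a → a ≤ b → 0ℚ ≤ c → c ≤ d → a * c ≤ b * d
*-mono {a} {b} {c} {d} 0≤a a≤b 0≤c c≤d = lin (≤-trans 0≤a a≤b ·≤ c≤d ⊕ 0≤c ·≤ a≤b) (solve (a ∷ b ∷ c ∷ d ∷ []) ring)

0≤-diff : ∀ {a b} → a ≤ b → 0ℚ ≤ b - a
0≤-diff {a} {b} p = lin p (solve (a ∷ b ∷ []) ring)

0≤1 : 0ℚ ≤ 1ℚ
0≤1 = *≤* (ℤ.+≤+ z≤n)

0≤½ : 0ℚ ≤ ½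
0≤½ = *≤* (ℤ.+≤+ z≤n)

a≤a+b : ∀ {a b} → 0ℚ ≤ b → a ≤ a + b
a≤a+b {a} {b} h = lin h (solve (a ∷ b ∷ []) ring)

b≤a+b : ∀ {a b} → 0ℚ ≤ a → b ≤ a + b
b≤a+b {a} {b} h = lin h (solve (a ∷ b ∷ []) ring)

x≤1⇒xy≤y : ∀ {x y} → x ≤ 1ℚ → 0ℚ ≤ y → x * y ≤ y
x≤1⇒xy≤y {x} {y} p q = ≤-trans (*-monoʳ-≤-nonNeg y {{nonNegative q}} p) (≤-reflexive (*-identityˡ y))

abs≤ : ∀ {a b} → a ≤ b → - a ≤ b → ∣ a ∣ ≤ b
abs≤ {a} p q with ∣p∣≡p∨∣p∣≡-p a
... | inj₁ e = ≤-trans (≤-reflexive e) p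
... | inj₂ e = ≤-trans (≤-reflexive e) q

≤abs : ∀ a → a ≤ ∣ a ∣
≤abs a with ≤-total 0ℚ a
... | inj₁ p = ≤-reflexive (sym (0≤p⇒∣p∣≡p p))
... | inj₂ p = ≤-trans p (0≤∣p∣ a)

-≤abs : ∀ a → - a ≤ ∣ a ∣
-≤abs a = ≤-trans (≤abs (- a)) (≤-reflexive (∣-p∣≡∣p∣ a))

abs-upper : ∀ {a b} → ∣ a ∣ ≤ b → a ≤ b
abs-upper {a} p = ≤-trans (≤abs a) p

ι : ℕ → ℚ
ι zero = 0ℚ
ι (suc n) = ι n + 1ℚ

ι-+ : ∀ m n → ι (m ℕ.+ n) ≡ ι m + ι n
ι-+ zero n = sym (+-identityˡ (ι n))
ι-+ (suc m) n = trans (cong (_+ 1ℚ) (ι-+ m n)) (((∀ a b → a + b + 1ℚ ≡ a + 1ℚ + b) ∋ solve-∀ ring) (ι m) (ι n))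

ι-* : ∀ m n → ι (m ℕ.* n) ≡ ι m * ι n
ι-* zero n = sym (*-zeroˡ (ι n))
ι-* (suc m) n = trans (ι-+ n (m ℕ.* n)) (trans (cong (ι n +_) (ι-* m n)) (((∀ a b → b + a * b ≡ (a + 1ℚ) * b) ∋ solve-∀ ring) (ι m) (ι n)))

0≤ι : ∀ n → 0ℚ ≤ ι n
0≤ι zero = ≤-refl
0≤ι (suc n) = 0≤-+ (0≤ι n) 0≤1

ι-mono : ∀ {m n} → m ℕ.≤ n → ι m ≤ ι n
ι-mono {n = n} z≤n = 0≤ι n
ι-mono (s≤s p) = ι-mono p ⊕ ≤-refl

1≤ι : ∀ {n} → 1 ℕ.≤ n → 1ℚ ≤ ι n
1≤ι {n} p = ι-mono {1} {n} p

0<ι-suc : ∀ n → 0ℚ < ι (suc n)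
0<ι-suc n = <-≤-trans (*<* (ℤ.+<+ (s≤s z≤n))) (lin {1ℚ} {ι n + 1ℚ} (0≤ι n) (((∀ a → a + 1ℚ + 0ℚ ≡ 1ℚ + a) ∋ solve-∀ ring) (ι n)))

inv : ℕ → ℚ
inv zero = 0ℚ
inv (suc n) = 1/_ (ι (suc n)) {{>-nonZero (0<ι-suc n)}}

ι-inv : ∀ {n} → 1 ℕ.≤ n → ι n * inv n ≡ 1ℚ
ι-inv {suc n} _ = *-inverseʳ (ι (suc n)) {{>-nonZero (0<ι-suc n)}}

cancel-ι : ∀ {n a b} → 1 ℕ.≤ n → ι n * a ≡ ι n * b → a ≡ b
cancel-ι {n} {a} {b} p e = begin
  a                 ≡⟨ *-identityˡ a ⟨
  1ℚ * a            ≡⟨ cong (_* a) (ι-inv p) ⟨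
  ι n * inv n * a   ≡⟨ ((∀ x y a → x * y * a ≡ y * (x * a)) ∋ solve-∀ ring) (ι n) (inv n) a ⟩
  inv n * (ι n * a) ≡⟨ cong (inv n *_) e ⟩
  inv n * (ι n * b) ≡⟨ ((∀ x y a → y * (x * a) ≡ x * y * a) ∋ solve-∀ ring) (ι n) (inv n) b ⟩
  ι n * inv n * b   ≡⟨ cong (_* b) (ι-inv p) ⟩
  1ℚ * b            ≡⟨ *-identityˡ b ⟩
  b                 ∎
  where open ≡-Reasoning

cancel-ι-≤ : ∀ {n a b} → 1 ℕ.≤ n → ι n * a ≤ ι n * b → a ≤ b
cancel-ι-≤ {suc n} {a} {b} p = *-cancelˡ-≤-pos (ι (suc n)) {{positive (0<ι-suc n)}}

0≤inv : ∀ n → 0ℚ ≤ inv n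
0≤inv zero = ≤-refl
0≤inv (suc n) = cancel-ι-≤ {suc n} (s≤s z≤n) (≤-trans (≤-reflexive (*-zeroʳ (ι (suc n)))) (≤-trans 0≤1 (≤-reflexive (sym (ι-inv {suc n} (s≤s z≤n))))))

inv-* : ∀ m n → inv (m ℕ.* n) ≡ inv m * inv n
inv-* zero n = sym (*-zeroˡ (inv n))
inv-* (suc m) zero = trans (cong inv (ℕₚ.*-zeroʳ m)) (sym (*-zeroʳ (inv (suc m))))
inv-* (suc m) (suc n) = cancel-ι {suc m ℕ.* suc n} (s≤s z≤n) (begin
  ι (suc m ℕ.* suc n) * inv (suc m ℕ.* suc n)         ≡⟨ ι-inv {suc m ℕ.* suc n} (s≤s z≤n) ⟩
  1ℚ * 1ℚ                                             ≡⟨ cong₂ _*_ (ι-inv {suc m} (s≤s z≤n)) (ι-inv {suc n} (s≤s z≤n)) ⟨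
  (ι (suc m) * inv (suc m)) * (ι (suc n) * inv (suc n)) ≡⟨ ((∀ a b c d → (a * b) * (c * d) ≡ a * c * (b * d)) ∋ solve-∀ ring) (ι (suc m)) (inv (suc m)) (ι (suc n)) (inv (suc n)) ⟩
  ι (suc m) * ι (suc n) * (inv (suc m) * inv (suc n)) ≡⟨ cong (_* (inv (suc m) * inv (suc n))) (ι-* (suc m) (suc n)) ⟨
  ι (suc m ℕ.* suc n) * (inv (suc m) * inv (suc n))   ∎)
  where open ≡-Reasoning

inv-anti : ∀ {m n} → 1 ℕ.≤ m → m ℕ.≤ n → inv n ≤ inv m
inv-anti {m} {n} p m≤n = lin (0≤-* (0≤inv m) (0≤inv n) ·≤ ι-mono m≤n) (begin
  inv m + inv m * inv n * ι m ≡⟨ ((∀ a b c → a + a * b * c ≡ a + c * a * b) ∋ solve-∀ ring) (inv m) (inv n) (ι m) ⟩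
  inv m + ι m * inv m * inv n ≡⟨ cong₂ (λ x y → x + y * inv n) (sym (*-identityʳ (inv m))) (ι-inv p) ⟩
  inv m * 1ℚ + 1ℚ * inv n     ≡⟨ cong (λ x → inv m * x + 1ℚ * inv n) (ι-inv (ℕₚ.≤-trans p m≤n)) ⟨
  inv m * (ι n * inv n) + 1ℚ * inv n ≡⟨ ((∀ a b c → a * (c * b) + 1ℚ * b ≡ b + a * b * c) ∋ solve-∀ ring) (inv m) (inv n) (ι n) ⟩
  inv n + inv m * inv n * ι n ∎)
  where open ≡-Reasoning

inv≤1 : ∀ n → inv n ≤ 1ℚ
inv≤1 zero = 0≤1
inv≤1 (suc n) = inv-anti {1} {suc n} (s≤s z≤n) (s≤s z≤n)

infixr 7 _·≡_

_·≡_ : ∀ c {a b} → a ≡ b → c * a ≤ c * b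
c ·≡ e = ≤-reflexive (cong (c *_) e)

lin≡ : ∀ {a b A B} → A ≡ B → b + A ≡ a + B → a ≡ b
lin≡ A≡B eq = ≤-antisym (lin (≤-reflexive A≡B) eq) (lin (≤-reflexive (sym A≡B)) (sym eq))

∣0∣≤ : ∀ {a b} → a ≡ 0ℚ → 0ℚ ≤ b → ∣ a ∣ ≤ b
∣0∣≤ refl p = p

abs-sum : ∀ {a b A B} → ∣ a ∣ ≤ A → ∣ b ∣ ≤ B → ∣ a + b ∣ ≤ A + B
abs-sum {a} {b} p q = ≤-trans (∣p+q∣≤∣p∣+∣q∣ a b) (p ⊕ q)

abs-mul : ∀ {a b A B} → ∣ a ∣ ≤ A → ∣ b ∣ ≤ B → ∣ a * b ∣ ≤ A * B
abs-mul {a} {b} p q = ≤-trans (≤-reflexive (∣p*q∣≡∣p∣*∣q∣ a b)) (*-mono (0≤∣p∣ a) p (0≤∣p∣ b) q)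

abs-nonneg : ∀ {a b} → 0ℚ ≤ a → a ≤ b → ∣ a ∣ ≤ b
abs-nonneg p q = ≤-trans (≤-reflexive (0≤p⇒∣p∣≡p p)) q

abs-resp : ∀ {a b c} → a ≡ b → ∣ a ∣ ≤ c → ∣ b ∣ ≤ c
abs-resp refl p = p

-- Indicators and finite sums

𝟙 : ∀ {p} {P : Set p} → Dec P → ℚ
𝟙 (yes _) = 1ℚ
𝟙 (no _) = 0ℚ

𝟙-yes : ∀ {p} {P : Set p} (d : Dec P) → P → 𝟙 d ≡ 1ℚ
𝟙-yes (yes _) _ = refl
𝟙-yes (no ¬p) p = ⊥-elim (¬p p)

𝟙-no : ∀ {p} {P : Set p} (d : Dec P) → ¬ P → 𝟙 d ≡ 0ℚ
𝟙-no (yes p) ¬p = ⊥-elim (¬p p)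
𝟙-no (no _) _ = refl

𝟙-cong : ∀ {p q} {P : Set p} {Q : Set q} (d : Dec P) (e : Dec Q) → (P → Q) → (Q → P) → 𝟙 d ≡ 𝟙 e
𝟙-cong (yes p) e f g = sym (𝟙-yes e (f p))
𝟙-cong (no ¬p) e f g = sym (𝟙-no e (λ q → ¬p (g q)))

𝟙-mono : ∀ {p q} {P : Set p} {Q : Set q} (d : Dec P) (e : Dec Q) → (P → Q) → 𝟙 d ≤ 𝟙 e
𝟙-mono (yes p) e f = ≤-reflexive (sym (𝟙-yes e (f p)))
𝟙-mono (no ¬p) (yes _) f = 0≤1
𝟙-mono (no ¬p) (no _) f = ≤-refl

0≤𝟙 : ∀ {p} {P : Set p} (d : Dec P) → 0ℚ ≤ 𝟙 d
0≤𝟙 (yes _) = 0≤1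
0≤𝟙 (no _) = ≤-refl

𝟙≤1 : ∀ {p} {P : Set p} (d : Dec P) → 𝟙 d ≤ 1ℚ
𝟙≤1 (yes _) = ≤-refl
𝟙≤1 (no _) = 0≤1

𝟙-when : ∀ {p} {P : Set p} (d : Dec P) {a b : ℚ} → (P → a ≡ b) → 𝟙 d * a ≡ 𝟙 d * b
𝟙-when (yes p) e = cong (1ℚ *_) (e p)
𝟙-when (no _) {a} {b} e = trans (*-zeroˡ a) (sym (*-zeroˡ b))

0≤-sq : ∀ x → 0ℚ ≤ x * x
0≤-sq x with ≤-total 0ℚ x
... | inj₁ p = 0≤-* p p
... | inj₂ p = ≤-trans (0≤-* (neg-antimono-≤ p) (neg-antimono-≤ p)) (≤-reflexive (((∀ x → - x * - x ≡ x * x) ∋ solve-∀ ring) x))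

∑From : ℕ → ℕ → (ℕ → ℚ) → ℚ
∑From a zero f = 0ℚ
∑From a (suc n) f = ∑From a n f + f (a ℕ.+ n)

∑ ∑₁ : ℕ → (ℕ → ℚ) → ℚ
∑ = ∑From 0
∑₁ = ∑From 1

module _ {a : ℕ} where

  ∑-cong : ∀ n {f g} → (∀ i → i ℕ.< n → f (a ℕ.+ i) ≡ g (a ℕ.+ i)) → ∑From a n f ≡ ∑From a n g
  ∑-cong zero h = refl
  ∑-cong (suc n) h = cong₂ _+_ (∑-cong n (λ i p → h i (ℕₚ.m<n⇒m<1+n p))) (h n ℕₚ.≤-refl)

  ∑-mono : ∀ n {f g} → (∀ i → i ℕ.< n → f (a ℕ.+ i) ≤ g (a ℕ.+ i)) → ∑From a n f ≤ ∑From a n g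
  ∑-mono zero h = ≤-refl
  ∑-mono (suc n) h = ∑-mono n (λ i p → h i (ℕₚ.m<n⇒m<1+n p)) ⊕ h n ℕₚ.≤-refl

  ∑-0 : ∀ n → ∑From a n (λ _ → 0ℚ) ≡ 0ℚ
  ∑-0 zero = refl
  ∑-0 (suc n) = trans (+-identityʳ (∑From a n (λ _ → 0ℚ))) (∑-0 n)

  ∑-≡0 : ∀ n {f} → (∀ i → i ℕ.< n → f (a ℕ.+ i) ≡ 0ℚ) → ∑From a n f ≡ 0ℚ
  ∑-≡0 n h = trans (∑-cong n h) (∑-0 n)

  ∑-≥0 : ∀ n {f} → (∀ i → i ℕ.< n → 0ℚ ≤ f (a ℕ.+ i)) → 0ℚ ≤ ∑From a n f
  ∑-≥0 n h = ≤-trans (≤-reflexive (sym (∑-0 n))) (∑-mono n h)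

  ∑-+ : ∀ n (f g : ℕ → ℚ) → ∑From a n (λ i → f i + g i) ≡ ∑From a n f + ∑From a n g
  ∑-+ zero f g = refl
  ∑-+ (suc n) f g = trans (cong (_+ (f (a ℕ.+ n) + g (a ℕ.+ n))) (∑-+ n f g))
    (((∀ a b c d → a + b + (c + d) ≡ a + c + (b + d)) ∋ solve-∀ ring) (∑From a n f) (∑From a n g) (f (a ℕ.+ n)) (g (a ℕ.+ n)))

  ∑-*ˡ : ∀ n c (f : ℕ → ℚ) → ∑From a n (λ i → c * f i) ≡ c * ∑From a n f
  ∑-*ˡ zero c f = sym (*-zeroʳ c)
  ∑-*ˡ (suc n) c f = trans (cong (_+ c * f (a ℕ.+ n)) (∑-*ˡ n c f)) (sym (*-distribˡ-+ c (∑From a n f) (f (a ℕ.+ n))))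

  ∑-*ʳ : ∀ n c (f : ℕ → ℚ) → ∑From a n (λ i → f i * c) ≡ ∑From a n f * c
  ∑-*ʳ n c f = trans (∑-cong n (λ i _ → *-comm (f (a ℕ.+ i)) c)) (trans (∑-*ˡ n c f) (*-comm c (∑From a n f)))

  ∑-neg : ∀ n (f : ℕ → ℚ) → ∑From a n (λ i → - f i) ≡ - ∑From a n f
  ∑-neg zero f = refl
  ∑-neg (suc n) f = trans (cong (_+ - f (a ℕ.+ n)) (∑-neg n f)) (sym (neg-distrib-+ (∑From a n f) (f (a ℕ.+ n))))

  ∑-sub : ∀ n (f g : ℕ → ℚ) → ∑From a n (λ i → f i - g i) ≡ ∑From a n f - ∑From a n g
  ∑-sub n f g = trans (∑-+ n f (λ i → - g i)) (cong (∑From a n f +_) (∑-neg n g))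

  ∑-swap : ∀ {b} m n (f : ℕ → ℕ → ℚ) → ∑From a m (λ i → ∑From b n (f i)) ≡ ∑From b n (λ j → ∑From a m (λ i → f i j))
  ∑-swap {b} m zero f = ∑-0 m
  ∑-swap {b} m (suc n) f = trans (∑-+ m (λ i → ∑From b n (f i)) (λ i → f i (b ℕ.+ n))) (cong (_+ ∑From a m (λ i → f i (b ℕ.+ n))) (∑-swap m n f))

  ∑-abs : ∀ n (f : ℕ → ℚ) → ∣ ∑From a n f ∣ ≤ ∑From a n (λ i → ∣ f i ∣)
  ∑-abs zero f = ≤-refl
  ∑-abs (suc n) f = abs-sum (∑-abs n f) ≤-refl

  ∑-abs≤ : ∀ n {f g : ℕ → ℚ} → (∀ i → i ℕ.< n → ∣ f (a ℕ.+ i) ∣ ≤ g (a ℕ.+ i)) → ∣ ∑From a n f ∣ ≤ ∑From a n g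
  ∑-abs≤ n {f} h = ≤-trans (∑-abs n f) (∑-mono n h)

  ∑-const : ∀ n c → ∑From a n (λ _ → c) ≡ ι n * c
  ∑-const zero c = sym (*-zeroˡ c)
  ∑-const (suc n) c = trans (cong (_+ c) (∑-const n c)) (((∀ a c → a * c + c ≡ (a + 1ℚ) * c) ∋ solve-∀ ring) (ι n) c)

  ∑-tele : ∀ n (f : ℕ → ℚ) → ∑From a n (λ i → f (suc i) - f i) ≡ f (a ℕ.+ n) - f a
  ∑-tele zero f = trans (sym (+-inverseʳ (f a))) (cong (λ k → f k - f a) (sym (ℕₚ.+-identityʳ a)))
  ∑-tele (suc n) f = trans (cong (_+ (f (suc (a ℕ.+ n)) - f (a ℕ.+ n))) (∑-tele n f))
    (trans (((∀ a b c → a - b + (c - a) ≡ c - b) ∋ solve-∀ ring) (f (a ℕ.+ n)) (f a) (f (suc (a ℕ.+ n)))) (cong (λ k → f k - f a) (sym (ℕₚ.+-suc a n))))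

  ∑-split : ∀ m n (f : ℕ → ℚ) → ∑From a (m ℕ.+ n) f ≡ ∑From a m f + ∑From (a ℕ.+ m) n f
  ∑-split m zero f = trans (cong (λ k → ∑From a k f) (ℕₚ.+-identityʳ m)) (sym (+-identityʳ (∑From a m f)))
  ∑-split m (suc n) f = trans (cong (λ k → ∑From a k f) (ℕₚ.+-suc m n))
    (trans (cong₂ _+_ (∑-split m n f) (cong f (sym (ℕₚ.+-assoc a m n)))) (+-assoc (∑From a m f) (∑From (a ℕ.+ m) n f) (f (a ℕ.+ m ℕ.+ n))))

  ∑-shift : ∀ n (f : ℕ → ℚ) → ∑From a n f ≡ ∑ n (λ i → f (a ℕ.+ i))
  ∑-shift zero f = refl
  ∑-shift (suc n) f = cong (_+ f (a ℕ.+ n)) (∑-shift n f)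

  ∑-extend : ∀ {m n} {f : ℕ → ℚ} → m ℕ.≤ n → (∀ i → a ℕ.+ m ℕ.≤ i → i ℕ.< a ℕ.+ n → f i ≡ 0ℚ) → ∑From a m f ≡ ∑From a n f
  ∑-extend {m} {n} {f} m≤n h = begin
    ∑From a m f                                   ≡⟨ +-identityʳ (∑From a m f) ⟨
    ∑From a m f + 0ℚ                              ≡⟨ cong (∑From a m f +_) (trans (∑-shift′ (n ℕ.∸ m)) (∑-zero (n ℕ.∸ m) (λ i p → h (a ℕ.+ m ℕ.+ i) (ℕₚ.m≤m+n (a ℕ.+ m) i) (bound i p)))) ⟨
    ∑From a m f + ∑From (a ℕ.+ m) (n ℕ.∸ m) f     ≡⟨ ∑-split m (n ℕ.∸ m) f ⟨
    ∑From a (m ℕ.+ (n ℕ.∸ m)) f                   ≡⟨ cong (λ k → ∑From a k f) (ℕₚ.m+[n∸m]≡n m≤n) ⟩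
    ∑From a n f                                   ∎
    where
    open ≡-Reasoning
    bound : ∀ i → i ℕ.< n ℕ.∸ m → a ℕ.+ m ℕ.+ i ℕ.< a ℕ.+ n
    bound i p = subst (ℕ._< a ℕ.+ n) (sym (ℕₚ.+-assoc a m i)) (ℕₚ.+-monoʳ-< a (subst (m ℕ.+ i ℕ.<_) (ℕₚ.m+[n∸m]≡n m≤n) (ℕₚ.+-monoʳ-< m p)))
    ∑-shift′ : ∀ k → ∑From (a ℕ.+ m) k f ≡ ∑ k (λ i → f (a ℕ.+ m ℕ.+ i))
    ∑-shift′ zero = refl
    ∑-shift′ (suc k) = cong (_+ f (a ℕ.+ m ℕ.+ k)) (∑-shift′ k)
    ∑-zero : ∀ k {g : ℕ → ℚ} → (∀ i → i ℕ.< k → g i ≡ 0ℚ) → ∑ k g ≡ 0ℚ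
    ∑-zero zero _ = refl
    ∑-zero (suc k) q = cong₂ _+_ (∑-zero k (λ i p → q i (ℕₚ.m<n⇒m<1+n p))) (q k ℕₚ.≤-refl)

  ∑-extend-≤ : ∀ {m n} {f : ℕ → ℚ} → m ℕ.≤ n → (∀ i → i ℕ.< n → 0ℚ ≤ f (a ℕ.+ i)) → ∑From a m f ≤ ∑From a n f
  ∑-extend-≤ {m} {zero} z≤n h = ≤-refl
  ∑-extend-≤ {m} {suc n} {f} m≤n h with m ℕₚ.≟ suc n
  ... | yes refl = ≤-refl
  ... | no m≢n = lin (∑-extend-≤ {m} {n} {f} (ℕ.s≤s⁻¹ (ℕₚ.≤∧≢⇒< m≤n m≢n)) (λ i p → h i (ℕₚ.m<n⇒m<1+n p)) ⊕ h n ℕₚ.≤-refl)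
    (((∀ x y z → y + z + (x + 0ℚ) ≡ x + (y + z)) ∋ solve-∀ ring) (∑From a m f) (∑From a n f) (f (a ℕ.+ n)))

∑-point : ∀ n a (g : ℕ → ℚ) → a ℕ.< n → ∑ n (λ i → 𝟙 (a ℕₚ.≟ i) * g i) ≡ g a
∑-point (suc n) a g p with a ℕₚ.≟ n
... | yes refl = trans (cong₂ _+_ (∑-≡0 n (λ i q → trans (cong (_* g i) (𝟙-no (a ℕₚ.≟ i) (ℕₚ.>⇒≢ q))) (*-zeroˡ (g i)))) (*-identityˡ (g a))) (+-identityˡ (g a))
... | no a≢n = trans (cong₂ _+_ (∑-point n a g (ℕₚ.≤∧≢⇒< (ℕ.s≤s⁻¹ p) a≢n)) (*-zeroˡ (g n))) (+-identityʳ (g a))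

∑-single : ∀ n {f : ℕ → ℚ} a → a ℕ.< n → (∀ i → i ℕ.< n → i ≢ a → f i ≡ 0ℚ) → ∑ n f ≡ f a
∑-single n {f} a p h = trans (∑-cong n λ i q → lemma i q (a ℕₚ.≟ i)) (∑-point n a f p)
  where
  lemma : ∀ i → i ℕ.< n → (d : Dec (a ≡ i)) → f i ≡ 𝟙 (a ℕₚ.≟ i) * f i
  lemma i q (yes refl) = sym (trans (cong (_* f i) (𝟙-yes (a ℕₚ.≟ i) refl)) (*-identityˡ (f i)))
  lemma i q (no ¬e) = trans (h i q (λ e → ¬e (sym e))) (sym (trans (cong (_* f i) (𝟙-no (a ℕₚ.≟ i) ¬e)) (*-zeroˡ (f i))))

∑-term≤ : ∀ n {f : ℕ → ℚ} a → a ℕ.< n → (∀ i → i ℕ.< n → 0ℚ ≤ f i) → f a ≤ ∑ n f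
∑-term≤ n {f} a p h = ≤-trans (≤-reflexive (sym (∑-point n a f p)))
  (∑-mono n (λ i q → lin (h i q ·≤ 𝟙≤1 (a ℕₚ.≟ i)) (((∀ x y → x + x * y ≡ y * x + x * 1ℚ) ∋ solve-∀ ring) (f i) (𝟙 (a ℕₚ.≟ i)))))

∑₁-cong : ∀ x {f g} → (∀ n → 1 ℕ.≤ n → n ℕ.≤ x → f n ≡ g n) → ∑₁ x f ≡ ∑₁ x g
∑₁-cong x h = ∑-cong x (λ i p → h (suc i) (s≤s z≤n) p)

∑₁-mono : ∀ x {f g} → (∀ n → 1 ℕ.≤ n → n ℕ.≤ x → f n ≤ g n) → ∑₁ x f ≤ ∑₁ x g
∑₁-mono x h = ∑-mono x (λ i p → h (suc i) (s≤s z≤n) p)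

∑₁-≥0 : ∀ x {f} → (∀ n → 1 ℕ.≤ n → n ℕ.≤ x → 0ℚ ≤ f n) → 0ℚ ≤ ∑₁ x f
∑₁-≥0 x h = ∑-≥0 x (λ i p → h (suc i) (s≤s z≤n) p)

∑₁-≡0 : ∀ x {f} → (∀ n → 1 ℕ.≤ n → n ℕ.≤ x → f n ≡ 0ℚ) → ∑₁ x f ≡ 0ℚ
∑₁-≡0 x h = ∑-≡0 x (λ i p → h (suc i) (s≤s z≤n) p)

∑₁-abs≤ : ∀ x {f g} → (∀ n → 1 ℕ.≤ n → n ℕ.≤ x → ∣ f n ∣ ≤ g n) → ∣ ∑₁ x f ∣ ≤ ∑₁ x g
∑₁-abs≤ x h = ∑-abs≤ x (λ i p → h (suc i) (s≤s z≤n) p)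

∑₁-extend : ∀ {x y f} → x ℕ.≤ y → (∀ n → x ℕ.< n → n ℕ.≤ y → f n ≡ 0ℚ) → ∑₁ x f ≡ ∑₁ y f
∑₁-extend p h = ∑-extend p (λ i q r → h i q (ℕ.s≤s⁻¹ r))

∑₁-extend-≤ : ∀ {x y f} → x ℕ.≤ y → (∀ n → 1 ℕ.≤ n → n ℕ.≤ y → 0ℚ ≤ f n) → ∑₁ x f ≤ ∑₁ y f
∑₁-extend-≤ {f = f} p h = ∑-extend-≤ {f = f} p (λ i r → h (suc i) (s≤s z≤n) r)

∑₁-point : ∀ x a (g : ℕ → ℚ) → 1 ℕ.≤ a → ∑₁ x (λ n → 𝟙 (a ℕₚ.≟ n) * g n) ≡ 𝟙 (a ℕₚ.≤? x) * g a
∑₁-point x (suc a) g _ with suc a ℕₚ.≤? x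
... | yes p = trans (∑-shift x _) (trans (∑-cong x (λ i _ → cong (_* g (suc i)) (𝟙-cong (suc a ℕₚ.≟ suc i) (a ℕₚ.≟ i) ℕₚ.suc-injective (cong suc))))
  (trans (∑-point x a (λ i → g (suc i)) p) (sym (*-identityˡ (g (suc a))))))
... | no ¬p = trans (∑₁-≡0 x (λ n _ q → trans (cong (_* g n) (𝟙-no (suc a ℕₚ.≟ n) (λ { refl → ¬p q }))) (*-zeroˡ (g n)))) (sym (*-zeroˡ (g (suc a))))

-- The boundary term is taken at suc x to avoid a predecessor.
abel : ∀ x (a u : ℕ → ℚ) → ∑₁ x (λ n → a n * u n) ≡ ∑₁ x a * u (suc x) - ∑₁ x (λ n → ∑₁ n a * (u (suc n) - u n))
abel zero a u = sym (trans (+-identityʳ (0ℚ * u 1)) (*-zeroˡ (u 1)))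
abel (suc x) a u = trans (cong (_+ a (suc x) * u (suc x)) (abel x a u))
  (((∀ A u R a u' → A * u - R + a * u ≡ (A + a) * u' - (R + (A + a) * (u' - u))) ∋ solve-∀ ring)
    (∑₁ x a) (u (suc x)) (∑₁ x (λ n → ∑₁ n a * (u (suc n) - u n))) (a (suc x)) (u (suc (suc x))))

-- Summation by parts leaves K times the boundary value of u and K times its total variation; the
-- majorant V absorbs both, since its decrements telescope to V 1 - V (suc x).
abel-bound : ∀ x (a u V : ℕ → ℚ) K → 0ℚ ≤ K → (∀ n → n ℕ.≤ x → ∣ ∑₁ n a ∣ ≤ K) → ∣ u (suc x) ∣ ≤ V (suc x) →
  (∀ n → 1 ℕ.≤ n → n ℕ.≤ x → ∣ u (suc n) - u n ∣ ≤ V n - V (suc n)) →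
  ∣ ∑₁ x (λ n → a n * u n) ∣ ≤ K * V 1
abel-bound x a u V K 0≤K A≤K u≤V Δ = abs-resp (sym (abel x a u)) (≤-trans
  (abs-sum (abs-mul (A≤K x ℕₚ.≤-refl) u≤V)
    (≤-trans (≤-reflexive (∣-p∣≡∣p∣ (∑₁ x (λ n → ∑₁ n a * (u (suc n) - u n)))))
      (∑₁-abs≤ x {g = λ n → K * (V n - V (suc n))} (λ n p q → abs-mul (A≤K n q) (Δ n p q)))))
  (≤-reflexive (trans (cong (K * V (suc x) +_) (trans (∑-*ˡ x K (λ n → V n - V (suc n)))
      (cong (K *_) (trans (∑-cong x (λ i _ → ((∀ a b → a - b ≡ - b - (- a)) ∋ solve-∀ ring) (V (suc i)) (V (suc (suc i))))) (∑-tele x (λ n → - V n))))))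
    (((∀ K v w → K * v + K * (- v - (- w)) ≡ K * w) ∋ solve-∀ ring) K (V (suc x)) (V 1)))))

-- Floor division and Dirichlet convolution

infixl 7 _div_

-- A total division, so that sums over divisors d need no non-zero instance for each d.
_div_ : ℕ → ℕ → ℕ
x div zero = 0
x div suc d = x ℕ./ suc d

*-≤⇒≤-div : ∀ x d m → 1 ℕ.≤ d → d ℕ.* m ℕ.≤ x → m ℕ.≤ x div d
*-≤⇒≤-div x (suc d) m _ p = subst (ℕ._≤ x ℕ./ suc d) (ℕ÷.m*n/n≡m m (suc d)) (ℕ÷./-monoˡ-≤ (suc d) (subst (ℕ._≤ x) (ℕₚ.*-comm (suc d) m) p))

div-*-≤ : ∀ x d → d ℕ.* (x div d) ℕ.≤ x
div-*-≤ x zero = z≤n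
div-*-≤ x (suc d) = subst (ℕ._≤ x) (ℕₚ.*-comm (x ℕ./ suc d) (suc d)) (ℕ÷.m/n*n≤m x (suc d))

≤-div⇒*-≤ : ∀ x d m → m ℕ.≤ x div d → d ℕ.* m ℕ.≤ x
≤-div⇒*-≤ x d m p = ℕₚ.≤-trans (ℕₚ.*-monoʳ-≤ d p) (div-*-≤ x d)

div-≤ : ∀ x d → x div d ℕ.≤ x
div-≤ x zero = z≤n
div-≤ x (suc d) = ℕ÷.m/n≤m x (suc d)

<-*-suc-div : ∀ x d → 1 ℕ.≤ d → x ℕ.< d ℕ.* suc (x div d)
<-*-suc-div x d p with x ℕₚ.<? d ℕ.* suc (x div d)
... | yes q = q
... | no ¬q = ⊥-elim (ℕₚ.<-irrefl refl (*-≤⇒≤-div x d (suc (x div d)) p (ℕₚ.≮⇒≥ ¬q)))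

∑₁-div : ∀ x d (g : ℕ → ℚ) → 1 ℕ.≤ d → ∑₁ (x div d) g ≡ ∑₁ x (λ m → 𝟙 (d ℕ.* m ℕₚ.≤? x) * g m)
∑₁-div x d g 1≤d = trans
  (∑₁-cong (x div d) (λ m _ p → sym (trans (cong (_* g m) (𝟙-yes (d ℕ.* m ℕₚ.≤? x) (≤-div⇒*-≤ x d m p))) (*-identityˡ (g m)))))
  (∑₁-extend (div-≤ x d) (λ m p _ → trans (cong (_* g m) (𝟙-no (d ℕ.* m ℕₚ.≤? x) (λ q → ℕₚ.<⇒≱ p (*-≤⇒≤-div x d m 1≤d q)))) (*-zeroˡ (g m))))

-- Dirichlet convolution as a sum over a full square with an indicator: the square may be enlarged
-- freely (`conv-extend`), after which all interchanges of summation are unconditional.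
conv : (ℕ → ℚ) → (ℕ → ℚ) → ℕ → ℚ
conv f g n = ∑₁ n λ d → ∑₁ n λ m → 𝟙 (d ℕ.* m ℕₚ.≟ n) * (f d * g m)

*≡⇒≤ˡ : ∀ {d m n} → 1 ℕ.≤ m → d ℕ.* m ≡ n → d ℕ.≤ n
*≡⇒≤ˡ {d} {suc m} _ refl = ℕₚ.m≤m*n d (suc m)

*≡⇒≤ʳ : ∀ {d m n} → 1 ℕ.≤ d → d ℕ.* m ≡ n → m ℕ.≤ n
*≡⇒≤ʳ {suc d} {m} _ refl = ℕₚ.m≤n*m m (suc d)

1≤* : ∀ {m n} → 1 ℕ.≤ m → 1 ℕ.≤ n → 1 ℕ.≤ m ℕ.* n
1≤* {suc m} {suc n} _ _ = s≤s z≤n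

1≤*ˡ : ∀ m n → 1 ℕ.≤ m ℕ.* n → 1 ℕ.≤ m
1≤*ˡ (suc m) n _ = s≤s z≤n

1≤*ʳ : ∀ m n → 1 ℕ.≤ m ℕ.* n → 1 ℕ.≤ n
1≤*ʳ m n p = 1≤*ˡ n m (subst (1 ℕ.≤_) (ℕₚ.*-comm m n) p)

conv-extend : ∀ f g {n N} → n ℕ.≤ N → conv f g n ≡ ∑₁ N λ d → ∑₁ N λ m → 𝟙 (d ℕ.* m ℕₚ.≟ n) * (f d * g m)
conv-extend f g {n} {N} n≤N = trans
  (∑₁-cong n (λ d 1≤d _ → ∑₁-extend n≤N (λ m n<m _ → zero-term d m (λ e → ℕₚ.<⇒≱ n<m (*≡⇒≤ʳ 1≤d e)))))
  (∑₁-extend n≤N (λ d n<d _ → ∑₁-≡0 N (λ m 1≤m _ → zero-term d m (λ e → ℕₚ.<⇒≱ n<d (*≡⇒≤ˡ 1≤m e)))))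
  where
  zero-term : ∀ d m → ¬ (d ℕ.* m ≡ n) → 𝟙 (d ℕ.* m ℕₚ.≟ n) * (f d * g m) ≡ 0ℚ
  zero-term d m ¬e = trans (cong (_* (f d * g m)) (𝟙-no (d ℕ.* m ℕₚ.≟ n) ¬e)) (*-zeroˡ (f d * g m))

conv-congˡ : ∀ {f f′} g n → (∀ d → 1 ℕ.≤ d → d ℕ.≤ n → f d ≡ f′ d) → conv f g n ≡ conv f′ g n
conv-congˡ g n h = ∑₁-cong n (λ d p q → ∑₁-cong n (λ m _ _ → cong (λ z → 𝟙 (d ℕ.* m ℕₚ.≟ n) * (z * g m)) (h d p q)))

conv-congʳ : ∀ f {g g′} n → (∀ d → 1 ℕ.≤ d → d ℕ.≤ n → g d ≡ g′ d) → conv f g n ≡ conv f g′ n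
conv-congʳ f n h = ∑₁-cong n (λ d _ _ → ∑₁-cong n (λ m p q → cong (λ z → 𝟙 (d ℕ.* m ℕₚ.≟ n) * (f d * z)) (h m p q)))

conv-comm : ∀ f g n → conv f g n ≡ conv g f n
conv-comm f g n = trans (∑-swap n n _) (∑₁-cong n (λ d _ _ → ∑₁-cong n (λ m _ _ →
  cong₂ _*_ (𝟙-cong (m ℕ.* d ℕₚ.≟ n) (d ℕ.* m ℕₚ.≟ n) (trans (ℕₚ.*-comm d m)) (trans (ℕₚ.*-comm m d))) (*-comm (f m) (g d)))))

conv-+ʳ : ∀ f g h n → conv f (λ m → g m + h m) n ≡ conv f g n + conv f h n
conv-+ʳ f g h n = trans (∑₁-cong n (λ d _ _ → trans (∑₁-cong n (λ m _ _ →
    ((∀ i a b c → i * (a * (b + c)) ≡ i * (a * b) + i * (a * c)) ∋ solve-∀ ring) (𝟙 (d ℕ.* m ℕₚ.≟ n)) (f d) (g m) (h m)))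
    (∑-+ n _ _)))
  (∑-+ n _ _)

-- Sorting the pairs (d, m) by d. The weight W is arbitrary: it later becomes 1, a character, a
-- class indicator over n, or the smoothing x - n.
hyperbola : ∀ x W f g → ∑₁ x (λ n → W n * conv f g n) ≡ ∑₁ x (λ d → f d * ∑₁ (x div d) (λ m → W (d ℕ.* m) * g m))
hyperbola x W f g = begin
  ∑₁ x (λ n → W n * conv f g n)
    ≡⟨ ∑₁-cong x (λ n _ n≤x → cong (W n *_) (conv-extend f g n≤x)) ⟩
  ∑₁ x (λ n → W n * ∑₁ x λ d → ∑₁ x λ m → 𝟙 (d ℕ.* m ℕₚ.≟ n) * (f d * g m))
    ≡⟨ ∑₁-cong x (λ n _ _ → trans (sym (∑-*ˡ x (W n) _)) (∑₁-cong x (λ d _ _ → sym (∑-*ˡ x (W n) _)))) ⟩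
  ∑₁ x (λ n → ∑₁ x λ d → ∑₁ x λ m → W n * (𝟙 (d ℕ.* m ℕₚ.≟ n) * (f d * g m)))
    ≡⟨ ∑-swap x x _ ⟩
  ∑₁ x (λ d → ∑₁ x λ n → ∑₁ x λ m → W n * (𝟙 (d ℕ.* m ℕₚ.≟ n) * (f d * g m)))
    ≡⟨ ∑₁-cong x (λ d _ _ → ∑-swap x x _) ⟩
  ∑₁ x (λ d → ∑₁ x λ m → ∑₁ x λ n → W n * (𝟙 (d ℕ.* m ℕₚ.≟ n) * (f d * g m)))
    ≡⟨ ∑₁-cong x (λ d 1≤d _ → ∑₁-cong x (λ m 1≤m _ → inner d m 1≤d 1≤m)) ⟩
  ∑₁ x (λ d → ∑₁ x λ m → f d * (𝟙 (d ℕ.* m ℕₚ.≤? x) * (W (d ℕ.* m) * g m)))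
    ≡⟨ ∑₁-cong x (λ d 1≤d _ → trans (∑-*ˡ x (f d) _) (cong (f d *_) (sym (∑₁-div x d _ 1≤d)))) ⟩
  ∑₁ x (λ d → f d * ∑₁ (x div d) (λ m → W (d ℕ.* m) * g m)) ∎
  where
  open ≡-Reasoning
  inner : ∀ d m → 1 ℕ.≤ d → 1 ℕ.≤ m →
    ∑₁ x (λ n → W n * (𝟙 (d ℕ.* m ℕₚ.≟ n) * (f d * g m))) ≡ f d * (𝟙 (d ℕ.* m ℕₚ.≤? x) * (W (d ℕ.* m) * g m))
  inner d m p q = trans
    (trans (∑₁-cong x (λ n _ _ → ((∀ w i c → w * (i * c) ≡ i * w * c) ∋ solve-∀ ring) (W n) (𝟙 (d ℕ.* m ℕₚ.≟ n)) (f d * g m)))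
      (trans (∑-*ʳ x (f d * g m) _) (cong (_* (f d * g m)) (∑₁-point x (d ℕ.* m) W (1≤* p q)))))
    (((∀ i w a b → i * w * (a * b) ≡ a * (i * (w * b))) ∋ solve-∀ ring) (𝟙 (d ℕ.* m ℕₚ.≤? x)) (W (d ℕ.* m)) (f d) (g m))

conv³ : (ℕ → ℚ) → (ℕ → ℚ) → (ℕ → ℚ) → ℕ → ℚ
conv³ f g h n = ∑₁ n λ d → ∑₁ n λ e → ∑₁ n λ k → 𝟙 (d ℕ.* (e ℕ.* k) ℕₚ.≟ n) * (f d * (g e * h k))

conv-conv³ : ∀ f g h n → conv f (conv g h) n ≡ conv³ f g h n
conv-conv³ f g h n = ∑₁-cong n (λ d 1≤d _ → begin
  ∑₁ n (λ m → 𝟙 (d ℕ.* m ℕₚ.≟ n) * (f d * conv g h m))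
    ≡⟨ ∑₁-cong n (λ m _ m≤n → cong (λ z → 𝟙 (d ℕ.* m ℕₚ.≟ n) * (f d * z)) (conv-extend g h m≤n)) ⟩
  ∑₁ n (λ m → 𝟙 (d ℕ.* m ℕₚ.≟ n) * (f d * ∑₁ n λ e → ∑₁ n λ k → 𝟙 (e ℕ.* k ℕₚ.≟ m) * (g e * h k)))
    ≡⟨ ∑₁-cong n (λ m _ _ → trans (sym (*-assoc (𝟙 (d ℕ.* m ℕₚ.≟ n)) (f d) _)) (trans (sym (∑-*ˡ n (𝟙 (d ℕ.* m ℕₚ.≟ n) * f d) _)) (∑₁-cong n (λ e _ _ → sym (∑-*ˡ n (𝟙 (d ℕ.* m ℕₚ.≟ n) * f d) _))))) ⟩
  ∑₁ n (λ m → ∑₁ n λ e → ∑₁ n λ k → 𝟙 (d ℕ.* m ℕₚ.≟ n) * f d * (𝟙 (e ℕ.* k ℕₚ.≟ m) * (g e * h k)))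
    ≡⟨ ∑-swap n n _ ⟩
  ∑₁ n (λ e → ∑₁ n λ m → ∑₁ n λ k → 𝟙 (d ℕ.* m ℕₚ.≟ n) * f d * (𝟙 (e ℕ.* k ℕₚ.≟ m) * (g e * h k)))
    ≡⟨ ∑₁-cong n (λ e _ _ → ∑-swap n n _) ⟩
  ∑₁ n (λ e → ∑₁ n λ k → ∑₁ n λ m → 𝟙 (d ℕ.* m ℕₚ.≟ n) * f d * (𝟙 (e ℕ.* k ℕₚ.≟ m) * (g e * h k)))
    ≡⟨ ∑₁-cong n (λ e 1≤e _ → ∑₁-cong n (λ k 1≤k _ → inner d e k 1≤d 1≤e 1≤k)) ⟩
  ∑₁ n (λ e → ∑₁ n λ k → 𝟙 (d ℕ.* (e ℕ.* k) ℕₚ.≟ n) * (f d * (g e * h k))) ∎)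
  where
  open ≡-Reasoning
  inner : ∀ d e k → 1 ℕ.≤ d → 1 ℕ.≤ e → 1 ℕ.≤ k →
    ∑₁ n (λ m → 𝟙 (d ℕ.* m ℕₚ.≟ n) * f d * (𝟙 (e ℕ.* k ℕₚ.≟ m) * (g e * h k))) ≡ 𝟙 (d ℕ.* (e ℕ.* k) ℕₚ.≟ n) * (f d * (g e * h k))
  inner d e k p q r = trans
    (trans (∑₁-cong n (λ m _ _ → ((∀ a b i c → a * b * (i * c) ≡ i * a * (b * c)) ∋ solve-∀ ring) (𝟙 (d ℕ.* m ℕₚ.≟ n)) (f d) (𝟙 (e ℕ.* k ℕₚ.≟ m)) (g e * h k)))
      (∑-*ʳ n (f d * (g e * h k)) _))
    (cong (_* (f d * (g e * h k))) (trans (∑₁-point n (e ℕ.* k) (λ m → 𝟙 (d ℕ.* m ℕₚ.≟ n)) (1≤* q r)) (absorb (d ℕ.* (e ℕ.* k) ℕₚ.≟ n))))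
    where
    absorb : (dec : Dec (d ℕ.* (e ℕ.* k) ≡ n)) → 𝟙 (e ℕ.* k ℕₚ.≤? n) * 𝟙 dec ≡ 𝟙 dec
    absorb (yes eq) = trans (*-identityʳ _) (𝟙-yes (e ℕ.* k ℕₚ.≤? n) (*≡⇒≤ʳ p eq))
    absorb (no _) = *-zeroʳ (𝟙 (e ℕ.* k ℕₚ.≤? n))

-- By commutativity both sides are of the form u ∗ (v ∗ w), and their triple sums differ by a cyclic
-- rotation of the three variables.
conv-assoc : ∀ f g h n → conv (conv f g) h n ≡ conv f (conv g h) n
conv-assoc f g h n = begin
  conv (conv f g) h n   ≡⟨ conv-comm (conv f g) h n ⟩
  conv h (conv f g) n   ≡⟨ conv-conv³ h f g n ⟩
  conv³ h f g n         ≡⟨ ∑-swap n n _ ⟩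
  ∑₁ n (λ e → ∑₁ n λ d → ∑₁ n λ k → 𝟙 (d ℕ.* (e ℕ.* k) ℕₚ.≟ n) * (h d * (f e * g k)))
    ≡⟨ ∑₁-cong n (λ e _ _ → ∑-swap n n _) ⟩
  ∑₁ n (λ e → ∑₁ n λ k → ∑₁ n λ d → 𝟙 (d ℕ.* (e ℕ.* k) ℕₚ.≟ n) * (h d * (f e * g k)))
    ≡⟨ ∑₁-cong n (λ e _ _ → ∑₁-cong n (λ k _ _ → ∑₁-cong n (λ d _ _ → cong₂ _*_
         (𝟙-cong (d ℕ.* (e ℕ.* k) ℕₚ.≟ n) (e ℕ.* (k ℕ.* d) ℕₚ.≟ n) (trans (sym (rot d e k))) (trans (rot d e k)))
         (((∀ a b c → a * (b * c) ≡ b * (c * a)) ∋ solve-∀ ring) (h d) (f e) (g k))))) ⟩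
  conv³ f g h n         ≡⟨ conv-conv³ f g h n ⟨
  conv f (conv g h) n   ∎
  where
  open ≡-Reasoning
  rot : ∀ d e k → d ℕ.* (e ℕ.* k) ≡ e ℕ.* (k ℕ.* d)
  rot d e k = trans (ℕₚ.*-comm d (e ℕ.* k)) (ℕₚ.*-assoc e k d)

one : ℕ → ℚ
one _ = 1ℚ

δ : ℕ → ℚ
δ n = 𝟙 (n ℕₚ.≟ 1)

conv-δˡ : ∀ f n → 1 ℕ.≤ n → conv δ f n ≡ f n
conv-δˡ f n 1≤n = trans (cong (∑₁ n) refl) (trans
  (∑₁-cong n (λ d _ _ → trans (∑₁-cong n (λ m _ _ → trans (((∀ i e y → i * (e * y) ≡ e * (i * y)) ∋ solve-∀ ring) (𝟙 (d ℕ.* m ℕₚ.≟ n)) (δ d) (f m))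
     (cong₂ _*_ (𝟙-cong (d ℕₚ.≟ 1) (1 ℕₚ.≟ d) sym sym) refl))) (∑-*ˡ n (𝟙 (1 ℕₚ.≟ d)) _)))
  (trans (∑₁-point n 1 (λ d → ∑₁ n (λ m → 𝟙 (d ℕ.* m ℕₚ.≟ n) * f m)) (s≤s z≤n))
  (trans (cong (_* ∑₁ n (λ m → 𝟙 (1 ℕ.* m ℕₚ.≟ n) * f m)) (𝟙-yes (1 ℕₚ.≤? n) 1≤n))
  (trans (*-identityˡ _)
  (trans (∑₁-cong n (λ m _ _ → cong (_* f m) (𝟙-cong (1 ℕ.* m ℕₚ.≟ n) (n ℕₚ.≟ m) (λ e → trans (sym e) (ℕₚ.*-identityˡ m)) (λ e → trans (ℕₚ.*-identityˡ m) (sym e)))))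
  (trans (∑₁-point n n f 1≤n) (trans (cong (_* f n) (𝟙-yes (n ℕₚ.≤? n) ℕₚ.≤-refl)) (*-identityˡ (f n)))))))))

-- Prime factorizations, divisor sums and the Möbius function

prime≥2 : ∀ {p} → Prime p → 2 ℕ.≤ p
prime≥2 pr = ℕ.nonTrivial⇒n>1 _ {{prime⇒nonTrivial pr}}

prime≥1 : ∀ {p} → Prime p → 1 ℕ.≤ p
prime≥1 pr = ℕₚ.≤-trans (s≤s z≤n) (prime≥2 pr)

primeFactors : ℕ → List ℕ
primeFactors zero = []
primeFactors (suc n) = factors (factorise (suc n))

primeFactors-product : ∀ {n} → 1 ℕ.≤ n → product (primeFactors n) ≡ n
primeFactors-product {suc n} _ = sym (PrimeFactorisation.isFactorisation (factorise (suc n)))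

primeFactors-prime : ∀ n → All Prime (primeFactors n)
primeFactors-prime zero = All.[]
primeFactors-prime (suc n) = PrimeFactorisation.factorsPrime (factorise (suc n))

-- The completely additive function with prescribed values at primes; it yields both Ω and the
-- approximate logarithm.
additive : (ℕ → ℕ) → ℕ → ℕ
additive w n = sum (map w (primeFactors n))

additive-unique : ∀ w n ps → 1 ℕ.≤ n → n ≡ product ps → All Prime ps → additive w n ≡ sum (map w ps)
additive-unique w (suc n) ps _ eq pr = ListAction.sum-↭ (↭.map⁺ w
  (factorisationUnique (factorise (suc n)) (record { factors = ps ; isFactorisation = eq ; factorsPrime = pr })))

additive-* : ∀ w m n → 1 ℕ.≤ m → 1 ℕ.≤ n → additive w (m ℕ.* n) ≡ additive w m ℕ.+ additive w n
additive-* w m n p q = trans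
  (additive-unique w (m ℕ.* n) (primeFactors m ++ primeFactors n) (1≤* p q)
    (sym (trans (ListAction.product-++ (primeFactors m) (primeFactors n)) (cong₂ ℕ._*_ (primeFactors-product p) (primeFactors-product q))))
    (Allₚ.++⁺ (primeFactors-prime m) (primeFactors-prime n)))
  (trans (cong sum (Listₚ.map-++ w (primeFactors m) (primeFactors n))) (ListAction.sum-++ (map w (primeFactors m)) (map w (primeFactors n))))

additive-prime : ∀ w {p} → Prime p → additive w p ≡ w p
additive-prime w {p} pr = trans (additive-unique w p (p ∷ []) (prime≥1 pr) (sym (ℕₚ.*-identityʳ p)) (pr All.∷ All.[])) (ℕₚ.+-identityʳ (w p))

additive-1 : ∀ w → additive w 1 ≡ 0
additive-1 w = additive-unique w 1 [] (s≤s z≤n) refl All.[]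

Ω : ℕ → ℕ
Ω = additive (λ _ → 1)

prime-divisor : ∀ n → 2 ℕ.≤ n → ∃ λ p → Prime p × p ∣ n
prime-divisor n 2≤n with primeFactors n | primeFactors-prime n | primeFactors-product {n} (ℕₚ.≤-trans (s≤s z≤n) 2≤n)
... | [] | _ | refl = ⊥-elim (ℕₚ.<-irrefl refl 2≤n)
... | p ∷ ps | pr All.∷ _ | eq = p , pr , divides (product ps) (trans (sym eq) (ℕₚ.*-comm p (product ps)))

prime-coprime : ∀ {p d} → Prime p → ¬ p ∣ d → Coprime d p
prime-coprime pr ¬p∣d {k} (k∣d , k∣p) with prime⇒irreducible pr k∣p
... | inj₁ e = e
... | inj₂ refl = ⊥-elim (¬p∣d k∣d)

-- The bound on d makes the property decidable; for n ≥ 1 it excludes nothing, because d² dividing n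
-- forces d ≤ n.
Squarefree : ℕ → Set
Squarefree n = ∀ {d} → d ℕ.< suc n → d ℕ.* d ∣ n → d ≡ 1

squarefree? : ∀ n → Dec (Squarefree n)
squarefree? n = ℕₚ.allUpTo? (λ d → (d ℕ.* d ∣? n) →-dec (d ℕₚ.≟ 1)) (suc n)

squarefree-∣ : ∀ {n} → 1 ℕ.≤ n → Squarefree n → ∀ d → d ℕ.* d ∣ n → d ≡ 1
squarefree-∣ {suc n} _ sf zero d²∣n with ∣.0∣⇒≡0 d²∣n
... | ()
squarefree-∣ {suc n} _ sf (suc d) d²∣n = sf (s≤s (ℕₚ.≤-trans (ℕₚ.m≤m*n (suc d) (suc d)) (∣.∣⇒≤ d²∣n))) d²∣n

squarefree-prime-* : ∀ {p n} → Prime p → 1 ℕ.≤ n → ¬ p ∣ n → Squarefree n → Squarefree (p ℕ.* n)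
squarefree-prime-* {p} {n} pr 1≤n ¬p∣n sf {d} _ d²∣pn with p ∣? d
... | yes (divides k refl) = ⊥-elim (¬p∣n (∣.*-cancelˡ-∣ p {{prime⇒nonZero pr}} (∣.∣-trans (∣.*-pres-∣ (∣.n∣m*n k) (∣.n∣m*n k)) d²∣pn)))
... | no ¬p∣d = squarefree-∣ 1≤n sf d (Coprime.coprime-divisor {n = p} (prime-coprime pr ¬p∣d²) d²∣pn)
  where
  ¬p∣d² : ¬ p ∣ d ℕ.* d
  ¬p∣d² q with euclidsLemma d d pr q
  ... | inj₁ r = ¬p∣d r
  ... | inj₂ r = ¬p∣d r

sign : ℕ → ℚ
sign zero = 1ℚ
sign (suc n) = - sign n

∣sign∣≤1 : ∀ n → ∣ sign n ∣ ≤ 1ℚ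
∣sign∣≤1 zero = ≤-refl
∣sign∣≤1 (suc n) = ≤-trans (≤-reflexive (∣-p∣≡∣p∣ (sign n))) (∣sign∣≤1 n)

μ : ℕ → ℚ
μ n = 𝟙 (squarefree? n) * sign (Ω n)

∣μ∣≤1 : ∀ n → ∣ μ n ∣ ≤ 1ℚ
∣μ∣≤1 n = abs-mul (abs-nonneg (0≤𝟙 (squarefree? n)) (𝟙≤1 (squarefree? n))) (∣sign∣≤1 (Ω n))

μ-1 : μ 1 ≡ 1ℚ
μ-1 = cong₂ _*_ (𝟙-yes (squarefree? 1) (λ {d} _ q → ℕₚ.m*n≡1⇒m≡1 d d (∣.∣1⇒≡1 q))) (cong sign (additive-1 (λ _ → 1)))

∤-ind : ℕ → ℕ → ℚ
∤-ind p d = 1ℚ - 𝟙 (p ∣? d)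

∤-ind-∣ : ∀ {p d} → p ∣ d → ∤-ind p d ≡ 0ℚ
∤-ind-∣ {p} {d} q = cong (λ z → 1ℚ - z) (𝟙-yes (p ∣? d) q)

∤-ind-∤ : ∀ {p d} → ¬ p ∣ d → ∤-ind p d ≡ 1ℚ
∤-ind-∤ {p} {d} q = cong (λ z → 1ℚ - z) (𝟙-no (p ∣? d) q)

μ-prime-* : ∀ {p n} → Prime p → 1 ℕ.≤ n → μ (p ℕ.* n) ≡ - (∤-ind p n * μ n)
μ-prime-* {p} {n} pr 1≤n = go (p ∣? n)
  where
  go : Dec (p ∣ n) → μ (p ℕ.* n) ≡ - (∤-ind p n * μ n)
  go (yes p∣n) = trans (trans (cong (_* sign (Ω (p ℕ.* n))) (𝟙-no (squarefree? (p ℕ.* n)) not-sf)) (*-zeroˡ (sign (Ω (p ℕ.* n)))))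
    (sym (cong -_ (trans (cong (_* μ n) (∤-ind-∣ p∣n)) (*-zeroˡ (μ n)))))
    where
    not-sf : ¬ Squarefree (p ℕ.* n)
    not-sf sf = ¬prime[1] (subst Prime (squarefree-∣ (1≤* (prime≥1 pr) 1≤n) sf p (∣.*-monoʳ-∣ p p∣n)) pr)
  go (no ¬p∣n) = trans
    (cong₂ _*_
      (𝟙-cong (squarefree? (p ℕ.* n)) (squarefree? n)
        (λ sf {d} _ d²∣n → squarefree-∣ (1≤* (prime≥1 pr) 1≤n) sf d (∣.∣-trans d²∣n (∣.n∣m*n p)))
        (squarefree-prime-* pr 1≤n ¬p∣n))
      (cong sign (trans (additive-* (λ _ → 1) p n (prime≥1 pr) 1≤n) (cong (ℕ._+ Ω n) (additive-prime (λ _ → 1) pr)))))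
    (trans (((∀ a b → a * - b ≡ - (1ℚ * (a * b))) ∋ solve-∀ ring) (𝟙 (squarefree? n)) (sign (Ω n)))
      (sym (cong (λ z → - (z * μ n)) (∤-ind-∤ ¬p∣n))))

D : (ℕ → ℚ) → ℕ → ℚ
D f n = ∑₁ n (λ d → 𝟙 (d ∣? n) * f d)

∑₁-cofactor : ∀ x d n → 1 ℕ.≤ d → 1 ℕ.≤ n → n ℕ.≤ x → ∑₁ x (λ m → 𝟙 (d ℕ.* m ℕₚ.≟ n)) ≡ 𝟙 (d ∣? n)
∑₁-cofactor x d n 1≤d 1≤n n≤x with d ∣? n
... | yes (divides k refl) = begin
  ∑₁ x (λ m → 𝟙 (d ℕ.* m ℕₚ.≟ k ℕ.* d)) ≡⟨ ∑₁-cong x (λ m _ _ → trans (𝟙-cong (d ℕ.* m ℕₚ.≟ k ℕ.* d) (k ℕₚ.≟ m)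
                                            (λ e → sym (ℕₚ.*-cancelˡ-≡ m k d {{ℕ.>-nonZero 1≤d}} (trans e (ℕₚ.*-comm k d)))) (λ { refl → ℕₚ.*-comm d k }))
                                            (sym (*-identityʳ (𝟙 (k ℕₚ.≟ m))))) ⟩
  ∑₁ x (λ m → 𝟙 (k ℕₚ.≟ m) * 1ℚ)        ≡⟨ ∑₁-point x k one (1≤*ˡ k d 1≤n) ⟩
  𝟙 (k ℕₚ.≤? x) * 1ℚ                    ≡⟨ cong (_* 1ℚ) (𝟙-yes (k ℕₚ.≤? x) (ℕₚ.≤-trans (*≡⇒≤ˡ 1≤d refl) n≤x)) ⟩
  1ℚ * 1ℚ                               ≡⟨ *-identityˡ 1ℚ ⟩
  1ℚ                                    ∎
  where open ≡-Reasoning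
... | no ¬d∣n = ∑₁-≡0 x (λ m _ _ → 𝟙-no (d ℕ.* m ℕₚ.≟ n) (λ e → ¬d∣n (divides m (trans (sym e) (ℕₚ.*-comm d m)))))

conv-one : ∀ f n → 1 ℕ.≤ n → conv f one n ≡ D f n
conv-one f n 1≤n = ∑₁-cong n (λ d 1≤d _ → trans
  (∑₁-cong n (λ m _ _ → cong (𝟙 (d ℕ.* m ℕₚ.≟ n) *_) (*-identityʳ (f d))))
  (trans (∑-*ʳ n (f d) (λ m → 𝟙 (d ℕ.* m ℕₚ.≟ n))) (cong (_* f d) (∑₁-cofactor n d n 1≤d 1≤n ℕₚ.≤-refl))))

∑₁-multiples : ∀ x p (g : ℕ → ℚ) → 1 ℕ.≤ p → ∑₁ x (λ n → 𝟙 (p ∣? n) * g n) ≡ ∑₁ (x div p) (λ m → g (p ℕ.* m))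
∑₁-multiples x p g 1≤p = sym (begin
  ∑₁ (x div p) (λ m → g (p ℕ.* m))
    ≡⟨ ∑₁-div x p (λ m → g (p ℕ.* m)) 1≤p ⟩
  ∑₁ x (λ m → 𝟙 (p ℕ.* m ℕₚ.≤? x) * g (p ℕ.* m))
    ≡⟨ ∑₁-cong x (λ m 1≤m _ → ∑₁-point x (p ℕ.* m) g (1≤* 1≤p 1≤m)) ⟨
  ∑₁ x (λ m → ∑₁ x (λ n → 𝟙 (p ℕ.* m ℕₚ.≟ n) * g n))
    ≡⟨ ∑-swap x x (λ m n → 𝟙 (p ℕ.* m ℕₚ.≟ n) * g n) ⟩
  ∑₁ x (λ n → ∑₁ x (λ m → 𝟙 (p ℕ.* m ℕₚ.≟ n) * g n))
    ≡⟨ ∑₁-cong x (λ n 1≤n n≤x → trans (∑-*ʳ x (g n) (λ m → 𝟙 (p ℕ.* m ℕₚ.≟ n))) (cong (_* g n) (∑₁-cofactor x p n 1≤p 1≤n n≤x))) ⟩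
  ∑₁ x (λ n → 𝟙 (p ∣? n) * g n) ∎)
  where open ≡-Reasoning

div-cancel : ∀ p n → 1 ℕ.≤ p → p ℕ.* n div p ≡ n
div-cancel (suc p) n _ = trans (cong (ℕ._/ suc p) (ℕₚ.*-comm (suc p) n)) (ℕ÷.m*n/n≡m n (suc p))

D-cong : ∀ n {f g} → (∀ d → 1 ℕ.≤ d → d ∣ n → f d ≡ g d) → D f n ≡ D g n
D-cong n h = ∑₁-cong n (λ d 1≤d _ → 𝟙-when (d ∣? n) (h d 1≤d))

D-+ : ∀ f g n → D (λ d → f d + g d) n ≡ D f n + D g n
D-+ f g n = trans (∑₁-cong n (λ d _ _ → *-distribˡ-+ (𝟙 (d ∣? n)) (f d) (g d))) (∑-+ n (λ d → 𝟙 (d ∣? n) * f d) (λ d → 𝟙 (d ∣? n) * g d))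

D-* : ∀ c f n → D (λ d → c * f d) n ≡ c * D f n
D-* c f n = trans (∑₁-cong n (λ d _ _ → ((∀ i c x → i * (c * x) ≡ c * (i * x)) ∋ solve-∀ ring) (𝟙 (d ∣? n)) c (f d))) (∑-*ˡ n c (λ d → 𝟙 (d ∣? n) * f d))

D-neg : ∀ f n → D (λ d → - f d) n ≡ - D f n
D-neg f n = trans (∑₁-cong n (λ d _ _ → sym (neg-distribʳ-* (𝟙 (d ∣? n)) (f d)))) (∑-neg n (λ d → 𝟙 (d ∣? n) * f d))

D-1 : ∀ f → D f 1 ≡ f 1
D-1 f = trans (+-identityˡ (𝟙 (1 ∣? 1) * f 1)) (trans (cong (_* f 1) (𝟙-yes (1 ∣? 1) ∣.∣-refl)) (*-identityˡ (f 1)))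

-- Divisors of p n that are multiples of p are p times the divisors of n; the others are the
-- divisors of n prime to p. Here p may divide n, so this one recursion evaluates μ ∗ 1, Λ and 1 ∗ χ
-- at prime powers.
D-prime-* : ∀ f {p n} → Prime p → 1 ℕ.≤ n → D f (p ℕ.* n) ≡ D (λ d → f (p ℕ.* d)) n + D (λ d → ∤-ind p d * f d) n
D-prime-* f {p} {n} pr 1≤n = begin
  D f (p ℕ.* n)
    ≡⟨ ∑₁-cong (p ℕ.* n) (λ d _ _ → ((∀ i x y → x * y ≡ i * (x * y) + (1ℚ - i) * x * y) ∋ solve-∀ ring) (𝟙 (p ∣? d)) (𝟙 (d ∣? p ℕ.* n)) (f d)) ⟩
  ∑₁ (p ℕ.* n) (λ d → 𝟙 (p ∣? d) * (𝟙 (d ∣? p ℕ.* n) * f d) + ∤-ind p d * 𝟙 (d ∣? p ℕ.* n) * f d)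
    ≡⟨ ∑-+ (p ℕ.* n) (λ d → 𝟙 (p ∣? d) * (𝟙 (d ∣? p ℕ.* n) * f d)) (λ d → ∤-ind p d * 𝟙 (d ∣? p ℕ.* n) * f d) ⟩
  ∑₁ (p ℕ.* n) (λ d → 𝟙 (p ∣? d) * (𝟙 (d ∣? p ℕ.* n) * f d)) + ∑₁ (p ℕ.* n) (λ d → ∤-ind p d * 𝟙 (d ∣? p ℕ.* n) * f d)
    ≡⟨ cong₂ _+_ multiples nonmultiples ⟩
  D (λ d → f (p ℕ.* d)) n + D (λ d → ∤-ind p d * f d) n ∎
  where
  open ≡-Reasoning
  1≤p : 1 ℕ.≤ p
  1≤p = prime≥1 pr
  multiples : ∑₁ (p ℕ.* n) (λ d → 𝟙 (p ∣? d) * (𝟙 (d ∣? p ℕ.* n) * f d)) ≡ D (λ d → f (p ℕ.* d)) n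
  multiples = trans (∑₁-multiples (p ℕ.* n) p (λ d → 𝟙 (d ∣? p ℕ.* n) * f d) 1≤p)
    (trans (cong (λ k → ∑₁ k (λ m → 𝟙 (p ℕ.* m ∣? p ℕ.* n) * f (p ℕ.* m))) (div-cancel p n 1≤p))
      (∑₁-cong n (λ m _ _ → cong (_* f (p ℕ.* m)) (𝟙-cong (p ℕ.* m ∣? p ℕ.* n) (m ∣? n)
        (∣.*-cancelˡ-∣ p {{prime⇒nonZero pr}}) (∣.*-monoʳ-∣ p)))))
  same : ∀ d → Dec (p ∣ d) → ∤-ind p d * 𝟙 (d ∣? p ℕ.* n) ≡ 𝟙 (d ∣? n) * ∤-ind p d
  same d (yes p∣d) = trans (cong (_* 𝟙 (d ∣? p ℕ.* n)) (∤-ind-∣ p∣d)) (trans (*-zeroˡ (𝟙 (d ∣? p ℕ.* n))) (sym (trans (cong (𝟙 (d ∣? n) *_) (∤-ind-∣ p∣d)) (*-zeroʳ (𝟙 (d ∣? n))))))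
  same d (no ¬p∣d) = trans (cong (∤-ind p d *_) (𝟙-cong (d ∣? p ℕ.* n) (d ∣? n) (Coprime.coprime-divisor {n = p} (prime-coprime pr ¬p∣d)) (λ q → ∣.∣-trans q (∣.n∣m*n p))))
    (*-comm (∤-ind p d) (𝟙 (d ∣? n)))
  nonmultiples : ∑₁ (p ℕ.* n) (λ d → ∤-ind p d * 𝟙 (d ∣? p ℕ.* n) * f d) ≡ D (λ d → ∤-ind p d * f d) n
  nonmultiples = trans (∑₁-cong (p ℕ.* n) (λ d _ _ → trans (cong (_* f d) (same d (p ∣? d))) (*-assoc (𝟙 (d ∣? n)) (∤-ind p d) (f d))))
    (sym (∑₁-extend (*≡⇒≤ʳ 1≤p refl) (λ d n<d _ → trans (cong (_* (∤-ind p d * f d)) (𝟙-no (d ∣? n) (λ q → ℕₚ.<⇒≱ n<d (∣.∣⇒≤ {{ℕ.>-nonZero 1≤n}} q)))) (*-zeroˡ (∤-ind p d * f d)))))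

-- For n = p m the two halves of `D-prime-*` cancel, because μ(p d) is -μ(d) when p does not divide
-- d and 0 otherwise.
μ-sum : ∀ n → 1 ℕ.≤ n → D μ n ≡ δ n
μ-sum n 1≤n with n ℕₚ.≟ 1
... | yes refl = trans (D-1 μ) μ-1
... | no n≢1 with prime-divisor n (ℕₚ.≤∧≢⇒< 1≤n (λ e → n≢1 (sym e)))
...   | p , pr , divides m refl = begin
  D μ (m ℕ.* p) ≡⟨ cong (D μ) (ℕₚ.*-comm m p) ⟩
  D μ (p ℕ.* m) ≡⟨ D-prime-* μ pr 1≤m ⟩
  D (λ d → μ (p ℕ.* d)) m + D (λ d → ∤-ind p d * μ d) m
    ≡⟨ cong (_+ D (λ d → ∤-ind p d * μ d) m) (trans (D-cong m (λ d 1≤d _ → μ-prime-* pr 1≤d)) (D-neg (λ d → ∤-ind p d * μ d) m)) ⟩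
  - D (λ d → ∤-ind p d * μ d) m + D (λ d → ∤-ind p d * μ d) m ≡⟨ +-inverseˡ (D (λ d → ∤-ind p d * μ d) m) ⟩
  0ℚ ∎
  where
  open ≡-Reasoning
  1≤m : 1 ℕ.≤ m
  1≤m = 1≤*ˡ m p 1≤n

D-∤-coprime : ∀ (f : ℕ → ℚ) {p m} → ¬ p ∣ m → D (λ d → ∤-ind p d * f d) m ≡ D f m
D-∤-coprime f {p} {m} ¬p∣m = D-cong m (λ d _ d∣m → trans (cong (_* f d) (∤-ind-∤ {p} {d} (λ p∣d → ¬p∣m (∣.∣-trans p∣d d∣m)))) (*-identityˡ (f d)))

D-∤-* : ∀ (f : ℕ → ℚ) {p m} → Prime p → 1 ℕ.≤ m → D (λ d → ∤-ind p d * f d) (p ℕ.* m) ≡ D (λ d → ∤-ind p d * f d) m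
D-∤-* f {p} {m} pr 1≤m = trans (D-prime-* (λ d → ∤-ind p d * f d) pr 1≤m) (trans (cong₂ _+_
  (trans (D-cong m (λ d _ _ → trans (cong (_* f (p ℕ.* d)) (∤-ind-∣ {p} {p ℕ.* d} (∣.m∣m*n d))) (trans (*-zeroˡ (f (p ℕ.* d))) (sym (*-zeroˡ 0ℚ))))) (trans (D-* 0ℚ (λ _ → 0ℚ) m) (*-zeroˡ (D (λ _ → 0ℚ) m))))
  (D-cong m (λ d _ _ → idem d (p ∣? d))))
  (+-identityˡ (D (λ d → ∤-ind p d * f d) m)))
  where
  idem : ∀ d → Dec (p ∣ d) → ∤-ind p d * (∤-ind p d * f d) ≡ ∤-ind p d * f d
  idem d (yes q) = trans (cong (_* (∤-ind p d * f d)) (∤-ind-∣ q)) (trans (*-zeroˡ (∤-ind p d * f d)) (sym (trans (cong (_* f d) (∤-ind-∣ q)) (*-zeroˡ (f d)))))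
  idem d (no q) = trans (cong (_* (∤-ind p d * f d)) (∤-ind-∤ q)) (*-identityˡ (∤-ind p d * f d))

-- powerOf p m is 1 if m is a power of the prime p, and 0 otherwise.
powerOf : ℕ → ℕ → ℚ
powerOf p m = D (λ d → ∤-ind p d * μ d) m

powerOf-∤ : ∀ {p m} → 1 ℕ.≤ m → ¬ p ∣ m → powerOf p m ≡ δ m
powerOf-∤ {p} {m} 1≤m ¬p∣m = trans (D-∤-coprime μ ¬p∣m) (μ-sum m 1≤m)

powerOf-* : ∀ {p m} → Prime p → 1 ℕ.≤ m → powerOf p (p ℕ.* m) ≡ powerOf p m
powerOf-* = D-∤-* μ

0≤powerOf : ∀ {p} → Prime p → ∀ m → 1 ℕ.≤ m → 0ℚ ≤ powerOf p m
0≤powerOf {p} pr = <-rec _ go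
  where
  go : ∀ m → (∀ {k} → k ℕ.< m → 1 ℕ.≤ k → 0ℚ ≤ powerOf p k) → 1 ℕ.≤ m → 0ℚ ≤ powerOf p m
  go m rec 1≤m with p ∣? m
  ... | no ¬p∣m = ≤-trans (0≤𝟙 (m ℕₚ.≟ 1)) (≤-reflexive (sym (powerOf-∤ 1≤m ¬p∣m)))
  ... | yes (divides k refl) = ≤-trans (rec k<kp 1≤k) (≤-reflexive (trans (sym (powerOf-* pr 1≤k)) (cong (powerOf p) (ℕₚ.*-comm p k))))
    where
    1≤k : 1 ℕ.≤ k
    1≤k = 1≤*ˡ k p 1≤m
    k<kp : k ℕ.< k ℕ.* p
    k<kp = ℕₚ.m<m*n k p {{ℕ.>-nonZero 1≤k}} (prime≥2 pr)

-- An exactly additive rational approximation to log₂, regular up to B.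
record Log (B : ℕ) : Set where
  field
    L : ℕ → ℚ
    L-* : ∀ m n → 1 ℕ.≤ m → 1 ℕ.≤ n → L (m ℕ.* n) ≡ L m + L n
    0≤L : ∀ n → 0ℚ ≤ L n
    L-2 : L 2 ≡ 1ℚ
    L-step : ∀ n → 1 ℕ.≤ n → n ℕ.< B → ∣ L (suc n) - L n ∣ ≤ ι 4 * inv n

-- The von Mangoldt function and Selberg's function

module Mangoldt {B : ℕ} (log : Log B) where
  open Log log public

  L-1 : L 1 ≡ 0ℚ
  L-1 = lin≡ (sym (L-* 1 1 (s≤s z≤n) (s≤s z≤n))) (((∀ a → 0ℚ + (a + a) ≡ a + a) ∋ solve-∀ ring) (L 1))

  -- The form -Σ μ(d) L(d) of μ ∗ L involves a plain divisor sum, so that the recursion at a prime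
  -- applies to it directly.
  Λ : ℕ → ℚ
  Λ n = - D (λ d → μ d * L d) n

  -- In L(p d) = L p + L d the contribution of L d cancels against the divisors prime to p; only L p
  -- remains, multiplied by the indicator of powers of p.
  Λ-prime-* : ∀ {p m} → Prime p → 1 ℕ.≤ m → Λ (p ℕ.* m) ≡ L p * powerOf p m
  Λ-prime-* {p} {m} pr 1≤m = begin
    - D (λ d → μ d * L d) (p ℕ.* m)
      ≡⟨ cong -_ (D-prime-* (λ d → μ d * L d) pr 1≤m) ⟩
    - (D (λ d → μ (p ℕ.* d) * L (p ℕ.* d)) m + D (λ d → ∤-ind p d * (μ d * L d)) m)
      ≡⟨ cong (λ z → - (z + D (λ d → ∤-ind p d * (μ d * L d)) m)) (trans
           (D-cong m (λ d 1≤d _ → trans (cong₂ _*_ (μ-prime-* pr 1≤d) (L-* p d (prime≥1 pr) 1≤d))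
             (((∀ i m l l′ → - (i * m) * (l + l′) ≡ (- l) * (i * m) + (- 1ℚ) * (i * (m * l′))) ∋ solve-∀ ring) (∤-ind p d) (μ d) (L p) (L d))))
           (trans (D-+ (λ d → (- L p) * (∤-ind p d * μ d)) (λ d → (- 1ℚ) * (∤-ind p d * (μ d * L d))) m)
             (cong₂ _+_ (D-* (- L p) (λ d → ∤-ind p d * μ d) m) (D-* (- 1ℚ) (λ d → ∤-ind p d * (μ d * L d)) m)))) ⟩
    - ((- L p) * powerOf p m + (- 1ℚ) * D (λ d → ∤-ind p d * (μ d * L d)) m + D (λ d → ∤-ind p d * (μ d * L d)) m)
      ≡⟨ ((∀ l e x → - ((- l) * e + (- 1ℚ) * x + x) ≡ l * e) ∋ solve-∀ ring) (L p) (powerOf p m) (D (λ d → ∤-ind p d * (μ d * L d)) m) ⟩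
    L p * powerOf p m ∎
    where open ≡-Reasoning

  Λ-1 : Λ 1 ≡ 0ℚ
  Λ-1 = cong -_ (trans (D-1 (λ d → μ d * L d)) (trans (cong (μ 1 *_) L-1) (*-zeroʳ (μ 1))))

  0≤Λ : ∀ n → 1 ℕ.≤ n → 0ℚ ≤ Λ n
  0≤Λ n 1≤n with n ℕₚ.≟ 1
  ... | yes refl = ≤-reflexive (sym Λ-1)
  ... | no n≢1 with prime-divisor n (ℕₚ.≤∧≢⇒< 1≤n (λ e → n≢1 (sym e)))
  ...   | p , pr , divides m refl = ≤-trans (0≤-* (0≤L p) (0≤powerOf pr m (1≤*ˡ m p 1≤n)))
    (≤-reflexive (trans (sym (Λ-prime-* pr (1≤*ˡ m p 1≤n))) (cong Λ (ℕₚ.*-comm p m))))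

  L-cofactor : ∀ d m n c → 1 ℕ.≤ d → 1 ℕ.≤ m → 𝟙 (d ℕ.* m ℕₚ.≟ n) * (c * (L d + L m)) ≡ 𝟙 (d ℕ.* m ℕₚ.≟ n) * (c * L n)
  L-cofactor d m n c p q = 𝟙-when (d ℕ.* m ℕₚ.≟ n) (λ { refl → cong (c *_) (sym (L-* d m p q)) })

  -- Adding μ L ∗ 1 to μ ∗ L gives weight L d + L m = L n to each factorization, hence L n times δ
  -- n; this vanishes since L 1 = 0.
  conv-μ-L : ∀ n → 1 ℕ.≤ n → conv μ L n ≡ Λ n
  conv-μ-L n 1≤n = lin≡ {A = conv μ L n + conv (λ d → μ d * L d) one n} {B = L n * conv μ one n}
    (begin
      conv μ L n + conv (λ d → μ d * L d) one n
        ≡⟨ sym (∑-+ n _ _) ⟩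
      ∑₁ n (λ d → ∑₁ n (λ m → 𝟙 (d ℕ.* m ℕₚ.≟ n) * (μ d * L m)) + ∑₁ n (λ m → 𝟙 (d ℕ.* m ℕₚ.≟ n) * (μ d * L d * 1ℚ)))
        ≡⟨ ∑₁-cong n (λ d 1≤d _ → trans (sym (∑-+ n _ _)) (trans (∑₁-cong n (λ m 1≤m _ →
             trans (((∀ i u l l′ → i * (u * l′) + i * (u * l * 1ℚ) ≡ i * (u * (l + l′))) ∋ solve-∀ ring) (𝟙 (d ℕ.* m ℕₚ.≟ n)) (μ d) (L d) (L m))
               (trans (L-cofactor d m n (μ d) 1≤d 1≤m) (((∀ i u l → i * (u * l) ≡ l * (i * (u * 1ℚ))) ∋ solve-∀ ring) (𝟙 (d ℕ.* m ℕₚ.≟ n)) (μ d) (L n)))))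
             (∑-*ˡ n (L n) _))) ⟩
      ∑₁ n (λ d → L n * ∑₁ n (λ m → 𝟙 (d ℕ.* m ℕₚ.≟ n) * (μ d * 1ℚ)))
        ≡⟨ ∑-*ˡ n (L n) _ ⟩
      L n * conv μ one n ∎)
    (begin
      Λ n + (conv μ L n + conv (λ d → μ d * L d) one n)
        ≡⟨ cong (λ z → - z + (conv μ L n + conv (λ d → μ d * L d) one n)) (sym (conv-one (λ d → μ d * L d) n 1≤n)) ⟩
      - conv (λ d → μ d * L d) one n + (conv μ L n + conv (λ d → μ d * L d) one n)
        ≡⟨ ((∀ a b → - b + (a + b) ≡ a + 0ℚ) ∋ solve-∀ ring) (conv μ L n) (conv (λ d → μ d * L d) one n) ⟩
      conv μ L n + 0ℚ ≡⟨ cong (conv μ L n +_) (sym (trans (cong (L n *_) (trans (conv-one μ n 1≤n) (μ-sum n 1≤n))) (Lδ (n ℕₚ.≟ 1)))) ⟩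
      conv μ L n + L n * conv μ one n ∎)
    where
    open ≡-Reasoning
    Lδ : (d : Dec (n ≡ 1)) → L n * 𝟙 d ≡ 0ℚ
    Lδ (yes refl) = trans (*-identityʳ (L 1)) L-1
    Lδ (no _) = *-zeroʳ (L n)

  conv-one-μ : ∀ n → 1 ℕ.≤ n → conv one μ n ≡ δ n
  conv-one-μ n 1≤n = trans (conv-comm one μ n) (trans (conv-one μ n 1≤n) (μ-sum n 1≤n))

  conv-Λ-one : ∀ n → 1 ℕ.≤ n → conv Λ one n ≡ L n
  conv-Λ-one n 1≤n = begin
    conv Λ one n               ≡⟨ conv-comm Λ one n ⟩
    conv one Λ n               ≡⟨ conv-congʳ one n (λ m 1≤m _ → sym (conv-μ-L m 1≤m)) ⟩
    conv one (conv μ L) n      ≡⟨ conv-assoc one μ L n ⟨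
    conv (conv one μ) L n      ≡⟨ conv-congˡ L n (λ m 1≤m _ → conv-one-μ m 1≤m) ⟩
    conv δ L n                 ≡⟨ conv-δˡ L n 1≤n ⟩
    L n                        ∎
    where open ≡-Reasoning

  -- Selberg's function Λ₂ = Λ L + Λ ∗ Λ = μ ∗ L².
  Λ₂ : ℕ → ℚ
  Λ₂ n = Λ n * L n + conv Λ Λ n

  L² : ℕ → ℚ
  L² n = L n * L n

  -- Since 1 ∗ Λ ∗ Λ = L ∗ Λ, each factorization d m = n carries Λ m with the weights L m and L d,
  -- which add up to L n; the remaining factor is 1 ∗ Λ = L.
  conv-one-Λ₂ : ∀ n → 1 ℕ.≤ n → conv one Λ₂ n ≡ L² n
  conv-one-Λ₂ n 1≤n = begin
    conv one Λ₂ n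
      ≡⟨ conv-+ʳ one (λ m → Λ m * L m) (conv Λ Λ) n ⟩
    conv one (λ m → Λ m * L m) n + conv one (conv Λ Λ) n
      ≡⟨ cong (conv one (λ m → Λ m * L m) n +_) (trans (sym (conv-assoc one Λ Λ n))
           (conv-congˡ Λ n (λ m 1≤m _ → trans (conv-comm one Λ m) (conv-Λ-one m 1≤m)))) ⟩
    conv one (λ m → Λ m * L m) n + conv L Λ n
      ≡⟨ sym (∑-+ n _ _) ⟩
    ∑₁ n (λ d → ∑₁ n (λ m → 𝟙 (d ℕ.* m ℕₚ.≟ n) * (1ℚ * (Λ m * L m))) + ∑₁ n (λ m → 𝟙 (d ℕ.* m ℕₚ.≟ n) * (L d * Λ m)))
      ≡⟨ ∑₁-cong n (λ d 1≤d _ → trans (sym (∑-+ n _ _)) (trans (∑₁-cong n (λ m 1≤m _ →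
           trans (((∀ i u l l′ → i * (1ℚ * (u * l′)) + i * (l * u) ≡ i * (u * (l + l′))) ∋ solve-∀ ring) (𝟙 (d ℕ.* m ℕₚ.≟ n)) (Λ m) (L d) (L m))
             (trans (L-cofactor d m n (Λ m) 1≤d 1≤m) (((∀ i u l → i * (u * l) ≡ l * (i * (1ℚ * u))) ∋ solve-∀ ring) (𝟙 (d ℕ.* m ℕₚ.≟ n)) (Λ m) (L n)))))
           (∑-*ˡ n (L n) _))) ⟩
    ∑₁ n (λ d → L n * ∑₁ n (λ m → 𝟙 (d ℕ.* m ℕₚ.≟ n) * (1ℚ * Λ m)))
      ≡⟨ ∑-*ˡ n (L n) _ ⟩
    L n * conv one Λ n
      ≡⟨ cong (L n *_) (trans (conv-comm one Λ n) (conv-Λ-one n 1≤n)) ⟩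
    L² n ∎
    where open ≡-Reasoning

  conv-μ-L² : ∀ n → 1 ℕ.≤ n → conv μ L² n ≡ Λ₂ n
  conv-μ-L² n 1≤n = begin
    conv μ L² n                ≡⟨ conv-congʳ μ n (λ m 1≤m _ → sym (conv-one-Λ₂ m 1≤m)) ⟩
    conv μ (conv one Λ₂) n     ≡⟨ conv-assoc μ one Λ₂ n ⟨
    conv (conv μ one) Λ₂ n     ≡⟨ conv-congˡ Λ₂ n (λ m 1≤m _ → trans (conv-comm μ one m) (conv-one-μ m 1≤m)) ⟩
    conv δ Λ₂ n                ≡⟨ conv-δˡ Λ₂ n 1≤n ⟩
    Λ₂ n                       ∎
    where open ≡-Reasoning

  -- Λ n is one of the non-negative terms of the divisor sum 1 ∗ Λ = L.
  Λ≤L : ∀ n → 1 ℕ.≤ n → Λ n ≤ L n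
  Λ≤L (suc n) 1≤n = ≤-trans
    (lin (∑₁-≥0 n (λ d 1≤d _ → 0≤-* (0≤𝟙 (d ∣? suc n)) (0≤Λ d 1≤d)))
      (((∀ a b → a + b + 0ℚ ≡ b + a) ∋ solve-∀ ring) (∑₁ n (λ d → 𝟙 (d ∣? suc n) * Λ d)) (Λ (suc n))))
    (≤-reflexive (trans (cong (∑₁ n (λ d → 𝟙 (d ∣? suc n) * Λ d) +_) (sym (trans (cong (_* Λ (suc n)) (𝟙-yes (suc n ∣? suc n) ∣.∣-refl)) (*-identityˡ (Λ (suc n))))))
      (trans (sym (conv-one Λ (suc n) 1≤n)) (conv-Λ-one (suc n) 1≤n))))

-- The integer part of the binary logarithm

private
  bump : ∀ {P : Set} → ℕ → Dec P → ℕ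
  bump k (yes _) = suc k
  bump k (no _) = k

-- lg n = ⌊log₂ n⌋, with lg 0 = 0.
lg : ℕ → ℕ
lg zero = 0
lg (suc zero) = 0
lg (suc (suc n)) = bump (lg (suc n)) (2 ℕ.^ suc (lg (suc n)) ℕₚ.≤? suc (suc n))

private
  bump-lower : ∀ k n (d : Dec (2 ℕ.^ suc k ℕ.≤ n)) → 2 ℕ.^ k ℕ.≤ n → 2 ℕ.^ bump k d ℕ.≤ n
  bump-lower k n (yes p) _ = p
  bump-lower k n (no _) q = q

  bump-upper : ∀ k n (d : Dec (2 ℕ.^ suc k ℕ.≤ suc n)) → n ℕ.< 2 ℕ.^ suc k → suc n ℕ.< 2 ℕ.^ suc (bump k d)
  bump-upper k n (yes _) q = ℕₚ.≤-trans (s≤s q) (ℕₚ.^-monoʳ-< 2 (s≤s (s≤s z≤n)) (ℕₚ.n<1+n (suc k)))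
  bump-upper k n (no ¬p) _ = ℕₚ.≰⇒> ¬p

lg-lower : ∀ n → 1 ℕ.≤ n → 2 ℕ.^ lg n ℕ.≤ n
lg-lower (suc zero) _ = s≤s z≤n
lg-lower (suc (suc n)) _ = bump-lower (lg (suc n)) (suc (suc n)) (2 ℕ.^ suc (lg (suc n)) ℕₚ.≤? suc (suc n)) (ℕₚ.≤-trans (lg-lower (suc n) (s≤s z≤n)) (ℕₚ.n≤1+n (suc n)))

lg-upper : ∀ n → n ℕ.< 2 ℕ.^ suc (lg n)
lg-upper zero = s≤s z≤n
lg-upper (suc zero) = s≤s (s≤s z≤n)
lg-upper (suc (suc n)) = bump-upper (lg (suc n)) (suc n) (2 ℕ.^ suc (lg (suc n)) ℕₚ.≤? suc (suc n)) (lg-upper (suc n))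

2^-cancel-< : ∀ {i j} → 2 ℕ.^ i ℕ.< 2 ℕ.^ j → i ℕ.< j
2^-cancel-< {i} {j} p with i ℕₚ.<? j
... | yes q = q
... | no ¬q = ⊥-elim (ℕₚ.<⇒≱ p (ℕₚ.^-monoʳ-≤ 2 (ℕₚ.≮⇒≥ ¬q)))

2^-cancel-≤ : ∀ {i j} → 2 ℕ.^ i ℕ.≤ 2 ℕ.^ j → i ℕ.≤ j
2^-cancel-≤ {i} {j} p with i ℕₚ.≤? j
... | yes q = q
... | no ¬q = ⊥-elim (ℕₚ.<⇒≱ (ℕₚ.^-monoʳ-< 2 (s≤s (s≤s z≤n)) (ℕₚ.≰⇒> ¬q)) p)

≤lg : ∀ {j n} → 2 ℕ.^ j ℕ.≤ n → j ℕ.≤ lg n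
≤lg {j} {n} p = ℕ.s≤s⁻¹ (2^-cancel-< (ℕₚ.≤-<-trans p (lg-upper n)))

lg≤ : ∀ {j n} → n ℕ.< 2 ℕ.^ suc j → lg n ℕ.≤ j
lg≤ {j} {zero} _ = z≤n
lg≤ {j} {suc n} p = ℕ.s≤s⁻¹ (2^-cancel-< (ℕₚ.≤-<-trans (lg-lower (suc n) (s≤s z≤n)) p))

1≤2^ : ∀ j → 1 ℕ.≤ 2 ℕ.^ j
1≤2^ j = ℕₚ.^-monoʳ-≤ 2 {0} {j} z≤n

lg-2^ : ∀ j → lg (2 ℕ.^ j) ≡ j
lg-2^ j = ℕₚ.≤-antisym (lg≤ (ℕₚ.^-monoʳ-< 2 (s≤s (s≤s z≤n)) (ℕₚ.n<1+n j))) (≤lg ℕₚ.≤-refl)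

lg-mono : ∀ {m n} → m ℕ.≤ n → lg m ℕ.≤ lg n
lg-mono {m} {n} p = lg≤ (ℕₚ.≤-<-trans p (lg-upper n))

lg-*-lower : ∀ m n → 1 ℕ.≤ m → 1 ℕ.≤ n → lg m ℕ.+ lg n ℕ.≤ lg (m ℕ.* n)
lg-*-lower m n p q = ≤lg (subst (ℕ._≤ m ℕ.* n) (sym (ℕₚ.^-distribˡ-+-* 2 (lg m) (lg n))) (ℕₚ.*-mono-≤ (lg-lower m p) (lg-lower n q)))

lg-div-lower : ∀ x d → 1 ℕ.≤ d → d ℕ.≤ x → lg d ℕ.+ lg (x div d) ℕ.≤ lg x
lg-div-lower x d 1≤d d≤x = ℕₚ.≤-trans
  (lg-*-lower d (x div d) 1≤d (*-≤⇒≤-div x d 1 1≤d (subst (ℕ._≤ x) (sym (ℕₚ.*-identityʳ d)) d≤x)))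
  (lg-mono (div-*-≤ x d))

lg-div-upper : ∀ x d → 1 ℕ.≤ d → lg x ℕ.≤ suc (lg d ℕ.+ lg (x div d))
lg-div-upper x d 1≤d = lg≤ (begin-strict
  x                                                     <⟨ <-*-suc-div x d 1≤d ⟩
  d ℕ.* suc (x div d)                                   ≤⟨ ℕₚ.*-mono-≤ (ℕₚ.<⇒≤ (lg-upper d)) (lg-upper (x div d)) ⟩
  2 ℕ.^ suc (lg d) ℕ.* 2 ℕ.^ suc (lg (x div d))         ≡⟨ ℕₚ.^-distribˡ-+-* 2 (suc (lg d)) (suc (lg (x div d))) ⟨
  2 ℕ.^ (suc (lg d) ℕ.+ suc (lg (x div d)))             ≡⟨ cong (λ k → 2 ℕ.^ suc k) (ℕₚ.+-suc (lg d) (lg (x div d))) ⟩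
  2 ℕ.^ suc (suc (lg d ℕ.+ lg (x div d)))               ∎)
  where open ℕₚ.≤-Reasoning

n<2^n : ∀ n → n ℕ.< 2 ℕ.^ n
n<2^n zero = s≤s z≤n
n<2^n (suc n) = ℕₚ.≤-trans (s≤s (n<2^n n)) (ℕₚ.^-monoʳ-< 2 (s≤s (s≤s z≤n)) (ℕₚ.n<1+n n))

-- Construction of the additive approximate logarithm

private
  ^-distribʳ-* : ∀ k m n → (m ℕ.* n) ℕ.^ k ≡ m ℕ.^ k ℕ.* n ℕ.^ k
  ^-distribʳ-* zero m n = refl
  ^-distribʳ-* (suc k) m n = trans (cong (m ℕ.* n ℕ.*_) (^-distribʳ-* k m n)) (interchange m n (m ℕ.^ k) (n ℕ.^ k))
    where
    interchange : ∀ a b c d → a ℕ.* b ℕ.* (c ℕ.* d) ≡ a ℕ.* c ℕ.* (b ℕ.* d)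
    interchange = solve-ℕ

  ^-comm : ∀ a m n → (a ℕ.^ m) ℕ.^ n ≡ (a ℕ.^ n) ℕ.^ m
  ^-comm a m n = trans (ℕₚ.^-*-assoc a m n) (trans (cong (a ℕ.^_) (ℕₚ.*-comm m n)) (sym (ℕₚ.^-*-assoc a n m)))

  -- Bernoulli's inequality (1 - 1/(n+1))^h ≥ 1 - h/(n+1) with denominators cleared.
  bernoulli : ∀ n h k → h ℕ.+ k ≡ suc n → suc n ℕ.^ h ℕ.* k ℕ.≤ n ℕ.^ h ℕ.* suc n
  bernoulli n zero k refl = ℕₚ.≤-refl
  bernoulli n (suc h) k eq = begin
    suc n ℕ.* suc n ℕ.^ h ℕ.* k     ≡⟨ trans (cong (ℕ._* k) (ℕₚ.*-comm (suc n) (suc n ℕ.^ h))) (ℕₚ.*-assoc (suc n ℕ.^ h) (suc n) k) ⟩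
    suc n ℕ.^ h ℕ.* (suc n ℕ.* k)   ≤⟨ ℕₚ.*-monoʳ-≤ (suc n ℕ.^ h) (subst (suc n ℕ.* k ℕ.≤_) (sym (ℕₚ.*-suc n k)) (ℕₚ.+-monoˡ-≤ (n ℕ.* k) (subst (k ℕ.≤_) (ℕₚ.suc-injective eq) (ℕₚ.m≤n+m k h)))) ⟩
    suc n ℕ.^ h ℕ.* (n ℕ.* suc k)   ≡⟨ trans (cong (suc n ℕ.^ h ℕ.*_) (ℕₚ.*-comm n (suc k))) (trans (sym (ℕₚ.*-assoc (suc n ℕ.^ h) (suc k) n)) (ℕₚ.*-comm (suc n ℕ.^ h ℕ.* suc k) n)) ⟩
    n ℕ.* (suc n ℕ.^ h ℕ.* suc k)   ≤⟨ ℕₚ.*-monoʳ-≤ n (bernoulli n h (suc k) (trans (ℕₚ.+-suc h k) eq)) ⟩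
    n ℕ.* (n ℕ.^ h ℕ.* suc n)       ≡⟨ ℕₚ.*-assoc n (n ℕ.^ h) (suc n) ⟨
    n ℕ.* n ℕ.^ h ℕ.* suc n         ∎
    where open ℕₚ.≤-Reasoning

  halve : ∀ n → ∃ λ h → n ℕ.≤ h ℕ.+ h × h ℕ.+ h ℕ.≤ suc n
  halve zero = 0 , z≤n , z≤n
  halve (suc zero) = 1 , s≤s z≤n , ℕₚ.≤-refl
  halve (suc (suc n)) with halve n
  ... | h , p , q = suc h , subst (suc (suc n) ℕ.≤_) (cong suc (sym (ℕₚ.+-suc h h))) (s≤s (s≤s p)) , subst (ℕ._≤ suc (suc (suc n))) (cong suc (sym (ℕₚ.+-suc h h))) (s≤s (s≤s q))

  -- This says log₂(1 + 1/n) ≤ 1/h for h up to about n/2, the upper half of the regularity of the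
  -- logarithm.
  suc^≤2*^ : ∀ n h → h ℕ.+ h ℕ.≤ suc n → suc n ℕ.^ h ℕ.≤ 2 ℕ.* n ℕ.^ h
  suc^≤2*^ n h p = ℕₚ.*-cancelʳ-≤ _ _ (suc n) (begin
    suc n ℕ.^ h ℕ.* suc n           ≤⟨ ℕₚ.*-monoʳ-≤ (suc n ℕ.^ h) sn≤2k ⟩
    suc n ℕ.^ h ℕ.* (k ℕ.+ k)       ≡⟨ ℕₚ.*-distribˡ-+ (suc n ℕ.^ h) k k ⟩
    suc n ℕ.^ h ℕ.* k ℕ.+ suc n ℕ.^ h ℕ.* k ≤⟨ ℕₚ.+-mono-≤ b b ⟩
    n ℕ.^ h ℕ.* suc n ℕ.+ n ℕ.^ h ℕ.* suc n ≡⟨ ℕₚ.*-distribʳ-+ (suc n) (n ℕ.^ h) (n ℕ.^ h) ⟨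
    (n ℕ.^ h ℕ.+ n ℕ.^ h) ℕ.* suc n ≡⟨ cong (ℕ._* suc n) (cong (n ℕ.^ h ℕ.+_) (sym (ℕₚ.+-identityʳ (n ℕ.^ h)))) ⟩
    2 ℕ.* n ℕ.^ h ℕ.* suc n         ∎)
    where
    open ℕₚ.≤-Reasoning
    k : ℕ
    k = suc n ℕ.∸ h
    h+k : h ℕ.+ k ≡ suc n
    h+k = ℕₚ.m+[n∸m]≡n (ℕₚ.≤-trans (ℕₚ.m≤m+n h h) p)
    h≤k : h ℕ.≤ k
    h≤k = ℕₚ.+-cancelˡ-≤ h h k (subst (h ℕ.+ h ℕ.≤_) (sym h+k) p)
    sn≤2k : suc n ℕ.≤ k ℕ.+ k
    sn≤2k = subst (ℕ._≤ k ℕ.+ k) h+k (ℕₚ.+-monoˡ-≤ k h≤k)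
    b : suc n ℕ.^ h ℕ.* k ℕ.≤ n ℕ.^ h ℕ.* suc n
    b = bernoulli n h k h+k

-- M log₂ n is approximated by the additive function with values ⌊log₂ pᴹ⌋, the error being at most Ω n.
module LogConstruction (B : ℕ) where
  -- The defect of ℓ is at most Ω n ≤ n and only ever enters multiplied by a number at most B. For n
  -- < B such a product is at most B², so M dominates it.
  M : ℕ
  M = suc (B ℕ.* B)

  ℓ : ℕ → ℕ
  ℓ = additive (λ p → lg (p ℕ.^ M))

  private
    1≤^ : ∀ {n} k → 1 ℕ.≤ n → 1 ℕ.≤ n ℕ.^ k
    1≤^ {suc n} k _ = ℕₚ.^-monoʳ-≤ (suc n) {0} {k} z≤n

    list-lower : ∀ ps → All Prime ps → 2 ℕ.^ sum (map (λ p → lg (p ℕ.^ M)) ps) ℕ.≤ product ps ℕ.^ M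
    list-lower [] _ = 1≤^ M (s≤s z≤n)
    list-lower (p ∷ ps) (pr All.∷ prs) = subst₂ ℕ._≤_
      (sym (ℕₚ.^-distribˡ-+-* 2 (lg (p ℕ.^ M)) (sum (map (λ p → lg (p ℕ.^ M)) ps)))) (sym (^-distribʳ-* M p (product ps)))
      (ℕₚ.*-mono-≤ (lg-lower (p ℕ.^ M) (1≤^ M (prime≥1 pr))) (list-lower ps prs))

    list-upper : ∀ ps → All Prime ps → product ps ℕ.^ M ℕ.≤ 2 ℕ.^ (sum (map (λ p → lg (p ℕ.^ M)) ps) ℕ.+ sum (map (λ _ → 1) ps))
    list-upper [] _ = ℕₚ.≤-reflexive (ℕₚ.^-zeroˡ M)
    list-upper (p ∷ ps) (pr All.∷ prs) = subst₂ ℕ._≤_ (sym (^-distribʳ-* M p (product ps)))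
      (trans (sym (ℕₚ.^-distribˡ-+-* 2 (suc a) (b ℕ.+ c))) (cong (2 ℕ.^_) (trans (cong suc (sym (ℕₚ.+-assoc a b c))) (sym (ℕₚ.+-suc (a ℕ.+ b) c)))))
      (ℕₚ.*-mono-≤ (ℕₚ.<⇒≤ (lg-upper (p ℕ.^ M))) (list-upper ps prs))
      where
      a = lg (p ℕ.^ M)
      b = sum (map (λ p → lg (p ℕ.^ M)) ps)
      c = sum (map (λ _ → 1) ps)

    list-Ω : ∀ ps → All Prime ps → 2 ℕ.^ sum (map (λ _ → 1) ps) ℕ.≤ product ps
    list-Ω [] _ = s≤s z≤n
    list-Ω (p ∷ ps) (pr All.∷ prs) = ℕₚ.*-mono-≤ (prime≥2 pr) (list-Ω ps prs)

    ℓ-lower : ∀ n → 1 ℕ.≤ n → 2 ℕ.^ ℓ n ℕ.≤ n ℕ.^ M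
    ℓ-lower n p = subst (λ k → 2 ℕ.^ ℓ n ℕ.≤ k ℕ.^ M) (primeFactors-product p) (list-lower (primeFactors n) (primeFactors-prime n))

    ℓ-upper : ∀ n → 1 ℕ.≤ n → n ℕ.^ M ℕ.≤ 2 ℕ.^ (ℓ n ℕ.+ Ω n)
    ℓ-upper n p = subst (λ k → k ℕ.^ M ℕ.≤ 2 ℕ.^ (ℓ n ℕ.+ Ω n)) (primeFactors-product p) (list-upper (primeFactors n) (primeFactors-prime n))

    Ω≤ : ∀ n → 1 ℕ.≤ n → Ω n ℕ.≤ n
    Ω≤ n p = ℕₚ.≤-trans (ℕₚ.<⇒≤ (n<2^n (Ω n))) (subst (2 ℕ.^ Ω n ℕ.≤_) (primeFactors-product p) (list-Ω (primeFactors n) (primeFactors-prime n)))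

    -- The inequality (n+1)^h ≤ 2 n^h is raised to the power M; bounding both sides by powers of 2
    -- turns it into a comparison of exponents.
    up : ∀ n h → 1 ℕ.≤ n → h ℕ.+ h ℕ.≤ suc n → ℓ (suc n) ℕ.* h ℕ.≤ M ℕ.+ (ℓ n ℕ.+ Ω n) ℕ.* h
    up n h p q = 2^-cancel-≤ (begin
      2 ℕ.^ (ℓ (suc n) ℕ.* h)                ≡⟨ ℕₚ.^-*-assoc 2 (ℓ (suc n)) h ⟨
      (2 ℕ.^ ℓ (suc n)) ℕ.^ h                ≤⟨ ℕₚ.^-monoˡ-≤ h (ℓ-lower (suc n) (s≤s z≤n)) ⟩
      (suc n ℕ.^ M) ℕ.^ h                    ≡⟨ ^-comm (suc n) M h ⟩
      (suc n ℕ.^ h) ℕ.^ M                    ≤⟨ ℕₚ.^-monoˡ-≤ M (suc^≤2*^ n h q) ⟩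
      (2 ℕ.* n ℕ.^ h) ℕ.^ M                  ≡⟨ ^-distribʳ-* M 2 (n ℕ.^ h) ⟩
      2 ℕ.^ M ℕ.* (n ℕ.^ h) ℕ.^ M            ≡⟨ cong (2 ℕ.^ M ℕ.*_) (^-comm n h M) ⟩
      2 ℕ.^ M ℕ.* (n ℕ.^ M) ℕ.^ h            ≤⟨ ℕₚ.*-monoʳ-≤ (2 ℕ.^ M) (ℕₚ.^-monoˡ-≤ h (ℓ-upper n p)) ⟩
      2 ℕ.^ M ℕ.* (2 ℕ.^ (ℓ n ℕ.+ Ω n)) ℕ.^ h ≡⟨ cong (2 ℕ.^ M ℕ.*_) (ℕₚ.^-*-assoc 2 (ℓ n ℕ.+ Ω n) h) ⟩
      2 ℕ.^ M ℕ.* 2 ℕ.^ ((ℓ n ℕ.+ Ω n) ℕ.* h) ≡⟨ ℕₚ.^-distribˡ-+-* 2 M ((ℓ n ℕ.+ Ω n) ℕ.* h) ⟨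
      2 ℕ.^ (M ℕ.+ (ℓ n ℕ.+ Ω n) ℕ.* h)      ∎)
      where open ℕₚ.≤-Reasoning

    down : ∀ n → 1 ℕ.≤ n → ℓ n ℕ.≤ ℓ (suc n) ℕ.+ Ω (suc n)
    down n p = 2^-cancel-≤ (ℕₚ.≤-trans (ℓ-lower n p) (ℕₚ.≤-trans (ℕₚ.^-monoˡ-≤ M (ℕₚ.n≤1+n n)) (ℓ-upper (suc n) (s≤s z≤n))))

    -- With n ≤ 2 h, n times the increment is at most 2 · 2 M: one M comes from the factor 2 in
    -- `up`, the other bounds the defect Ω n · h. This is the origin of the constant 4 in `L-step`.
    up-ι : ∀ n → 1 ℕ.≤ n → n ℕ.< B → ι n * (ι (ℓ (suc n)) - ι (ℓ n)) ≤ ι 4 * ι M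
    up-ι n p n<B with halve n
    ... | h , n≤2h , 2h≤sn with ≤-total (ι (ℓ (suc n))) (ι (ℓ n))
    ...   | inj₁ a≤b = lin (0≤ι n ·≤ a≤b ⊕ 0≤-* (0≤ι 4) (0≤ι M)) (((∀ n a b m → m + (n * a + 0ℚ) ≡ n * (a - b) + (n * b + m)) ∋ solve-∀ ring) (ι n) (ι (ℓ (suc n))) (ι (ℓ n)) (ι 4 * ι M))
    ...   | inj₂ b≤a = lin
            (≤-trans (ι-mono n≤2h) (≤-reflexive (ι-+ h h)) ·′ 0≤-diff b≤a ⊕ (0≤ι 2 ·≤ hstep))
            (((∀ n h a b m → ι 4 * m + (n * (a - b) + ι 2 * (a * h)) ≡ n * (a - b) + ((h + h) * (a - b) + ι 2 * (m + (b * h + m)))) ∋ solve-∀ ring)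
               (ι n) (ι h) (ι (ℓ (suc n))) (ι (ℓ n)) (ι M))
      where
      _·′_ : ∀ {x y c} → x ≤ y → 0ℚ ≤ c → x * c ≤ y * c
      _·′_ {x} {y} {c} x≤y 0≤c = *-monoʳ-≤-nonNeg c {{nonNegative 0≤c}} x≤y
      h≤n : h ℕ.≤ n
      h≤n with h ℕₚ.≤? n
      ... | yes q = q
      ... | no ¬q = ⊥-elim (ℕₚ.<⇒≱ (ℕₚ.<-≤-trans (s≤s (ℕₚ.m≤m+n (suc n) n)) (ℕₚ.≤-trans (ℕₚ.≤-reflexive (sym (ℕₚ.+-suc (suc n) n))) (ℕₚ.+-mono-≤ (ℕₚ.≰⇒> ¬q) (ℕₚ.≰⇒> ¬q)))) 2h≤sn)
      nat : ℓ (suc n) ℕ.* h ℕ.≤ M ℕ.+ (ℓ n ℕ.* h ℕ.+ M)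
      nat = ℕₚ.≤-trans (up n h p 2h≤sn) (ℕₚ.+-monoʳ-≤ M (ℕₚ.≤-trans (ℕₚ.≤-reflexive (ℕₚ.*-distribʳ-+ h (ℓ n) (Ω n)))
        (ℕₚ.+-monoʳ-≤ (ℓ n ℕ.* h) (ℕₚ.≤-trans (ℕₚ.*-mono-≤ (ℕₚ.≤-trans (Ω≤ n p) (ℕₚ.<⇒≤ n<B)) (ℕₚ.≤-trans h≤n (ℕₚ.<⇒≤ n<B))) (ℕₚ.n≤1+n (B ℕ.* B))))))
      hstep : ι (ℓ (suc n)) * ι h ≤ ι M + (ι (ℓ n) * ι h + ι M)
      hstep = ≤-trans (≤-reflexive (sym (ι-* (ℓ (suc n)) h))) (≤-trans (ι-mono nat)
        (≤-reflexive (trans (ι-+ M (ℓ n ℕ.* h ℕ.+ M)) (cong (ι M +_) (trans (ι-+ (ℓ n ℕ.* h) M) (cong (_+ ι M) (ι-* (ℓ n) h)))))))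

    down-ι : ∀ n → 1 ℕ.≤ n → n ℕ.< B → ι n * (ι (ℓ n) - ι (ℓ (suc n))) ≤ ι 4 * ι M
    down-ι n p n<B = lin
      (0≤ι n ·≤ ≤-trans (ι-mono (ℕₚ.≤-trans (down n p) (ℕₚ.+-monoʳ-≤ (ℓ (suc n)) (ℕₚ.≤-trans (Ω≤ (suc n) (s≤s z≤n)) n<B)))) (≤-reflexive (ι-+ (ℓ (suc n)) B))
        ⊕ ι-mono (ℕₚ.≤-trans (ℕₚ.*-monoˡ-≤ B (ℕₚ.<⇒≤ n<B)) (ℕₚ.n≤1+n (B ℕ.* B)))
        ⊕ 0≤-* (0≤ι 3) (0≤ι M))
      (trans (cong (λ z → ι 4 * ι M + (ι n * ι (ℓ n) + z + 0ℚ)) (ι-* n B))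
        (((∀ n a b B m → ι 4 * m + (n * a + n * B + 0ℚ) ≡ n * (a - b) + (n * (b + B) + m + ι 3 * m)) ∋ solve-∀ ring) (ι n) (ι (ℓ n)) (ι (ℓ (suc n))) (ι B) (ι M)))

    scale : ∀ n x → 1 ℕ.≤ n → ι n * x ≤ ι 4 * ι M → x * inv M ≤ ι 4 * inv n
    scale n x p h = lin (0≤-* (0≤inv n) (0≤inv M) ·≤ h) (begin
      ι 4 * inv n + inv n * inv M * (ι n * x)     ≡⟨ ((∀ i j n x → ι 4 * i + i * j * (n * x) ≡ ι 4 * i * 1ℚ + (n * i) * (x * j)) ∋ solve-∀ ring) (inv n) (inv M) (ι n) x ⟩
      ι 4 * inv n * 1ℚ + (ι n * inv n) * (x * inv M) ≡⟨ cong₂ (λ u v → ι 4 * inv n * u + v * (x * inv M)) (sym (ι-inv {M} (s≤s z≤n))) (ι-inv p) ⟩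
      ι 4 * inv n * (ι M * inv M) + 1ℚ * (x * inv M) ≡⟨ ((∀ i j m x → ι 4 * i * (m * j) + 1ℚ * (x * j) ≡ x * j + i * j * (ι 4 * m)) ∋ solve-∀ ring) (inv n) (inv M) (ι M) x ⟩
      x * inv M + inv n * inv M * (ι 4 * ι M) ∎)
      where open ≡-Reasoning

  log : Log B
  log = record
    { L = λ n → ι (ℓ n) * inv M
    ; L-* = λ m n p q → trans (cong (λ z → ι z * inv M) (additive-* _ m n p q)) (trans (cong (_* inv M) (ι-+ (ℓ m) (ℓ n))) (*-distribʳ-+ (inv M) (ι (ℓ m)) (ι (ℓ n))))
    ; 0≤L = λ n → 0≤-* (0≤ι (ℓ n)) (0≤inv M)
    ; L-2 = trans (cong (λ z → ι z * inv M) (trans (additive-prime (λ p → lg (p ℕ.^ M)) prime[2]) (lg-2^ M))) (ι-inv {M} (s≤s z≤n))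
    ; L-step = λ n p q → abs≤
        (≤-trans (≤-reflexive (((∀ a b i → a * i - b * i ≡ (a - b) * i) ∋ solve-∀ ring) (ι (ℓ (suc n))) (ι (ℓ n)) (inv M))) (scale n _ p (up-ι n p q)))
        (≤-trans (≤-reflexive (((∀ a b i → - (a * i - b * i) ≡ (b - a) * i) ∋ solve-∀ ring) (ι (ℓ (suc n))) (ι (ℓ n)) (inv M))) (scale n _ p (down-ι n p q)))
    }

-- Variation of the logarithm and Chebyshev's estimate

inv-1 : inv 1 ≡ 1ℚ
inv-1 = trans (sym (*-identityˡ (inv 1))) (ι-inv {1} (s≤s z≤n))

inv-step : ∀ n → 1 ℕ.≤ n → inv n - inv (suc n) ≡ inv n * inv (suc n)
inv-step n p = begin
  inv n - inv (suc n)
    ≡⟨ ((∀ i j → i - j ≡ i * 1ℚ - j * 1ℚ) ∋ solve-∀ ring) (inv n) (inv (suc n)) ⟩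
  inv n * 1ℚ - inv (suc n) * 1ℚ
    ≡⟨ cong₂ (λ u v → inv n * u - inv (suc n) * v) (sym (ι-inv {suc n} (s≤s z≤n))) (sym (ι-inv p)) ⟩
  inv n * (ι (suc n) * inv (suc n)) - inv (suc n) * (ι n * inv n)
    ≡⟨ ((∀ i j n → i * ((n + 1ℚ) * j) - j * (n * i) ≡ i * j) ∋ solve-∀ ring) (inv n) (inv (suc n)) (ι n) ⟩
  inv n * inv (suc n) ∎
  where open ≡-Reasoning

inv-anti-step : ∀ n → 1 ℕ.≤ n → inv (suc n) ≤ inv n
inv-anti-step n p = inv-anti p (ℕₚ.n≤1+n n)

half-cases : ∀ x → x ≡ x div 2 ℕ.+ x div 2 ⊎ x ≡ suc (x div 2 ℕ.+ x div 2)
half-cases x with ℕₚ.m≤n⇒m<n∨m≡n (subst (ℕ._≤ x) (cong (x div 2 ℕ.+_) (ℕₚ.+-identityʳ (x div 2))) (div-*-≤ x 2))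
... | inj₂ e = inj₁ (sym e)
... | inj₁ p = inj₂ (ℕₚ.≤-antisym (ℕ.s≤s⁻¹ (subst (suc x ℕ.≤_) e (<-*-suc-div x 2 (s≤s z≤n)))) p)
  where
  e : 2 ℕ.* suc (x div 2) ≡ suc (suc (x div 2 ℕ.+ x div 2))
  e = ((∀ y → 2 ℕ.* suc y ≡ suc (suc (y ℕ.+ y))) ∋ solve-ℕ) (x div 2)

-- Kept abstract: unfolding the numeral would be expensive.
abstract
  K₂ : ℚ
  K₂ = ι 96

  0≤K₂ : 0ℚ ≤ K₂
  0≤K₂ = 0≤ι 96

module Chebyshev {B : ℕ} (log : Log B) where
  open Mangoldt log public

  L-step-up : ∀ n → 1 ℕ.≤ n → n ℕ.< B → L (suc n) - L n ≤ ι 4 * inv n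
  L-step-up n p q = abs-upper (L-step n p q)

  L-step-down : ∀ n → 1 ℕ.≤ n → n ℕ.< B → L n - L (suc n) ≤ ι 4 * inv n
  L-step-down n p q = ≤-trans (≤-reflexive (((∀ a b → a - b ≡ - (b - a)) ∋ solve-∀ ring) (L n) (L (suc n)))) (≤-trans (-≤abs (L (suc n) - L n)) (L-step n p q))

  4inv≤4 : ∀ n → ι 4 * inv n ≤ ι 4
  4inv≤4 n = ≤-trans (0≤ι 4 ·≤ inv≤1 n) (≤-reflexive (*-identityʳ (ι 4)))

  L-linear : ∀ n → n ℕ.< B → L (suc n) ≤ ι 4 * ι n
  L-linear zero _ = ≤-reflexive (trans L-1 (sym (*-zeroʳ (ι 4))))
  L-linear (suc n) p = lin (L-linear n (ℕₚ.<-trans (ℕₚ.n<1+n n) p) ⊕ L-step-up (suc n) (s≤s z≤n) p ⊕ 4inv≤4 (suc n))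
    (((∀ a b n e → ι 4 * (n + 1ℚ) + (a + (b - a) + e) ≡ b + (ι 4 * n + e + ι 4)) ∋ solve-∀ ring) (L (suc n)) (L (suc (suc n))) (ι n) (ι 4 * inv (suc n)))

  L-2^ : ∀ j → L (2 ℕ.^ j) ≡ ι j
  L-2^ zero = L-1
  L-2^ (suc j) = trans (L-* 2 (2 ℕ.^ j) (s≤s z≤n) (1≤2^ j)) (trans (cong₂ _+_ L-2 (L-2^ j)) (+-comm 1ℚ (ι j)))

  L-block : ∀ j i → 2 ℕ.^ j ℕ.+ i ℕ.≤ B → ∣ L (2 ℕ.^ j ℕ.+ i) - ι j ∣ ≤ ι 4 * inv (2 ℕ.^ j) * ι i
  L-block j zero p = ∣0∣≤ (trans (cong (λ z → L z - ι j) (ℕₚ.+-identityʳ (2 ℕ.^ j))) (trans (cong (_- ι j) (L-2^ j)) (+-inverseʳ (ι j))))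
    (≤-reflexive (sym (*-zeroʳ (ι 4 * inv (2 ℕ.^ j)))))
  L-block j (suc i) p = abs-resp (trans (((∀ a b c → a - b + (c - a) ≡ c - b) ∋ solve-∀ ring) (L n) (ι j) (L (suc n))) (cong (λ z → L z - ι j) (sym (ℕₚ.+-suc (2 ℕ.^ j) i))))
    (≤-trans (abs-sum (L-block j i (ℕₚ.<⇒≤ n<B)) (≤-trans (L-step n 1≤n n<B) (0≤ι 4 ·≤ inv-anti (1≤2^ j) (ℕₚ.m≤m+n (2 ℕ.^ j) i))))
      (≤-reflexive (((∀ c i → c * i + c ≡ c * (i + 1ℚ)) ∋ solve-∀ ring) (ι 4 * inv (2 ℕ.^ j)) (ι i))))
    where
    n : ℕ
    n = 2 ℕ.^ j ℕ.+ i
    n<B : n ℕ.< B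
    n<B = subst (ℕ._≤ B) (ℕₚ.+-suc (2 ℕ.^ j) i) p
    1≤n : 1 ℕ.≤ n
    1≤n = ℕₚ.≤-trans (1≤2^ j) (ℕₚ.m≤m+n (2 ℕ.^ j) i)

  -- At powers of 2 the two logarithms agree exactly; inside a dyadic block at most 2^j steps of
  -- size at most 4 / 2^j follow.
  L≈lg : ∀ n → 1 ℕ.≤ n → n ℕ.≤ B → ∣ L n - ι (lg n) ∣ ≤ ι 4
  L≈lg n 1≤n n≤B = subst (λ z → ∣ L z - ι (lg n) ∣ ≤ ι 4) split (≤-trans (L-block (lg n) i (subst (ℕ._≤ B) (sym split) n≤B))
    (≤-trans (0≤-* (0≤ι 4) (0≤inv P) ·≤ ι-mono i≤P)
      (≤-reflexive (trans (((∀ v t → ι 4 * v * t ≡ ι 4 * (t * v)) ∋ solve-∀ ring) (inv P) (ι P)) (trans (cong (ι 4 *_) (ι-inv (1≤2^ (lg n)))) (*-identityʳ (ι 4)))))))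
    where
    P i : ℕ
    P = 2 ℕ.^ lg n
    i = n ℕ.∸ P
    split : P ℕ.+ i ≡ n
    split = ℕₚ.m+[n∸m]≡n (lg-lower n 1≤n)
    i≤P : i ℕ.≤ P
    i≤P = ℕₚ.+-cancelˡ-≤ P i P (subst (ℕ._≤ P ℕ.+ P) (sym split) (ℕₚ.≤-trans (ℕₚ.<⇒≤ (lg-upper n)) (ℕₚ.≤-reflexive (cong (P ℕ.+_) (ℕₚ.+-identityʳ P)))))

  -- L n / n and (L n)² / n have bounded variation, controlled by telescoping majorants.
  V₁ : ℕ → ℚ
  V₁ n = (L n + ι 8) * inv n

  private
    -- As i - j = i j and l′ - l ≤ 4 i, twice the increment costs 8 i j. This is why the majorant
    -- adds 8 = 2 · 4 to L.
    variation₁ : ∀ l l′ i j → 0ℚ ≤ l → 0ℚ ≤ i → 0ℚ ≤ j → i - j ≡ i * j → l′ - l ≤ ι 4 * i →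
      ∣ l′ * j - l * i ∣ ≤ (l + ι 8) * i - (l′ + ι 8) * j
    variation₁ l l′ i j 0≤l 0≤i 0≤j e h = abs≤
      (lin (0≤-* (0≤ι 2) 0≤j ·≤ h ⊕ 0≤-* (0≤-* (0≤ι 2) 0≤l) (0≤-* 0≤i 0≤j) ⊕ (ι 2 * l + ι 8) ·≡ sym e) (solve (l ∷ l′ ∷ i ∷ j ∷ []) ring))
      (lin (0≤-* (0≤ι 8) (0≤-* 0≤i 0≤j) ⊕ ι 8 ·≡ sym e) (solve (l ∷ l′ ∷ i ∷ j ∷ []) ring))

    -- The difference of squares is at most 8 l i + 16 i². Doubling it and adding the 64 i coming
    -- from the linear term 16 l gives at most 16 l i + 96 i, which explains the coefficients of
    -- `V₂`.
    variation₂ : ∀ l l′ i j → 0ℚ ≤ l → 0ℚ ≤ i → i ≤ 1ℚ → 0ℚ ≤ j → i - j ≡ i * j → l′ - l ≤ ι 4 * i → l - l′ ≤ ι 4 * i →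
      ∣ l′ * l′ * j - l * l * i ∣ ≤ (l * l + ι 16 * l + ι 96) * i - (l′ * l′ + ι 16 * l′ + ι 96) * j
    variation₂ l l′ i j 0≤l 0≤i i≤1 0≤j e h h′ = abs≤
      (lin (0≤-* (0≤-+ (0≤-* (0≤ι 4) 0≤l) (0≤ι 16)) 0≤j ·≤ h
        ⊕ (0≤-* (0≤ι 2) 0≤j ·≤ 0≤-* (0≤-diff h) (0≤-diff h′))
        ⊕ 0≤-* (0≤ι 32) (0≤-* 0≤i 0≤j) ·≤ i≤1
        ⊕ 0≤-* (0≤-* (0≤ι 2) (0≤-* 0≤l 0≤l)) (0≤-* 0≤i 0≤j)
        ⊕ (ι 2 * l * l + ι 16 * l + ι 96) ·≡ sym e) (solve (l ∷ l′ ∷ i ∷ j ∷ []) ring))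
      (lin (0≤-* (0≤ι 16) 0≤j ·≤ h ⊕ 0≤-* (0≤-* (0≤ι 16) 0≤l) (0≤-* 0≤i 0≤j) ⊕ 0≤-* (0≤ι 32) (0≤-* 0≤i 0≤j) ⊕ (ι 16 * l + ι 96) ·≡ sym e)
        (solve (l ∷ l′ ∷ i ∷ j ∷ []) ring))

  L/n-variation : ∀ n → 1 ℕ.≤ n → n ℕ.< B → ∣ L (suc n) * inv (suc n) - L n * inv n ∣ ≤ V₁ n - V₁ (suc n)
  L/n-variation n p q = variation₁ (L n) (L (suc n)) (inv n) (inv (suc n)) (0≤L n) (0≤inv n) (0≤inv (suc n)) (inv-step n p) (L-step-up n p q)

  V₁-1 : V₁ 1 ≡ ι 8
  V₁-1 = trans (cong₂ (λ z v → (z + ι 8) * v) L-1 inv-1) (((∀ c → (0ℚ + c) * 1ℚ ≡ c) ∋ solve-∀ ring) (ι 8))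

  abstract
    V₂ : ℕ → ℚ
    V₂ n = (L n * L n + ι 16 * L n + ι 96) * inv n

    L²/n-variation : ∀ n → 1 ℕ.≤ n → n ℕ.< B → ∣ L² (suc n) * inv (suc n) - L² n * inv n ∣ ≤ V₂ n - V₂ (suc n)
    L²/n-variation n p q = variation₂ (L n) (L (suc n)) (inv n) (inv (suc n)) (0≤L n) (0≤inv n) (inv≤1 n) (0≤inv (suc n)) (inv-step n p) (L-step-up n p q) (L-step-down n p q)

    V₂-1 : V₂ 1 ≡ K₂
    V₂-1 = trans (cong₂ (λ z v → (z * z + ι 16 * z + ι 96) * v) L-1 inv-1) (((∀ b c → (0ℚ * 0ℚ + b * 0ℚ + c) * 1ℚ ≡ c) ∋ solve-∀ ring) (ι 16) (ι 96))

    ∣L²/n∣≤V₂ : ∀ n → ∣ L² n * inv n ∣ ≤ V₂ n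
    ∣L²/n∣≤V₂ n = abs-nonneg (0≤-* (0≤-* (0≤L n) (0≤L n)) (0≤inv n))
      (majorant (L n) (inv n) (ι 16) (ι 96) (0≤-* (0≤-+ (0≤-* (0≤ι 16) (0≤L n)) (0≤ι 96)) (0≤inv n)))
      where
      majorant : ∀ l i c e → 0ℚ ≤ (c * l + e) * i → l * l * i ≤ (l * l + c * l + e) * i
      majorant l i c e h = lin h (solve (l ∷ i ∷ c ∷ e ∷ []) ring)

  -- Partial summation: a partial sum of size n meets an increment of L of size 4 / n, so each index
  -- costs at most 4.
  ∑-aL : ∀ (a : ℕ → ℚ) x → x ℕ.< B → (∀ n → ∣ ∑₁ n a ∣ ≤ ι n) → ∣ ∑₁ x (λ n → a n * L n) - ∑₁ x a * L (suc x) ∣ ≤ ι 4 * ι x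
  ∑-aL a x x<B h = abs-resp (sym (trans (cong (_- ∑₁ x a * L (suc x)) (abel x a L)) (((∀ p r → p - r - p ≡ - r) ∋ solve-∀ ring) (∑₁ x a * L (suc x)) R)))
    (≤-trans (≤-reflexive (∣-p∣≡∣p∣ R)) (≤-trans (∑₁-abs≤ x {g = λ _ → ι 4} (λ n p q → ≤-trans (abs-mul (h n) (L-step n p (ℕₚ.≤-<-trans q x<B)))
        (≤-reflexive (trans (((∀ n i → n * (ι 4 * i) ≡ ι 4 * (n * i)) ∋ solve-∀ ring) (ι n) (inv n)) (trans (cong (ι 4 *_) (ι-inv p)) (*-identityʳ (ι 4)))))))
      (≤-reflexive (trans (∑-const {1} x (ι 4)) (*-comm (ι x) (ι 4))))))
    where
    R : ℚ
    R = ∑₁ x (λ n → ∑₁ n a * (L (suc n) - L n))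

  ∑₁-one : ∀ n → ∑₁ n one ≡ ι n
  ∑₁-one n = trans (∑-const n 1ℚ) (*-identityʳ (ι n))

  T ψ : ℕ → ℚ
  T x = ∑₁ x L
  ψ x = ∑₁ x Λ

  T-hyperbola : ∀ x → T x ≡ ∑₁ x (λ d → Λ d * ι (x div d))
  T-hyperbola x = trans (∑₁-cong x (λ n p _ → trans (sym (conv-Λ-one n p)) (sym (*-identityˡ (conv Λ one n)))))
    (trans (hyperbola x one Λ one) (∑₁-cong x (λ d _ _ → cong (Λ d *_) (∑₁-one (x div d)))))

  T-estimate : ∀ x → x ℕ.< B → ∣ T x - ι x * L (suc x) ∣ ≤ ι 4 * ι x
  T-estimate x x<B = subst₂ (λ u v → ∣ u - v * L (suc x) ∣ ≤ ι 4 * ι x) (∑₁-cong x (λ n _ _ → *-identityˡ (L n))) (∑₁-one x)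
    (∑-aL one x x<B (λ n → ≤-trans (≤-reflexive (cong ∣_∣ (∑₁-one n))) (abs-nonneg (0≤ι n) ≤-refl)))

  private
    -- Chebyshev's device: ⌊x/d⌋ - 2 ⌊y/d⌋ with y = ⌊x/2⌋ is non-negative for every d, and at least
    -- 1 for y < d ≤ x because then ⌊y/d⌋ = 0.
    ψ-halve : ∀ x → ψ x ≤ ψ (x div 2) + (T x - ι 2 * T (x div 2))
    ψ-halve x = lin {A = ∑₁ x (λ d → Λ d * (1ℚ - ι (x div d) + ι 2 * ι (y div d)))} {B = ψ y} bound
      (trans (cong (ψ y + (T x - ι 2 * T y) +_) expand) (((∀ p t s w → p + (t - s) + (w - t + s) ≡ w + p) ∋ solve-∀ ring) (ψ y) (T x) (ι 2 * T y) (ψ x)))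
      where
      open ≡-Reasoning
      y : ℕ
      y = x div 2
      2y≤x : 2 ℕ.* y ℕ.≤ x
      2y≤x = div-*-≤ x 2
      Ty : T y ≡ ∑₁ x (λ d → Λ d * ι (y div d))
      Ty = trans (T-hyperbola y) (∑₁-extend (div-≤ x 2) (λ d y<d _ → trans (cong (λ z → Λ d * ι z) (small d y<d)) (*-zeroʳ (Λ d))))
        where
        small : ∀ d → y ℕ.< d → y div d ≡ 0
        small (suc d) p = ℕ÷.m<n⇒m/n≡0 p
      expand : ∑₁ x (λ d → Λ d * (1ℚ - ι (x div d) + ι 2 * ι (y div d))) ≡ ψ x - T x + ι 2 * T y
      expand = begin
        ∑₁ x (λ d → Λ d * (1ℚ - ι (x div d) + ι 2 * ι (y div d)))
          ≡⟨ ∑₁-cong x (λ d _ _ → ((∀ l a b → l * (1ℚ - a + ι 2 * b) ≡ l - l * a + ι 2 * (l * b)) ∋ solve-∀ ring) (Λ d) (ι (x div d)) (ι (y div d))) ⟩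
        ∑₁ x (λ d → Λ d - Λ d * ι (x div d) + ι 2 * (Λ d * ι (y div d)))
          ≡⟨ trans (∑-+ x (λ d → Λ d - Λ d * ι (x div d)) (λ d → ι 2 * (Λ d * ι (y div d)))) (cong₂ _+_ (∑-sub x Λ (λ d → Λ d * ι (x div d))) (∑-*ˡ x (ι 2) (λ d → Λ d * ι (y div d)))) ⟩
        ψ x - ∑₁ x (λ d → Λ d * ι (x div d)) + ι 2 * ∑₁ x (λ d → Λ d * ι (y div d))
          ≡⟨ cong₂ (λ u v → ψ x - u + ι 2 * v) (sym (T-hyperbola x)) (sym Ty) ⟩
        ψ x - T x + ι 2 * T y ∎
      bound : ∑₁ x (λ d → Λ d * (1ℚ - ι (x div d) + ι 2 * ι (y div d))) ≤ ψ y
      bound = ≤-trans (∑₁-mono x {g = λ d → 𝟙 (d ℕₚ.≤? y) * Λ d} term)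
        (≤-reflexive (sym (trans (∑₁-cong y (λ d _ d≤y → sym (trans (cong (_* Λ d) (𝟙-yes (d ℕₚ.≤? y) d≤y)) (*-identityˡ (Λ d)))))
          (∑₁-extend (div-≤ x 2) (λ d y<d _ → trans (cong (_* Λ d) (𝟙-no (d ℕₚ.≤? y) (ℕₚ.<⇒≱ y<d))) (*-zeroˡ (Λ d)))))))
        where
        small : ∀ d → y ℕ.< d → y div d ≡ 0
        small (suc d) p = ℕ÷.m<n⇒m/n≡0 p
        term : ∀ d → 1 ℕ.≤ d → d ℕ.≤ x → Λ d * (1ℚ - ι (x div d) + ι 2 * ι (y div d)) ≤ 𝟙 (d ℕₚ.≤? y) * Λ d
        term d 1≤d d≤x with d ℕₚ.≤? y
        ... | yes d≤y = lin (0≤Λ d 1≤d ·≤ ι-mono {2 ℕ.* (y div d)} {x div d} (*-≤⇒≤-div x d (2 ℕ.* (y div d)) 1≤d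
                (ℕₚ.≤-trans (ℕₚ.≤-reflexive (((∀ d k → d ℕ.* (2 ℕ.* k) ≡ 2 ℕ.* (d ℕ.* k)) ∋ solve-ℕ) d (y div d))) (ℕₚ.≤-trans (ℕₚ.*-monoʳ-≤ 2 (div-*-≤ y d)) 2y≤x))))
              (trans (cong (λ z → 1ℚ * Λ d + Λ d * z) (ι-* 2 (y div d)))
                (((∀ l a b → 1ℚ * l + l * (ι 2 * b) ≡ l * (1ℚ - a + ι 2 * b) + l * a) ∋ solve-∀ ring) (Λ d) (ι (x div d)) (ι (y div d))))
        ... | no d≰y = lin (0≤Λ d 1≤d ·≤ 1≤ι (*-≤⇒≤-div x d 1 1≤d (subst (ℕ._≤ x) (sym (ℕₚ.*-identityʳ d)) d≤x)))
              (trans (((∀ l a → 0ℚ * l + l * 1ℚ ≡ l * (1ℚ - a + ι 2 * 0ℚ) + l * a) ∋ solve-∀ ring) (Λ d) (ι (x div d)))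
                (cong (λ z → Λ d * (1ℚ - ι (x div d) + ι 2 * ι z) + Λ d * ι (x div d)) (sym (small d (ℕₚ.≰⇒> d≰y)))))

    arith : ∀ x y e l l′ tx ty → 0ℚ ≤ x → 0ℚ ≤ l → x ≡ y + y + e → 0ℚ ≤ e → e ≤ 1ℚ → l′ ≤ l + ι 5 → l ≤ ι 4 * y →
      tx - x * l′ ≤ ι 4 * x → y * l - ty ≤ ι 4 * y → tx - ι 2 * ty ≤ ι 15 * x
    arith x y e l l′ tx ty 0≤x 0≤l x≡ 0≤e e≤1 p q r s =
      lin (0≤x ·≤ p ⊕ q ⊕ r ⊕ 0≤ι 2 ·≤ s ⊕ (l - ι 6) ·≡ x≡ ⊕ 0≤l ·≤ e≤1 ⊕ 0≤-* (0≤ι 6) 0≤e) (solve (x ∷ y ∷ e ∷ l ∷ l′ ∷ tx ∷ ty ∷ []) ring)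

    -- T x is x L(x+1) up to O(x), and L(2y+2) = 1 + L(y+1) exactly, so the logarithms cancel. Even
    -- x requires one further step of L, from 2y+1 to 2y+2.
    T-halve : ∀ x → suc x ℕ.< B → T x - ι 2 * T (x div 2) ≤ ι 15 * ι x
    T-halve x x<B = go (half-cases x)
      where
      y : ℕ
      y = x div 2
      x<B′ : x ℕ.< B
      x<B′ = ℕₚ.<-trans (ℕₚ.n<1+n x) x<B
      y<B : y ℕ.< B
      y<B = ℕₚ.≤-<-trans (div-≤ x 2) x<B′
      L-even : L (suc (suc (y ℕ.+ y))) ≡ 1ℚ + L (suc y)
      L-even = trans (cong L (((∀ y → suc (suc (y ℕ.+ y)) ≡ 2 ℕ.* suc y) ∋ solve-ℕ) y)) (trans (L-* 2 (suc y) (s≤s z≤n) (s≤s z≤n)) (cong (_+ L (suc y)) L-2))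
      est-x : T x - ι x * L (suc x) ≤ ι 4 * ι x
      est-x = abs-upper (T-estimate x x<B′)
      est-y : ι y * L (suc y) - T y ≤ ι 4 * ι y
      est-y = ≤-trans (≤-reflexive (((∀ a b → a - b ≡ - (b - a)) ∋ solve-∀ ring) (ι y * L (suc y)) (T y))) (≤-trans (-≤abs _) (T-estimate y y<B))
      go : x ≡ y ℕ.+ y ⊎ x ≡ suc (y ℕ.+ y) → T x - ι 2 * T y ≤ ι 15 * ι x
      go (inj₁ e) = arith (ι x) (ι y) 0ℚ (L (suc y)) (L (suc x)) (T x) (T y) (0≤ι x) (0≤L (suc y)) (trans (cong ι e) (trans (ι-+ y y) (sym (+-identityʳ (ι y + ι y)))))
        ≤-refl 0≤1 (lin (L-step-down (suc x) (s≤s z≤n) x<B ⊕ 4inv≤4 (suc x) ⊕ ≤-reflexive (trans (cong (λ z → L (suc (suc z))) e) L-even))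
          (((∀ a b l f → l + ι 5 + (a - b + f + b) ≡ a + (f + ι 4 + (1ℚ + l))) ∋ solve-∀ ring) (L (suc x)) (L (suc (suc x))) (L (suc y)) (ι 4 * inv (suc x))))
        (L-linear y y<B) est-x est-y
      go (inj₂ e) = arith (ι x) (ι y) 1ℚ (L (suc y)) (L (suc x)) (T x) (T y) (0≤ι x) (0≤L (suc y)) (trans (cong ι e) (cong (_+ 1ℚ) (ι-+ y y)))
        0≤1 ≤-refl (lin (≤-reflexive (trans (cong (λ z → L (suc z)) e) L-even) ⊕ 0≤ι 4) (((∀ a l → l + ι 5 + (a + 0ℚ) ≡ a + (1ℚ + l + ι 4)) ∋ solve-∀ ring) (L (suc x)) (L (suc y))))
        (L-linear y y<B) est-x est-y

  -- Iterated halving sums the geometric series 15 (x + x/2 + x/4 + ...) ≤ 30 x.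
  chebyshev : ∀ x → suc x ℕ.< B → ψ x ≤ ι 30 * ι x
  chebyshev = <-rec _ go
    where
    go : ∀ x → (∀ {y} → y ℕ.< x → suc y ℕ.< B → ψ y ≤ ι 30 * ι y) → suc x ℕ.< B → ψ x ≤ ι 30 * ι x
    go zero _ _ = ≤-reflexive (sym (*-zeroʳ (ι 30)))
    go (suc x) rec p = lin (ψ-halve (suc x) ⊕ T-halve (suc x) p ⊕ rec y<x (ℕₚ.<-trans (s≤s y<x) p) ⊕ 0≤ι 15 ·≤ ι-mono (div-*-≤ (suc x) 2))
      (trans (cong (λ z → ι 30 * ι (suc x) + (ψ (suc x) + (T (suc x) - ι 2 * T y) + ψ y + ι 15 * z)) (ι-* 2 y))
        (((∀ X w p t Y → ι 30 * X + (w + t + p + ι 15 * (ι 2 * Y)) ≡ w + (p + t + ι 15 * X + ι 30 * Y + ι 15 * X)) ∋ solve-∀ ring)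
          (ι (suc x)) (ψ (suc x)) (ψ y) (T (suc x) - ι 2 * T y) (ι y)))
      where
      y : ℕ
      y = suc x div 2
      y<x : y ℕ.< suc x
      y<x = ℕ÷.m/n<m (suc x) 2 (s≤s (s≤s z≤n))

-- Residue classes modulo q, units and periodic sums

module Residues (q : ℕ) {{q≢0 : ℕ.NonZero q}} where

  infix 4 _≈_ _≈?_

  _≈_ : ℕ → ℕ → Set
  a ≈ b = a ℕ.% q ≡ b ℕ.% q

  _≈?_ : ∀ a b → Dec (a ≈ b)
  a ≈? b = a ℕ.% q ℕₚ.≟ b ℕ.% q

  1≤q : 1 ℕ.≤ q
  1≤q = ℕ.>-nonZero⁻¹ q

  ≈-* : ∀ {a b c d} → a ≈ b → c ≈ d → a ℕ.* c ≈ b ℕ.* d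
  ≈-* {a} {b} {c} {d} p r = trans (ℕ÷.%-distribˡ-* a c q) (trans (cong₂ (λ x y → (x ℕ.* y) ℕ.% q) p r) (sym (ℕ÷.%-distribˡ-* b d q)))

  %-≈ : ∀ a → a ℕ.% q ≈ a
  %-≈ a = ℕ÷.m%n%n≡m%n a q

  ≈-≡ : ∀ {a b} → a ≡ b → a ≈ b
  ≈-≡ = cong (ℕ._% q)

  ≈-+q : ∀ a → q ℕ.+ a ≈ a
  ≈-+q a = trans (cong (ℕ._% q) (ℕₚ.+-comm q a)) (ℕ÷.[m+n]%n≡m%n a q)

  unit-inverse : ∀ {d} → Coprime d q → ∃ λ e → e ℕ.* d ≈ 1
  unit-inverse {d} c with Coprime.coprime-Bézout c
  ... | +- x y eq = x , trans (cong (ℕ._% q) (sym eq)) (ℕ÷.[m+kn]%n≡m%n 1 y q)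
  -- Here x d ≡ -1, so the inverse is -x; its representative without subtraction is x d x.
  ... | -+ x y eq = x ℕ.* d ℕ.* x , (begin
    (x ℕ.* d ℕ.* x ℕ.* d) ℕ.% q                      ≡⟨ ℕ÷.[m+kn]%n≡m%n (x ℕ.* d ℕ.* x ℕ.* d) y q ⟨
    (x ℕ.* d ℕ.* x ℕ.* d ℕ.+ y ℕ.* q) ℕ.% q          ≡⟨ cong (λ z → (x ℕ.* d ℕ.* x ℕ.* d ℕ.+ z) ℕ.% q) eq ⟨
    (x ℕ.* d ℕ.* x ℕ.* d ℕ.+ (1 ℕ.+ x ℕ.* d)) ℕ.% q  ≡⟨ cong (ℕ._% q) (((∀ x d → x ℕ.* d ℕ.* x ℕ.* d ℕ.+ (1 ℕ.+ x ℕ.* d) ≡ 1 ℕ.+ x ℕ.* d ℕ.* (1 ℕ.+ x ℕ.* d)) ∋ solve-ℕ) x d) ⟩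
    (1 ℕ.+ x ℕ.* d ℕ.* (1 ℕ.+ x ℕ.* d)) ℕ.% q        ≡⟨ cong (λ z → (1 ℕ.+ z) ℕ.% q) (trans (cong (x ℕ.* d ℕ.*_) eq) (sym (ℕₚ.*-assoc (x ℕ.* d) y q))) ⟩
    (1 ℕ.+ x ℕ.* d ℕ.* y ℕ.* q) ℕ.% q                ≡⟨ ℕ÷.[m+kn]%n≡m%n 1 (x ℕ.* d ℕ.* y) q ⟩
    1 ℕ.% q                                          ∎)
    where open ≡-Reasoning

  coprime-* : ∀ {a b} → Coprime a q → Coprime b q → Coprime (a ℕ.* b) q
  coprime-* {a} {b} ca cb {k} (k∣ab , k∣q) = cb (Coprime.coprime-divisor {n = a} (λ { (i∣k , i∣a) → ca (i∣a , ∣.∣-trans i∣k k∣q) }) k∣ab , k∣q)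

  coprime-*ˡ : ∀ a b → Coprime (a ℕ.* b) q → Coprime a q
  coprime-*ˡ a b c (k∣a , k∣q) = c (∣.∣-trans k∣a (∣.m∣m*n b) , k∣q)

  coprime-*ʳ : ∀ a b → Coprime (a ℕ.* b) q → Coprime b q
  coprime-*ʳ a b c (k∣b , k∣q) = c (∣.∣-trans k∣b (∣.n∣m*n a) , k∣q)

  coprime-≈ : ∀ {a b} → a ≈ b → Coprime a q → Coprime b q
  coprime-≈ {a} {b} e c {k} (k∣b , k∣q) = c (∣.∣n∣m%n⇒∣m k∣q (subst (k ∣_) (sym e) (∣.%-presˡ-∣ k∣b k∣q)) , k∣q)

  coprime-1 : Coprime 1 q
  coprime-1 (k∣1 , _) = ∣.∣1⇒≡1 k∣1

  inverse-coprime : ∀ {e d} → e ℕ.* d ≈ 1 → Coprime e q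
  inverse-coprime {e} {d} h = coprime-*ˡ e d (coprime-≈ (sym h) coprime-1)

  unit-solve : ∀ {e d m l} → e ℕ.* d ≈ 1 → d ℕ.* m ≈ l → m ≈ e ℕ.* l
  unit-solve {e} {d} {m} {l} h p = trans (≈-≡ (sym (ℕₚ.*-identityˡ m))) (trans (≈-* {1} {e ℕ.* d} {m} {m} (sym h) refl)
    (trans (≈-≡ (ℕₚ.*-assoc e d m)) (≈-* {e} {e} {d ℕ.* m} {l} refl p)))

  unit-solution : ∀ {e d} l → e ℕ.* d ≈ 1 → d ℕ.* (e ℕ.* l) ≈ l
  unit-solution {e} {d} l h = trans (≈-≡ (((∀ d e l → d ℕ.* (e ℕ.* l) ≡ e ℕ.* d ℕ.* l) ∋ solve-ℕ) d e l)) (trans (≈-* {e ℕ.* d} {1} {l} {l} h refl) (≈-≡ (ℕₚ.*-identityˡ l)))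

  unit-count : ∀ {d} l → Coprime d q → ∑ q (λ c → 𝟙 (d ℕ.* c ≈? l)) ≡ 1ℚ
  unit-count {d} l c with unit-inverse c
  ... | e , h = trans (∑-single q c₀ (ℕ÷.m%n<n (e ℕ.* l) q) (λ i i<q i≢c₀ → 𝟙-no (d ℕ.* i ≈? l) (λ p → i≢c₀ (trans (sym (ℕ÷.m<n⇒m%n≡m i<q)) (unit-solve {e} {d} {i} {l} h p)))))
    (𝟙-yes (d ℕ.* c₀ ≈? l) (trans (≈-* {d} {d} {c₀} {e ℕ.* l} refl (%-≈ (e ℕ.* l))) (unit-solution {e} {d} l h)))
    where
    c₀ : ℕ
    c₀ = (e ℕ.* l) ℕ.% q

  ∑-class : ∀ n (g : ℕ → ℚ) → ∑ q (λ c → 𝟙 (n ≈? c) * g c) ≡ g (n ℕ.% q)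
  ∑-class n g = trans (∑-cong q (λ c c<q → cong (_* g c) (𝟙-cong (n ≈? c) (n ℕ.% q ℕₚ.≟ c) (λ e → trans e (ℕ÷.m<n⇒m%n≡m c<q)) (λ e → trans e (sym (ℕ÷.m<n⇒m%n≡m c<q))))))
    (∑-point q (n ℕ.% q) g (ℕ÷.m%n<n n q))

  ∑-unit : ∀ {d} (g : ℕ → ℚ) → Coprime d q → ∑ q (λ c → g ((d ℕ.* c) ℕ.% q)) ≡ ∑ q g
  ∑-unit {d} g cd = begin
    ∑ q (λ c → g ((d ℕ.* c) ℕ.% q))                   ≡⟨ ∑-cong q (λ c _ → sym (∑-class (d ℕ.* c) g)) ⟩
    ∑ q (λ c → ∑ q (λ b → 𝟙 (d ℕ.* c ≈? b) * g b))    ≡⟨ ∑-swap q q (λ c b → 𝟙 (d ℕ.* c ≈? b) * g b) ⟩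
    ∑ q (λ b → ∑ q (λ c → 𝟙 (d ℕ.* c ≈? b) * g b))    ≡⟨ ∑-cong q (λ b _ → trans (∑-*ʳ q (g b) (λ c → 𝟙 (d ℕ.* c ≈? b))) (trans (cong (_* g b) (unit-count b cd)) (*-identityˡ (g b)))) ⟩
    ∑ q g                                             ∎
    where open ≡-Reasoning

  module _ (a : ℕ → ℚ) (periodic : ∀ n → a (q ℕ.+ n) ≡ a n) (∣a∣≤1 : ∀ n → ∣ a n ∣ ≤ 1ℚ) (zero-sum : ∑ q a ≡ 0ℚ) where

    private
      ∑From-suc : ∀ s n → ∑From s (suc n) a ≡ a s + ∑From (suc s) n a
      ∑From-suc s zero = trans (+-identityˡ (a (s ℕ.+ 0))) (trans (cong a (ℕₚ.+-identityʳ s)) (sym (+-identityʳ (a s))))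
      ∑From-suc s (suc n) = trans (cong₂ _+_ (∑From-suc s n) (cong a (ℕₚ.+-suc s n))) (+-assoc (a s) (∑From (suc s) n a) (a (suc (s ℕ.+ n))))

      zero-sum-from : ∀ s → ∑From s q a ≡ 0ℚ
      zero-sum-from zero = zero-sum
      zero-sum-from (suc s) = lin≡ (trans (sym (∑From-suc s q)) (cong₂ _+_ (zero-sum-from s) (trans (cong a (ℕₚ.+-comm s q)) (periodic s))))
        (((∀ x y → 0ℚ + (x + y) ≡ y + (0ℚ + x)) ∋ solve-∀ ring) (a s) (∑From (suc s) q a))

    -- Full periods contribute nothing wherever the window starts, so fewer than q terms of size at
    -- most 1 survive.
    ∣∑-periodic∣≤ : ∀ y s → ∣ ∑From s y a ∣ ≤ ι q
    ∣∑-periodic∣≤ = <-rec _ go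
      where
      go : ∀ y → (∀ {z} → z ℕ.< y → ∀ s → ∣ ∑From s z a ∣ ≤ ι q) → ∀ s → ∣ ∑From s y a ∣ ≤ ι q
      go y rec s with q ℕₚ.≤? y
      ... | no q≰y = ≤-trans (∑-abs≤ y {g = one} (λ i _ → ∣a∣≤1 (s ℕ.+ i))) (≤-trans (≤-reflexive (trans (∑-const y 1ℚ) (*-identityʳ (ι y)))) (ι-mono (ℕₚ.<⇒≤ (ℕₚ.≰⇒> q≰y))))
      ... | yes q≤y = abs-resp (sym eq) (rec (ℕₚ.∸-monoʳ-< 1≤q q≤y) (s ℕ.+ q))
        where
        eq : ∑From s y a ≡ ∑From (s ℕ.+ q) (y ℕ.∸ q) a
        eq = trans (cong (λ k → ∑From s k a) (sym (ℕₚ.m+[n∸m]≡n q≤y))) (trans (∑-split q (y ℕ.∸ q) a) (trans (cong (_+ ∑From (s ℕ.+ q) (y ℕ.∸ q) a) (zero-sum-from s)) (+-identityˡ (∑From (s ℕ.+ q) (y ℕ.∸ q) a))))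

  χ₀ : ℕ → ℚ
  χ₀ n = 𝟙 (coprime? n q)

  0≤χ₀ : ∀ n → 0ℚ ≤ χ₀ n
  0≤χ₀ n = 0≤𝟙 (coprime? n q)

  χ₀≤1 : ∀ n → χ₀ n ≤ 1ℚ
  χ₀≤1 n = 𝟙≤1 (coprime? n q)

  χ₀-≈ : ∀ {a b} → a ≈ b → χ₀ a ≡ χ₀ b
  χ₀-≈ {a} {b} e = 𝟙-cong (coprime? a q) (coprime? b q) (coprime-≈ e) (coprime-≈ (sym e))

  χ₀-* : ∀ a b → χ₀ (a ℕ.* b) ≡ χ₀ a * χ₀ b
  χ₀-* a b = by (coprime? a q) (coprime? b q)
    where
    by : (ca : Dec (Coprime a q)) (cb : Dec (Coprime b q)) → χ₀ (a ℕ.* b) ≡ 𝟙 ca * 𝟙 cb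
    by (yes ca) (yes cb) = trans (𝟙-yes (coprime? (a ℕ.* b) q) (coprime-* ca cb)) (sym (*-identityˡ 1ℚ))
    by (yes ca) (no ¬cb) = trans (𝟙-no (coprime? (a ℕ.* b) q) (λ c → ¬cb (coprime-*ʳ a b c))) (sym (*-zeroʳ 1ℚ))
    by (no ¬ca) cb = trans (𝟙-no (coprime? (a ℕ.* b) q) (λ c → ¬ca (coprime-*ˡ a b c))) (sym (*-zeroˡ (𝟙 cb)))

  φ : ℚ
  φ = ∑ q χ₀

  1≤φ : 1ℚ ≤ φ
  1≤φ = ≤-trans (≤-reflexive (sym (𝟙-yes (coprime? (1 ℕ.% q) q) (coprime-≈ (sym (%-≈ 1)) coprime-1)))) (∑-term≤ q (1 ℕ.% q) (ℕ÷.m%n<n 1 q) (λ i _ → 0≤χ₀ i))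

  φ≤q : φ ≤ ι q
  φ≤q = ≤-trans (∑-mono q (λ i _ → χ₀≤1 i)) (≤-reflexive (trans (∑-const q 1ℚ) (*-identityʳ (ι q))))

  private
    0<φ : 0ℚ < φ
    0<φ = <-≤-trans (0<ι-suc 0) 1≤φ

  ν : ℚ
  ν = 1/_ φ {{>-nonZero 0<φ}}

  φν : φ * ν ≡ 1ℚ
  φν = *-inverseʳ φ {{>-nonZero 0<φ}}

  0≤ν : 0ℚ ≤ ν
  0≤ν = <⇒≤ (positive⁻¹ ν {{1/pos⇒pos φ {{positive 0<φ}}}})

  ν≤1 : ν ≤ 1ℚ
  ν≤1 = lin (0≤ν ·≤ 1≤φ ⊕ 1ℚ ·≡ φν) (((∀ f n → 1ℚ + (n * 1ℚ + 1ℚ * (f * n)) ≡ n + (n * f + 1ℚ * 1ℚ)) ∋ solve-∀ ring) φ ν)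

  -- The indicator of the class l minus its mean over the units. Along multiples of a unit it has
  -- zero sum over a period, and along multiples of a non-unit it vanishes when l is a unit, so it
  -- never produces a main term.
  dev : ℕ → ℕ → ℚ
  dev l n = 𝟙 (n ≈? l) - ν * χ₀ n

  ∣dev∣≤1 : ∀ l n → ∣ dev l n ∣ ≤ 1ℚ
  ∣dev∣≤1 l n = abs≤
    (lin (𝟙≤1 (n ≈? l) ⊕ 0≤-* 0≤ν (0≤χ₀ n)) (((∀ a b → 1ℚ + (a + 0ℚ) ≡ a - b + (1ℚ + b)) ∋ solve-∀ ring) (𝟙 (n ≈? l)) (ν * χ₀ n)))
    (lin (0≤𝟙 (n ≈? l) ⊕ 0≤ν ·≤ χ₀≤1 n ⊕ ν≤1) (((∀ a n x → 1ℚ + (0ℚ + n * x + n) ≡ - (a - n * x) + (a + n * 1ℚ + 1ℚ)) ∋ solve-∀ ring) (𝟙 (n ≈? l)) ν (χ₀ n)))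

  dev-≈ : ∀ l {a b} → a ≈ b → dev l a ≡ dev l b
  dev-≈ l {a} {b} e = cong₂ (λ x y → x - ν * y) (𝟙-cong (a ≈? l) (b ≈? l) (λ p → trans (sym e) p) (λ p → trans e p)) (χ₀-≈ e)

  dev-∑ : ∀ {d l} → Coprime d q → Coprime l q → ∑ q (λ m → dev l (d ℕ.* m)) ≡ 0ℚ
  dev-∑ {d} {l} cd cl = begin
    ∑ q (λ m → 𝟙 (d ℕ.* m ≈? l) - ν * χ₀ (d ℕ.* m))
      ≡⟨ trans (∑-sub q (λ m → 𝟙 (d ℕ.* m ≈? l)) (λ m → ν * χ₀ (d ℕ.* m))) (cong₂ _-_ (unit-count l cd) (∑-*ˡ q ν (λ m → χ₀ (d ℕ.* m)))) ⟩
    1ℚ - ν * ∑ q (λ m → χ₀ (d ℕ.* m))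
      ≡⟨ cong (λ z → 1ℚ - ν * z) (∑-cong q (λ m _ → trans (χ₀-* d m) (trans (cong (_* χ₀ m) (𝟙-yes (coprime? d q) cd)) (*-identityˡ (χ₀ m))))) ⟩
    1ℚ - ν * φ
      ≡⟨ cong (λ z → 1ℚ - z) (trans (*-comm ν φ) φν) ⟩
    1ℚ - 1ℚ ≡⟨ +-inverseʳ 1ℚ ⟩
    0ℚ ∎
    where open ≡-Reasoning

  dev-partial : ∀ {d l} → Coprime d q → Coprime l q → ∀ y → ∣ ∑₁ y (λ m → dev l (d ℕ.* m)) ∣ ≤ ι q
  dev-partial {d} {l} cd cl y = ∣∑-periodic∣≤ (λ m → dev l (d ℕ.* m))
    (λ m → dev-≈ l (≈-* {d} {d} {q ℕ.+ m} {m} refl (≈-+q m))) (λ m → ∣dev∣≤1 l (d ℕ.* m)) (dev-∑ cd cl) y 1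

  dev-noncoprime : ∀ {d l} → ¬ Coprime d q → Coprime l q → ∀ m → dev l (d ℕ.* m) ≡ 0ℚ
  dev-noncoprime {d} {l} ¬cd cl m = trans (cong₂ (λ x y → x - ν * y)
      (𝟙-no (d ℕ.* m ≈? l) (λ e → ¬cd (coprime-*ˡ d m (coprime-≈ (sym e) cl))))
      (𝟙-no (coprime? (d ℕ.* m) q) (λ c → ¬cd (coprime-*ˡ d m c))))
    (((∀ v → 0ℚ - v * 0ℚ ≡ 0ℚ) ∋ solve-∀ ring) ν)

  κ : ℚ
  κ = φ * inv q

  0≤κ : 0ℚ ≤ κ
  0≤κ = 0≤-* (≤-trans 0≤1 1≤φ) (0≤inv q)

  κ≤1 : κ ≤ 1ℚ
  κ≤1 = ≤-trans (*-monoʳ-≤-nonNeg (inv q) {{nonNegative (0≤inv q)}} φ≤q) (≤-reflexive (ι-inv 1≤q))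

  qκ : ι q * κ ≡ φ
  qκ = trans (((∀ a f i → a * (f * i) ≡ f * (a * i)) ∋ solve-∀ ring) (ι q) φ (inv q)) (trans (cong (φ *_) (ι-inv 1≤q)) (*-identityʳ φ))

  A : ℕ → ℚ
  A y = ∑₁ y χ₀

  A-estimate : ∀ y → ∣ A y - κ * ι y ∣ ≤ ι q
  A-estimate y = abs-resp (trans (∑-sub y χ₀ (λ _ → κ)) (cong (λ z → A y - z) (trans (∑-const y κ) (*-comm (ι y) κ))))
    (∣∑-periodic∣≤ (λ m → χ₀ m - κ) (λ m → cong (_- κ) (χ₀-≈ (≈-+q m)))
      (λ m → abs≤ (lin (χ₀≤1 m ⊕ 0≤κ) (((∀ x k → 1ℚ + (x + 0ℚ) ≡ x - k + (1ℚ + k)) ∋ solve-∀ ring) (χ₀ m) κ))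
                  (lin (0≤χ₀ m ⊕ κ≤1) (((∀ x k → 1ℚ + (0ℚ + k) ≡ - (x - k) + (x + 1ℚ)) ∋ solve-∀ ring) (χ₀ m) κ)))
      (trans (∑-sub q χ₀ (λ _ → κ)) (trans (cong (λ z → φ - z) (trans (∑-const q κ) qκ)) (+-inverseʳ φ))) y 1)

  0≤A : ∀ y → 0ℚ ≤ A y
  0≤A y = ∑₁-≥0 y (λ n _ _ → 0≤χ₀ n)

  A≤ : ∀ y → A y ≤ ι y
  A≤ y = ≤-trans (∑₁-mono y (λ n _ _ → χ₀≤1 n)) (≤-reflexive (trans (∑-const y 1ℚ) (*-identityʳ (ι y))))

  -- Error constants for Mertens (C₁), Selberg over all units (C₂), Selberg in one class (C₃) and
  -- the mass of one class (C₄, C₅). They depend on q alone, so k may be chosen large against them.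
  Q C₁ C₂ C₃ C₄ C₅ : ℚ
  Q = ι q
  C₁ = ι 34 * (Q * (Q + 1ℚ)) + ι 8
  C₂ = (C₁ + ι 5) * (C₁ + ι 2)
  C₃ = C₂ + K₂ * Q
  C₄ = C₃ + ι 4 + ι 4 * C₁
  C₅ = 1ℚ + C₁ + ι 2 * C₄

  0≤C₁ : 0ℚ ≤ C₁
  0≤C₁ = 0≤-+ (0≤-* (0≤ι 34) (0≤-* (0≤ι q) (0≤-+ (0≤ι q) 0≤1))) (0≤ι 8)

  0≤C₃ : 0ℚ ≤ C₃
  0≤C₃ = 0≤-+ (0≤-* (0≤-+ 0≤C₁ (0≤ι 5)) (0≤-+ 0≤C₁ (0≤ι 2))) (0≤-* 0≤K₂ (0≤ι q))

  0≤C₄ : 0ℚ ≤ C₄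
  0≤C₄ = 0≤-+ (0≤-+ 0≤C₃ (0≤ι 4)) (0≤-* (0≤ι 4) 0≤C₁)

  0≤C₅ : 0ℚ ≤ C₅
  0≤C₅ = 0≤-+ (0≤-+ 0≤1 0≤C₁) (0≤-* (0≤ι 2) 0≤C₄)

  -- Parameters of the lower bound for Σ χ(n)/n, χ a real character modulo q, and the resulting bound C₆ for Σ χ(n) Λ(n)/n.
  z₀ A₀ x₀ : ℕ
  z₀ = 4 ℕ.* q ℕ.+ 16 ℕ.* (16 ℕ.* (q ℕ.* q))
  A₀ = 16 ℕ.* (q ℕ.* z₀)
  x₀ = 4 ℕ.* (z₀ ℕ.* z₀)

  C₆ : ℚ
  C₆ = ι 8 * ι z₀ * (ι 38 * Q) + ι 4 * ι A₀

-- Each dyadic block has 2^j terms of size at most 2^-j and contributes at most 1.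
harmonic : ∀ J y → suc y ≡ 2 ℕ.^ J → ∑₁ y inv ≤ ι J
harmonic zero zero _ = ≤-refl
harmonic (suc J) y e = subst (λ z → ∑₁ z inv ≤ ι (suc J)) y≡ (≤-trans (≤-reflexive (∑-split y₀ P inv))
  (harmonic J y₀ sy₀ ⊕ ≤-trans (∑-mono P {g = λ _ → inv P} (λ i _ → inv-anti (1≤2^ J) (ℕₚ.≤-trans (ℕₚ.≤-reflexive (sym sy₀)) (ℕₚ.m≤m+n (suc y₀) i))))
    (≤-reflexive (trans (∑-const P (inv P)) (ι-inv (1≤2^ J))))))
  where
  P y₀ : ℕ
  P = 2 ℕ.^ J
  y₀ = ℕ.pred P
  sy₀ : suc y₀ ≡ P
  sy₀ = ℕₚ.suc-pred P {{ℕ.>-nonZero (1≤2^ J)}}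
  y≡ : y₀ ℕ.+ P ≡ y
  y≡ = ℕₚ.suc-injective (trans (cong (ℕ._+ P) sy₀) (trans (cong (P ℕ.+_) (sym (ℕₚ.+-identityʳ P))) (sym e)))

harmonic-lg : ∀ x → ∑₁ x inv ≤ ι (suc (lg x))
harmonic-lg x = ≤-trans (∑₁-extend-≤ {f = inv} (ℕ.s≤s⁻¹ (subst (x ℕ.<_) (sym e) (lg-upper x))) (λ n _ _ → 0≤inv n)) (harmonic (suc (lg x)) (ℕ.pred (2 ℕ.^ suc (lg x))) e)
  where
  e : suc (ℕ.pred (2 ℕ.^ suc (lg x))) ≡ 2 ℕ.^ suc (lg x)
  e = ℕₚ.suc-pred (2 ℕ.^ suc (lg x)) {{ℕ.>-nonZero (1≤2^ (suc (lg x)))}}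

div-approx : ∀ x d → 1 ℕ.≤ d → ∣ ι (x div d) - ι x * inv d ∣ ≤ 1ℚ
div-approx x d 1≤d = abs≤
  (lin (0≤inv d ·≤ ι-mono (div-*-≤ x d) ⊕ 0≤1 ⊕ ι (x div d) ·≡ sym (ι-inv 1≤d))
    (trans (cong (λ z → 1ℚ + (inv d * z + 0ℚ + ι (x div d) * 1ℚ)) (ι-* d (x div d)))
      (((∀ i n t x → 1ℚ + (i * (n * t) + 0ℚ + t * 1ℚ) ≡ t - x * i + (i * x + 1ℚ + t * (n * i))) ∋ solve-∀ ring) (inv d) (ι d) (ι (x div d)) (ι x))))
  (lin (0≤inv d ·≤ ι-mono (ℕₚ.<⇒≤ (<-*-suc-div x d 1≤d)) ⊕ (ι (x div d) + 1ℚ) ·≡ ι-inv 1≤d)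
    (trans (((∀ i n t x → 1ℚ + (i * x + (t + 1ℚ) * (n * i)) ≡ - (t - x * i) + (i * (n * (t + 1ℚ)) + (t + 1ℚ) * 1ℚ)) ∋ solve-∀ ring) (inv d) (ι d) (ι (x div d)) (ι x))
      (cong (λ z → - (ι (x div d) - ι x * inv d) + (inv d * z + (ι (x div d) + 1ℚ) * 1ℚ)) (sym (ι-* d (suc (x div d)))))))

-- Mertens and Selberg estimates in residue classes
module Selberg {B : ℕ} (log : Log B) (q : ℕ) {{q≢0 : ℕ.NonZero q}} where
  open Chebyshev log public
  open Residues q public

  b : ℕ → ℚ
  b n = χ₀ n * (Λ n * inv n)

  0≤b : ∀ n → 1 ℕ.≤ n → 0ℚ ≤ b n
  0≤b n p = 0≤-* (0≤χ₀ n) (0≤-* (0≤Λ n p) (0≤inv n))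

  m : ℕ → ℚ
  m x = ∑₁ x b

  private
    ∑-χ₀L : ∀ x → ∑₁ x (λ n → χ₀ n * L n) ≡ ∑₁ x (λ d → χ₀ d * Λ d * A (x div d))
    ∑-χ₀L x = trans (∑₁-cong x (λ n p _ → cong (χ₀ n *_) (sym (conv-Λ-one n p)))) (trans (hyperbola x χ₀ Λ one)
      (∑₁-cong x (λ d _ _ → trans (cong (Λ d *_) (trans (∑₁-cong (x div d) (λ k _ _ → trans (*-identityʳ (χ₀ (d ℕ.* k))) (χ₀-* d k))) (∑-*ˡ (x div d) (χ₀ d) χ₀)))
        (((∀ l c a → l * (c * a) ≡ c * l * a) ∋ solve-∀ ring) (Λ d) (χ₀ d) (A (x div d))))))

    A-div : ∀ x d → 1 ℕ.≤ d → ∣ A (x div d) - κ * ι x * inv d ∣ ≤ Q + 1ℚ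
    A-div x d p = abs-resp (((∀ a k t x i → a - k * t + k * (t - x * i) ≡ a - k * x * i) ∋ solve-∀ ring) (A (x div d)) κ (ι (x div d)) (ι x) (inv d))
      (abs-sum (A-estimate (x div d)) (≤-trans (abs-mul (abs-nonneg 0≤κ κ≤1) (div-approx x d p)) (≤-reflexive (*-identityˡ 1ℚ))))

    step₁ : ∀ x → suc x ℕ.< B → ∣ ∑₁ x (λ n → χ₀ n * L n) - κ * ι x * m x ∣ ≤ (Q + 1ℚ) * (ι 30 * ι x)
    step₁ x x<B = abs-resp (trans (∑-sub x (λ d → χ₀ d * Λ d * A (x div d)) (λ d → κ * ι x * b d)) (cong₂ _-_ (sym (∑-χ₀L x)) (∑-*ˡ x (κ * ι x) b)))
      (≤-trans (∑₁-abs≤ x {g = λ d → (Q + 1ℚ) * Λ d} (λ d p _ →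
          abs-resp (((∀ c l a kx i → c * l * (a - kx * i) ≡ c * l * a - kx * (c * (l * i))) ∋ solve-∀ ring) (χ₀ d) (Λ d) (A (x div d)) (κ * ι x) (inv d))
          (≤-trans (abs-mul (abs-mul (abs-nonneg (0≤χ₀ d) (χ₀≤1 d)) (abs-nonneg (0≤Λ d p) ≤-refl)) (A-div x d p))
            (≤-reflexive (((∀ l c → 1ℚ * l * c ≡ c * l) ∋ solve-∀ ring) (Λ d) (Q + 1ℚ))))))
        (≤-trans (≤-reflexive (∑-*ˡ x (Q + 1ℚ) Λ)) (0≤-+ (0≤ι q) 0≤1 ·≤ chebyshev x x<B)))

    step₂ : ∀ x → x ℕ.< B → ∣ ∑₁ x (λ n → χ₀ n * L n) - κ * ι x * L (suc x) ∣ ≤ ι 4 * ι x + Q * (ι 4 * ι x)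
    step₂ x x<B = abs-resp (((∀ s a l k → s - a * l + (a - k) * l ≡ s - k * l) ∋ solve-∀ ring) (∑₁ x (λ n → χ₀ n * L n)) (A x) (L (suc x)) (κ * ι x))
      (abs-sum (∑-aL χ₀ x x<B (λ n → abs-nonneg (0≤A n) (A≤ n))) (abs-mul (A-estimate x) (abs-nonneg (0≤L (suc x)) (L-linear x x<B))))

  -- The sum of χ₀ L is evaluated twice up to O(x): by L = 1 ∗ Λ as κ x m(x), by partial summation
  -- as κ x L(x+1). Division by κ is avoided through multiplication by q, since q κ = φ ≥ 1.
  mertens′ : ∀ x → 1 ℕ.≤ x → suc x ℕ.< B → ∣ m x - L (suc x) ∣ ≤ ι 34 * (Q * (Q + 1ℚ))
  mertens′ x 1≤x x<B = cancel-ι-≤ {x} 1≤x (≤-trans (≤-reflexive (cong (_* ∣ Δ ∣) (sym (0≤p⇒∣p∣≡p (0≤ι x)))))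
    (lin {A = Q * ∣ κ * ι x * Δ ∣ + ∣ ι x ∣ * ∣ Δ ∣ * 1ℚ} {B = Q * (ι 34 * (Q + 1ℚ) * ι x) + ∣ ι x ∣ * ∣ Δ ∣ * φ}
      (0≤ι q ·≤ bound ⊕ (0≤-* (0≤∣p∣ (ι x)) (0≤∣p∣ Δ) ·≤ 1≤φ))
      (begin
        ι x * (ι 34 * (Q * (Q + 1ℚ))) + (Q * ∣ κ * ι x * Δ ∣ + ∣ ι x ∣ * ∣ Δ ∣ * 1ℚ)
          ≡⟨ cong (λ z → ι x * (ι 34 * (Q * (Q + 1ℚ))) + (Q * z + ∣ ι x ∣ * ∣ Δ ∣ * 1ℚ)) (trans (∣p*q∣≡∣p∣*∣q∣ (κ * ι x) Δ) (cong (_* ∣ Δ ∣) (trans (∣p*q∣≡∣p∣*∣q∣ κ (ι x)) (cong (_* ∣ ι x ∣) (0≤p⇒∣p∣≡p 0≤κ))))) ⟩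
        ι x * (ι 34 * (Q * (Q + 1ℚ))) + (Q * (κ * ∣ ι x ∣ * ∣ Δ ∣) + ∣ ι x ∣ * ∣ Δ ∣ * 1ℚ)
          ≡⟨ ((∀ c x q k a d → x * (c * (q * (q + 1ℚ))) + (q * (k * a * d) + a * d * 1ℚ) ≡ x * (c * (q * (q + 1ℚ))) + (a * d * (q * k) + a * d * 1ℚ)) ∋ solve-∀ ring) (ι 34) (ι x) Q κ ∣ ι x ∣ ∣ Δ ∣ ⟩
        ι x * (ι 34 * (Q * (Q + 1ℚ))) + (∣ ι x ∣ * ∣ Δ ∣ * (Q * κ) + ∣ ι x ∣ * ∣ Δ ∣ * 1ℚ)
          ≡⟨ cong (λ z → ι x * (ι 34 * (Q * (Q + 1ℚ))) + (∣ ι x ∣ * ∣ Δ ∣ * z + ∣ ι x ∣ * ∣ Δ ∣ * 1ℚ)) qκ ⟩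
        ι x * (ι 34 * (Q * (Q + 1ℚ))) + (∣ ι x ∣ * ∣ Δ ∣ * φ + ∣ ι x ∣ * ∣ Δ ∣ * 1ℚ)
          ≡⟨ ((∀ c x q f a d → x * (c * (q * (q + 1ℚ))) + (a * d * f + a * d * 1ℚ) ≡ a * d + (q * (c * (q + 1ℚ) * x) + a * d * f)) ∋ solve-∀ ring) (ι 34) (ι x) Q φ ∣ ι x ∣ ∣ Δ ∣ ⟩
        ∣ ι x ∣ * ∣ Δ ∣ + (Q * (ι 34 * (Q + 1ℚ) * ι x) + ∣ ι x ∣ * ∣ Δ ∣ * φ) ∎)))
    where
    open ≡-Reasoning
    Δ : ℚ
    Δ = m x - L (suc x)
    bound : ∣ κ * ι x * Δ ∣ ≤ ι 34 * (Q + 1ℚ) * ι x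
    bound = abs-resp (((∀ s k m l → - (s - k * m) + (s - k * l) ≡ k * (m - l)) ∋ solve-∀ ring) (∑₁ x (λ n → χ₀ n * L n)) (κ * ι x) (m x) (L (suc x)))
      (≤-trans (abs-sum (≤-trans (≤-reflexive (∣-p∣≡∣p∣ (∑₁ x (λ n → χ₀ n * L n) - κ * ι x * m x))) (step₁ x x<B)) (step₂ x (ℕₚ.<-trans (ℕₚ.n<1+n x) x<B)))
        (≤-reflexive (((∀ q x → (q + 1ℚ) * (ι 30 * x) + (ι 4 * x + q * (ι 4 * x)) ≡ ι 34 * (q + 1ℚ) * x) ∋ solve-∀ ring) Q (ι x))))

  mertens : ∀ x → 1 ℕ.≤ x → suc x ℕ.< B → ∣ m x - ι (lg x) ∣ ≤ C₁
  mertens x 1≤x x<B = abs-resp (((∀ m l l₀ g → m - l + (l - l₀ + (l₀ - g)) ≡ m - g) ∋ solve-∀ ring) (m x) (L (suc x)) (L x) (ι (lg x)))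
    (≤-trans (abs-sum (mertens′ x 1≤x x<B) (abs-sum (≤-trans (L-step x 1≤x x<B′) (4inv≤4 x)) (L≈lg x 1≤x (ℕₚ.<⇒≤ x<B′))))
      (≤-reflexive (((∀ c → c + (ι 4 + ι 4) ≡ c + ι 8) ∋ solve-∀ ring) (ι 34 * (Q * (Q + 1ℚ))))))
    where
    x<B′ : x ℕ.< B
    x<B′ = ℕₚ.<-trans (ℕₚ.n<1+n x) x<B

  m≤ : ∀ x → 1 ℕ.≤ x → suc x ℕ.< B → m x ≤ ι (lg x) + C₁
  m≤ x p r = lin (abs-upper (mertens x p r)) (((∀ m g c → g + c + (m - g) ≡ m + c) ∋ solve-∀ ring) (m x) (ι (lg x)) C₁)

  0≤m : ∀ x → 0ℚ ≤ m x
  0≤m x = ∑₁-≥0 x (λ n p _ → 0≤b n p)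

  private
    -- The bounded partial sums of `dev` meet a sequence L²/n of bounded variation. The bound is
    -- uniform in d and y, whether d is a unit or not.
    dev-sum : ∀ {d l} y → y ℕ.< B → Coprime l q → ∣ ∑₁ y (λ n → dev l (d ℕ.* n) * (L² n * inv n)) ∣ ≤ K₂ * Q
    dev-sum {d} {l} y y<B cl = by (coprime? d q)
      where
      abs-bound : Coprime d q → ∣ ∑₁ y (λ n → dev l (d ℕ.* n) * (L² n * inv n)) ∣ ≤ Q * V₂ 1
      abs-bound cd = abel-bound y (λ n → dev l (d ℕ.* n)) (λ n → L² n * inv n) V₂ Q (0≤ι q) (λ n _ → dev-partial cd cl n)
        (∣L²/n∣≤V₂ (suc y))
        (λ n p r → L²/n-variation n p (ℕₚ.≤-<-trans r y<B))

      by : Dec (Coprime d q) → ∣ ∑₁ y (λ n → dev l (d ℕ.* n) * (L² n * inv n)) ∣ ≤ K₂ * Q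
      by (no ¬cd) = ∣0∣≤ (∑₁-≡0 y (λ n _ _ → trans (cong (_* (L² n * inv n)) (dev-noncoprime ¬cd cl n)) (*-zeroˡ (L² n * inv n)))) (0≤-* 0≤K₂ (0≤ι q))
      by (yes cd) = ≤-trans (abs-bound cd) (≤-reflexive (trans (cong (Q *_) V₂-1) (*-comm Q K₂)))

  -- Writing Λ₂ = μ ∗ L² and using only |μ| ≤ 1 costs a harmonic sum, hence O(log x). This trivial
  -- estimate suffices because the main term has size (log x)²; for Λ itself it would be useless.
  dev-Λ₂ : ∀ l x → x ℕ.< B → Coprime l q → ∣ ∑₁ x (λ n → dev l n * inv n * Λ₂ n) ∣ ≤ K₂ * Q * ι (suc (lg x))
  dev-Λ₂ l x x<B cl = abs-resp (sym expand) (≤-trans (∑₁-abs≤ x {g = λ d → K₂ * Q * inv d} (λ d _ _ →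
      ≤-trans (abs-mul (abs-mul (∣μ∣≤1 d) (abs-nonneg (0≤inv d) ≤-refl)) (dev-sum {d} (x div d) (ℕₚ.≤-<-trans (div-≤ x d) x<B) cl))
        (≤-reflexive (((∀ i c → 1ℚ * i * c ≡ c * i) ∋ solve-∀ ring) (inv d) (K₂ * Q)))))
    (≤-trans (≤-reflexive (∑-*ˡ x (K₂ * Q) inv)) (0≤-* 0≤K₂ (0≤ι q) ·≤ harmonic-lg x)))
    where
    expand : ∑₁ x (λ n → dev l n * inv n * Λ₂ n) ≡ ∑₁ x (λ d → μ d * inv d * ∑₁ (x div d) (λ n → dev l (d ℕ.* n) * (L² n * inv n)))
    expand = trans (∑₁-cong x (λ n p _ → cong (dev l n * inv n *_) (sym (conv-μ-L² n p)))) (trans (hyperbola x (λ n → dev l n * inv n) μ L²)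
      (∑₁-cong x (λ d _ _ → trans (cong (μ d *_) (trans (∑₁-cong (x div d) (λ n _ _ →
          trans (cong (λ z → dev l (d ℕ.* n) * z * L² n) (inv-* d n)) (((∀ v i j s → v * (i * j) * s ≡ i * (v * (s * j))) ∋ solve-∀ ring) (dev l (d ℕ.* n)) (inv d) (inv n) (L² n))))
          (∑-*ˡ (x div d) (inv d) (λ n → dev l (d ℕ.* n) * (L² n * inv n)))))
        (sym (*-assoc (μ d) (inv d) (∑₁ (x div d) (λ n → dev l (d ℕ.* n) * (L² n * inv n))))))))

  total-Λ₂ : ℕ → ℚ
  total-Λ₂ x = ∑₁ x (λ n → χ₀ n * inv n * Λ₂ n)

  total-Λ₂-expand : ∀ x → total-Λ₂ x ≡ ∑₁ x (λ d → b d * (L d + m (x div d)))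
  total-Λ₂-expand x = begin
    ∑₁ x (λ n → χ₀ n * inv n * Λ₂ n)
      ≡⟨ trans (∑₁-cong x (λ n _ _ → *-distribˡ-+ (χ₀ n * inv n) (Λ n * L n) (conv Λ Λ n))) (∑-+ x (λ n → χ₀ n * inv n * (Λ n * L n)) (λ n → χ₀ n * inv n * conv Λ Λ n)) ⟩
    ∑₁ x (λ n → χ₀ n * inv n * (Λ n * L n)) + ∑₁ x (λ n → χ₀ n * inv n * conv Λ Λ n)
      ≡⟨ cong₂ _+_ (∑₁-cong x (λ n _ _ → ((∀ c i l g → c * i * (l * g) ≡ c * (l * i) * g) ∋ solve-∀ ring) (χ₀ n) (inv n) (Λ n) (L n)))
           (trans (hyperbola x (λ n → χ₀ n * inv n) Λ Λ) (∑₁-cong x (λ d _ _ → trans (cong (Λ d *_) (trans (∑₁-cong (x div d) (λ k _ _ →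
               trans (cong₂ (λ u v → u * v * Λ k) (χ₀-* d k) (inv-* d k)) (((∀ c c′ i i′ l → c * c′ * (i * i′) * l ≡ c * i * (c′ * (l * i′))) ∋ solve-∀ ring) (χ₀ d) (χ₀ k) (inv d) (inv k) (Λ k))))
               (∑-*ˡ (x div d) (χ₀ d * inv d) b)))
             (((∀ l c i s → l * (c * i * s) ≡ c * (l * i) * s) ∋ solve-∀ ring) (Λ d) (χ₀ d) (inv d) (m (x div d)))))) ⟩
    ∑₁ x (λ d → b d * L d) + ∑₁ x (λ d → b d * m (x div d))
      ≡⟨ trans (sym (∑-+ x (λ d → b d * L d) (λ d → b d * m (x div d)))) (∑₁-cong x (λ d _ _ → sym (*-distribˡ-+ (b d) (L d) (m (x div d))))) ⟩
    ∑₁ x (λ d → b d * (L d + m (x div d))) ∎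
    where open ≡-Reasoning

  private
    lg-defect : ∀ x d → 1 ℕ.≤ d → d ℕ.≤ x → ∣ ι (lg d) + ι (lg (x div d)) - ι (lg x) ∣ ≤ 1ℚ
    lg-defect x d p r = abs≤
      (lin (≤-trans (≤-reflexive (sym (ι-+ (lg d) (lg (x div d))))) (ι-mono (lg-div-lower x d p r)) ⊕ 0≤1)
        (((∀ s x → 1ℚ + (s + 0ℚ) ≡ s - x + (x + 1ℚ)) ∋ solve-∀ ring) (ι (lg d) + ι (lg (x div d))) (ι (lg x))))
      (lin (≤-trans (ι-mono (lg-div-upper x d p)) (≤-reflexive (cong (_+ 1ℚ) (ι-+ (lg d) (lg (x div d))))))
        (((∀ s x → 1ℚ + x ≡ - (s - x) + (s + 1ℚ)) ∋ solve-∀ ring) (ι (lg d) + ι (lg (x div d))) (ι (lg x))))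

    total-arith : ∀ X M c s → 0ℚ ≤ X → 0ℚ ≤ c → M ≤ X + c → ∣ M - X ∣ ≤ c → ∣ s - X * M ∣ ≤ (c + ι 5) * M → ∣ s - X * X ∣ ≤ (c + ι 5) * (c + ι 2) * (X + 1ℚ)
    total-arith X M c s 0≤X 0≤c M≤ h₁ h₂ = abs-resp (((∀ X M s → s - X * M + X * (M - X) ≡ s - X * X) ∋ solve-∀ ring) X M s)
      (≤-trans (abs-sum h₂ (abs-mul (abs-nonneg 0≤X ≤-refl) h₁))
        (lin (0≤-+ 0≤c (0≤ι 5) ·≤ M≤ ⊕ 0≤-+ (0≤-* (0≤-+ (0≤-* 0≤c (0≤-+ 0≤c (0≤ι 5))) (0≤ι 5)) 0≤X) (0≤-+ (0≤-* (0≤ι 2) 0≤c) (0≤ι 10)))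
          (solve (X ∷ M ∷ c ∷ []) ring)))

  -- By Mertens each bracket L d + m(x/d) is lg x + O(1), so the sum is lg x · m x + O(m x); Mertens
  -- is then applied once more to m x.
  total-estimate : ∀ x → 1 ℕ.≤ x → suc x ℕ.< B → ∣ total-Λ₂ x - ι (lg x) * ι (lg x) ∣ ≤ C₂ * (ι (lg x) + 1ℚ)
  total-estimate x 1≤x x<B = total-arith X (m x) C₁ (total-Λ₂ x) (0≤ι (lg x)) 0≤C₁ (m≤ x 1≤x x<B) (mertens x 1≤x x<B)
    (abs-resp (trans (∑-sub x (λ d → b d * (L d + m (x div d))) (λ d → X * b d)) (cong₂ _-_ (sym (total-Λ₂-expand x)) (∑-*ˡ x X b)))
      (≤-trans (∑₁-abs≤ x {g = λ d → (C₁ + ι 5) * b d} term) (≤-reflexive (∑-*ˡ x (C₁ + ι 5) b))))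
    where
    X : ℚ
    X = ι (lg x)
    term : ∀ d → 1 ℕ.≤ d → d ℕ.≤ x → ∣ b d * (L d + m (x div d)) - X * b d ∣ ≤ (C₁ + ι 5) * b d
    term d p r = abs-resp (((∀ b l m g g′ x → b * (l - g + (m - g′ + (g + g′ - x))) ≡ b * (l + m) - x * b) ∋ solve-∀ ring) (b d) (L d) (m (x div d)) (ι (lg d)) (ι (lg (x div d))) X)
      (≤-trans (abs-mul (abs-nonneg (0≤b d p) ≤-refl) (abs-sum (L≈lg d p (ℕₚ.≤-trans r (ℕₚ.<⇒≤ (ℕₚ.<-trans (ℕₚ.n<1+n x) x<B))))
          (abs-sum (mertens (x div d) (*-≤⇒≤-div x d 1 p (subst (ℕ._≤ x) (sym (ℕₚ.*-identityʳ d)) r)) (ℕₚ.≤-<-trans (s≤s (div-≤ x d)) x<B)) (lg-defect x d p r))))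
        (≤-reflexive (((∀ b c → b * (ι 4 + (c + 1ℚ)) ≡ (c + ι 5) * b) ∋ solve-∀ ring) (b d) C₁)))

  -- The class indicator is `dev l` plus ν χ₀: the first part is an error term, the second the total
  -- over all units.
  selberg : ∀ l x → Coprime l q → 1 ℕ.≤ x → suc x ℕ.< B → ∣ ∑₁ x (λ n → 𝟙 (n ≈? l) * inv n * Λ₂ n) - ν * (ι (lg x) * ι (lg x)) ∣ ≤ C₃ * (ι (lg x) + 1ℚ)
  selberg l x cl 1≤x x<B = abs-resp
    (trans (cong (_+ ν * (total-Λ₂ x - X * X)) (trans (∑₁-cong x (λ n _ _ → ((∀ i v c j l → (i - v * c) * j * l ≡ i * j * l - v * (c * j * l)) ∋ solve-∀ ring) (𝟙 (n ≈? l)) ν (χ₀ n) (inv n) (Λ₂ n)))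
      (trans (∑-sub x (λ n → 𝟙 (n ≈? l) * inv n * Λ₂ n) (λ n → ν * (χ₀ n * inv n * Λ₂ n))) (cong (λ z → ∑₁ x (λ n → 𝟙 (n ≈? l) * inv n * Λ₂ n) - z) (∑-*ˡ x ν (λ n → χ₀ n * inv n * Λ₂ n))))))
      (((∀ s v t x → s - v * t + v * (t - x) ≡ s - v * x) ∋ solve-∀ ring) (∑₁ x (λ n → 𝟙 (n ≈? l) * inv n * Λ₂ n)) ν (total-Λ₂ x) (X * X)))
    (≤-trans (abs-sum (dev-Λ₂ l x (ℕₚ.<-trans (ℕₚ.n<1+n x) x<B) cl) (abs-mul (abs-nonneg 0≤ν ν≤1) (total-estimate x 1≤x x<B)))
      (≤-reflexive (((∀ c d x → c * (x + 1ℚ) + 1ℚ * (d * (x + 1ℚ)) ≡ (d + c) * (x + 1ℚ)) ∋ solve-∀ ring) (K₂ * Q) C₂ X)))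
    where
    X : ℚ
    X = ι (lg x)

private
  harmonic-step : ∀ H i j d e e′ → H ≤ e + j * d → i ≤ d + (e′ - e) → H + i ≤ e′ + (j + 1ℚ) * d
  harmonic-step H i j d e e′ h h′ = lin (h ⊕ h′) (solve (H ∷ i ∷ j ∷ d ∷ e ∷ e′ ∷ []) ring)

-- The first D terms are at most 1 and the others at most 1/D. The argument j being a logarithm
-- already, this avoids an iterated logarithm: a linear bound of arbitrarily small slope averages
-- well against the geometric weights.
harmonic-linear : ∀ D j → 1 ℕ.≤ D → ∑₁ j inv ≤ ι D + ι j * inv D
harmonic-linear D j 1≤D = ≤-trans (go j) (ι-mono (ℕₚ.m⊓n≤n j D) ⊕ ≤-refl)
  where
  step : ∀ j → Dec (suc j ℕ.≤ D) → inv (suc j) ≤ inv D + (ι (suc j ℕ.⊓ D) - ι (j ℕ.⊓ D))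
  step j (yes h) = ≤-trans (inv≤1 (suc j)) (≤-trans (lin (0≤inv D) (((∀ a d → d + (a + 1ℚ - a) + 0ℚ ≡ 1ℚ + d) ∋ solve-∀ ring) (ι j) (inv D)))
    (≤-reflexive (cong₂ (λ u v → inv D + (ι u - ι v)) (sym (ℕₚ.m≤n⇒m⊓n≡m h)) (sym (ℕₚ.m≤n⇒m⊓n≡m (ℕₚ.<⇒≤ h))))))
  step j (no h) = ≤-trans (inv-anti 1≤D (ℕₚ.<⇒≤ (ℕₚ.≰⇒> h))) (≤-reflexive (trans (((∀ d e → d ≡ d + (e - e)) ∋ solve-∀ ring) (inv D) (ι D))
    (cong₂ (λ u v → inv D + (ι u - ι v)) (sym (ℕₚ.m≥n⇒m⊓n≡n (ℕₚ.<⇒≤ (ℕₚ.≰⇒> h)))) (sym (ℕₚ.m≥n⇒m⊓n≡n (ℕ.s≤s⁻¹ (ℕₚ.≰⇒> h)))))))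
  go : ∀ j → ∑₁ j inv ≤ ι (j ℕ.⊓ D) + ι j * inv D
  go zero = ≤-reflexive (sym (trans (+-identityˡ (0ℚ * inv D)) (*-zeroˡ (inv D))))
  go (suc j) = harmonic-step (∑₁ j inv) (inv (suc j)) (ι j) (inv D) (ι (j ℕ.⊓ D)) (ι (suc j ℕ.⊓ D)) (go j) (step j (suc j ℕₚ.≤? D))

-- Geometric weights and their moments

module Geometric (k : ℕ) (1≤k : 1 ℕ.≤ k) where

  r : ℚ
  r = 1ℚ - inv k

  0≤r : 0ℚ ≤ r
  0≤r = 0≤-diff (inv≤1 k)

  -- `p` is the geometric law with mean k - 1, and `pw j` is the mass of its tail from j on.
  pw p : ℕ → ℚ
  pw zero = 1ℚ
  pw (suc j) = r * pw j
  p j = inv k * pw j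

  0≤pw : ∀ j → 0ℚ ≤ pw j
  0≤pw zero = 0≤1
  0≤pw (suc j) = 0≤-* 0≤r (0≤pw j)

  0≤p : ∀ j → 0ℚ ≤ p j
  0≤p j = 0≤-* (0≤inv k) (0≤pw j)

  pw-suc≤ : ∀ j → pw (suc j) ≤ pw j
  pw-suc≤ j = lin (0≤p j) (((∀ i w → w + 0ℚ ≡ (1ℚ - i) * w + i * w) ∋ solve-∀ ring) (inv k) (pw j))

  pw-+ : ∀ i j → pw (i ℕ.+ j) ≡ pw i * pw j
  pw-+ zero j = sym (*-identityˡ (pw j))
  pw-+ (suc i) j = trans (cong (r *_) (pw-+ i j)) (sym (*-assoc r (pw i) (pw j)))

  pw≤1 : ∀ j → pw j ≤ 1ℚ
  pw≤1 zero = ≤-refl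
  pw≤1 (suc j) = ≤-trans (pw-suc≤ j) (pw≤1 j)

  ∑-p : ∀ J → ∑ J p ≡ 1ℚ - pw J
  ∑-p zero = sym (+-inverseʳ 1ℚ)
  ∑-p (suc J) = trans (cong (_+ p J) (∑-p J)) (((∀ i w → 1ℚ - w + i * w ≡ 1ℚ - (1ℚ - i) * w) ∋ solve-∀ ring) (inv k) (pw J))

  ∑-p-from : ∀ i J → i ℕ.≤ J → ∑ J (λ j → p j * 𝟙 (i ℕₚ.≤? j)) ≡ pw i - pw J
  ∑-p-below : ∀ i J → J ℕ.≤ i → ∑ J (λ j → p j * 𝟙 (i ℕₚ.≤? j)) ≡ 0ℚ
  ∑-p-below i J J≤i = ∑-≡0 J (λ j j<J → trans (cong (p j *_) (𝟙-no (i ℕₚ.≤? j) (ℕₚ.<⇒≱ (ℕₚ.<-≤-trans j<J J≤i)))) (*-zeroʳ (p j)))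
  ∑-p-from zero zero _ = sym (+-inverseʳ 1ℚ)
  ∑-p-from i (suc J) i≤sJ with ℕₚ.m≤n⇒m<n∨m≡n i≤sJ
  ... | inj₂ refl = trans (∑-p-below (suc J) (suc J) ℕₚ.≤-refl) (sym (+-inverseʳ (pw (suc J))))
  ... | inj₁ (s≤s i≤J) = trans (cong₂ _+_ (∑-p-from i J i≤J) (cong (p J *_) (𝟙-yes (i ℕₚ.≤? J) i≤J)))
    (((∀ x i w → x - w + i * w * 1ℚ ≡ x - (1ℚ - i) * w) ∋ solve-∀ ring) (pw i) (inv k) (pw J))

  ∑-p-from-≤ : ∀ i J → ∑ J (λ j → p j * 𝟙 (i ℕₚ.≤? j)) ≤ pw i
  ∑-p-from-≤ i J with ℕₚ.≤-total i J
  ... | inj₁ h = lin (0≤pw J) (trans (((∀ x w → x + 0ℚ ≡ x - w + w) ∋ solve-∀ ring) (pw i) (pw J)) (cong (_+ pw J) (sym (∑-p-from i J h))))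
  ... | inj₂ h = ≤-trans (≤-reflexive (∑-p-below i J h)) (0≤pw i)

  mean : ∀ J → ∑ J (λ j → p j * ι j) + pw J * ι J ≤ ι k
  mean J = ≤-trans (≤-reflexive (tele J)) (≤-trans (∑-mono J (λ j _ → pw-suc≤ j)) (lin (0≤-* (0≤ι k) (0≤pw J))
      (trans (((∀ k w → k + 0ℚ ≡ k * (1ℚ - w) + k * w) ∋ solve-∀ ring) (ι k) (pw J)) (cong (_+ ι k * pw J) (sym total)))))
    where
    tele : ∀ J → ∑ J (λ j → p j * ι j) + pw J * ι J ≡ ∑ J (λ j → pw (suc j))
    tele zero = trans (+-identityˡ (1ℚ * 0ℚ)) (*-zeroʳ 1ℚ)
    tele (suc J) = lin≡ (tele J) (((∀ s i w n s′ → s′ + (1ℚ - i) * w + (s + w * n) ≡ s + i * w * n + (1ℚ - i) * w * (n + 1ℚ) + s′) ∋ solve-∀ ring) (∑ J (λ j → p j * ι j)) (inv k) (pw J) (ι J) (∑ J (λ j → pw (suc j))))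
    total : ∑ J pw ≡ ι k * (1ℚ - pw J)
    total = trans (sym (*-identityˡ (∑ J pw))) (trans (cong (_* ∑ J pw) (sym (ι-inv 1≤k))) (trans (*-assoc (ι k) (inv k) (∑ J pw)) (cong (ι k *_) (trans (sym (∑-*ˡ J (inv k) pw)) (∑-p J)))))

  mean≤ : ∀ J → ∑ J (λ j → p j * ι j) ≤ ι k
  mean≤ J = lin (mean J ⊕ 0≤-* (0≤pw J) (0≤ι J)) (((∀ s t k → k + (s + t + 0ℚ) ≡ s + (k + t)) ∋ solve-∀ ring) (∑ J (λ j → p j * ι j)) (pw J * ι J) (ι k))

  -- The quadratic polynomial g with g(x) - r g(x+1) = x² / k, which makes the truncated second
  -- moment telescope; its value at 0 is the full second moment.
  quad : ℚ → ℚ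
  quad x = x * x + ι 2 * (ι k - 1ℚ) * x + (ι k - 1ℚ) * (ι 2 * ι k - 1ℚ)

  second-moment : ∀ J → ∑ J (λ j → p j * (ι j * ι j)) ≡ quad 0ℚ - pw J * quad (ι J)
  second-moment zero = sym (((∀ x → x - 1ℚ * x ≡ 0ℚ) ∋ solve-∀ ring) (quad 0ℚ))
  second-moment (suc J) = lin≡ (cong₂ _+_ (second-moment J) (cong (λ z → pw J * (ι J + ι J + ι 2 * ι k - 1ℚ) * z) (sym (ι-inv 1≤k))))
    (((∀ s i w n k q₀ → let q = λ x → x * x + ι 2 * (k - 1ℚ) * x + (k - 1ℚ) * (ι 2 * k - 1ℚ) in
        q₀ - (1ℚ - i) * w * q (n + 1ℚ) + (s + w * (n + n + ι 2 * k - 1ℚ) * 1ℚ) ≡ s + i * w * (n * n) + (q₀ - w * q n + w * (n + n + ι 2 * k - 1ℚ) * (k * i))) ∋ solve-∀ ring)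
      (∑ J (λ j → p j * (ι j * ι j))) (inv k) (pw J) (ι J) (ι k) (quad 0ℚ))

  pw-bernoulli : ∀ j → pw j * (1ℚ + ι j * inv k) ≤ 1ℚ
  pw-bernoulli zero = ≤-reflexive (((∀ i → 1ℚ * (1ℚ + 0ℚ * i) ≡ 1ℚ) ∋ solve-∀ ring) (inv k))
  pw-bernoulli (suc j) = lin (pw-bernoulli j ⊕ 0≤-* (0≤-* (0≤pw j) (0≤ι (suc j))) (0≤-* (0≤inv k) (0≤inv k)))
    (((∀ w j i → 1ℚ + (w * (1ℚ + j * i) + 0ℚ) ≡ (1ℚ - i) * w * (1ℚ + (j + 1ℚ) * i) + (1ℚ + w * (j + 1ℚ) * (i * i))) ∋ solve-∀ ring) (pw j) (ι j) (inv k))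

  pw-k : ι 2 * pw k ≤ 1ℚ
  pw-k = lin (pw-bernoulli k ⊕ pw k ·≡ sym (ι-inv 1≤k)) (((∀ w k i → 1ℚ + (w * (1ℚ + k * i) + w * 1ℚ) ≡ ι 2 * w + (1ℚ + w * (k * i))) ∋ solve-∀ ring) (pw k) (ι k) (inv k))

  -- Bernoulli's inequality gives r^k ≤ 1/2, and this is raised to the power m.
  pw-tail : ∀ m → ι (2 ℕ.^ m) * pw (m ℕ.* k) ≤ 1ℚ
  pw-tail zero = ≤-refl
  pw-tail (suc m) = ≤-trans (≤-reflexive (trans (cong₂ _*_ (ι-* 2 (2 ℕ.^ m)) (pw-+ k (m ℕ.* k))) (((∀ c t w v → c * t * (w * v) ≡ (c * w) * (t * v)) ∋ solve-∀ ring) (ι 2) (ι (2 ℕ.^ m)) (pw k) (pw (m ℕ.* k)))))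
    (≤-trans (*-mono (0≤-* (0≤ι 2) (0≤pw k)) pw-k (0≤-* (0≤ι (2 ℕ.^ m)) (0≤pw (m ℕ.* k))) (pw-tail m)) (≤-reflexive (*-identityˡ 1ℚ)))

-- Averages over dyadic cutoffs

private
  E-arith : ∀ e s n g v j c₃ c₁ → e ≤ s + ι 4 * n → n ≤ j + c₁ → 0ℚ ≤ g → 0ℚ ≤ j → 0ℚ ≤ c₁ → s + g - v ≤ c₃ * (j + 1ℚ) → e ≤ v + (c₃ + ι 4 + ι 4 * c₁) * (j + 1ℚ)
  E-arith e s n g v j c₃ c₁ h₁ h₂ h₃ h₄ h₅ h₆ = lin (h₁ ⊕ 0≤ι 4 ·≤ h₂ ⊕ h₃ ⊕ h₆ ⊕ 0≤-* (0≤-* (0≤ι 4) h₅) h₄ ⊕ 0≤ι 4) (solve (e ∷ s ∷ n ∷ g ∷ v ∷ j ∷ c₃ ∷ c₁ ∷ []) ring)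

  N-rec : ∀ n n′ e e′ i i′ j H v c → 0ℚ ≤ i → 0ℚ ≤ i′ → 0ℚ ≤ v → j * i ≡ 1ℚ → (j + 1ℚ) * i′ ≡ 1ℚ → e′ - e ≡ (j + 1ℚ) * (n′ - n) →
    e ≤ v * (j * j) + c * (j + 1ℚ) → n - i * e ≤ H → n′ - i′ * e′ ≤ H + v + c * i
  N-rec n n′ e e′ i i′ j H v c 0≤i 0≤i′ 0≤v e₁ e₂ bl he h =
    lin (h ⊕ 0≤-* 0≤i 0≤i′ ·≤ he ⊕ i′ ·≡ sym bl ⊕ (n′ - n) ·≡ sym e₂ ⊕ (c * i) ·≡ e₂ ⊕ (e * i) ·≡ sym e₂ ⊕ (e * i′) ·≡ e₁ ⊕ (v * (j * i′)) ·≡ e₁ ⊕ v ·≡ e₂ ⊕ 0≤-* 0≤v 0≤i′)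
      (solve (n ∷ n′ ∷ e ∷ e′ ∷ i ∷ i′ ∷ j ∷ H ∷ v ∷ c ∷ []) ring)

  N-base-arith : ∀ n e c₁ v z → n ≤ ι 1 + c₁ → 0ℚ ≤ e → n - e ≤ 1ℚ + c₁ + v * 0ℚ + z * 0ℚ
  N-base-arith n e c₁ v z h₁ h₂ = lin (h₁ ⊕ h₂) (solve (n ∷ e ∷ c₁ ∷ v ∷ z ∷ []) ring)

  N-combine : ∀ n e i j v c a s d e₀ → 0ℚ ≤ i → i ≤ 1ℚ → 0ℚ ≤ c → 0ℚ ≤ d → 0ℚ ≤ v → (j + 1ℚ) * i ≡ 1ℚ → n - i * e ≤ a + v * j + c * s → e ≤ v * ((j + 1ℚ) * (j + 1ℚ)) + c * (j + 1ℚ + 1ℚ) →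
    s ≤ e₀ + j * d → n ≤ (ι 2 * v + c * d) * (j + 1ℚ) + (c * e₀ + (a + ι 2 * c))
  N-combine n e i j v c a s d e₀ 0≤i i≤1 0≤c 0≤d 0≤v e₁ h₁ h₂ h₃ =
    lin (h₁ ⊕ 0≤i ·≤ h₂ ⊕ 0≤c ·≤ h₃ ⊕ (v * (j + 1ℚ)) ·≡ e₁ ⊕ c ·≡ e₁ ⊕ 0≤c ·≤ i≤1 ⊕ 0≤-* 0≤c 0≤d ⊕ 0≤v)
      (solve (n ∷ e ∷ i ∷ j ∷ v ∷ c ∷ a ∷ s ∷ d ∷ e₀ ∷ []) ring)

  N-zero-arith : ∀ c₁ c₄ d a → 0ℚ ≤ c₄ → 0ℚ ≤ d → 0ℚ + c₁ ≤ a * 0ℚ + (c₄ * d + (1ℚ + c₁ + ι 2 * c₄))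
  N-zero-arith c₁ c₄ d a h₁ h₂ = lin (0≤-* h₁ h₂ ⊕ 0≤ι 2 ·≤ h₁ ⊕ 0≤1) (solve (c₁ ∷ c₄ ∷ d ∷ a ∷ []) ring)

record Setup : Set where
  field
    {B} : ℕ
    log : Log B
    q : ℕ
    {{q≢0}} : ℕ.NonZero q
    k J : ℕ
    1≤k : 1 ℕ.≤ k
    2^J<B : 2 ℕ.^ J ℕ.< B

module Laplace (setup : Setup) where
  open Setup setup public
  open Selberg log q public
  open Geometric k 1≤k public

  -- The last number of a dyadic block, chosen as cutoff so that n ≤ top j is equivalent to lg n ≤
  -- j.
  top : ℕ → ℕ
  top j = ℕ.pred (2 ℕ.^ suc j)

  x∞ : ℕ
  x∞ = ℕ.pred (2 ℕ.^ J)

  suc-top : ∀ j → suc (top j) ≡ 2 ℕ.^ suc j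
  suc-top j = ℕₚ.suc-pred (2 ℕ.^ suc j) {{ℕ.>-nonZero (1≤2^ (suc j))}}

  suc-x∞ : suc x∞ ≡ 2 ℕ.^ J
  suc-x∞ = ℕₚ.suc-pred (2 ℕ.^ J) {{ℕ.>-nonZero (1≤2^ J)}}

  1≤top : ∀ j → 1 ℕ.≤ top j
  1≤top j = ℕ.s≤s⁻¹ (subst (2 ℕ.≤_) (sym (suc-top j)) (ℕₚ.^-monoʳ-≤ 2 {1} {suc j} (s≤s z≤n)))

  lg-top : ∀ j → lg (top j) ≡ j
  lg-top j = ℕₚ.≤-antisym (lg≤ (subst (top j ℕ.<_) (suc-top j) ℕₚ.≤-refl))
    (≤lg (ℕ.s≤s⁻¹ (subst (2 ℕ.^ j ℕ.<_) (sym (suc-top j)) (ℕₚ.^-monoʳ-< 2 (s≤s (s≤s z≤n)) (ℕₚ.n<1+n j)))))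

  ≤top⇒lg≤ : ∀ {n j} → n ℕ.≤ top j → lg n ℕ.≤ j
  ≤top⇒lg≤ {n} {j} h = lg≤ (subst (n ℕ.<_) (suc-top j) (s≤s h))

  lg≤⇒≤top : ∀ {n j} → lg n ℕ.≤ j → n ℕ.≤ top j
  lg≤⇒≤top {n} {j} h = ℕ.s≤s⁻¹ (subst (n ℕ.<_) (sym (suc-top j)) (ℕₚ.<-≤-trans (lg-upper n) (ℕₚ.^-monoʳ-≤ 2 (s≤s h))))

  top≤x∞ : ∀ {j} → j ℕ.< J → top j ℕ.≤ x∞
  top≤x∞ {j} h = ℕ.s≤s⁻¹ (subst₂ ℕ._≤_ (sym (suc-top j)) (sym suc-x∞) (ℕₚ.^-monoʳ-≤ 2 h))

  x∞<B : suc x∞ ℕ.< B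
  x∞<B = subst (ℕ._< B) (sym suc-x∞) 2^J<B

  top<B : ∀ {j} → j ℕ.< J → suc (top j) ℕ.< B
  top<B h = ℕₚ.≤-<-trans (s≤s (top≤x∞ h)) x∞<B

  lg≤J : ∀ {n} → 1 ℕ.≤ n → n ℕ.≤ x∞ → suc (lg n) ℕ.≤ J
  lg≤J {n} 1≤n h = 2^-cancel-< (ℕₚ.≤-<-trans (lg-lower n 1≤n) (subst (n ℕ.<_) suc-x∞ (s≤s h)))

  w : ℕ → ℚ
  w n = pw (lg n)

  0≤w : ∀ n → 0ℚ ≤ w n
  0≤w n = 0≤pw (lg n)

  -- A given n is counted at the cutoffs j with lg n ≤ j < J, whose total mass is r^(lg n) - r^J;
  -- the subtracted sum is the price of truncating at J.
  average : ∀ f → ∑ J (λ j → p j * ∑₁ (top j) f) ≡ ∑₁ x∞ (λ n → f n * w n) - pw J * ∑₁ x∞ f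
  average f = begin
    ∑ J (λ j → p j * ∑₁ (top j) f)
      ≡⟨ ∑-cong J (λ j h → trans (cong (p j *_) (truncate-sum j h)) (sym (∑-*ˡ x∞ (p j) (λ n → 𝟙 (lg n ℕₚ.≤? j) * f n)))) ⟩
    ∑ J (λ j → ∑₁ x∞ (λ n → p j * (𝟙 (lg n ℕₚ.≤? j) * f n)))
      ≡⟨ ∑-swap J x∞ (λ j n → p j * (𝟙 (lg n ℕₚ.≤? j) * f n)) ⟩
    ∑₁ x∞ (λ n → ∑ J (λ j → p j * (𝟙 (lg n ℕₚ.≤? j) * f n)))
      ≡⟨ ∑₁-cong x∞ (λ n 1≤n n≤ → trans (∑-cong J (λ j _ → sym (*-assoc (p j) (𝟙 (lg n ℕₚ.≤? j)) (f n)))) (trans (∑-*ʳ J (f n) (λ j → p j * 𝟙 (lg n ℕₚ.≤? j)))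
           (trans (cong (_* f n) (∑-p-from (lg n) J (ℕₚ.<⇒≤ (lg≤J 1≤n n≤)))) (((∀ w v f → (w - v) * f ≡ f * w - v * f) ∋ solve-∀ ring) (w n) (pw J) (f n))))) ⟩
    ∑₁ x∞ (λ n → f n * w n - pw J * f n)
      ≡⟨ trans (∑-sub x∞ (λ n → f n * w n) (λ n → pw J * f n)) (cong (λ z → ∑₁ x∞ (λ n → f n * w n) - z) (∑-*ˡ x∞ (pw J) f)) ⟩
    ∑₁ x∞ (λ n → f n * w n) - pw J * ∑₁ x∞ f ∎
    where
    open ≡-Reasoning
    truncate-sum : ∀ j → j ℕ.< J → ∑₁ (top j) f ≡ ∑₁ x∞ (λ n → 𝟙 (lg n ℕₚ.≤? j) * f n)
    truncate-sum j h = trans (∑₁-cong (top j) (λ n _ n≤ → sym (trans (cong (_* f n) (𝟙-yes (lg n ℕₚ.≤? j) (≤top⇒lg≤ n≤))) (*-identityˡ (f n)))))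
      (∑₁-extend (top≤x∞ h) (λ n top<n _ → trans (cong (_* f n) (𝟙-no (lg n ℕₚ.≤? j) (λ l → ℕₚ.<⇒≱ top<n (lg≤⇒≤top l)))) (*-zeroˡ (f n))))

  weighted : ∀ f → ∑₁ x∞ (λ n → f n * w n) ≡ ∑ J (λ j → p j * ∑₁ (top j) f) + pw J * ∑₁ x∞ f
  weighted f = lin≡ (sym (average f)) (((∀ a s t → s + t + (a - t) ≡ a + s) ∋ solve-∀ ring) (∑₁ x∞ (λ n → f n * w n)) (∑ J (λ j → p j * ∑₁ (top j) f)) (pw J * ∑₁ x∞ f))

  -- The truncated mean of j together with the tail mass r^J placed at J is at most k, so an affine
  -- bound in j becomes the same affine bound in k.
  weighted-≤ : ∀ f α γ → 0ℚ ≤ α → 0ℚ ≤ γ → (∀ j → j ℕ.< J → ∑₁ (top j) f ≤ α * ι j + γ) → ∑₁ x∞ f ≤ α * ι J + γ → ∑₁ x∞ (λ n → f n * w n) ≤ α * ι k + γ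
  weighted-≤ f α γ 0≤α 0≤γ h h∞ = ≤-trans (≤-reflexive (weighted f)) (≤-trans
    (∑-mono J (λ j j<J → 0≤p j ·≤ h j j<J) ⊕ 0≤pw J ·≤ h∞)
    (≤-trans (≤-reflexive (trans (cong (_+ pw J * (α * ι J + γ)) (trans (∑-cong J (λ j _ → ((∀ p a j c → p * (a * j + c) ≡ a * (p * j) + c * p) ∋ solve-∀ ring) (p j) α (ι j) γ))
        (trans (∑-+ J (λ j → α * (p j * ι j)) (λ j → γ * p j)) (cong₂ _+_ (∑-*ˡ J α (λ j → p j * ι j)) (trans (∑-*ˡ J γ p) (cong (γ *_) (∑-p J)))))))
        (((∀ a s c w j → a * s + c * (1ℚ - w) + w * (a * j + c) ≡ a * (s + w * j) + c) ∋ solve-∀ ring) α (∑ J (λ j → p j * ι j)) γ (pw J) (ι J))))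
      (0≤α ·≤ mean J ⊕ ≤-refl)))

  m-top : ∀ j → j ℕ.< J → m (top j) ≤ ι j + C₁
  m-top j h = ≤-trans (m≤ (top j) (1≤top j) (top<B h)) (≤-reflexive (cong (λ z → ι z + C₁) (lg-top j)))

  m-x∞ : m x∞ ≤ ι J + C₁
  m-x∞ = go x∞ refl
    where
    go : ∀ y → y ≡ x∞ → m x∞ ≤ ι J + C₁
    go zero e = ≤-trans (≤-reflexive (cong m (sym e))) (0≤-+ (0≤ι J) 0≤C₁)
    go (suc y) e = ≤-trans (m≤ x∞ 1≤x x∞<B) (ι-mono (ℕₚ.<⇒≤ (lg≤J 1≤x ℕₚ.≤-refl)) ⊕ ≤-refl)
      where
      1≤x : 1 ℕ.≤ x∞
      1≤x = subst (1 ℕ.≤_) e (s≤s z≤n)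

  F : ℚ
  F = ∑₁ x∞ (λ n → b n * w n)

  F≤ : F ≤ ι k + C₁
  F≤ = ≤-trans (weighted-≤ b 1ℚ C₁ 0≤1 0≤C₁ (λ j h → ≤-trans (m-top j h) (≤-reflexive (cong (_+ C₁) (sym (*-identityˡ (ι j))))))
    (≤-trans m-x∞ (≤-reflexive (cong (_+ C₁) (sym (*-identityˡ (ι J))))))) (≤-reflexive (cong (_+ C₁) (*-identityˡ (ι k))))

  β : ℕ → ℕ → ℚ
  β c n = 𝟙 (n ≈? c) * b n

  0≤β : ∀ c n → 1 ℕ.≤ n → 0ℚ ≤ β c n
  0≤β c n h = 0≤-* (0≤𝟙 (n ≈? c)) (0≤b n h)

  β≤b : ∀ c n → 1 ℕ.≤ n → β c n ≤ b n
  β≤b c n h = ≤-trans (*-monoʳ-≤-nonNeg (b n) {{nonNegative (0≤b n h)}} (𝟙≤1 (n ≈? c))) (≤-reflexive (*-identityˡ (b n)))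

  -- For a class: its mass, its mass weighted by ⌊log₂ n⌋, and the Λ L and Λ ∗ Λ parts of Selberg's
  -- sum.
  N E Qs G : ℕ → ℕ → ℚ
  N c x = ∑₁ x (β c)
  E c x = ∑₁ x (λ n → ι (lg n) * β c n)
  Qs c x = ∑₁ x (λ n → β c n * L n)
  G c x = ∑₁ x (λ d → b d * ∑₁ (x div d) (λ n → 𝟙 (d ℕ.* n ≈? c) * b n))

  X : ℕ → ℚ
  X c = ∑₁ x∞ (λ n → β c n * w n)

  0≤X : ∀ c → 0ℚ ≤ X c
  0≤X c = ∑₁-≥0 x∞ (λ n h _ → 0≤-* (0≤β c n h) (0≤w n))

  0≤G : ∀ c x → 0ℚ ≤ G c x
  0≤G c x = ∑₁-≥0 x (λ d h _ → 0≤-* (0≤b d h) (∑₁-≥0 (x div d) (λ n h′ _ → 0≤-* (0≤𝟙 (d ℕ.* n ≈? c)) (0≤b n h′))))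

  N≤m : ∀ c x → N c x ≤ m x
  N≤m c x = ∑₁-mono x (λ n h _ → β≤b c n h)

  ≈-χ₀ : ∀ {c} n → Coprime c q → 𝟙 (n ≈? c) ≡ 𝟙 (n ≈? c) * χ₀ n
  ≈-χ₀ {c} n cc = trans (sym (*-identityʳ (𝟙 (n ≈? c)))) (𝟙-when (n ≈? c) (λ e → sym (𝟙-yes (coprime? n q) (coprime-≈ (sym e) cc))))

  Λ₂-class : ∀ c x → Coprime c q → ∑₁ x (λ n → 𝟙 (n ≈? c) * inv n * Λ₂ n) ≡ Qs c x + G c x
  Λ₂-class c x cc = begin
    ∑₁ x (λ n → 𝟙 (n ≈? c) * inv n * Λ₂ n)
      ≡⟨ trans (∑₁-cong x (λ n _ _ → *-distribˡ-+ (𝟙 (n ≈? c) * inv n) (Λ n * L n) (conv Λ Λ n)))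
           (∑-+ x (λ n → 𝟙 (n ≈? c) * inv n * (Λ n * L n)) (λ n → 𝟙 (n ≈? c) * inv n * conv Λ Λ n)) ⟩
    ∑₁ x (λ n → 𝟙 (n ≈? c) * inv n * (Λ n * L n)) + ∑₁ x (λ n → 𝟙 (n ≈? c) * inv n * conv Λ Λ n)
      ≡⟨ cong₂ _+_
           (∑₁-cong x (λ n _ _ → trans (cong (λ z → z * inv n * (Λ n * L n)) (≈-χ₀ n cc))
             (((∀ i x v l g → i * x * v * (l * g) ≡ i * (x * (l * v)) * g) ∋ solve-∀ ring) (𝟙 (n ≈? c)) (χ₀ n) (inv n) (Λ n) (L n))))
           (trans (hyperbola x (λ n → 𝟙 (n ≈? c) * inv n) Λ Λ) (∑₁-cong x (λ d _ _ → trans (sym (∑-*ˡ (x div d) (Λ d) _)) (trans (∑₁-cong (x div d) (λ n _ _ → term d n)) (∑-*ˡ (x div d) (b d) _))))) ⟩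
    Qs c x + G c x ∎
    where
    open ≡-Reasoning
    term : ∀ d n → Λ d * (𝟙 (d ℕ.* n ≈? c) * inv (d ℕ.* n) * Λ n) ≡ b d * (𝟙 (d ℕ.* n ≈? c) * b n)
    term d n = trans (cong₂ (λ u v → Λ d * (u * v * Λ n)) (trans (≈-χ₀ (d ℕ.* n) cc) (cong (𝟙 (d ℕ.* n ≈? c) *_) (χ₀-* d n))) (inv-* d n))
      (((∀ l i x y u v l′ → l * (i * (x * y) * (u * v) * l′) ≡ x * (l * u) * (i * (y * (l′ * v)))) ∋ solve-∀ ring) (Λ d) (𝟙 (d ℕ.* n ≈? c)) (χ₀ d) (χ₀ n) (inv d) (inv n) (Λ n))

  selberg-top : ∀ c j → Coprime c q → j ℕ.< J → ∣ Qs c (top j) + G c (top j) - ν * (ι j * ι j) ∣ ≤ C₃ * (ι j + 1ℚ)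
  selberg-top c j cc h = subst (λ z → ∣ Qs c (top j) + G c (top j) - ν * (ι z * ι z) ∣ ≤ C₃ * (ι z + 1ℚ)) (lg-top j)
    (subst (λ z → ∣ z - ν * (ι (lg (top j)) * ι (lg (top j))) ∣ ≤ C₃ * (ι (lg (top j)) + 1ℚ)) (Λ₂-class c (top j) cc)
      (selberg c (top j) cc (1≤top j) (top<B h)))

  -- The non-negative convolution part is dropped from Selberg's formula; this is where a factor 2
  -- is lost.
  E≤ : ∀ c j → Coprime c q → j ℕ.< J → E c (top j) ≤ ν * (ι j * ι j) + C₄ * (ι j + 1ℚ)
  E≤ c j cc h = E-arith (E c (top j)) (Qs c (top j)) (N c (top j)) (G c (top j)) (ν * (ι j * ι j)) (ι j) C₃ C₁
    (≤-trans (∑₁-mono (top j) {g = λ n → β c n * L n + ι 4 * β c n} term) (≤-reflexive (trans (∑-+ (top j) (λ n → β c n * L n) (λ n → ι 4 * β c n)) (cong (Qs c (top j) +_) (∑-*ˡ (top j) (ι 4) (β c))))))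
    (≤-trans (N≤m c (top j)) (m-top j h)) (0≤G c (top j)) (0≤ι j) 0≤C₁ (abs-upper (selberg-top c j cc h))
    where
    term : ∀ n → 1 ℕ.≤ n → n ℕ.≤ top j → ι (lg n) * β c n ≤ β c n * L n + ι 4 * β c n
    term n 1≤n n≤ = lin (0≤β c n 1≤n ·≤ ≤-trans (-≤abs (L n - ι (lg n))) (L≈lg n 1≤n (ℕₚ.≤-trans n≤ (ℕₚ.<⇒≤ (ℕₚ.<-trans (ℕₚ.n<1+n (top j)) (top<B h))))))
      (((∀ b l g → b * l + ι 4 * b + b * - (l - g) ≡ g * b + b * ι 4) ∋ solve-∀ ring) (β c n) (L n) (ι (lg n)))

  private
    block : ∀ c j → E c (top (suc j)) - E c (top j) ≡ ι (suc j) * (N c (top (suc j)) - N c (top j))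
    block c j = begin
      E c (top (suc j)) - E c (top j)
        ≡⟨ cong (λ z → E c z - E c (top j)) (sym split) ⟩
      E c (top j ℕ.+ P) - E c (top j)
        ≡⟨ cong (_- E c (top j)) (∑-split (top j) P _) ⟩
      E c (top j) + ∑From (1 ℕ.+ top j) P (λ n → ι (lg n) * β c n) - E c (top j)
        ≡⟨ cong (λ z → E c (top j) + z - E c (top j)) (trans (∑-cong P (λ i h → cong (λ z → ι z * β c (suc (top j ℕ.+ i))) (lg-block i h))) (∑-*ˡ P (ι (suc j)) (β c))) ⟩
      E c (top j) + ι (suc j) * ∑From (1 ℕ.+ top j) P (β c) - E c (top j)
        ≡⟨ ((∀ e i s n → e + i * s - e ≡ i * (n + s - n)) ∋ solve-∀ ring) (E c (top j)) (ι (suc j)) (∑From (1 ℕ.+ top j) P (β c)) (N c (top j)) ⟩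
      ι (suc j) * (N c (top j) + ∑From (1 ℕ.+ top j) P (β c) - N c (top j))
        ≡⟨ cong (λ z → ι (suc j) * (z - N c (top j))) (trans (sym (∑-split (top j) P (β c))) (cong (N c) split)) ⟩
      ι (suc j) * (N c (top (suc j)) - N c (top j)) ∎
      where
      open ≡-Reasoning
      P : ℕ
      P = 2 ℕ.^ suc j
      split : top j ℕ.+ P ≡ top (suc j)
      split = ℕₚ.suc-injective (trans (cong (ℕ._+ P) (suc-top j)) (trans (cong (P ℕ.+_) (sym (ℕₚ.+-identityʳ P))) (sym (suc-top (suc j)))))
      lg-block : ∀ i → i ℕ.< P → lg (suc (top j ℕ.+ i)) ≡ suc j
      lg-block i h = ℕₚ.≤-antisym
        (≤top⇒lg≤ (subst (suc (top j ℕ.+ i) ℕ.≤_) split (subst (ℕ._≤ top j ℕ.+ P) (ℕₚ.+-suc (top j) i) (ℕₚ.+-monoʳ-≤ (top j) h))))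
        (≤lg (subst (ℕ._≤ suc (top j ℕ.+ i)) (suc-top j) (s≤s (ℕₚ.m≤m+n (top j) i))))

    -- Since lg is constant on a block, passing from j to j + 1 changes N - E / j only by E (1/j -
    -- 1/(j+1)), which the bound on E limits to ν + C₄ / j.
    N-Abel : ∀ c j → Coprime c q → suc j ℕ.< J → N c (top (suc j)) - inv (suc j) * E c (top (suc j)) ≤ 1ℚ + C₁ + ν * ι j + C₄ * ∑₁ j inv
    N-Abel c zero cc h = N-base-arith (N c (top 1)) (inv 1 * E c (top 1)) C₁ ν C₄ (≤-trans (N≤m c (top 1)) (m-top 1 h))
      (0≤-* (0≤inv 1) (∑₁-≥0 (top 1) (λ n p _ → 0≤-* (0≤ι (lg n)) (0≤β c n p))))
    N-Abel c (suc j) cc h = ≤-trans (N-rec (N c (top (suc j))) (N c (top (suc (suc j)))) (E c (top (suc j))) (E c (top (suc (suc j)))) (inv (suc j)) (inv (suc (suc j))) (ι (suc j))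
        (1ℚ + C₁ + ν * ι j + C₄ * ∑₁ j inv) ν C₄ (0≤inv (suc j)) (0≤inv (suc (suc j))) 0≤ν (ι-inv {suc j} (s≤s z≤n)) (ι-inv {suc (suc j)} (s≤s z≤n)) (block c (suc j))
        (E≤ c (suc j) cc h′) (N-Abel c j cc h′))
      (≤-reflexive (((∀ a v j c s i → a + v * j + c * s + v + c * i ≡ a + v * (j + 1ℚ) + c * (s + i)) ∋ solve-∀ ring) (1ℚ + C₁) ν (ι j) C₄ (∑₁ j inv) (inv (suc j))))
      where
      h′ : suc j ℕ.< J
      h′ = ℕₚ.<-trans (ℕₚ.n<1+n (suc j)) h

  -- One ν comes from the summed increments and a second one from the boundary term E / j, whence
  -- the slope 2 ν.
  N≤ : ∀ D c j → 1 ℕ.≤ D → Coprime c q → j ℕ.< J → N c (top j) ≤ (ι 2 * ν + C₄ * inv D) * ι j + (C₄ * ι D + C₅)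
  N≤ D c zero 1≤D cc h = ≤-trans (N≤m c (top 0)) (≤-trans (m-top 0 h) (N-zero-arith C₁ C₄ (ι D) (ι 2 * ν + C₄ * inv D) 0≤C₄ (0≤ι D)))
  N≤ D c (suc j) 1≤D cc h = N-combine (N c (top (suc j))) (E c (top (suc j))) (inv (suc j)) (ι j) ν C₄ (1ℚ + C₁) (∑₁ j inv) (inv D) (ι D) (0≤inv (suc j)) (inv≤1 (suc j)) 0≤C₄ (0≤inv D) 0≤ν
    (ι-inv {suc j} (s≤s z≤n)) (N-Abel c j cc h) (E≤ c (suc j) cc h) (harmonic-linear D j 1≤D)

-- Weighted class masses and their convolution

private
  minus-nonneg : ∀ s t → 0ℚ ≤ t → s - t ≤ s
  minus-nonneg s t h = lin h (solve (s ∷ t ∷ []) ring)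

module LaplaceBounds (setup : Setup) where
  open Laplace setup public

  X≤ : ∀ D c → 1 ℕ.≤ D → Coprime c q → X c ≤ (ι 2 * ν + C₄ * inv D) * ι k + (C₄ * ι D + C₅)
  X≤ D c 1≤D cc = weighted-≤ (β c) (ι 2 * ν + C₄ * inv D) (C₄ * ι D + C₅) 0≤α 0≤γ (λ j h → N≤ D c j 1≤D cc h) (by-J J refl)
    where
    0≤α : 0ℚ ≤ ι 2 * ν + C₄ * inv D
    0≤α = 0≤-+ (0≤-* (0≤ι 2) 0≤ν) (0≤-* 0≤C₄ (0≤inv D))
    0≤γ : 0ℚ ≤ C₄ * ι D + C₅
    0≤γ = 0≤-+ (0≤-* 0≤C₄ (0≤ι D)) 0≤C₅
    by-J : ∀ J′ → J′ ≡ J → ∑₁ x∞ (β c) ≤ (ι 2 * ν + C₄ * inv D) * ι J + (C₄ * ι D + C₅)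
    by-J zero e = ≤-trans (≤-reflexive (cong (λ z → ∑₁ (ℕ.pred (2 ℕ.^ z)) (β c)) (sym e))) (0≤-+ (0≤-* 0≤α (0≤ι J)) 0≤γ)
    by-J (suc j) e = ≤-trans (≤-reflexive (cong (λ z → ∑₁ (ℕ.pred (2 ℕ.^ z)) (β c)) (sym e))) (≤-trans (N≤ D c j 1≤D cc (ℕₚ.≤-reflexive e))
      (0≤α ·≤ ι-mono (ℕₚ.≤-trans (ℕₚ.n≤1+n j) (ℕₚ.≤-reflexive e)) ⊕ ≤-refl))

  -- The mass of the cofactors completing d to the class c. For a unit d it is X of the class c / d,
  -- so Θ c is the sum of X a X b over a b ≡ c.
  Φ : ℕ → ℕ → ℚ
  Φ c d = ∑₁ x∞ (λ n → 𝟙 (d ℕ.* n ≈? c) * (b n * w n))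

  Θ : ℕ → ℚ
  Θ c = ∑₁ x∞ (λ d → b d * w d * Φ c d)

  0≤bw : ∀ n → 1 ℕ.≤ n → 0ℚ ≤ b n * w n
  0≤bw n h = 0≤-* (0≤b n h) (0≤w n)

  0≤Φ : ∀ c d → 0ℚ ≤ Φ c d
  0≤Φ c d = ∑₁-≥0 x∞ (λ n h _ → 0≤-* (0≤𝟙 (d ℕ.* n ≈? c)) (0≤bw n h))

  0≤Θ : ∀ c → 0ℚ ≤ Θ c
  0≤Θ c = ∑₁-≥0 x∞ (λ d h _ → 0≤-* (0≤bw d h) (0≤Φ c d))

  0≤F : 0ℚ ≤ F
  0≤F = ∑₁-≥0 x∞ 0≤bw′
    where
    0≤bw′ : ∀ n → 1 ℕ.≤ n → n ℕ.≤ x∞ → 0ℚ ≤ b n * w n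
    0≤bw′ n h _ = 0≤bw n h

  private
    coef : ℕ → ℕ → ℕ → ℚ
    coef c d n = b d * (𝟙 (d ℕ.* n ≈? c) * b n)

    0≤coef : ∀ c d n → 1 ℕ.≤ d → 1 ℕ.≤ n → 0ℚ ≤ coef c d n
    0≤coef c d n h h′ = 0≤-* (0≤b d h) (0≤-* (0≤𝟙 (d ℕ.* n ≈? c)) (0≤b n h′))

    G-pairs : ∀ c x → x ℕ.≤ x∞ → G c x ≡ ∑₁ x∞ (λ d → ∑₁ x∞ (λ n → 𝟙 (d ℕ.* n ℕₚ.≤? x) * coef c d n))
    G-pairs c x x≤ = trans (∑₁-cong x (λ d 1≤d _ → row d 1≤d))
      (∑₁-extend x≤ (λ d x<d _ → ∑₁-≡0 x∞ (λ n 1≤n _ → trans (cong (_* coef c d n) (𝟙-no (d ℕ.* n ℕₚ.≤? x) (λ l → ℕₚ.<⇒≱ x<d (ℕₚ.≤-trans (*≡⇒≤ˡ 1≤n refl) l)))) (*-zeroˡ (coef c d n)))))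
      where
      row : ∀ d → 1 ℕ.≤ d → b d * ∑₁ (x div d) (λ n → 𝟙 (d ℕ.* n ≈? c) * b n) ≡ ∑₁ x∞ (λ n → 𝟙 (d ℕ.* n ℕₚ.≤? x) * coef c d n)
      row d 1≤d = trans (cong (b d *_) (∑₁-div x d (λ n → 𝟙 (d ℕ.* n ≈? c) * b n) 1≤d)) (trans (sym (∑-*ˡ x (b d) (λ n → 𝟙 (d ℕ.* n ℕₚ.≤? x) * (𝟙 (d ℕ.* n ≈? c) * b n))))
        (trans (∑₁-cong x (λ n _ _ → ((∀ u v w → u * (v * w) ≡ v * (u * w)) ∋ solve-∀ ring) (b d) (𝟙 (d ℕ.* n ℕₚ.≤? x)) (𝟙 (d ℕ.* n ≈? c) * b n)))
          (∑₁-extend x≤ (λ n x<n _ → trans (cong (_* coef c d n) (𝟙-no (d ℕ.* n ℕₚ.≤? x) (λ l → ℕₚ.<⇒≱ x<n (ℕₚ.≤-trans (*≡⇒≤ʳ 1≤d refl) l)))) (*-zeroˡ (coef c d n))))))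

  -- Submultiplicativity of n ↦ rˡᵍ ⁿ turns the averaged convolution into a product.
  ∑-pG≤Θ : ∀ c → ∑ J (λ j → p j * G c (top j)) ≤ Θ c
  ∑-pG≤Θ c = ≤-trans (≤-reflexive expand) (∑₁-mono x∞ (λ d 1≤d _ → ≤-trans (∑₁-mono x∞ {g = λ n → b d * w d * (𝟙 (d ℕ.* n ≈? c) * (b n * w n))} (λ n 1≤n _ → term d n 1≤d 1≤n))
    (≤-reflexive (∑-*ˡ x∞ (b d * w d) (λ n → 𝟙 (d ℕ.* n ≈? c) * (b n * w n))))))
    where
    open ≡-Reasoning
    expand : ∑ J (λ j → p j * G c (top j)) ≡ ∑₁ x∞ (λ d → ∑₁ x∞ (λ n → ∑ J (λ j → p j * 𝟙 (d ℕ.* n ℕₚ.≤? top j)) * coef c d n))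
    expand = begin
      ∑ J (λ j → p j * G c (top j))
        ≡⟨ ∑-cong J (λ j h → trans (cong (p j *_) (G-pairs c (top j) (top≤x∞ h))) (trans (sym (∑-*ˡ x∞ (p j) _)) (∑₁-cong x∞ (λ d _ _ → trans (sym (∑-*ˡ x∞ (p j) (λ n → 𝟙 (d ℕ.* n ℕₚ.≤? top j) * coef c d n)))
             (∑₁-cong x∞ (λ n _ _ → sym (*-assoc (p j) (𝟙 (d ℕ.* n ℕₚ.≤? top j)) (coef c d n)))))))) ⟩
      ∑ J (λ j → ∑₁ x∞ (λ d → ∑₁ x∞ (λ n → p j * 𝟙 (d ℕ.* n ℕₚ.≤? top j) * coef c d n)))
        ≡⟨ ∑-swap J x∞ (λ j d → ∑₁ x∞ (λ n → p j * 𝟙 (d ℕ.* n ℕₚ.≤? top j) * coef c d n)) ⟩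
      ∑₁ x∞ (λ d → ∑ J (λ j → ∑₁ x∞ (λ n → p j * 𝟙 (d ℕ.* n ℕₚ.≤? top j) * coef c d n)))
        ≡⟨ ∑₁-cong x∞ (λ d _ _ → trans (∑-swap J x∞ (λ j n → p j * 𝟙 (d ℕ.* n ℕₚ.≤? top j) * coef c d n)) (∑₁-cong x∞ (λ n _ _ → ∑-*ʳ J (coef c d n) (λ j → p j * 𝟙 (d ℕ.* n ℕₚ.≤? top j))))) ⟩
      ∑₁ x∞ (λ d → ∑₁ x∞ (λ n → ∑ J (λ j → p j * 𝟙 (d ℕ.* n ℕₚ.≤? top j)) * coef c d n)) ∎
    mass : ∀ d n → 1 ℕ.≤ d → 1 ℕ.≤ n → ∑ J (λ j → p j * 𝟙 (d ℕ.* n ℕₚ.≤? top j)) ≤ w d * w n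
    mass d n 1≤d 1≤n = ≤-trans (∑-mono J (λ j _ → 0≤p j ·≤ 𝟙-mono (d ℕ.* n ℕₚ.≤? top j) (lg d ℕ.+ lg n ℕₚ.≤? j) (λ l → ℕₚ.≤-trans (lg-*-lower d n 1≤d 1≤n) (≤top⇒lg≤ l))))
      (≤-trans (∑-p-from-≤ (lg d ℕ.+ lg n) J) (≤-reflexive (pw-+ (lg d) (lg n))))
    term : ∀ d n → 1 ℕ.≤ d → 1 ℕ.≤ n → ∑ J (λ j → p j * 𝟙 (d ℕ.* n ℕₚ.≤? top j)) * coef c d n ≤ b d * w d * (𝟙 (d ℕ.* n ≈? c) * (b n * w n))
    term d n 1≤d 1≤n = ≤-trans (*-monoʳ-≤-nonNeg (coef c d n) {{nonNegative (0≤coef c d n 1≤d 1≤n)}} (mass d n 1≤d 1≤n))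
      (≤-reflexive (((∀ u v x i y → u * v * (x * (i * y)) ≡ x * u * (i * (y * v))) ∋ solve-∀ ring) (w d) (w n) (b d) (𝟙 (d ℕ.* n ≈? c)) (b n)))

  -- Every n in range satisfies L n ≤ J + 4. The bound is too large by a factor of order J / k, but
  -- it multiplies X c and is meant for classes where X c is small.
  ∑-pQ≤ : ∀ c → ∑ J (λ j → p j * Qs c (top j)) ≤ (ι J + ι 4) * X c
  ∑-pQ≤ c = ≤-trans (≤-reflexive (average (λ n → β c n * L n))) (≤-trans
    (minus-nonneg (∑₁ x∞ (λ n → β c n * L n * w n)) (pw J * ∑₁ x∞ (λ n → β c n * L n)) (0≤-* (0≤pw J) (∑₁-≥0 x∞ (λ n h _ → 0≤-* (0≤β c n h) (0≤L n)))))
    (≤-trans (∑₁-mono x∞ {g = λ n → (ι J + ι 4) * (β c n * w n)} term) (≤-reflexive (∑-*ˡ x∞ (ι J + ι 4) (λ n → β c n * w n)))))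
    where
    term : ∀ n → 1 ℕ.≤ n → n ℕ.≤ x∞ → β c n * L n * w n ≤ (ι J + ι 4) * (β c n * w n)
    term n 1≤n n≤ = lin (0≤-* (0≤β c n 1≤n) (0≤w n) ·≤ (≤abs (L n - ι (lg n)) ⊕ L≈lg n 1≤n (ℕₚ.≤-trans n≤ (ℕₚ.<⇒≤ (ℕₚ.<-trans (ℕₚ.n<1+n x∞) x∞<B))) ⊕ ι-mono (ℕₚ.<⇒≤ (lg≤J 1≤n n≤))))
      (((∀ b l w g j a → (j + ι 4) * (b * w) + b * w * (l - g + a + g) ≡ b * l * w + b * w * (a + ι 4 + j)) ∋ solve-∀ ring) (β c n) (L n) (w n) (ι (lg n)) (ι J) ∣ L n - ι (lg n) ∣)

  -- Selberg's formula from below, averaged over the cutoffs: the main term becomes the second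
  -- moment, Λ L is charged to X c, and what remains is majorised by Θ c.
  Θ≥ : ∀ c → Coprime c q → ν * (quad 0ℚ - pw J * quad (ι J)) - C₃ * (ι k + 1ℚ) - (ι J + ι 4) * X c ≤ Θ c
  Θ≥ c cc = ≤-trans (lin (∑-mono J step ⊕ 0≤C₃ ·≤ mean≤ J ⊕ 0≤C₃ ·≤ total ⊕ ∑-pQ≤ c) rearrange) (∑-pG≤Θ c)
    where
    open ≡-Reasoning
    total : ∑ J p ≤ 1ℚ
    total = ≤-trans (≤-reflexive (∑-p J)) (lin (0≤pw J) (((∀ w → 1ℚ + 0ℚ ≡ 1ℚ - w + w) ∋ solve-∀ ring) (pw J)))
    S₀ S₁ SG SQ : ℚ
    S₀ = ∑ J p
    S₁ = ∑ J (λ j → p j * ι j)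
    SG = ∑ J (λ j → p j * G c (top j))
    SQ = ∑ J (λ j → p j * Qs c (top j))
    step : ∀ j → j ℕ.< J → ν * (p j * (ι j * ι j)) ≤ p j * G c (top j) + p j * Qs c (top j) + C₃ * (p j * ι j) + C₃ * p j
    step j h = lin (0≤p j ·≤ ≤-trans (-≤abs (Qs c (top j) + G c (top j) - ν * (ι j * ι j))) (selberg-top c j cc h))
      (((∀ p v j g s c → p * g + p * s + c * (p * j) + c * p + p * - (s + g - v * (j * j)) ≡ v * (p * (j * j)) + p * (c * (j + 1ℚ))) ∋ solve-∀ ring) (p j) ν (ι j) (G c (top j)) (Qs c (top j)) C₃)
    lhs : ∑ J (λ j → ν * (p j * (ι j * ι j))) ≡ ν * (quad 0ℚ - pw J * quad (ι J))
    lhs = trans (∑-*ˡ J ν (λ j → p j * (ι j * ι j))) (cong (ν *_) (second-moment J))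
    rhs : ∑ J (λ j → p j * G c (top j) + p j * Qs c (top j) + C₃ * (p j * ι j) + C₃ * p j) ≡ SG + SQ + C₃ * S₁ + C₃ * S₀
    rhs = trans (∑-+ J (λ j → p j * G c (top j) + p j * Qs c (top j) + C₃ * (p j * ι j)) (λ j → C₃ * p j)) (cong₂ _+_
      (trans (∑-+ J (λ j → p j * G c (top j) + p j * Qs c (top j)) (λ j → C₃ * (p j * ι j))) (cong₂ _+_ (∑-+ J (λ j → p j * G c (top j)) (λ j → p j * Qs c (top j))) (∑-*ˡ J C₃ (λ j → p j * ι j))))
      (∑-*ˡ J C₃ p))
    rearrange : SG + (∑ J (λ j → ν * (p j * (ι j * ι j))) + C₃ * S₁ + C₃ * S₀ + SQ)
      ≡ ν * (quad 0ℚ - pw J * quad (ι J)) - C₃ * (ι k + 1ℚ) - (ι J + ι 4) * X c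
        + (∑ J (λ j → p j * G c (top j) + p j * Qs c (top j) + C₃ * (p j * ι j) + C₃ * p j) + C₃ * ι k + C₃ * 1ℚ + (ι J + ι 4) * X c)
    rearrange = trans (cong (λ z → SG + (z + C₃ * S₁ + C₃ * S₀ + SQ)) lhs)
      (trans (((∀ g v c s₁ s₀ s k x → g + (v + c * s₁ + c * s₀ + s) ≡ v - c * (k + 1ℚ) - x + (g + s + c * s₁ + c * s₀ + c * k + c * 1ℚ + x)) ∋ solve-∀ ring)
          SG (ν * (quad 0ℚ - pw J * quad (ι J))) C₃ S₁ S₀ SQ (ι k) ((ι J + ι 4) * X c))
        (cong (λ z → ν * (quad 0ℚ - pw J * quad (ι J)) - C₃ * (ι k + 1ℚ) - (ι J + ι 4) * X c + (z + C₃ * ι k + C₃ * 1ℚ + (ι J + ι 4) * X c)) (sym rhs)))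

  ∑-𝟙≈ : ∀ n → ∑ q (λ c → 𝟙 (n ≈? c)) ≡ 1ℚ
  ∑-𝟙≈ n = trans (∑-cong q (λ c _ → sym (*-identityʳ (𝟙 (n ≈? c))))) (∑-class n one)

  ∑-X : ∑ q X ≡ F
  ∑-X = trans (∑-swap q x∞ (λ c n → β c n * w n)) (∑₁-cong x∞ (λ n _ _ → trans (∑-cong q (λ c _ → *-assoc (𝟙 (n ≈? c)) (b n) (w n)))
    (trans (∑-*ʳ q (b n * w n) (λ c → 𝟙 (n ≈? c))) (trans (cong (_* (b n * w n)) (∑-𝟙≈ n)) (*-identityˡ (b n * w n))))))

  ∑-Θ : ∑ q Θ ≡ F * F
  ∑-Θ = trans (∑-swap q x∞ (λ c d → b d * w d * Φ c d)) (trans (∑₁-cong x∞ (λ d _ _ → trans (∑-*ˡ q (b d * w d) (λ c → Φ c d)) (cong (b d * w d *_) (row d)))) (∑-*ʳ x∞ F (λ d → b d * w d)))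
    where
    row : ∀ d → ∑ q (λ c → Φ c d) ≡ F
    row d = trans (∑-swap q x∞ (λ c n → 𝟙 (d ℕ.* n ≈? c) * (b n * w n))) (∑₁-cong x∞ (λ n _ _ →
      trans (∑-*ʳ q (b n * w n) (λ c → 𝟙 (d ℕ.* n ≈? c))) (trans (cong (_* (b n * w n)) (∑-𝟙≈ (d ℕ.* n))) (*-identityˡ (b n * w n)))))

  X-≈ : ∀ {c c′} → c ≈ c′ → X c ≡ X c′
  X-≈ {c} {c′} e = ∑₁-cong x∞ (λ n _ _ → cong (λ z → z * b n * w n) (𝟙-cong (n ≈? c) (n ≈? c′) (λ h → trans h e) (λ h → trans h (sym e))))

  Φ≡X : ∀ {e d} c → e ℕ.* d ≈ 1 → Φ c d ≡ X (e ℕ.* c)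
  Φ≡X {e} {d} c h = ∑₁-cong x∞ (λ n _ _ → trans (cong (_* (b n * w n)) (𝟙-cong (d ℕ.* n ≈? c) (n ≈? e ℕ.* c) (unit-solve {e} {d} {n} {c} h)
      (λ n≈ → trans (≈-* {d} {d} {n} {e ℕ.* c} refl n≈) (unit-solution {e} {d} c h)))) (sym (*-assoc (𝟙 (n ≈? e ℕ.* c)) (b n) (w n))))

  Φ-class : ∀ {a a′ c} d → Coprime a q → a ℕ.* a′ ≈ c → d ≈ a → Φ c d ≡ X a′
  Φ-class {a} {a′} {c} d ca h d≈a with unit-inverse ca
  ... | e , ea≈1 = trans (Φ≡X {e} {d} c (trans (≈-* {e} {e} {d} {a} refl d≈a) ea≈1)) (X-≈ (sym (unit-solve {e} {a} {a′} {c} ea≈1 h)))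

  private
    X-restrict : ∀ a (g : ℕ → ℚ) y → (∀ d → d ≈ a → g d ≡ y) → ∑₁ x∞ (λ d → β a d * w d * g d) ≡ X a * y
    X-restrict a g y h = trans (∑₁-cong x∞ (λ d _ _ → trans (cong (_* g d) (*-assoc (𝟙 (d ≈? a)) (b d) (w d))) (trans (*-assoc (𝟙 (d ≈? a)) (b d * w d) (g d))
        (trans (𝟙-when (d ≈? a) (λ e → cong (b d * w d *_) (h d e))) (((∀ i u v y → i * (u * v * y) ≡ i * u * v * y) ∋ solve-∀ ring) (𝟙 (d ≈? a)) (b d) (w d) y)))))
      (∑-*ʳ x∞ y (λ d → β a d * w d))

    restrict-≤ : ∀ a (g : ℕ → ℚ) → (∀ d → 0ℚ ≤ b d * w d * g d) → ∑₁ x∞ (λ d → β a d * w d * g d) ≤ ∑₁ x∞ (λ d → b d * w d * g d)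
    restrict-≤ a g h = ∑₁-mono x∞ (λ d _ _ → lin (h d ·≤ 𝟙≤1 (d ≈? a))
      (((∀ i u v y → u * v * y + u * v * y * i ≡ i * u * v * y + u * v * y * 1ℚ) ∋ solve-∀ ring) (𝟙 (d ≈? a)) (b d) (w d) (g d)))

    b-noncoprime : ∀ d → ¬ Coprime d q → b d ≡ 0ℚ
    b-noncoprime d h = trans (cong (_* (Λ d * inv d)) (𝟙-no (coprime? d q) h)) (*-zeroˡ (Λ d * inv d))

    0≤b′ : ∀ d → 0ℚ ≤ b d
    0≤b′ zero = ≤-reflexive (sym (trans (cong (χ₀ 0 *_) (*-zeroʳ (Λ 0))) (*-zeroʳ (χ₀ 0))))
    0≤b′ (suc d) = 0≤b (suc d) (s≤s z≤n)

  XX≤Θ : ∀ {a a′ c} → Coprime a q → a ℕ.* a′ ≈ c → X a * X a′ ≤ Θ c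
  XX≤Θ {a} {a′} {c} ca h = ≤-trans (≤-reflexive (sym (X-restrict a (Φ c) (X a′) (λ d e → Φ-class {a} {a′} {c} d ca h e))))
    (restrict-≤ a (Φ c) (λ d → 0≤-* (0≤-* (0≤b′ d) (0≤w d)) (0≤Φ c d)))

  -- U F - Θ c is the weighted sum of U - Φ c d over d. All its terms are non-negative because Φ c d
  -- is the mass of a unit class; keeping only d ≡ a leaves the left side.
  deficiency : ∀ {a a′ c} U → (∀ e → Coprime e q → X e ≤ U) → Coprime a q → Coprime c q → a ℕ.* a′ ≈ c → X a * (U - X a′) ≤ U * F - Θ c
  deficiency {a} {a′} {c} U X≤U ca cc h = ≤-trans
    (≤-reflexive (sym (X-restrict a (λ d → U - Φ c d) (U - X a′) (λ d e → cong (λ z → U - z) (Φ-class {a} {a′} {c} d ca h e)))))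
    (≤-trans (restrict-≤ a (λ d → U - Φ c d) (λ d → by d (coprime? d q))) (≤-reflexive (trans (∑₁-cong x∞ (λ d _ _ → ((∀ x u y → x * (u - y) ≡ u * x - x * y) ∋ solve-∀ ring) (b d * w d) U (Φ c d)))
      (trans (∑-sub x∞ (λ d → U * (b d * w d)) (λ d → b d * w d * Φ c d)) (cong (_- Θ c) (∑-*ˡ x∞ U (λ d → b d * w d)))))))
    where
    by : ∀ d → Dec (Coprime d q) → 0ℚ ≤ b d * w d * (U - Φ c d)
    by d (no ¬cd) = ≤-reflexive (sym (trans (cong (λ z → z * w d * (U - Φ c d)) (b-noncoprime d ¬cd)) (((∀ u v → 0ℚ * u * v ≡ 0ℚ) ∋ solve-∀ ring) (w d) (U - Φ c d))))
    by d (yes cd) with unit-inverse cd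
    ... | e , h′ = 0≤-* (0≤-* (0≤b′ d) (0≤w d)) (0≤-diff (≤-trans (≤-reflexive (Φ≡X {e} {d} c h′)) (X≤U (e ℕ.* c) (coprime-* (inverse-coprime {e} {d} h′) cc))))

toℚᵘ-ι : ∀ n → toℚᵘ (ι n) ℚᵘ.≃ ℚᵘ.mkℚᵘ (ℤ.+ n) 0
toℚᵘ-ι zero = ℚᵘₚ.≃-refl
toℚᵘ-ι (suc n) = ℚᵘₚ.≃-trans (toℚᵘ-homo-+ (ι n) 1ℚ) (ℚᵘₚ.≃-trans (ℚᵘₚ.+-congˡ ℚᵘ.1ℚᵘ (toℚᵘ-ι n))
  (ℚᵘ.*≡* (cong (ℤ._* ℤ.+ 1) (trans (cong (ℤ._+ ℤ.+ 1) (ℤₚ.*-identityʳ (ℤ.+ n))) (cong ℤ.+_ (ℕₚ.+-comm n 1))))))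

archimedean : ∀ c → ∃ λ n → c ≤ ι n
archimedean c = ℤ.∣ ↥ c ∣ , toℚᵘ-cancel-≤ (ℚᵘₚ.≤-trans (bound c) (ℚᵘₚ.≤-reflexive (ℚᵘₚ.≃-sym (toℚᵘ-ι ℤ.∣ ↥ c ∣))))
  where
  bound : ∀ c → toℚᵘ c ℚᵘ.≤ ℚᵘ.mkℚᵘ (ℤ.+ ℤ.∣ ↥ c ∣) 0
  bound (mkℚ (ℤ.+ a) d _) = ℚᵘ.*≤* (subst₂ ℤ._≤_ (ℤₚ.pos-* a 1) (ℤₚ.pos-* a (suc d)) (ℤ.+≤+ (ℕₚ.*-monoʳ-≤ a (s≤s z≤n))))
  bound (mkℚ ℤ.-[1+ a ] d _) = ℚᵘ.*≤* ℤ.-≤+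

-- The contribution of proper prime powers

module PrimePowers {B : ℕ} (log : Log B) where
  open Chebyshev log

  -- The geometric series over powers of p in recursive form: 1 plus 1/p times the same sum up to y
  -- / p, so at most 1 + 2/2.
  powerOf-sum : ∀ {p} → Prime p → ∀ y → ∑₁ y (λ m → powerOf p m * inv m) ≤ ι 2
  powerOf-sum {p} pr = <-rec _ go
    where
    R : ℕ → ℚ
    R y = ∑₁ y (λ m → powerOf p m * inv m)
    split : ∀ m → 1 ℕ.≤ m → Dec (p ∣ m) → powerOf p m * inv m ≤ 𝟙 (p ∣? m) * (powerOf p m * inv m) + 𝟙 (1 ℕₚ.≟ m) * 1ℚ
    split m 1≤m (yes h) = lin (0≤-* (0≤𝟙 (1 ℕₚ.≟ m)) 0≤1) (trans (cong (λ z → z * (powerOf p m * inv m) + 𝟙 (1 ℕₚ.≟ m) * 1ℚ + 0ℚ) (𝟙-yes (p ∣? m) h))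
      (((∀ e x → 1ℚ * e + x + 0ℚ ≡ e + x) ∋ solve-∀ ring) (powerOf p m * inv m) (𝟙 (1 ℕₚ.≟ m) * 1ℚ)))
    split m 1≤m (no h) = ≤-trans (≤-reflexive (cong (_* inv m) (trans (powerOf-∤ 1≤m h) (𝟙-cong (m ℕₚ.≟ 1) (1 ℕₚ.≟ m) sym sym))))
      (≤-trans (0≤𝟙 (1 ℕₚ.≟ m) ·≤ inv≤1 m) (≤-reflexive (trans (sym (+-identityˡ (𝟙 (1 ℕₚ.≟ m) * 1ℚ))) (cong (_+ 𝟙 (1 ℕₚ.≟ m) * 1ℚ) (sym (trans (cong (_* (powerOf p m * inv m)) (𝟙-no (p ∣? m) h)) (*-zeroˡ (powerOf p m * inv m))))))))
    go : ∀ y → (∀ {y′} → y′ ℕ.< y → R y′ ≤ ι 2) → R y ≤ ι 2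
    go zero _ = 0≤ι 2
    go y@(suc _) rec = ≤-trans (∑₁-mono y (λ m 1≤m _ → split m 1≤m (p ∣? m))) (≤-trans
      (≤-reflexive (trans (∑-+ y (λ m → 𝟙 (p ∣? m) * (powerOf p m * inv m)) (λ m → 𝟙 (1 ℕₚ.≟ m) * 1ℚ)) (cong₂ _+_
        (trans (∑₁-multiples y p (λ m → powerOf p m * inv m) (prime≥1 pr)) (trans (∑₁-cong (y div p) (λ m 1≤m _ → trans (cong₂ _*_ (powerOf-* pr 1≤m) (inv-* p m))
          (((∀ e i j → e * (i * j) ≡ i * (e * j)) ∋ solve-∀ ring) (powerOf p m) (inv p) (inv m)))) (∑-*ˡ (y div p) (inv p) (λ m → powerOf p m * inv m))))
        (∑₁-point y 1 one (s≤s z≤n)))))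
      (lin (0≤inv p ·≤ rec (smaller p (prime≥2 pr)) ⊕ 0≤ι 2 ·≤ inv-anti {2} {p} (s≤s z≤n) (prime≥2 pr) ⊕ 1ℚ ·≡ ι-inv {2} (s≤s z≤n) ⊕ 𝟙≤1 (1 ℕₚ.≤? y))
        (((∀ i R h t → ι 2 + (i * R + ι 2 * i + 1ℚ * (ι 2 * h) + t) ≡ i * R + t * 1ℚ + (i * ι 2 + ι 2 * h + 1ℚ * 1ℚ + 1ℚ)) ∋ solve-∀ ring) (inv p) (R (y div p)) (inv 2) (𝟙 (1 ℕₚ.≤? y)))))
      where
      smaller : ∀ p → 2 ℕ.≤ p → y div p ℕ.< y
      smaller (suc p) h = ℕ÷.m/n<m y (suc p) h

  -- Each term is at most twice the decrement of `V₁`, so the sum is at most 2 · V₁ 1 = 16.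
  ∑-L/n² : ∀ x → x ℕ.< B → ∑₁ x (λ n → L n * (inv n * inv n)) ≤ ι 16
  ∑-L/n² x x<B = ≤-trans (∑₁-mono x {g = λ n → ι 2 * (V₁ n - V₁ (suc n))} (λ n p h → term (L n) (L (suc n)) (inv n) (inv (suc n)) (0≤L n) (0≤inv n) (0≤inv (suc n)) (inv-step n p) (double n p) (L-step-up n p (ℕₚ.≤-<-trans h x<B))))
    (≤-trans (≤-reflexive (trans (∑-*ˡ x (ι 2) (λ n → V₁ n - V₁ (suc n))) (cong (ι 2 *_) (trans (∑-cong x (λ i _ → ((∀ a b → a - b ≡ - b - (- a)) ∋ solve-∀ ring) (V₁ (suc i)) (V₁ (suc (suc i))))) (∑-tele x (λ n → - V₁ n))))))
      (lin (0≤ι 2 ·≤ 0≤-* (0≤-+ (0≤L (suc x)) (0≤ι 8)) (0≤inv (suc x)) ⊕ ι 2 ·≡ V₁-1) (((∀ a b → ι 16 + (ι 2 * 0ℚ + ι 2 * b) ≡ ι 2 * (- a - (- b)) + (ι 2 * a + ι 2 * ι 8)) ∋ solve-∀ ring) (V₁ (suc x)) (V₁ 1))))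
    where
    double : ∀ n → 1 ℕ.≤ n → inv n ≤ ι 2 * inv (suc n)
    double n p = lin (0≤-* (0≤inv (suc n)) (0≤-diff (inv≤1 n)) ⊕ 1ℚ ·≡ inv-step n p)
      (((∀ i j → ι 2 * j + (0ℚ + 1ℚ * (i - j)) ≡ i + (j * (1ℚ - i) + 1ℚ * (i * j))) ∋ solve-∀ ring) (inv n) (inv (suc n)))
    term : ∀ l l′ i j → 0ℚ ≤ l → 0ℚ ≤ i → 0ℚ ≤ j → i - j ≡ i * j → i ≤ ι 2 * j → l′ - l ≤ ι 4 * i → l * (i * i) ≤ ι 2 * ((l + ι 8) * i - (l′ + ι 8) * j)
    term l l′ i j 0≤l 0≤i 0≤j e h h′ = lin (0≤-* 0≤l 0≤i ·≤ h ⊕ 0≤-* (0≤ι 2) 0≤j ·≤ h′ ⊕ (ι 2 * l + ι 16) ·≡ sym e ⊕ 0≤-* (0≤ι 8) (0≤-* 0≤i 0≤j)) (solve (l ∷ l′ ∷ i ∷ j ∷ []) ring)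

  nonprime : ℕ → ℚ
  nonprime n = (1ℚ - 𝟙 (prime? n)) * (Λ n * inv n)

  private
    square-prime : ℕ → ℕ → ℚ
    square-prime n p = 𝟙 (prime? p) * 𝟙 (p ℕ.* p ∣? n)

    0≤square-prime : ∀ n p → 0ℚ ≤ square-prime n p
    0≤square-prime n p = 0≤-* (0≤𝟙 (prime? p)) (0≤𝟙 (p ℕ.* p ∣? n))

    0≤∑square-prime : ∀ n x → 0ℚ ≤ ∑₁ x (square-prime n)
    0≤∑square-prime n x = ∑₁-≥0 x (λ p _ _ → 0≤square-prime n p)

    0≤Λinv : ∀ n → 1 ℕ.≤ n → 0ℚ ≤ Λ n * inv n
    0≤Λinv n h = 0≤-* (0≤Λ n h) (0≤inv n)

    -- A proper prime power is divisible by the square of its prime.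
    nonprime-≤ : ∀ x n → 1 ℕ.≤ n → n ℕ.≤ x → nonprime n ≤ ∑₁ x (square-prime n) * (Λ n * inv n)
    nonprime-≤ x n 1≤n n≤x = by (prime? n) (n ℕₚ.≟ 1)
      where
      zero-case : nonprime n ≡ 0ℚ → nonprime n ≤ ∑₁ x (square-prime n) * (Λ n * inv n)
      zero-case e = ≤-trans (≤-reflexive e) (0≤-* (0≤∑square-prime n x) (0≤Λinv n 1≤n))
      vanish : Λ n ≡ 0ℚ → nonprime n ≡ 0ℚ
      vanish e = trans (cong (λ z → (1ℚ - 𝟙 (prime? n)) * (z * inv n)) e) (((∀ u v → u * (0ℚ * v) ≡ 0ℚ) ∋ solve-∀ ring) (1ℚ - 𝟙 (prime? n)) (inv n))
      by : Dec (Prime n) → Dec (n ≡ 1) → nonprime n ≤ ∑₁ x (square-prime n) * (Λ n * inv n)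
      by (yes pr) _ = zero-case (trans (cong (λ z → (1ℚ - z) * (Λ n * inv n)) (𝟙-yes (prime? n) pr)) (((∀ u → (1ℚ - 1ℚ) * u ≡ 0ℚ) ∋ solve-∀ ring) (Λ n * inv n)))
      by (no _) (yes refl) = zero-case (vanish Λ-1)
      by (no ¬pr) (no n≢1) = composite (prime-divisor n (ℕₚ.≤∧≢⇒< 1≤n (λ e → n≢1 (sym e))))
        where
        composite : (∃ λ p → Prime p × p ∣ n) → nonprime n ≤ ∑₁ x (square-prime n) * (Λ n * inv n)
        composite (p , pr , divides m n≡) = by-m (p ∣? m)
          where
          n≡pm : n ≡ p ℕ.* m
          n≡pm = trans n≡ (ℕₚ.*-comm m p)
          1≤m : 1 ℕ.≤ m
          1≤m = 1≤*ʳ p m (subst (1 ℕ.≤_) n≡pm 1≤n)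
          m≢1 : ¬ m ≡ 1
          m≢1 refl = ¬pr (subst Prime (sym (trans n≡pm (ℕₚ.*-identityʳ p))) pr)
          by-m : Dec (p ∣ m) → nonprime n ≤ ∑₁ x (square-prime n) * (Λ n * inv n)
          by-m (no ¬p∣m) = zero-case (vanish (trans (cong Λ n≡pm) (trans (Λ-prime-* pr 1≤m) (trans (cong (L p *_) (trans (powerOf-∤ 1≤m ¬p∣m) (𝟙-no (m ℕₚ.≟ 1) m≢1))) (*-zeroʳ (L p))))))
          by-m (yes p∣m) = *-mono (0≤-diff (𝟙≤1 (prime? n))) (≤-trans (lin (0≤𝟙 (prime? n)) (((∀ u → 1ℚ + 0ℚ ≡ 1ℚ - u + u) ∋ solve-∀ ring) (𝟙 (prime? n)))) 1≤sum) (0≤Λinv n 1≤n) ≤-refl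
            where
            p²∣n : p ℕ.* p ∣ n
            p²∣n = subst (p ℕ.* p ∣_) (sym n≡pm) (∣.*-monoʳ-∣ p p∣m)
            1≤sum : 1ℚ ≤ ∑₁ x (square-prime n)
            1≤sum = ≤-trans (≤-reflexive (sym (trans (cong₂ _*_ (𝟙-yes (p ℕₚ.≤? x) (ℕₚ.≤-trans (*≡⇒≤ˡ 1≤m (sym n≡pm)) n≤x)) (cong₂ _*_ (𝟙-yes (prime? p) pr) (𝟙-yes (p ℕ.* p ∣? n) p²∣n))) (trans (*-identityˡ (1ℚ * 1ℚ)) (*-identityˡ 1ℚ)))))
              (≤-trans (≤-reflexive (sym (∑₁-point x p (square-prime n) (prime≥1 pr))))
                (∑₁-mono x (λ i _ _ → lin (0≤square-prime n i ·≤ 𝟙≤1 (p ℕₚ.≟ i)) (((∀ s t → s + s * t ≡ t * s + s * 1ℚ) ∋ solve-∀ ring) (square-prime n i) (𝟙 (p ℕₚ.≟ i))))))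

  -- Multiples of p² carry L p / p² times a sum over powers of p, which is at most 2; the sum of L n
  -- / n² is at most 16.
  nonprime-sum : ∀ x → x ℕ.< B → ∑₁ x nonprime ≤ ι 32
  nonprime-sum x x<B = ≤-trans (∑₁-mono x (nonprime-≤ x)) (≤-trans (≤-reflexive swap) (≤-trans (∑₁-mono x {g = λ p → ι 2 * (L p * (inv p * inv p))} (λ p 1≤p _ → column p 1≤p (prime? p) refl))
    (≤-trans (≤-reflexive (∑-*ˡ x (ι 2) (λ p → L p * (inv p * inv p)))) (≤-trans (0≤ι 2 ·≤ ∑-L/n² x x<B) (≤-reflexive (sym (ι-* 2 16)))))))
    where
    swap : ∑₁ x (λ n → ∑₁ x (square-prime n) * (Λ n * inv n)) ≡ ∑₁ x (λ p → 𝟙 (prime? p) * ∑₁ x (λ n → 𝟙 (p ℕ.* p ∣? n) * (Λ n * inv n)))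
    swap = trans (∑₁-cong x (λ n _ _ → trans (sym (∑-*ʳ x (Λ n * inv n) (square-prime n))) (∑₁-cong x (λ p _ _ → *-assoc (𝟙 (prime? p)) (𝟙 (p ℕ.* p ∣? n)) (Λ n * inv n)))))
      (trans (∑-swap x x (λ n p → 𝟙 (prime? p) * (𝟙 (p ℕ.* p ∣? n) * (Λ n * inv n)))) (∑₁-cong x (λ p _ _ → ∑-*ˡ x (𝟙 (prime? p)) (λ n → 𝟙 (p ℕ.* p ∣? n) * (Λ n * inv n)))))
    0≤bound : ∀ p → 0ℚ ≤ L p * (inv p * inv p)
    0≤bound p = 0≤-* (0≤L p) (0≤-* (0≤inv p) (0≤inv p))
    column : ∀ p → 1 ℕ.≤ p → (d : Dec (Prime p)) → prime? p ≡ d → 𝟙 (prime? p) * ∑₁ x (λ n → 𝟙 (p ℕ.* p ∣? n) * (Λ n * inv n)) ≤ ι 2 * (L p * (inv p * inv p))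
    column p 1≤p (no ¬pr) _ = ≤-trans (≤-reflexive (trans (cong (_* ∑₁ x (λ n → 𝟙 (p ℕ.* p ∣? n) * (Λ n * inv n))) (𝟙-no (prime? p) ¬pr)) (*-zeroˡ (∑₁ x (λ n → 𝟙 (p ℕ.* p ∣? n) * (Λ n * inv n)))))) (0≤-* (0≤ι 2) (0≤bound p))
    column p 1≤p (yes pr) _ = ≤-trans (≤-reflexive (trans (cong₂ _*_ (𝟙-yes (prime? p) pr) (trans (∑₁-multiples x (p ℕ.* p) (λ n → Λ n * inv n) (1≤* 1≤p 1≤p))
        (trans (∑₁-cong (x div (p ℕ.* p)) (λ m 1≤m _ → term m 1≤m)) (∑-*ˡ (x div (p ℕ.* p)) (L p * (inv p * inv p)) (λ m → powerOf p m * inv m))))) (*-identityˡ _)))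
      (≤-trans (0≤bound p ·≤ powerOf-sum pr (x div (p ℕ.* p))) (≤-reflexive (*-comm (L p * (inv p * inv p)) (ι 2))))
      where
      term : ∀ m → 1 ℕ.≤ m → Λ (p ℕ.* p ℕ.* m) * inv (p ℕ.* p ℕ.* m) ≡ L p * (inv p * inv p) * (powerOf p m * inv m)
      term m 1≤m = trans (cong₂ _*_ (trans (cong Λ (ℕₚ.*-assoc p p m)) (trans (Λ-prime-* pr (1≤* 1≤p 1≤m)) (cong (L p *_) (powerOf-* pr 1≤m)))) (trans (inv-* (p ℕ.* p) m) (cong (_* inv m) (inv-* p p))))
        (((∀ l e i j → l * e * (i * i * j) ≡ l * (i * i) * (e * j)) ∋ solve-∀ ring) (L p) (powerOf p m) (inv p) (inv m))

  Λ/n≤4 : ∀ n → 1 ℕ.≤ n → n ℕ.≤ B → Λ n * inv n ≤ ι 4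
  Λ/n≤4 (suc n) 1≤n h = ≤-trans (*-monoʳ-≤-nonNeg (inv (suc n)) {{nonNegative (0≤inv (suc n))}} (≤-trans (Λ≤L (suc n) 1≤n) (≤-trans (L-linear n h) (0≤ι 4 ·≤ ι-mono (ℕₚ.n≤1+n n)))))
    (≤-reflexive (trans (*-assoc (ι 4) (ι (suc n)) (inv (suc n))) (trans (cong (ι 4 *_) (ι-inv 1≤n)) (*-identityʳ (ι 4)))))

  -- Each n ≤ N contributes at most 4, and beyond N only non-primes contribute. Applied to a class
  -- without large primes, this bounds its mass independently of x.
  ∑-no-primes : ∀ (s : ℕ → ℚ) N x → x ℕ.< B → (∀ n → 0ℚ ≤ s n) → (∀ n → s n ≤ 1ℚ) → (∀ n → N ℕ.< n → n ℕ.≤ x → Prime n → s n ≡ 0ℚ) →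
    ∑₁ x (λ n → s n * (Λ n * inv n)) ≤ ι 32 + ι 4 * ι N
  ∑-no-primes s N x x<B 0≤s s≤1 h = ≤-trans (∑₁-mono x {g = λ n → nonprime n + ι 4 * 𝟙 (n ℕₚ.≤? N)} (λ n p r → term n p r (prime? n) (n ℕₚ.≤? N)))
    (≤-trans (≤-reflexive (trans (∑-+ x nonprime (λ n → ι 4 * 𝟙 (n ℕₚ.≤? N))) (cong (∑₁ x nonprime +_) (∑-*ˡ x (ι 4) (λ n → 𝟙 (n ℕₚ.≤? N))))))
      (nonprime-sum x x<B ⊕ 0≤ι 4 ·≤ count))
    where
    count : ∑₁ x (λ n → 𝟙 (n ℕₚ.≤? N)) ≤ ι N
    count = ≤-trans (∑₁-extend-≤ {x} {N ℕ.+ x} {λ n → 𝟙 (n ℕₚ.≤? N)} (ℕₚ.m≤n+m x N) (λ n _ _ → 0≤𝟙 (n ℕₚ.≤? N)))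
      (≤-trans (≤-reflexive (sym (∑₁-extend {N} {N ℕ.+ x} (ℕₚ.m≤m+n N x) (λ n N<n _ → 𝟙-no (n ℕₚ.≤? N) (ℕₚ.<⇒≱ N<n)))))
        (≤-trans (∑₁-mono N (λ n _ _ → 𝟙≤1 (n ℕₚ.≤? N))) (≤-reflexive (∑₁-one N))))
    term : ∀ n → 1 ℕ.≤ n → n ℕ.≤ x → Dec (Prime n) → Dec (n ℕ.≤ N) → s n * (Λ n * inv n) ≤ nonprime n + ι 4 * 𝟙 (n ℕₚ.≤? N)
    term n p r _ (yes n≤N) = ≤-trans (*-mono (0≤s n) (s≤1 n) (0≤Λinv n p) (Λ/n≤4 n p (ℕₚ.≤-trans r (ℕₚ.<⇒≤ x<B))))
      (lin (0≤-* (0≤-diff (𝟙≤1 (prime? n))) (0≤Λinv n p)) (trans (cong (λ z → nonprime n + ι 4 * z + 0ℚ) (𝟙-yes (n ℕₚ.≤? N) n≤N)) (((∀ u → u + ι 4 * 1ℚ + 0ℚ ≡ 1ℚ * ι 4 + u) ∋ solve-∀ ring) (nonprime n))))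
    term n p r (yes pr) (no n≰N) = ≤-trans (≤-reflexive (trans (cong (_* (Λ n * inv n)) (h n (ℕₚ.≰⇒> n≰N) r pr)) (*-zeroˡ (Λ n * inv n))))
      (0≤-+ (0≤-* (0≤-diff (𝟙≤1 (prime? n))) (0≤Λinv n p)) (0≤-* (0≤ι 4) (0≤𝟙 (n ℕₚ.≤? N))))
    term n p r (no ¬pr) (no _) = ≤-trans (*-monoʳ-≤-nonNeg (Λ n * inv n) {{nonNegative (0≤Λinv n p)}} (s≤1 n))
      (lin (0≤-* (0≤ι 4) (0≤𝟙 (n ℕₚ.≤? N))) (trans (cong (λ z → (1ℚ - z) * (Λ n * inv n) + ι 4 * 𝟙 (n ℕₚ.≤? N) + 0ℚ) (𝟙-no (prime? n) ¬pr)) (((∀ u v → (1ℚ - 0ℚ) * u + v + 0ℚ ≡ 1ℚ * u + v) ∋ solve-∀ ring) (Λ n * inv n) (ι 4 * 𝟙 (n ℕₚ.≤? N)))))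

-- Real characters and the lower bound for Σ χ(n)/n

record RealCharacter (q : ℕ) : Set where
  field
    χ : ℕ → ℚ
    χ-* : ∀ a b → χ (a ℕ.* b) ≡ χ a * χ b
    χ-+q : ∀ n → χ (q ℕ.+ n) ≡ χ n
    χ-values : ∀ n → χ n ≡ 1ℚ ⊎ χ n ≡ 0ℚ ⊎ χ n ≡ - 1ℚ
    χ-1 : χ 1 ≡ 1ℚ
    χ-∑ : ∑ q χ ≡ 0ℚ

factor-out : ∀ {p} → Prime p → ∀ n → 1 ℕ.≤ n → ∃ λ v → ∃ λ m → n ≡ p ℕ.^ v ℕ.* m × ¬ p ∣ m
factor-out {p} pr = <-rec _ go
  where
  go : ∀ n → (∀ {k} → k ℕ.< n → 1 ℕ.≤ k → ∃ λ v → ∃ λ m → k ≡ p ℕ.^ v ℕ.* m × ¬ p ∣ m) → 1 ℕ.≤ n → ∃ λ v → ∃ λ m → n ≡ p ℕ.^ v ℕ.* m × ¬ p ∣ m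
  go n rec 1≤n with p ∣? n
  ... | no ¬p∣n = 0 , n , sym (ℕₚ.*-identityˡ n) , ¬p∣n
  ... | yes (divides k refl) with rec (ℕₚ.m<m*n k p {{ℕ.>-nonZero (1≤*ˡ k p 1≤n)}} (prime≥2 pr)) (1≤*ˡ k p 1≤n)
  ...   | v , m , refl , ¬p∣m = suc v , m , trans (ℕₚ.*-comm (p ℕ.^ v ℕ.* m) p) (sym (ℕₚ.*-assoc p (p ℕ.^ v) m)) , ¬p∣m

∑₁-ι : ∀ n → ι 2 * ∑₁ n ι ≡ ι n * (ι n + 1ℚ)
∑₁-ι zero = trans (*-zeroʳ (ι 2)) (sym (*-zeroˡ (0ℚ + 1ℚ)))
∑₁-ι (suc n) = lin≡ (∑₁-ι n) (((∀ s n → (n + 1ℚ) * (n + 1ℚ + 1ℚ) + ι 2 * s ≡ ι 2 * (s + (n + 1ℚ)) + n * (n + 1ℚ)) ∋ solve-∀ ring) (∑₁ n ι) (ι n))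

∑From-∑₁ : ∀ A n f → ∑From (suc A) n f ≡ ∑₁ n (λ i → f (A ℕ.+ i))
∑From-∑₁ A zero f = refl
∑From-∑₁ A (suc n) f = cong₂ _+_ (∑From-∑₁ A n f) (cong f (sym (ℕₚ.+-suc A n)))

private
  abs-step : ∀ a b → b ≤ a → ∣ b - a ∣ ≤ a - b
  abs-step a b h = abs≤ (lin (h ⊕ h) (solve (a ∷ b ∷ []) ring)) (≤-reflexive (((∀ a b → - (b - a) ≡ a - b) ∋ solve-∀ ring) a b))

  inv-θ≤ : ∀ i t d y → 0ℚ ≤ i → 0ℚ ≤ t → d * i ≡ 1ℚ → t ≤ y → i * (t * (d - t)) ≤ y
  inv-θ≤ i t d y h h₁ h₂ h₃ = lin (h₃ ⊕ t ·≡ h₂ ⊕ 0≤-* h (0≤-* h₁ h₁)) (solve (i ∷ t ∷ d ∷ y ∷ []) ring)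

  squares-contradictory : ∀ z m x → 0ℚ ≤ z → ι 3 * z ≤ x - m → x + 1ℚ ≤ m → ι 1 ≤ 0ℚ
  squares-contradictory z m x h₁ h₂ h₃ = lin (h₂ ⊕ h₃ ⊕ 0≤ι 3 ·≤ h₁) (solve (z ∷ m ∷ x ∷ []) ring)

  G-bound-arith : ∀ i j x t → t ≤ x → i ≤ j → i * (x * x) - x + t ≤ j * (x * x)
  G-bound-arith i j x t h h′ = lin (h ⊕ 0≤-sq x ·≤ h′) (solve (i ∷ j ∷ x ∷ t ∷ []) ring)

  P-lower-arith : ∀ q z x a j P t t₁ t₂ → 0ℚ ≤ z → ι 4 * q + ι 16 * ι 16 * (q * q) ≤ z → x ≡ ι 4 * (z * z) → a ≡ ι 16 * (q * z) → a * j ≡ 1ℚ →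
    ι 3 * (z * z) * z ≤ t → t ≡ t₁ + t₂ → ι 2 * t₁ ≤ x * x * P + x * q + a * a → ι 2 * t₂ ≤ q * (j * (x * x)) → ι 4 * (z * z * z) * 1ℚ ≤ ι 4 * (z * z * z) * (ι 4 * z * P)
  P-lower-arith q z x a j P t t₁ t₂ 0≤z hz refl refl aj h₁ refl h₂ h₃ =
    lin (0≤ι 2 ·≤ h₁ ⊕ h₂ ⊕ h₃ ⊕ 0≤-* 0≤z 0≤z ·≤ hz ⊕ (z * z * z) ·≡ aj) (solve (q ∷ z ∷ j ∷ P ∷ t₁ ∷ t₂ ∷ []) ring)

  ≤V₁ : ∀ l i → 0ℚ ≤ i → l * i ≤ (l + ι 8) * i
  ≤V₁ l i h = lin (0≤ι 8 ·≤ h) (solve (l ∷ i ∷ []) ring)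

  divide-lower : ∀ p s c k → 0ℚ ≤ s → 0ℚ ≤ c → 1ℚ ≤ c * p → p * s ≤ k → s ≤ c * k
  divide-lower p s c k h₁ h₂ h₃ h₄ = lin (h₁ ·≤ h₃ ⊕ h₂ ·≤ h₄) (solve (p ∷ s ∷ c ∷ k ∷ []) ring)

module CharacterSums (q : ℕ) {{q≢0 : ℕ.NonZero q}} (𝝌 : RealCharacter q) where
  open RealCharacter 𝝌
  open Residues q

  ∣χ∣≤1 : ∀ n → ∣ χ n ∣ ≤ 1ℚ
  ∣χ∣≤1 n with χ-values n
  ... | inj₁ e = ≤-reflexive (cong ∣_∣ e)
  ... | inj₂ (inj₁ e) = ≤-trans (≤-reflexive (cong ∣_∣ e)) 0≤1
  ... | inj₂ (inj₂ e) = ≤-reflexive (cong ∣_∣ e)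

  -- This is where non-principality enters, in the form of the vanishing sum over a period.
  ∣∑χ∣≤ : ∀ y s → ∣ ∑From s y χ ∣ ≤ Q
  ∣∑χ∣≤ = ∣∑-periodic∣≤ χ χ-+q ∣χ∣≤1 χ-∑

  r : ℕ → ℚ
  r = D χ

  module _ {p : ℕ} (pr : Prime p) where

    -- The sum 1 + χ(p) + ... + χ(p)^v in Horner form, which is the value of 1 ∗ χ at p^v.
    s : ℕ → ℚ
    s zero = 1ℚ
    s (suc v) = χ p * s v + 1ℚ

    r-prime-power : ∀ v m → 1 ℕ.≤ m → ¬ p ∣ m → r (p ℕ.^ v ℕ.* m) ≡ s v * r m
    r-prime-power v m 1≤m ¬p∣m = go v
      where
      1≤pᵛm : ∀ v → 1 ℕ.≤ p ℕ.^ v ℕ.* m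
      1≤pᵛm zero = ℕₚ.≤-trans 1≤m (ℕₚ.≤-reflexive (sym (ℕₚ.*-identityˡ m)))
      1≤pᵛm (suc v) = subst (1 ℕ.≤_) (sym (ℕₚ.*-assoc p (p ℕ.^ v) m)) (1≤* (prime≥1 pr) (1≤pᵛm v))
      away : ∀ v → D (λ d → ∤-ind p d * χ d) (p ℕ.^ v ℕ.* m) ≡ r m
      away zero = trans (cong (D (λ d → ∤-ind p d * χ d)) (ℕₚ.*-identityˡ m)) (D-∤-coprime χ ¬p∣m)
      away (suc v) = trans (cong (D (λ d → ∤-ind p d * χ d)) (ℕₚ.*-assoc p (p ℕ.^ v) m)) (trans (D-∤-* χ pr (1≤pᵛm v)) (away v))
      go : ∀ v → r (p ℕ.^ v ℕ.* m) ≡ s v * r m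
      go zero = trans (cong r (ℕₚ.*-identityˡ m)) (sym (*-identityˡ (r m)))
      go (suc v) = trans (cong r (ℕₚ.*-assoc p (p ℕ.^ v) m)) (trans (D-prime-* χ pr (1≤pᵛm v))
        (trans (cong₂ _+_ (trans (D-cong (p ℕ.^ v ℕ.* m) (λ d _ _ → χ-* p d)) (trans (D-* (χ p) χ (p ℕ.^ v ℕ.* m)) (cong (χ p *_) (go v)))) (away v))
          (((∀ c s r → c * (s * r) + r ≡ (c * s + 1ℚ) * r) ∋ solve-∀ ring) (χ p) (s v) (r m))))

    private
      step-bounds : ∀ c x → c ≡ 1ℚ ⊎ c ≡ 0ℚ ⊎ c ≡ - 1ℚ → 0ℚ ≤ x → 0ℚ ≤ c * (c * x + 1ℚ) + 1ℚ × (1ℚ ≤ x → 1ℚ ≤ c * (c * x + 1ℚ) + 1ℚ)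
      step-bounds c x (inj₁ refl) h = lin (h ⊕ 0≤ι 2) (solve (x ∷ []) ring) , (λ h′ → lin (h′ ⊕ 0≤ι 2) (solve (x ∷ []) ring))
      step-bounds c x (inj₂ (inj₁ refl)) h = lin 0≤1 (solve (x ∷ []) ring) , (λ h′ → lin (≤-refl {1ℚ}) (solve (x ∷ []) ring))
      step-bounds c x (inj₂ (inj₂ refl)) h = lin h (solve (x ∷ []) ring) , (λ h′ → lin h′ (solve (x ∷ []) ring))

    -- For χ(p) = -1 the values alternate between 1 and 0, so the induction advances by two and
    -- carries consecutive pairs.
    0≤s : ∀ v → 0ℚ ≤ s v × 0ℚ ≤ s (suc v)
    0≤s zero = 0≤1 , first (χ-values p)
      where
      first : χ p ≡ 1ℚ ⊎ χ p ≡ 0ℚ ⊎ χ p ≡ - 1ℚ → 0ℚ ≤ χ p * 1ℚ + 1ℚ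
      first (inj₁ e) = subst (λ c → 0ℚ ≤ c * 1ℚ + 1ℚ) (sym e) (0≤ι 2)
      first (inj₂ (inj₁ e)) = subst (λ c → 0ℚ ≤ c * 1ℚ + 1ℚ) (sym e) 0≤1
      first (inj₂ (inj₂ e)) = subst (λ c → 0ℚ ≤ c * 1ℚ + 1ℚ) (sym e) ≤-refl
    0≤s (suc v) = proj₂ (0≤s v) , proj₁ (step-bounds (χ p) (s v) (χ-values p) (proj₁ (0≤s v)))

    1≤s-even : ∀ v → 1ℚ ≤ s (v ℕ.+ v)
    1≤s-even zero = ≤-refl
    1≤s-even (suc v) = subst (λ k → 1ℚ ≤ s (suc k)) (sym (ℕₚ.+-suc v v)) (proj₂ (step-bounds (χ p) (s (v ℕ.+ v)) (χ-values p) (proj₁ (0≤s (v ℕ.+ v)))) (1≤s-even v))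

  -- Induction over n by removing the full power of a prime.
  prime-power-rec : (P : ℕ → Set) → P 1 → (∀ {p} → Prime p → ∀ v m → 1 ℕ.≤ m → ¬ p ∣ m → P m → P (p ℕ.^ v ℕ.* m)) → ∀ n → 1 ℕ.≤ n → P n
  prime-power-rec P P1 step = <-rec _ go
    where
    go : ∀ n → (∀ {k} → k ℕ.< n → 1 ℕ.≤ k → P k) → 1 ℕ.≤ n → P n
    go n rec 1≤n with n ℕₚ.≟ 1
    ... | yes refl = P1
    ... | no n≢1 with prime-divisor n (ℕₚ.≤∧≢⇒< 1≤n (λ e → n≢1 (sym e)))
    ...   | p , pr , p∣n with factor-out pr n 1≤n
    ...     | zero , m , e , ¬p∣m = ⊥-elim (¬p∣m (subst (p ∣_) (trans e (ℕₚ.*-identityˡ m)) p∣n))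
    ...     | suc v , m , refl , ¬p∣m = step pr (suc v) m 1≤m ¬p∣m (rec (ℕₚ.<-≤-trans (subst (m ℕ.<_) (ℕₚ.*-comm m p) (ℕₚ.m<m*n m p {{ℕ.>-nonZero 1≤m}} (prime≥2 pr))) (ℕₚ.*-monoˡ-≤ m p≤)) 1≤m)
      where
      1≤m : 1 ℕ.≤ m
      1≤m = 1≤*ʳ (p ℕ.^ suc v) m 1≤n
      p≤ : p ℕ.≤ p ℕ.^ suc v
      p≤ = *≡⇒≤ˡ (1≤*ʳ p (p ℕ.^ v) (1≤*ˡ (p ℕ.^ suc v) m 1≤n)) refl

  r-1 : r 1 ≡ 1ℚ
  r-1 = trans (D-1 χ) χ-1

  0≤r : ∀ n → 1 ℕ.≤ n → 0ℚ ≤ r n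
  0≤r = prime-power-rec (λ n → 0ℚ ≤ r n) (≤-trans 0≤1 (≤-reflexive (sym r-1)))
    (λ pr v m 1≤m ¬p∣m h → ≤-trans (0≤-* (proj₁ (0≤s pr v)) h) (≤-reflexive (sym (r-prime-power pr v m 1≤m ¬p∣m))))

  -- At the exponent 2 v the local factor is 2 v + 1, 1 or 1 for χ(p) = 1, 0 or -1.
  1≤r-square : ∀ n → 1 ℕ.≤ n → 1ℚ ≤ r (n ℕ.* n)
  1≤r-square = prime-power-rec (λ n → 1ℚ ≤ r (n ℕ.* n)) (≤-reflexive (sym r-1))
    (λ {p} pr v m 1≤m ¬p∣m h → ≤-trans (≤-reflexive (sym (*-identityˡ 1ℚ))) (≤-trans (*-mono 0≤1 (1≤s-even pr v) 0≤1 h)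
      (≤-reflexive (trans (sym (r-prime-power pr (v ℕ.+ v) (m ℕ.* m) (1≤* 1≤m 1≤m) (λ d → ¬p∣m (either (euclidsLemma m m pr d)))))
        (cong r (trans (cong (ℕ._* (m ℕ.* m)) (ℕₚ.^-distribˡ-+-* p v v)) (((∀ a m → a ℕ.* a ℕ.* (m ℕ.* m) ≡ a ℕ.* m ℕ.* (a ℕ.* m)) ∋ solve-ℕ) (p ℕ.^ v) m)))))))
    where
    either : ∀ {a} {A : Set a} → A ⊎ A → A
    either (inj₁ x) = x
    either (inj₂ x) = x

  -- At most one m has m² = n, so the sum is at most the indicator of squares.
  squares≤r : ∀ n → 1 ℕ.≤ n → ∀ z → ∑₁ z (λ m → 𝟙 (m ℕ.* m ℕₚ.≟ n)) ≤ r n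
  squares≤r n 1≤n zero = 0≤r n 1≤n
  squares≤r n 1≤n (suc z) = by (suc z ℕ.* suc z ℕₚ.≟ n)
    where
    by : (d : Dec (suc z ℕ.* suc z ≡ n)) → ∑₁ z (λ m → 𝟙 (m ℕ.* m ℕₚ.≟ n)) + 𝟙 (suc z ℕ.* suc z ℕₚ.≟ n) ≤ r n
    by (no ¬e) = ≤-trans (≤-reflexive (trans (cong (∑₁ z (λ m → 𝟙 (m ℕ.* m ℕₚ.≟ n)) +_) (𝟙-no (suc z ℕ.* suc z ℕₚ.≟ n) ¬e)) (+-identityʳ (∑₁ z (λ m → 𝟙 (m ℕ.* m ℕₚ.≟ n)))))) (squares≤r n 1≤n z)
    by (yes e) = ≤-trans (≤-reflexive (trans (cong₂ _+_ (∑₁-≡0 z (λ m _ m≤z → 𝟙-no (m ℕ.* m ℕₚ.≟ n) (λ e′ → ℕₚ.<⇒≢ (ℕₚ.*-mono-< (s≤s m≤z) (s≤s m≤z)) (trans e′ (sym e))))) (𝟙-yes (suc z ℕ.* suc z ℕₚ.≟ n) e)) (+-identityˡ 1ℚ)))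
      (≤-trans (1≤r-square (suc z) (s≤s z≤n)) (≤-reflexive (cong r e)))

  P : ℕ → ℚ
  P y = ∑₁ y (λ n → χ n * inv n)

  tail-bound : ∀ (u : ℕ → ℚ) A n → (∀ d → 1 ℕ.≤ d → 0ℚ ≤ u d) → (∀ d → 1 ℕ.≤ d → u (suc d) ≤ u d) → ∣ ∑From (suc A) n (λ d → χ d * u d) ∣ ≤ Q * u (suc A)
  tail-bound u A n 0≤u mono = abs-resp (sym (∑From-∑₁ A n (λ d → χ d * u d))) (≤-trans
    (abel-bound n (λ i → χ (A ℕ.+ i)) (λ i → u (A ℕ.+ i)) (λ i → u (A ℕ.+ i)) Q (0≤ι q) (λ m _ → abs-resp (∑From-∑₁ A m χ) (∣∑χ∣≤ m (suc A)))
      (abs-nonneg (0≤u (A ℕ.+ suc n) (ℕₚ.≤-trans (s≤s z≤n) (ℕₚ.m≤n+m (suc n) A))) ≤-refl) (λ m 1≤m _ → abs-step (u (A ℕ.+ m)) (u (A ℕ.+ suc m)) (subst (λ k → u k ≤ u (A ℕ.+ m)) (sym (ℕₚ.+-suc A m)) (mono (A ℕ.+ m) (ℕₚ.≤-trans 1≤m (ℕₚ.m≤n+m m A))))))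
    (≤-reflexive (cong (λ k → Q * u k) (ℕₚ.+-comm A 1))))

  P-tail : ∀ A y → A ℕ.≤ y → ∣ P y - P A ∣ ≤ Q * inv (suc A)
  P-tail A y A≤y = abs-resp (trans (((∀ a t → t ≡ a + t - a) ∋ solve-∀ ring) (P A) (∑From (suc A) (y ℕ.∸ A) (λ n → χ n * inv n)))
      (cong (_- P A) (trans (sym (∑-split A (y ℕ.∸ A) (λ n → χ n * inv n))) (cong P (ℕₚ.m+[n∸m]≡n A≤y)))))
    (tail-bound inv A (y ℕ.∸ A) (λ d _ → 0≤inv d) (λ d h → inv-anti-step d h))

  -- The lower bound for P comes from summing (x − n) (1 ∗ χ)(n) over n ≤ x = 4z² in two ways:
  -- the squares alone contribute 3z³, while the hyperbola method gives x² P(A) / 2 up to lower order terms.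
  module LowerBound (z : ℕ) (1≤z : 1 ℕ.≤ z) (z-large : ι 4 * Q + ι 16 * ι 16 * (Q * Q) ≤ ι z) (x A : ℕ) (x≡ : ι x ≡ ι 4 * (ι z * ι z)) (A≡ : ι A ≡ ι 16 * (Q * ι z)) (A≤x : A ℕ.≤ x) (1≤A : 1 ℕ.≤ A) where

    W : ℕ → ℚ
    W n = ι x - ι n

    G : ℕ → ℚ
    G d = ∑₁ (x div d) (λ m → W (d ℕ.* m))

    0≤W-multiple : ∀ d m → m ℕ.≤ x div d → 0ℚ ≤ W (d ℕ.* m)
    0≤W-multiple d m h = 0≤-diff (ι-mono (≤-div⇒*-≤ x d m h))

    0≤G : ∀ d → 1 ℕ.≤ d → 0ℚ ≤ G d
    0≤G d _ = ∑₁-≥0 (x div d) (λ m _ h → 0≤W-multiple d m h)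

    -- Monotonicity in d allows the whole range d > A to be bounded at once by the cancellation of
    -- χ.
    G-anti : ∀ d → 1 ℕ.≤ d → G (suc d) ≤ G d
    G-anti d 1≤d = ≤-trans (∑₁-mono (x div suc d) {g = λ m → W (d ℕ.* m)} (λ m _ _ → lin (ι-mono (ℕₚ.*-monoˡ-≤ m (ℕₚ.n≤1+n d)))
        (((∀ x a b → x - a + a ≡ x - b + b) ∋ solve-∀ ring) (ι x) (ι (d ℕ.* m)) (ι (suc d ℕ.* m)))))
      (∑₁-extend-≤ {f = λ m → W (d ℕ.* m)} (*-≤⇒≤-div x d (x div suc d) 1≤d (ℕₚ.≤-trans (ℕₚ.*-monoˡ-≤ (x div suc d) (ℕₚ.n≤1+n d)) (div-*-≤ x (suc d)))) (λ m _ h → 0≤W-multiple d m h))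

    -- e d = x mod d.
    e θ : ℕ → ℚ
    e d = ι x - ι d * ι (x div d)
    θ d = inv d * (e d * (ι d - e d))

    -- With e = x mod d the arithmetic progression sums exactly, with remainder θ d = e (d - e) / d.
    -- The linear weight x - n is chosen because θ d is then at most d and at most x.
    G-exact : ∀ d → 1 ℕ.≤ d → ι 2 * G d ≡ inv d * (ι x * ι x) - ι x + θ d
    G-exact d 1≤d = lin≡ {A = inv d * (ι d * (ι 2 * G d)) + ι 2 * G d * 1ℚ + ι x * 1ℚ}
      {B = inv d * (ι x * ι x - ι d * ι x + e d * (ι d - e d)) + ι 2 * G d * (ι d * inv d) + ι x * (ι d * inv d)}
      (cong₂ _+_ (cong₂ _+_ (cong (inv d *_) scaled) (cong (ι 2 * G d *_) (sym (ι-inv 1≤d)))) (cong (ι x *_) (sym (ι-inv 1≤d))))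
      (((∀ i x d g t → i * (x * x) - x + i * t + (i * (d * g) + g * 1ℚ + x * 1ℚ) ≡ g + (i * (x * x - d * x + t) + g * (d * i) + x * (d * i))) ∋ solve-∀ ring) (inv d) (ι x) (ι d) (ι 2 * G d) (e d * (ι d - e d)))
      where
      N : ℕ
      N = x div d
      G≡ : G d ≡ ι N * ι x - ι d * ∑₁ N ι
      G≡ = trans (∑₁-cong N (λ m _ _ → cong (λ z → ι x - z) (ι-* d m))) (trans (∑-sub N (λ _ → ι x) (λ m → ι d * ι m)) (cong₂ _-_ (∑-const N (ι x)) (∑-*ˡ N (ι d) ι)))
      scaled : ι d * (ι 2 * G d) ≡ ι x * ι x - ι d * ι x + e d * (ι d - e d)
      scaled = trans (cong (λ g → ι d * (ι 2 * g)) G≡) (trans (((∀ d n x s → d * (ι 2 * (n * x - d * s)) ≡ ι 2 * d * n * x - d * d * (ι 2 * s)) ∋ solve-∀ ring) (ι d) (ι N) (ι x) (∑₁ N ι))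
        (trans (cong (λ s → ι 2 * ι d * ι N * ι x - ι d * ι d * s) (∑₁-ι N))
          (((∀ d n x → ι 2 * d * n * x - d * d * (n * (n + 1ℚ)) ≡ x * x - d * x + (x - d * n) * (d - (x - d * n))) ∋ solve-∀ ring) (ι d) (ι N) (ι x))))

    0≤e : ∀ d → 0ℚ ≤ e d
    0≤e d = 0≤-diff (≤-trans (≤-reflexive (sym (ι-* d (x div d)))) (ι-mono (div-*-≤ x d)))

    e≤d : ∀ d → 1 ℕ.≤ d → e d ≤ ι d
    e≤d d h = lin (≤-trans (ι-mono (ℕₚ.<⇒≤ (<-*-suc-div x d h))) (≤-reflexive (ι-* d (suc (x div d))))) (((∀ x d n → d + x ≡ x - d * n + d * (n + 1ℚ)) ∋ solve-∀ ring) (ι x) (ι d) (ι (x div d)))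

    e≤x : ∀ d → e d ≤ ι x
    e≤x d = lin (0≤-* (0≤ι d) (0≤ι (x div d))) (((∀ x t → x + 0ℚ ≡ x - t + t) ∋ solve-∀ ring) (ι x) (ι d * ι (x div d)))

    private
      0≤inv-θ : ∀ i t d → 0ℚ ≤ i → 0ℚ ≤ t → t ≤ d → 0ℚ ≤ i * (t * (d - t))
      0≤inv-θ i t d h h₁ h₂ = 0≤-* h (0≤-* h₁ (0≤-diff h₂))

    0≤θ : ∀ d → 1 ℕ.≤ d → 0ℚ ≤ θ d
    0≤θ d h = 0≤inv-θ (inv d) (e d) (ι d) (0≤inv d) (0≤e d) (e≤d d h)

    θ≤d : ∀ d → 1 ℕ.≤ d → θ d ≤ ι d
    θ≤d d h = inv-θ≤ (inv d) (e d) (ι d) (ι d) (0≤inv d) (0≤e d) (ι-inv h) (e≤d d h)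

    θ≤x : ∀ d → 1 ℕ.≤ d → θ d ≤ ι x
    θ≤x d h = inv-θ≤ (inv d) (e d) (ι d) (ι x) (0≤inv d) (0≤e d) (ι-inv h) (e≤x d)

    total : ℚ
    total = ∑₁ x (λ d → χ d * G d)

    total≡ : ∑₁ x (λ n → W n * r n) ≡ total
    total≡ = trans (∑₁-cong x (λ n h _ → cong (W n *_) (sym (conv-one χ n h)))) (trans (hyperbola x W χ one)
      (∑₁-cong x (λ d _ _ → cong (χ d *_) (∑₁-cong (x div d) (λ m _ _ → *-identityʳ (W (d ℕ.* m)))))))

    z²-bound : ∀ m → m ℕ.≤ z → ι 3 * (ι z * ι z) ≤ W (m ℕ.* m)
    z²-bound m m≤z = lin (≤-trans (ι-mono (ℕₚ.*-mono-≤ m≤z m≤z)) (≤-reflexive (ι-* z z)) ⊕ ≤-reflexive (sym x≡))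
      (((∀ x a z → x - a + (a + ι 4 * z) ≡ ι 3 * z + (z + x)) ∋ solve-∀ ring) (ι x) (ι (m ℕ.* m)) (ι z * ι z))

    square≤x : ∀ m → m ℕ.≤ z → m ℕ.* m ℕ.≤ x
    square≤x m h = by (m ℕ.* m ℕₚ.≤? x)
      where
      by : Dec (m ℕ.* m ℕ.≤ x) → m ℕ.* m ℕ.≤ x
      by (yes p) = p
      by (no ¬p) = ⊥-elim (<-irrefl refl (<-≤-trans (0<ι-suc 0) (squares-contradictory (ι z * ι z) (ι (m ℕ.* m)) (ι x) (0≤-* (0≤ι z) (0≤ι z)) (z²-bound m h) (ι-mono (ℕₚ.≰⇒> ¬p)))))

    -- Each of the squares m² with m ≤ z carries weight at least 4 z² - z².
    total-lower : ι 3 * (ι z * ι z) * ι z ≤ total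
    total-lower = ≤-trans (≤-reflexive (trans (*-comm (ι 3 * (ι z * ι z)) (ι z)) (sym (∑-const z (ι 3 * (ι z * ι z)))))) (≤-trans
      (∑₁-mono z {g = λ m → W (m ℕ.* m)} (λ m _ h → z²-bound m h)) (≤-trans (≤-reflexive swap) (≤-trans
      (∑₁-mono x (λ n 1≤n n≤x → 0≤-diff (ι-mono n≤x) ·≤ squares≤r n 1≤n z)) (≤-reflexive total≡))))
      where
      swap : ∑₁ z (λ m → W (m ℕ.* m)) ≡ ∑₁ x (λ n → W n * ∑₁ z (λ m → 𝟙 (m ℕ.* m ℕₚ.≟ n)))
      swap = trans (∑₁-cong z (λ m 1≤m m≤z → sym (trans (∑₁-point x (m ℕ.* m) W (1≤* 1≤m 1≤m)) (trans (cong (_* W (m ℕ.* m)) (𝟙-yes (m ℕ.* m ℕₚ.≤? x) (square≤x m m≤z))) (*-identityˡ (W (m ℕ.* m)))))))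
        (trans (∑-swap z x (λ m n → 𝟙 (m ℕ.* m ℕₚ.≟ n) * W n)) (∑₁-cong x (λ n _ _ → trans (∑-*ʳ z (W n) (λ m → 𝟙 (m ℕ.* m ℕₚ.≟ n))) (*-comm (∑₁ z (λ m → 𝟙 (m ℕ.* m ℕₚ.≟ n))) (W n)))))

    initial : ι 2 * ∑₁ A (λ d → χ d * G d) ≤ ι x * ι x * P A + ι x * Q + ι A * ι A
    initial = ≤-trans (≤-reflexive expand) (≤-refl {ι x * ι x * P A} ⊕ 0≤ι x ·≤ ≤-trans (-≤abs (∑₁ A χ)) (∣∑χ∣≤ A 1) ⊕ abs-upper θ-bound)
      where
      expand : ι 2 * ∑₁ A (λ d → χ d * G d) ≡ ι x * ι x * P A + ι x * - ∑₁ A χ + ∑₁ A (λ d → χ d * θ d)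
      expand = trans (sym (∑-*ˡ A (ι 2) (λ d → χ d * G d))) (trans (∑₁-cong A (λ d 1≤d _ → trans (((∀ c g → ι 2 * (c * g) ≡ c * (ι 2 * g)) ∋ solve-∀ ring) (χ d) (G d)) (trans (cong (χ d *_) (G-exact d 1≤d))
          (((∀ c i x t → c * (i * (x * x) - x + t) ≡ x * x * (c * i) + - x * c + c * t) ∋ solve-∀ ring) (χ d) (inv d) (ι x) (θ d)))))
        (trans (∑-+ A (λ d → ι x * ι x * (χ d * inv d) + - ι x * χ d) (λ d → χ d * θ d)) (cong (_+ ∑₁ A (λ d → χ d * θ d)) (trans (∑-+ A (λ d → ι x * ι x * (χ d * inv d)) (λ d → - ι x * χ d))
          (cong₂ _+_ (∑-*ˡ A (ι x * ι x) (λ d → χ d * inv d)) (trans (∑-*ˡ A (- ι x) χ) (((∀ a b → - a * b ≡ a * - b) ∋ solve-∀ ring) (ι x) (∑₁ A χ))))))))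
      θ-bound : ∣ ∑₁ A (λ d → χ d * θ d) ∣ ≤ ι A * ι A
      θ-bound = ≤-trans (∑₁-abs≤ A {g = λ _ → ι A} (λ d 1≤d d≤A → ≤-trans (abs-mul (∣χ∣≤1 d) (abs-nonneg (0≤θ d 1≤d) (≤-trans (θ≤d d 1≤d) (ι-mono d≤A)))) (≤-reflexive (*-identityˡ (ι A))))) (≤-reflexive (∑-const A (ι A)))

    remainder : ι 2 * ∑From (suc A) (x ℕ.∸ A) (λ d → χ d * G d) ≤ Q * (inv A * (ι x * ι x))
    remainder = ≤-trans (0≤ι 2 ·≤ abs-upper (tail-bound G A (x ℕ.∸ A) 0≤G G-anti)) (≤-trans (≤-reflexive (((∀ q g → ι 2 * (q * g) ≡ q * (ι 2 * g)) ∋ solve-∀ ring) Q (G (suc A))))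
      (0≤ι q ·≤ ≤-trans (≤-reflexive (G-exact (suc A) (s≤s z≤n))) (G-bound-arith (inv (suc A)) (inv A) (ι x) (θ (suc A)) (θ≤x (suc A) (s≤s z≤n)) (inv-anti-step A 1≤A))))

    -- With x = 4 z² and A = 16 q z the two evaluations give 6 z³ ≤ 16 z⁴ P(A) + (4 q + 256 q²) z² +
    -- z³. The hypothesis on z bounds the middle term by z³, leaving 4 z³ ≤ 16 z⁴ P(A).
    P-A : 1ℚ ≤ ι 4 * ι z * P A
    P-A = cancel-ι-≤ {4 ℕ.* (z ℕ.* z ℕ.* z)} (1≤* {4} (s≤s z≤n) (1≤* (1≤* 1≤z 1≤z) 1≤z)) (subst (λ c → c * 1ℚ ≤ c * (ι 4 * ι z * P A))
      (sym (trans (ι-* 4 (z ℕ.* z ℕ.* z)) (cong (ι 4 *_) (trans (ι-* (z ℕ.* z) z) (cong (_* ι z) (ι-* z z))))))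
      (P-lower-arith Q (ι z) (ι x) (ι A) (inv A) (P A) total (∑₁ A (λ d → χ d * G d)) (∑From (suc A) (x ℕ.∸ A) (λ d → χ d * G d)) (0≤ι z) z-large x≡ A≡ (ι-inv 1≤A) total-lower
        (trans (cong (λ k → ∑₁ k (λ d → χ d * G d)) (sym (ℕₚ.m+[n∸m]≡n A≤x))) (∑-split A (x ℕ.∸ A) (λ d → χ d * G d))) initial remainder))

    -- Beyond A the sum moves by at most q / A = 1 / (16 z), and 1/4 - 1/16 exceeds 1/8.
    P-lower : ∀ y → A ℕ.≤ y → 1ℚ ≤ ι 8 * ι z * P y
    P-lower y A≤y = combine′ Q (ι z) (ι A) (inv A) (P A) (P y) (0≤ι z) A≡ (ι-inv 1≤A) P-A
      (≤-trans (-≤abs (P y - P A)) (≤-trans (P-tail A y A≤y) (0≤ι q ·≤ inv-anti-step A 1≤A)))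
      where
      combine′ : ∀ q z a j P P′ → 0ℚ ≤ z → a ≡ ι 16 * (q * z) → a * j ≡ 1ℚ → 1ℚ ≤ ι 4 * z * P → - (P′ - P) ≤ q * j → 1ℚ ≤ ι 8 * z * P′
      combine′ q z a j P P′ 0≤z refl aj h₁ h₂ = lin (0≤ι 2 ·≤ h₁ ⊕ 0≤-* (0≤ι 8) 0≤z ·≤ h₂ ⊕ ½ ·≡ aj ⊕ *≤* (ℤ.+≤+ z≤n)) (((∀ q z j P P′ → ι 8 * z * P′ + (ι 2 * 1ℚ + ι 8 * z * - (P′ - P) + ½ * (ι 16 * (q * z) * j) + 0ℚ) ≡ 1ℚ + (ι 2 * (ι 4 * z * P) + ι 8 * z * (q * j) + ½ * 1ℚ + ½)) ∋ solve-∀ ring) q z j P P′)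

  1≤z₀₀ : 1 ℕ.≤ z₀
  1≤z₀₀ = ℕₚ.≤-trans (1≤* {4} (s≤s z≤n) 1≤q) (ℕₚ.m≤m+n (4 ℕ.* q) (16 ℕ.* (16 ℕ.* (q ℕ.* q))))

  private
    4q≤z₀₀ : 4 ℕ.* q ℕ.≤ z₀
    4q≤z₀₀ = ℕₚ.m≤m+n (4 ℕ.* q) (16 ℕ.* (16 ℕ.* (q ℕ.* q)))

    z₀-value : ι 4 * Q + ι 16 * ι 16 * (Q * Q) ≡ ι z₀
    z₀-value = sym (trans (ι-+ (4 ℕ.* q) (16 ℕ.* (16 ℕ.* (q ℕ.* q)))) (cong₂ _+_ (ι-* 4 q)
      (trans (ι-* 16 (16 ℕ.* (q ℕ.* q))) (trans (cong (ι 16 *_) (trans (ι-* 16 (q ℕ.* q)) (cong (ι 16 *_) (ι-* q q)))) (sym (*-assoc (ι 16) (ι 16) (Q * Q)))))))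

    A₀≤x₀ : A₀ ℕ.≤ x₀
    A₀≤x₀ = ℕₚ.≤-trans (ℕₚ.≤-reflexive (((∀ q z₀ → 16 ℕ.* (q ℕ.* z₀) ≡ 4 ℕ.* ((4 ℕ.* q) ℕ.* z₀)) ∋ solve-ℕ) q z₀)) (ℕₚ.*-monoʳ-≤ 4 (ℕₚ.*-monoˡ-≤ z₀ 4q≤z₀₀))

  open LowerBound z₀ 1≤z₀₀ (≤-reflexive z₀-value) x₀ A₀ (trans (ι-* 4 (z₀ ℕ.* z₀)) (cong (ι 4 *_) (ι-* z₀ z₀))) (trans (ι-* 16 (q ℕ.* z₀)) (cong (ι 16 *_) (ι-* q z₀))) A₀≤x₀ (1≤* {16} (s≤s z≤n) (1≤* 1≤q 1≤z₀₀)) public using (P-lower)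

  module _ {B : ℕ} (log : Log B) where
    open Chebyshev log hiding (T)
    open PrimePowers log using (Λ/n≤4)

    S : ℕ → ℚ
    S x = ∑₁ x (λ n → χ n * (Λ n * inv n))

    private
      χL-bound : ∀ x → x ℕ.< B → ∣ ∑₁ x (λ n → χ n * (L n * inv n)) ∣ ≤ Q * ι 8
      χL-bound x x<B = ≤-trans (abel-bound x χ (λ n → L n * inv n) V₁ Q (0≤ι q) (λ n _ → ∣∑χ∣≤ n 1)
        (abs-nonneg (0≤-* (0≤L (suc x)) (0≤inv (suc x))) (≤V₁ (L (suc x)) (inv (suc x)) (0≤inv (suc x))))
        (λ n p h → L/n-variation n p (ℕₚ.≤-<-trans h x<B))) (≤-reflexive (cong (Q *_) V₁-1))

      χL-expand : ∀ x → ∑₁ x (λ n → χ n * (L n * inv n)) ≡ ∑₁ x (λ d → χ d * (Λ d * inv d) * P (x div d))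
      χL-expand x = trans (∑₁-cong x (λ n h _ → trans (cong (λ l → χ n * (l * inv n)) (sym (conv-Λ-one n h))) (((∀ c l i → c * (l * i) ≡ c * i * l) ∋ solve-∀ ring) (χ n) (conv Λ one n) (inv n))))
        (trans (hyperbola x (λ n → χ n * inv n) Λ one) (∑₁-cong x (λ d _ _ → trans (cong (Λ d *_) (trans (∑₁-cong (x div d) (λ m _ _ → trans (cong₂ (λ u v → u * v * 1ℚ) (χ-* d m) (inv-* d m))
            (((∀ c c′ i j → c * c′ * (i * j) * 1ℚ ≡ c * i * (c′ * j)) ∋ solve-∀ ring) (χ d) (χ m) (inv d) (inv m)))) (∑-*ˡ (x div d) (χ d * inv d) (λ m → χ m * inv m))))
          (((∀ l c i p → l * (c * i * p) ≡ c * (l * i) * p) ∋ solve-∀ ring) (Λ d) (χ d) (inv d) (P (x div d))))))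

      -- Replacing P(x/d) by P(x) costs q / (⌊x/d⌋ + 1); together with the factor 1/d this is at
      -- most q / x for every d, and Chebyshev sums Λ d to 30 x.
      error-bound : ∀ x → 1 ℕ.≤ x → suc x ℕ.< B → ∣ P x * S x - ∑₁ x (λ d → χ d * (Λ d * inv d) * P (x div d)) ∣ ≤ Q * ι 30
      error-bound x 1≤x x<B = abs-resp (trans (∑-sub x (λ d → P x * (χ d * (Λ d * inv d))) (λ d → χ d * (Λ d * inv d) * P (x div d))) (cong (_- ∑₁ x (λ d → χ d * (Λ d * inv d) * P (x div d))) (∑-*ˡ x (P x) (λ d → χ d * (Λ d * inv d)))))
        (≤-trans (∑₁-abs≤ x {g = λ d → Q * inv x * Λ d} (λ d p h → term d p)) (≤-trans (≤-reflexive (∑-*ˡ x (Q * inv x) Λ))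
          (≤-trans (0≤-* (0≤ι q) (0≤inv x) ·≤ chebyshev x x<B) (≤-reflexive (trans (((∀ q i c n → q * i * (c * n) ≡ q * c * (n * i)) ∋ solve-∀ ring) Q (inv x) (ι 30) (ι x)) (trans (cong (Q * ι 30 *_) (ι-inv 1≤x)) (*-identityʳ (Q * ι 30))))))))
        where
        term : ∀ d → 1 ℕ.≤ d → ∣ P x * (χ d * (Λ d * inv d)) - χ d * (Λ d * inv d) * P (x div d) ∣ ≤ Q * inv x * Λ d
        term d 1≤d = abs-resp (((∀ c l i p p′ → c * (l * (i * (p - p′))) ≡ p * (c * (l * i)) - c * (l * i) * p′) ∋ solve-∀ ring) (χ d) (Λ d) (inv d) (P x) (P (x div d)))
          (≤-trans (abs-mul (∣χ∣≤1 d) (abs-mul (abs-nonneg (0≤Λ d 1≤d) ≤-refl) (≤-trans (abs-mul (abs-nonneg (0≤inv d) ≤-refl) (P-tail (x div d) x (div-≤ x d)))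
              (≤-trans (≤-reflexive (trans (((∀ i q j → i * (q * j) ≡ q * (i * j)) ∋ solve-∀ ring) (inv d) Q (inv (suc (x div d)))) (cong (Q *_) (sym (inv-* d (suc (x div d))))))) (0≤ι q ·≤ inv-anti 1≤x (ℕₚ.<⇒≤ (<-*-suc-div x d 1≤d)))))))
            (≤-reflexive (((∀ l c → 1ℚ * (l * c) ≡ c * l) ∋ solve-∀ ring) (Λ d) (Q * inv x))))

      PS-bound : ∀ x → 1 ℕ.≤ x → suc x ℕ.< B → ∣ P x * S x ∣ ≤ ι 38 * Q
      PS-bound x 1≤x x<B = abs-resp (((∀ a b → a - b + b ≡ a) ∋ solve-∀ ring) (P x * S x) (∑₁ x (λ d → χ d * (Λ d * inv d) * P (x div d))))
        (≤-trans (abs-sum (error-bound x 1≤x x<B) (abs-resp (χL-expand x) (χL-bound x (ℕₚ.<-trans (ℕₚ.n<1+n x) x<B)))) (≤-reflexive (((∀ q → q * ι 30 + q * ι 8 ≡ ι 38 * q) ∋ solve-∀ ring) Q)))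

    S-bound : ∀ x → suc x ℕ.< B → ∣ S x ∣ ≤ C₆
    S-bound x x<B = by (A₀ ℕₚ.≤? x)
      where
      by : Dec (A₀ ℕ.≤ x) → ∣ S x ∣ ≤ C₆
      -- Below A₀ no lower bound for P is available; fewer than A₀ terms of size at most 4 account
      -- for the second summand of `C₆`.
      by (no A₀≰x) = ≤-trans (∑₁-abs≤ x {g = λ _ → ι 4} (λ n p h → ≤-trans (abs-mul (∣χ∣≤1 n) (abs-nonneg (0≤-* (0≤Λ n p) (0≤inv n)) (Λ/n≤4 n p (ℕₚ.≤-trans h (ℕₚ.<⇒≤ (ℕₚ.<-trans (ℕₚ.n<1+n x) x<B)))))) (≤-reflexive (*-identityˡ (ι 4)))))
        (≤-trans (≤-reflexive (trans (∑-const x (ι 4)) (*-comm (ι x) (ι 4)))) (≤-trans (0≤ι 4 ·≤ ι-mono (ℕₚ.<⇒≤ (ℕₚ.≰⇒> A₀≰x)))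
          (b≤a+b (0≤-* (0≤-* (0≤ι 8) (0≤ι z₀)) (0≤-* (0≤ι 38) (0≤ι q))))))
      by (yes A₀≤x) = ≤-trans (divide-lower (P x) ∣ S x ∣ (ι 8 * ι z₀) (ι 38 * Q) (0≤∣p∣ (S x)) (0≤-* (0≤ι 8) (0≤ι z₀)) (P-lower x A₀≤x)
          (≤-trans (*-monoʳ-≤-nonNeg ∣ S x ∣ {{∣-∣-nonNeg (S x)}} (≤abs (P x))) (≤-trans (≤-reflexive (sym (∣p*q∣≡∣p∣*∣q∣ (P x) (S x)))) (PS-bound x (ℕₚ.≤-trans (1≤* {16} (s≤s z≤n) (1≤* 1≤q 1≤z₀₀)) A₀≤x) x<B))))
        (a≤a+b (0≤-* (0≤ι 4) (0≤ι A₀)))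

-- Numerical certificates for the dichotomy of masses

private
  divide-arith : ∀ f v K ε y x → 0ℚ ≤ f → f * v ≡ 1ℚ → 0ℚ ≤ x → v * K ≤ ι 2 * y → y * x ≤ ε * (K * K) → K * x ≤ K * (ι 2 * f * ε * K)
  divide-arith f v K ε y x 0≤f fv 0≤x hy h = lin (0≤-* 0≤f 0≤x ·≤ hy ⊕ 0≤-* (0≤ι 2) 0≤f ·≤ h ⊕ (K * x) ·≡ sym fv) (solve (f ∷ v ∷ K ∷ ε ∷ y ∷ x ∷ []) ring)

  UF-arith : ∀ v t K → 0ℚ ≤ t → t ≤ 1ℚ → v ≤ 1ℚ → (ι 2 * v * K + t * K) * (K + t * K) ≤ ι 2 * v * (K * K) + ι 4 * t * (K * K)
  UF-arith v t K h h′ h″ = lin (0≤-* h (0≤-sq K) ·≤ h′ ⊕ 0≤-* (0≤-* (0≤ι 2) h) (0≤-sq K) ·≤ h″) (solve (v ∷ t ∷ K ∷ []) ring)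

  near-arith : ∀ v t K s x → 0ℚ ≤ t → 0ℚ ≤ K → s ≤ v → 0ℚ ≤ v → ι 2 * v * K + t * K - x ≤ s * K → v * K ≤ ι 2 * x
  near-arith v t K s x 0≤t 0≤K hs 0≤v h = lin (0≤ι 2 ·≤ h ⊕ 0≤-* (0≤ι 2) 0≤K ·≤ hs ⊕ 0≤-* (0≤ι 2) (0≤-* 0≤t 0≤K) ⊕ 0≤-* 0≤v 0≤K) (solve (v ∷ t ∷ K ∷ s ∷ x ∷ []) ring)

  light-arith : ∀ v t K x → 0ℚ ≤ t → 0ℚ ≤ K → 0ℚ ≤ v → ι 2 * x ≤ v * K → v * K ≤ ι 2 * (ι 2 * v * K + t * K - x)
  light-arith v t K x 0≤t 0≤K 0≤v h = lin (h ⊕ 0≤-* (0≤ι 2) (0≤-* 0≤t 0≤K) ⊕ 0≤-* (0≤ι 2) (0≤-* 0≤v 0≤K)) (solve (v ∷ t ∷ K ∷ x ∷ []) ring)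

  Θ-light-arith : ∀ t v s K x → 0ℚ ≤ K → 0ℚ ≤ x → v - s ≤ t → v - K * x - s ≤ t
  Θ-light-arith t v s K x h h′ h″ = lin (h″ ⊕ 0≤-* h h′) (solve (t ∷ v ∷ s ∷ K ∷ x ∷ []) ring)

  Θ-heavy-arith : ∀ t v T K x m s → 0ℚ ≤ t → 0ℚ ≤ T → 0ℚ ≤ K → 0ℚ ≤ s → 1ℚ ≤ m → ι 2 * v * K + T * K - x ≤ s * K → ι 2 * v * (K * K) - K * x - (T + m * s) * (K * K) ≤ t
  Θ-heavy-arith t v T K x m s h h₁ h₂ h₃ h₄ h₅ = lin (h ⊕ h₂ ·≤ h₅ ⊕ 0≤-* h₃ (0≤-sq K) ·≤ h₄ ⊕ 0≤-* (0≤-* (0≤ι 2) h₁) (0≤-sq K)) (solve (t ∷ v ∷ T ∷ K ∷ x ∷ m ∷ s ∷ []) ring)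

  total-excess-arith : ∀ F x t v s K f → 0ℚ ≤ K → t ≤ F * F → x ≤ F → v ≡ ι 2 * (K * K) → t - v + K * x + f * s ≤ F * F - ι 2 * (K * K) + K * F + f * s
  total-excess-arith F x t v s K f h h₁ h₂ refl = lin (h₁ ⊕ h ·≤ h₂) (solve (F ∷ x ∷ t ∷ s ∷ K ∷ f ∷ []) ring)

  -- F ≤ (1 + T) K makes F² + K F - 2 K² at most 3 T K² + T² K², hence at most 4 T K².
  Θ-upper-arith : ∀ t v K x s f T F → t - v + K * x + s * (K * K) ≤ F * F - ι 2 * (K * K) + K * F + f * (s * (K * K)) → F ≤ K + T * K → 0ℚ ≤ F → 0ℚ ≤ K → 0ℚ ≤ T → T ≤ 1ℚ → 0ℚ ≤ s →
    t ≤ v - K * x + (ι 4 * T + f * s) * (K * K)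
  Θ-upper-arith t v K x s f T F h hF 0≤F 0≤K 0≤T T≤1 0≤s = lin (h ⊕ 0≤F ·≤ hF ⊕ 0≤-+ (0≤-+ 0≤K 0≤K) (0≤-* 0≤T 0≤K) ·≤ hF ⊕ 0≤-* 0≤T (0≤-sq K) ·≤ T≤1 ⊕ 0≤-* 0≤s (0≤-sq K)) (solve (t ∷ v ∷ K ∷ x ∷ s ∷ f ∷ T ∷ F ∷ []) ring)

  not-small-arith : ∀ f v K → 0ℚ ≤ f → 1ℚ ≤ K → f * v ≡ 1ℚ → v * v * (K * K) ≤ 0ℚ → 1ℚ ≤ 0ℚ
  not-small-arith f v K 0≤f 1≤K e h = lin (0≤-* 0≤f 0≤f ·≤ h ⊕ (K * K) ·≡ sym e ⊕ (f * v * (K * K)) ·≡ sym e ⊕ 1≤K ⊕ ≤-trans 0≤1 1≤K ·≤ 1≤K) (solve (f ∷ v ∷ K ∷ []) ring)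

  heavy-heavy-arith : ∀ v T K x y z s f s′ t → 0ℚ ≤ v → 0ℚ ≤ K → 0ℚ ≤ T → v * K ≤ ι 2 * x → v * K ≤ ι 2 * y → 0ℚ ≤ y → x * y ≤ t → t ≤ ι 2 * v * (K * K) - K * z + (ι 4 * T + f * s′) * (K * K) →
    ι 2 * v * K + T * K - z ≤ s * K → ι 8 * (s + ι 4 * T + f * s′) ≤ v * v → v * v * (K * K) ≤ 0ℚ
  heavy-heavy-arith v T K x y z s f s′ t 0≤v 0≤K 0≤T hx hy 0≤y hxy ht hz hA = lin (0≤-* (0≤ι 2) (0≤-* 0≤v 0≤K) ·≤ hy ⊕ 0≤-* (0≤ι 4) 0≤y ·≤ hx ⊕ 0≤ι 8 ·≤ hxy ⊕ 0≤ι 8 ·≤ ht ⊕ 0≤-* (0≤ι 8) 0≤K ·≤ hz ⊕ 0≤-sq K ·≤ hA ⊕ 0≤-* (0≤-* (0≤ι 8) 0≤T) (0≤-sq K))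
    (solve (v ∷ T ∷ K ∷ x ∷ y ∷ z ∷ s ∷ f ∷ s′ ∷ t ∷ []) ring)

  heavy-light-arith : ∀ v t K x e → 0ℚ ≤ v → 0ℚ ≤ t → 0ℚ ≤ K → e ≤ v → ι 2 * v * K + t * K - x ≤ e * K → v * K ≤ ι 2 * x
  heavy-light-arith v t K x e 0≤v 0≤t 0≤K he h = lin (0≤ι 2 ·≤ h ⊕ 0≤-* (0≤ι 2) 0≤K ·≤ he ⊕ 0≤-* (0≤ι 2) (0≤-* 0≤t 0≤K) ⊕ 0≤-* 0≤v 0≤K) (solve (v ∷ t ∷ K ∷ x ∷ e ∷ []) ring)

  F-lower-arith : ∀ f v T K F t → 0ℚ ≤ f → f * v ≡ 1ℚ → 0ℚ ≤ T → 0ℚ ≤ K → 0ℚ ≤ F → ι 4 * T ≤ v → t ≤ (ι 2 * v * K + T * K) * F → ι 2 * v * (K * K) - ι 2 * T * (K * K) ≤ t → K * K ≤ K * (ι 2 * F)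
  F-lower-arith f v T K F t 0≤f e 0≤T 0≤K 0≤F hT h h′ =
    lin (0≤⅙ ·≤ (0≤-* (0≤ι 4) 0≤f ·≤ h ⊕ 0≤-* (0≤ι 4) 0≤f ·≤ h′ ⊕ 0≤-+ (0≤-* 0≤K 0≤F) (0≤-* (0≤ι 2) (0≤-sq K)) ·≤ fT ⊕ (ι 8 * (K * F)) ·≡ e ⊕ (ι 8 * (K * K)) ·≡ sym e) ⊕ 0≤-* 0≤½ (0≤-* 0≤K 0≤F)) (solve (f ∷ v ∷ T ∷ K ∷ F ∷ t ∷ []) ring)
    where
    0≤⅙ : 0ℚ ≤ ℤ.+ 1 / 6
    0≤⅙ = *≤* (ℤ.+≤+ z≤n)
    fT : f * (ι 4 * T) ≤ 1ℚ
    fT = ≤-trans (0≤f ·≤ hT) (≤-reflexive e)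

  too-light-arith : ∀ f s K F → 1ℚ ≤ K → K ≤ ι 2 * F → ι 24 * (f * s) ≤ 1ℚ → F ≤ f * (s * K) → 1ℚ ≤ 0ℚ
  too-light-arith f s K F h₁ h₂ h₃ h₄ = lin (h₁ ⊕ h₂ ⊕ h₂ ⊕ 0≤ι 4 ·≤ h₄ ⊕ 0≤⅙ ·≤ (≤-trans 0≤1 h₁ ·≤ h₃) ⊕ 0≤⅚ ·≤ ≤-trans 0≤1 h₁) (solve (f ∷ s ∷ K ∷ F ∷ []) ring)
    where
    0≤⅙ : 0ℚ ≤ ℤ.+ 1 / 6
    0≤⅙ = *≤* (ℤ.+≤+ z≤n)
    0≤⅚ : 0ℚ ≤ ℤ.+ 5 / 6
    0≤⅚ = *≤* (ℤ.+≤+ z≤n)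

  contradiction-arith : ∀ f s K F M c → 1ℚ ≤ K → K ≤ ι 2 * F → ι 24 * (f * s) ≤ 1ℚ → M + F ≤ f * (ι 2 * (s * K)) → - M ≤ c → ι 12 * c ≤ K → 1ℚ ≤ 0ℚ
  contradiction-arith f s K F M c h₁ h₂ h₃ h₄ h₅ h₆ = lin (h₁ ⊕ 0≤¼ ·≤ (0≤ι 6 ·≤ h₂ ⊕ 0≤ι 12 ·≤ h₄ ⊕ 0≤ι 12 ·≤ h₅ ⊕ h₆ ⊕ ≤-trans 0≤1 h₁ ·≤ h₃)) (solve (f ∷ s ∷ K ∷ F ∷ M ∷ c ∷ []) ring)
    where
    0≤¼ : 0ℚ ≤ ℤ.+ 1 / 4
    0≤¼ = *≤* (ℤ.+≤+ z≤n)

-- Heavy and light classes, the resulting character and the contradiction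

module Contradiction (setup : Setup) where
  open LaplaceBounds setup

  K : ℚ
  K = ι k

  -- σ measures how close, relative to K, each mass is to 0 or to U: dividing the error 6 τ K² of
  -- `gap-l` by a mass of at least ν K / 2 gives 12 φ τ. s₃ is the resulting relative error of Θ in
  -- a light class.
  σ s₃ : ℚ → ℚ → ℚ
  σ τ _ = ι 12 * φ * τ
  s₃ τ ρ = τ + ρ * σ τ ρ

  X-noncoprime : ∀ c → ¬ Coprime c q → X c ≡ 0ℚ
  X-noncoprime c h = ∑₁-≡0 x∞ (λ n _ _ → trans (cong (_* w n) (trans (𝟙-when (n ≈? c) (λ e → trans (cong (_* (Λ n * inv n)) (𝟙-no (coprime? n q) (λ cn → h (coprime-≈ e cn)))) (*-zeroˡ (Λ n * inv n)))) (*-zeroʳ (𝟙 (n ≈? c))))) (*-zeroˡ (w n)))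

  -- τ bounds the error terms relative to k and k², ρ bounds J / k, and D balances the two parts of the harmonic error in N≤.
  Regime : (l N D : ℕ) (τ ρ : ℚ) → Set
  Regime l N D τ ρ =
    (Coprime l q × (∀ n → N ℕ.< n → n ℕ.≤ x∞ → Prime n → ¬ n ≈ l)) ×
    (1 ℕ.≤ D × 0ℚ ≤ τ × τ ≤ 1ℚ × 1ℚ ≤ ρ) ×
    (C₁ ≤ τ * K ×
      C₄ * inv D * K + (C₄ * ι D + C₅) ≤ τ * K ×
      ι 2 * ν * (K * K) - τ * (K * K) ≤ ν * (quad 0ℚ - pw J * quad (ι J)) - C₃ * (K + 1ℚ) ×
      ι J + ι 4 ≤ ρ * K ×
      ρ * (ι 32 + ι 4 * ι N) ≤ τ * K ×
      ι 12 * C₆ ≤ K) ×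
    (σ τ ρ ≤ ν ×
      ι 8 * (σ τ ρ + ι 4 * τ + φ * s₃ τ ρ) ≤ ν * ν ×
      ι 2 * φ * (ι 4 * τ + s₃ τ ρ) ≤ ν ×
      ι 24 * (φ * σ τ ρ) ≤ 1ℚ ×
      ι 4 * τ ≤ ν)

  module _ (l N D : ℕ) (τ ρ : ℚ) (regime : Regime l N D τ ρ) where
    private
      cl : Coprime l q
      cl = proj₁ (proj₁ regime)

      none : ∀ n → N ℕ.< n → n ℕ.≤ x∞ → Prime n → ¬ n ≈ l
      none = proj₂ (proj₁ regime)

      1≤D : 1 ℕ.≤ D
      1≤D = proj₁ (proj₁ (proj₂ regime))

      0≤τ : 0ℚ ≤ τ
      0≤τ = proj₁ (proj₂ (proj₁ (proj₂ regime)))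

      τ≤1 : τ ≤ 1ℚ
      τ≤1 = proj₁ (proj₂ (proj₂ (proj₁ (proj₂ regime))))

      1≤ρ : 1ℚ ≤ ρ
      1≤ρ = proj₂ (proj₂ (proj₂ (proj₁ (proj₂ regime))))

      h₁ : C₁ ≤ τ * K
      h₁ = proj₁ (proj₁ (proj₂ (proj₂ regime)))

      h₂ : C₄ * inv D * K + (C₄ * ι D + C₅) ≤ τ * K
      h₂ = proj₁ (proj₂ (proj₁ (proj₂ (proj₂ regime))))

      h₃ : ι 2 * ν * (K * K) - τ * (K * K) ≤ ν * (quad 0ℚ - pw J * quad (ι J)) - C₃ * (K + 1ℚ)
      h₃ = proj₁ (proj₂ (proj₂ (proj₁ (proj₂ (proj₂ regime)))))

      h₄ : ι J + ι 4 ≤ ρ * K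
      h₄ = proj₁ (proj₂ (proj₂ (proj₂ (proj₁ (proj₂ (proj₂ regime))))))

      h₅ : ρ * (ι 32 + ι 4 * ι N) ≤ τ * K
      h₅ = proj₁ (proj₂ (proj₂ (proj₂ (proj₂ (proj₁ (proj₂ (proj₂ regime)))))))

      h₆ : ι 12 * C₆ ≤ K
      h₆ = proj₂ (proj₂ (proj₂ (proj₂ (proj₂ (proj₁ (proj₂ (proj₂ regime)))))))

      A₁ : σ τ ρ ≤ ν
      A₁ = proj₁ (proj₂ (proj₂ (proj₂ regime)))

      A₂ : ι 8 * (σ τ ρ + ι 4 * τ + φ * s₃ τ ρ) ≤ ν * ν
      A₂ = proj₁ (proj₂ (proj₂ (proj₂ (proj₂ regime))))

      A₃ : ι 2 * φ * (ι 4 * τ + s₃ τ ρ) ≤ ν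
      A₃ = proj₁ (proj₂ (proj₂ (proj₂ (proj₂ (proj₂ regime)))))

      A₄ : ι 24 * (φ * σ τ ρ) ≤ 1ℚ
      A₄ = proj₁ (proj₂ (proj₂ (proj₂ (proj₂ (proj₂ (proj₂ regime))))))

      A₅ : ι 4 * τ ≤ ν
      A₅ = proj₂ (proj₂ (proj₂ (proj₂ (proj₂ (proj₂ (proj₂ regime))))))

    σ₀ s₀ U : ℚ
    σ₀ = σ τ ρ
    s₀ = s₃ τ ρ
    U = ι 2 * ν * K + τ * K

    1≤K : 1ℚ ≤ K
    1≤K = 1≤ι 1≤k

    0≤K : 0ℚ ≤ K
    0≤K = 0≤ι k

    0≤φ : 0ℚ ≤ φ
    0≤φ = ≤-trans 0≤1 1≤φ

    0≤ρ : 0ℚ ≤ ρ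
    0≤ρ = ≤-trans 0≤1 1≤ρ

    0≤σ₀ : 0ℚ ≤ σ₀
    0≤σ₀ = 0≤-* (0≤-* (0≤ι 12) 0≤φ) 0≤τ

    0≤s₀ : 0ℚ ≤ s₀
    0≤s₀ = 0≤-+ 0≤τ (0≤-* 0≤ρ 0≤σ₀)

    absurd : 1ℚ ≤ 0ℚ → ⊥
    absurd h = <-irrefl refl (<-≤-trans (0<ι-suc 0) h)

    -- A factor of size at least ν K / 2 is cancelled from a product, with 1 / ν = φ.
    divide : ∀ ε y x → 0ℚ ≤ x → ν * K ≤ ι 2 * y → y * x ≤ ε * (K * K) → x ≤ ι 2 * φ * ε * K
    divide ε y x 0≤x hy h = cancel-ι-≤ {k} 1≤k (divide-arith φ ν K ε y x 0≤φ φν 0≤x hy h)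

    X≤U : ∀ e → Coprime e q → X e ≤ U
    X≤U e ce = lin (X≤ D e 1≤D ce ⊕ h₂) (((∀ x v c K d t → ι 2 * v * K + t + (x + (c * K + d)) ≡ x + ((ι 2 * v + c) * K + d + t)) ∋ solve-∀ ring) (X e) ν (C₄ * inv D) K (C₄ * ι D + C₅) (τ * K))

    Θ-lower : ∀ c → Coprime c q → ι 2 * ν * (K * K) - τ * (K * K) - ρ * K * X c ≤ Θ c
    Θ-lower c cc = lin (Θ≥ c cc ⊕ h₃ ⊕ 0≤X c ·≤ h₄) (((∀ t g r m x j → t + (g - j * x + r + x * j) ≡ r - m * x + (t + g + x * m)) ∋ solve-∀ ring)
      (Θ c) (ν * (quad 0ℚ - pw J * quad (ι J)) - C₃ * (K + 1ℚ)) (ι 2 * ν * (K * K) - τ * (K * K)) (ρ * K) (X c) (ι J + ι 4))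

    -- The absence of primes beyond N bounds X l independently of k. The factor ρ is included
    -- because `Θ-lower` charges ρ K per unit of mass.
    ρXl≤ : ρ * X l ≤ τ * K
    ρXl≤ = ≤-trans (0≤ρ ·≤ ≤-trans (∑₁-mono x∞ {g = β l} (λ n 1≤n _ → ≤-trans (0≤β l n 1≤n ·≤ pw≤1 (lg n)) (≤-reflexive (*-identityʳ (β l n)))))
      (≤-trans (≤-reflexive (∑₁-cong x∞ (λ n _ _ → sym (*-assoc (𝟙 (n ≈? l)) (χ₀ n) (Λ n * inv n)))))
        (∑-no-primes (λ n → 𝟙 (n ≈? l) * χ₀ n) N x∞ (ℕₚ.<-trans (ℕₚ.n<1+n x∞) x∞<B) (λ n → 0≤-* (0≤𝟙 (n ≈? l)) (0≤χ₀ n))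
          (λ n → ≤-trans (*-mono (0≤𝟙 (n ≈? l)) (𝟙≤1 (n ≈? l)) (0≤χ₀ n) (χ₀≤1 n)) (≤-reflexive (*-identityˡ 1ℚ)))
          (λ n N<n n≤ pr → trans (cong (_* χ₀ n) (𝟙-no (n ≈? l) (none n N<n n≤ pr))) (*-zeroˡ (χ₀ n)))))) h₅
      where open PrimePowers log

    F≤K : F ≤ K + τ * K
    F≤K = ≤-trans F≤ (≤-refl {K} ⊕ h₁)

    UF≤ : U * F ≤ ι 2 * ν * (K * K) + ι 4 * τ * (K * K)
    UF≤ = ≤-trans (0≤-+ (0≤-* (0≤-* (0≤ι 2) 0≤ν) 0≤K) (0≤-* 0≤τ 0≤K) ·≤ F≤K) (UF-arith ν τ K 0≤τ τ≤1 ν≤1)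

    -- U F is about 2 ν K²; where Θ c comes close to this value, every non-negative summand of the
    -- deficiency must be small.
    gap : ∀ {a a′ c} ε → Coprime a q → Coprime c q → a ℕ.* a′ ≈ c → ι 2 * ν * (K * K) - ε * (K * K) ≤ Θ c → X a * (U - X a′) ≤ (ι 4 * τ + ε) * (K * K)
    gap {a} {a′} {c} ε ca cc h hΘ = ≤-trans (deficiency {a} {a′} {c} U X≤U ca cc h)
      (lin (UF≤ ⊕ hΘ) (((∀ u t v T K e → (T + e) * K + (u + (v - e * K)) ≡ u - t + (v + T * K + t)) ∋ solve-∀ ring) (U * F) (Θ c) (ι 2 * ν * (K * K)) (ι 4 * τ) (K * K) ε))

    Θl-lower : ι 2 * ν * (K * K) - ι 2 * τ * (K * K) ≤ Θ l
    Θl-lower = lin (Θ-lower l cl ⊕ 0≤K ·≤ ρXl≤) (((∀ t v T K m x → t + (v - T * (K * K) - m * K * x + K * (m * x)) ≡ v - ι 2 * T * (K * K) + (t + K * (T * K))) ∋ solve-∀ ring) (Θ l) (ι 2 * ν * (K * K)) τ K ρ (X l))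

    gap-l : ∀ {a a′} → Coprime a q → a ℕ.* a′ ≈ l → X a * (U - X a′) ≤ ι 6 * τ * (K * K)
    gap-l {a} {a′} ca h = ≤-trans (gap {a} {a′} {l} (ι 2 * τ) ca cl h Θl-lower) (≤-reflexive (((∀ t K → (ι 4 * t + ι 2 * t) * K ≡ ι 6 * t * K) ∋ solve-∀ ring) τ (K * K)))

    -- Each X a turns out to be close to 0 or to 2 ν K.
    Heavy : ℕ → Set
    Heavy a = ν * K ≤ ι 2 * X a

    Heavy? : ∀ a → Dec (Heavy a)
    Heavy? a = ν * K ≤? ι 2 * X a

    Heavy-≈ : ∀ {a b} → a ≈ b → Heavy a → Heavy b
    Heavy-≈ e h = ≤-trans h (≤-reflexive (cong (ι 2 *_) (X-≈ e)))

    private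
      σ-value : ∀ f t K → ι 2 * f * (ι 6 * t) * K ≡ ι 12 * f * t * K
      σ-value = solve-∀ ring

      -- The factor X a being large, `gap-l` pushes the partner class up to the ceiling U.
      reflect : ∀ {a a′} → Coprime a q → Coprime a′ q → a ℕ.* a′ ≈ l → Heavy a → U - X a′ ≤ σ₀ * K
      reflect {a} {a′} ca ca′ h H = ≤-trans (divide (ι 6 * τ) (X a) (U - X a′) (0≤-diff (X≤U a′ ca′)) H (gap-l {a} {a′} ca h)) (≤-reflexive (σ-value φ τ K))

      near : ∀ {x} → U - x ≤ σ₀ * K → ν * K ≤ ι 2 * x
      near {x} h = near-arith ν τ K σ₀ x 0≤τ 0≤K A₁ 0≤ν h

      partner : ∀ {a} → Coprime a q → ∃ λ a′ → a ℕ.* a′ ≈ l × Coprime a′ q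
      partner {a} ca = proj₁ e ℕ.* l , unit-solution {proj₁ e} {a} l (proj₂ e) , coprime-* {proj₁ e} {l} (inverse-coprime {proj₁ e} {a} (proj₂ e)) cl
        where
        e : ∃ λ e → e ℕ.* a ≈ 1
        e = unit-inverse ca

      swap-≈ : ∀ {a b c} → a ℕ.* b ≈ c → b ℕ.* a ≈ c
      swap-≈ {a} {b} h = trans (≈-≡ (ℕₚ.*-comm b a)) h

    -- Reflection is applied twice: the partner is near U, hence heavy, and its own partner is a.
    heavy-lower : ∀ {a} → Coprime a q → Heavy a → U - X a ≤ σ₀ * K
    heavy-lower {a} ca H = by (partner ca)
      where
      by : (∃ λ a′ → a ℕ.* a′ ≈ l × Coprime a′ q) → U - X a ≤ σ₀ * K
      by (a′ , h , ca′) = reflect {a′} {a} ca′ ca (swap-≈ {a} {a′} h) (near (reflect {a} {a′} ca ca′ h H))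

    -- The partner is light as well, since otherwise reflection would make a heavy; so U - X of the
    -- partner is large and can be cancelled in `gap-l`.
    light-upper : ∀ {a} → Coprime a q → ¬ Heavy a → X a ≤ σ₀ * K
    light-upper {a} ca ¬H = by (partner ca)
      where
      by : (∃ λ a′ → a ℕ.* a′ ≈ l × Coprime a′ q) → X a ≤ σ₀ * K
      by (a′ , h , ca′) = ≤-trans (divide (ι 6 * τ) (U - X a′) (X a) (0≤X a) (light-arith ν τ K (X a′) 0≤τ 0≤K 0≤ν (<⇒≤ (≰⇒> ¬H′))) (≤-trans (≤-reflexive (*-comm (U - X a′) (X a))) (gap-l {a} {a′} ca h))) (≤-reflexive (σ-value φ τ K))
        where
        ¬H′ : ¬ Heavy a′
        ¬H′ H′ = ¬H (near (reflect {a′} {a} ca′ ca (swap-≈ {a} {a′} h) H′))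

    Θ-lower-light : ∀ {c} → Coprime c q → ¬ Heavy c → ι 2 * ν * (K * K) - s₀ * (K * K) ≤ Θ c
    Θ-lower-light {c} cc ¬H = lin (Θ-lower c cc ⊕ 0≤-* 0≤ρ 0≤K ·≤ light-upper cc ¬H) (((∀ t v T K m x s → t + (v - T * (K * K) - m * K * x + m * K * x) ≡ v - (T + m * s) * (K * K) + (t + m * K * (s * K))) ∋ solve-∀ ring) (Θ c) (ι 2 * ν * (K * K)) τ K ρ (X c) σ₀)

    -- One bound for both kinds of class: in a heavy class K X c is already about 2 ν K², so the
    -- left side is not positive.
    Θ-lower′ : ∀ {c} → Coprime c q → ι 2 * ν * (K * K) - K * X c - s₀ * (K * K) ≤ Θ c
    Θ-lower′ {c} cc = by (Heavy? c)
      where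
      by : Dec (Heavy c) → ι 2 * ν * (K * K) - K * X c - s₀ * (K * K) ≤ Θ c
      by (no ¬H) = Θ-light-arith (Θ c) (ι 2 * ν * (K * K)) (s₀ * (K * K)) K (X c) 0≤K (0≤X c) (Θ-lower-light cc ¬H)
      by (yes H) = Θ-heavy-arith (Θ c) ν τ K (X c) ρ σ₀ (0≤Θ c) 0≤τ 0≤K 0≤σ₀ 1≤ρ (heavy-lower cc H)

    -- Summing the lower bounds over all units leaves no room: they are nearly equalities.
    Θ-upper : ∀ {c} → c ℕ.< q → Coprime c q → Θ c ≤ ι 2 * ν * (K * K) - K * X c + (ι 4 * τ + φ * s₀) * (K * K)
    Θ-upper {c} c<q cc = Θ-upper-arith (Θ c) (ι 2 * ν * (K * K)) K (X c) s₀ φ τ F (≤-trans (≤-reflexive (sym (trans (cong (_* excess c) (𝟙-yes (coprime? c q) cc)) (*-identityˡ (excess c))))) (≤-trans (∑-term≤ q c c<q (λ i _ → 0≤excess i (coprime? i q)))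
        (≤-trans (≤-reflexive total) (total-excess-arith F (∑ q (λ i → χ₀ i * X i)) (∑ q (λ i → χ₀ i * Θ i)) (φ * (ι 2 * ν * (K * K))) (s₀ * (K * K)) K φ 0≤K Θ-part X-part (trans (((∀ f v K → f * (ι 2 * v * (K * K)) ≡ ι 2 * (f * v) * (K * K)) ∋ solve-∀ ring) φ ν K) (trans (cong (λ z → ι 2 * z * (K * K)) φν) (cong (_* (K * K)) (*-identityʳ (ι 2)))))))))
        F≤K 0≤F 0≤K 0≤τ τ≤1 0≤s₀
      where
      excess : ℕ → ℚ
      excess i = Θ i - ι 2 * ν * (K * K) + K * X i + s₀ * (K * K)
      0≤excess : ∀ i → (d : Dec (Coprime i q)) → 0ℚ ≤ χ₀ i * excess i
      0≤excess i (yes ci) = 0≤-* (0≤χ₀ i) (lin (Θ-lower′ ci) (((∀ t v x s → t - v + x + s + (v - x - s) ≡ 0ℚ + t) ∋ solve-∀ ring) (Θ i) (ι 2 * ν * (K * K)) (K * X i) (s₀ * (K * K))))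
      0≤excess i (no ¬ci) = ≤-reflexive (sym (trans (cong (_* excess i) (𝟙-no (coprime? i q) ¬ci)) (*-zeroˡ (excess i))))
      total : ∑ q (λ i → χ₀ i * excess i) ≡ ∑ q (λ i → χ₀ i * Θ i) - φ * (ι 2 * ν * (K * K)) + K * ∑ q (λ i → χ₀ i * X i) + φ * (s₀ * (K * K))
      total = trans (∑-cong q (λ i _ → ((∀ c t v K x s → c * (t - v + K * x + s) ≡ c * t - c * v + K * (c * x) + c * s) ∋ solve-∀ ring) (χ₀ i) (Θ i) (ι 2 * ν * (K * K)) K (X i) (s₀ * (K * K))))
        (trans (∑-+ q (λ i → χ₀ i * Θ i - χ₀ i * (ι 2 * ν * (K * K)) + K * (χ₀ i * X i)) (λ i → χ₀ i * (s₀ * (K * K)))) (cong₂ _+_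
          (trans (∑-+ q (λ i → χ₀ i * Θ i - χ₀ i * (ι 2 * ν * (K * K))) (λ i → K * (χ₀ i * X i))) (cong₂ _+_ (trans (∑-sub q (λ i → χ₀ i * Θ i) (λ i → χ₀ i * (ι 2 * ν * (K * K)))) (cong (λ z → ∑ q (λ i → χ₀ i * Θ i) - z) (∑-*ʳ q (ι 2 * ν * (K * K)) χ₀))) (∑-*ˡ q K (λ i → χ₀ i * X i))))
          (∑-*ʳ q (s₀ * (K * K)) χ₀)))
      drop : ∀ i {y} → 0ℚ ≤ y → χ₀ i * y ≤ y
      drop i = x≤1⇒xy≤y (χ₀≤1 i)
      Θ-part : ∑ q (λ i → χ₀ i * Θ i) ≤ F * F
      Θ-part = ≤-trans (∑-mono q (λ i _ → drop i (0≤Θ i))) (≤-reflexive ∑-Θ)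
      X-part : ∑ q (λ i → χ₀ i * X i) ≤ F
      X-part = ≤-trans (∑-mono q (λ i _ → drop i (0≤X i))) (≤-reflexive ∑-X)

    private
      not-small : ν * ν * (K * K) ≤ 0ℚ → ⊥
      not-small h = absurd (not-small-arith φ ν K 0≤φ 1≤K φν h)

    -- If a b were heavy, the term K X in `Θ-upper` would use up 2 ν K² and leave Θ near 0, against
    -- X a X b ≥ ν² K² / 4.
    heavy-heavy : ∀ {a b} → Coprime a q → Coprime b q → Heavy a → Heavy b → ¬ Heavy (a ℕ.* b)
    heavy-heavy {a} {b} ca cb Ha Hb Hab = not-small (heavy-heavy-arith ν τ K (X a) (X b) (X c) σ₀ φ s₀ (Θ c) 0≤ν 0≤K 0≤τ Ha Hb (0≤X b) (XX≤Θ {a} {b} {c} ca (sym (%-≈ (a ℕ.* b)))) (Θ-upper {c} (ℕ÷.m%n<n (a ℕ.* b) q) cc) (heavy-lower cc (Heavy-≈ (sym (%-≈ (a ℕ.* b))) Hab)) A₂)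
      where
      c : ℕ
      c = (a ℕ.* b) ℕ.% q
      cc : Coprime c q
      cc = coprime-≈ (sym (%-≈ (a ℕ.* b))) (coprime-* ca cb)

    -- If a b were light, Θ would be nearly maximal there, and the gap inequality would push X b up
    -- to U.
    heavy-light : ∀ {a b} → Coprime a q → Coprime b q → Heavy a → ¬ Heavy b → Heavy (a ℕ.* b)
    heavy-light {a} {b} ca cb Ha ¬Hb = by (Heavy? (a ℕ.* b))
      where
      by : Dec (Heavy (a ℕ.* b)) → Heavy (a ℕ.* b)
      by (yes H) = H
      by (no ¬H) = ⊥-elim (¬Hb (heavy-light-arith ν τ K (X b) (ι 2 * φ * (ι 4 * τ + s₀)) 0≤ν 0≤τ 0≤K A₃ (divide (ι 4 * τ + s₀) (X a) (U - X b) (0≤-diff (X≤U b cb)) Ha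
          (gap {a} {b} {a ℕ.* b} s₀ ca (coprime-* ca cb) refl (Θ-lower-light (coprime-* ca cb) ¬H)))))

    one-light : ¬ Heavy 1
    one-light H = heavy-heavy {1} {1} coprime-1 coprime-1 H H H

    -- The inverse e of b is light, since otherwise e b ≡ 1 would be heavy; if a b were heavy, so
    -- would be (a b) e ≡ a.
    light-light : ∀ {a b} → Coprime a q → Coprime b q → ¬ Heavy a → ¬ Heavy b → ¬ Heavy (a ℕ.* b)
    light-light {a} {b} ca cb ¬Ha ¬Hb Hab = by (unit-inverse cb)
      where
      by : (∃ λ e → e ℕ.* b ≈ 1) → ⊥
      by (e , h) = ¬Ha (Heavy-≈ {a ℕ.* b ℕ.* e} {a} abe≈a (heavy-light {a ℕ.* b} {e} (coprime-* ca cb) ce Hab (λ He → one-light (Heavy-≈ {e ℕ.* b} {1} h (heavy-light {e} {b} ce cb He ¬Hb)))))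
        where
        ce : Coprime e q
        ce = inverse-coprime {e} {b} h
        abe≈a : a ℕ.* b ℕ.* e ≈ a
        abe≈a = trans (≈-≡ (((∀ a b e → a ℕ.* b ℕ.* e ≡ a ℕ.* (e ℕ.* b)) ∋ solve-ℕ) a b e)) (trans (≈-* {a} {a} {e ℕ.* b} {1} refl h) (≈-≡ (ℕₚ.*-identityʳ a)))

    -- The deficiency is non-negative, so Θ l ≤ U F; here Θ l is about 2 ν K² and U about 2 ν K.
    F-lower : K ≤ ι 2 * F
    F-lower = cancel-ι-≤ {k} 1≤k (F-lower-arith φ ν τ K F (Θ l) 0≤φ φν 0≤τ 0≤K 0≤F A₅ Θl≤ Θl-lower)
      where
      Θl≤ : Θ l ≤ U * F
      Θl≤ = lin (0≤-* (0≤X 1) (0≤-diff (X≤U l cl)) ⊕ deficiency {1} {l} {l} U X≤U coprime-1 cl (≈-≡ (ℕₚ.*-identityˡ l))) (((∀ u t x → u + (0ℚ + x) ≡ t + (x + (u - t))) ∋ solve-∀ ring) (U * F) (Θ l) (X 1 * (U - X l)))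

    χ : ℕ → ℚ
    χ n = χ₀ n * (1ℚ - ι 2 * 𝟙 (Heavy? n))

    χ-noncoprime : ∀ {n} → ¬ Coprime n q → χ n ≡ 0ℚ
    χ-noncoprime {n} h = trans (cong (_* (1ℚ - ι 2 * 𝟙 (Heavy? n))) (𝟙-no (coprime? n q) h)) (*-zeroˡ (1ℚ - ι 2 * 𝟙 (Heavy? n)))

    χ-light : ∀ {n} → Coprime n q → ¬ Heavy n → χ n ≡ 1ℚ
    χ-light {n} cn h = cong₂ (λ u v → u * (1ℚ - ι 2 * v)) (𝟙-yes (coprime? n q) cn) (𝟙-no (Heavy? n) h)

    χ-heavy : ∀ {n} → Coprime n q → Heavy n → χ n ≡ - 1ℚ
    χ-heavy {n} cn h = cong₂ (λ u v → u * (1ℚ - ι 2 * v)) (𝟙-yes (coprime? n q) cn) (𝟙-yes (Heavy? n) h)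

    private
      light-heavy : ∀ {a b} → Coprime a q → Coprime b q → ¬ Heavy a → Heavy b → Heavy (a ℕ.* b)
      light-heavy {a} {b} ca cb ¬Ha Hb = subst Heavy (ℕₚ.*-comm b a) (heavy-light cb ca Hb ¬Ha)

      χ-product : ∀ a b → Dec (Coprime a q) → Dec (Coprime b q) → Dec (Heavy a) → Dec (Heavy b) → χ (a ℕ.* b) ≡ χ a * χ b
      χ-product a b (no ¬ca) _ _ _ = trans (χ-noncoprime (λ c → ¬ca (coprime-*ˡ a b c))) (sym (trans (cong (_* χ b) (χ-noncoprime ¬ca)) (*-zeroˡ (χ b))))
      χ-product a b (yes _) (no ¬cb) _ _ = trans (χ-noncoprime (λ c → ¬cb (coprime-*ʳ a b c))) (sym (trans (cong (χ a *_) (χ-noncoprime ¬cb)) (*-zeroʳ (χ a))))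
      χ-product a b (yes ca) (yes cb) (yes Ha) (yes Hb) = trans (χ-light (coprime-* ca cb) (heavy-heavy ca cb Ha Hb)) (sym (cong₂ _*_ (χ-heavy ca Ha) (χ-heavy cb Hb)))
      χ-product a b (yes ca) (yes cb) (yes Ha) (no ¬Hb) = trans (χ-heavy (coprime-* ca cb) (heavy-light ca cb Ha ¬Hb)) (sym (cong₂ _*_ (χ-heavy ca Ha) (χ-light cb ¬Hb)))
      χ-product a b (yes ca) (yes cb) (no ¬Ha) (yes Hb) = trans (χ-heavy (coprime-* ca cb) (light-heavy ca cb ¬Ha Hb)) (sym (cong₂ _*_ (χ-light ca ¬Ha) (χ-heavy cb Hb)))
      χ-product a b (yes ca) (yes cb) (no ¬Ha) (no ¬Hb) = trans (χ-light (coprime-* ca cb) (light-light ca cb ¬Ha ¬Hb)) (sym (cong₂ _*_ (χ-light ca ¬Ha) (χ-light cb ¬Hb)))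

      χ-value : ∀ n → Dec (Coprime n q) → Dec (Heavy n) → χ n ≡ 1ℚ ⊎ χ n ≡ 0ℚ ⊎ χ n ≡ - 1ℚ
      χ-value n (no ¬cn) _ = inj₂ (inj₁ (χ-noncoprime ¬cn))
      χ-value n (yes cn) (yes H) = inj₂ (inj₂ (χ-heavy cn H))
      χ-value n (yes cn) (no ¬H) = inj₁ (χ-light cn ¬H)

    χ-mult : ∀ a b → χ (a ℕ.* b) ≡ χ a * χ b
    χ-mult a b = χ-product a b (coprime? a q) (coprime? b q) (Heavy? a) (Heavy? b)

    χ-≈ : ∀ {a b} → a ≈ b → χ a ≡ χ b
    χ-≈ {a} {b} e = cong₂ (λ u v → u * (1ℚ - ι 2 * v)) (χ₀-≈ e) (𝟙-cong (Heavy? a) (Heavy? b) (Heavy-≈ e) (Heavy-≈ (sym e)))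

    private
      X-light : ∀ c → Dec (Coprime c q) → ¬ (Coprime c q × Heavy c) → X c ≤ χ₀ c * (σ₀ * K)
      X-light c (no ¬cc) _ = ≤-trans (≤-reflexive (X-noncoprime c ¬cc)) (0≤-* (0≤χ₀ c) (0≤-* 0≤σ₀ 0≤K))
      X-light c (yes cc) h = ≤-trans (light-upper cc (λ H → h (cc , H))) (≤-reflexive (sym (trans (cong (_* (σ₀ * K)) (𝟙-yes (coprime? c q) cc)) (*-identityˡ (σ₀ * K)))))

      too-light : F ≤ φ * (σ₀ * K) → ⊥
      too-light h = absurd (too-light-arith φ σ₀ K F 1≤K F-lower A₄ h)

      -- Multiplication by a heavy class permutes the classes and changes the sign of χ. Without
      -- heavy classes F would be at most φ σ K, against `F-lower`.
      zero-sum : Dec (∃ λ c → c ℕ.< q × Coprime c q × Heavy c) → ∑ q χ ≡ 0ℚ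
      zero-sum (yes (h , _ , ch , H)) = lin≡ {A = ½ * ∑ q χ} {B = ½ * - ∑ q χ} (cong (½ *_) antisym) (((∀ s → 0ℚ + ½ * s ≡ s + ½ * - s) ∋ solve-∀ ring) (∑ q χ))
        where
        antisym : ∑ q χ ≡ - ∑ q χ
        antisym = trans (sym (∑-unit χ ch)) (trans (∑-cong q (λ c _ → trans (χ-≈ (%-≈ (h ℕ.* c))) (trans (χ-mult h c) (trans (cong (_* χ c) (χ-heavy ch H)) (((∀ x → - 1ℚ * x ≡ - x) ∋ solve-∀ ring) (χ c)))))) (∑-neg q χ))
      zero-sum (no none-heavy) = ⊥-elim (too-light (≤-trans (≤-reflexive (sym ∑-X)) (≤-trans (∑-mono q (λ c c<q → X-light c (coprime? c q) (λ { (cc , H) → none-heavy (c , c<q , cc , H) }))) (≤-reflexive (∑-*ʳ q (σ₀ * K) χ₀)))))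

    𝝌 : RealCharacter q
    𝝌 = record
      { χ = χ
      ; χ-* = χ-mult
      ; χ-+q = λ n → χ-≈ (≈-+q n)
      ; χ-values = λ n → χ-value n (coprime? n q) (Heavy? n)
      ; χ-1 = χ-light coprime-1 one-light
      ; χ-∑ = zero-sum (ℕₚ.anyUpTo? (λ c → coprime? c q ×-dec Heavy? c) q)
      }

    private
      χΛ : ℕ → ℚ
      χΛ n = χ n * (Λ n * inv n)

      Mχ : ℚ
      Mχ = ∑₁ x∞ (λ n → χΛ n * w n)

      S-bound′ : ∀ x → suc x ℕ.< B → ∣ ∑₁ x χΛ ∣ ≤ C₆
      S-bound′ = CharacterSums.S-bound q 𝝌 log

      Mχ-bound : ∣ Mχ ∣ ≤ C₆
      Mχ-bound = abs-resp (sym (weighted χΛ)) (≤-trans (abs-sum (∑-abs≤ J {g = λ j → p j * C₆} (λ j j<J → abs-mul (abs-nonneg (0≤p j) ≤-refl) (S-bound′ (top j) (top<B j<J)))) (abs-mul (abs-nonneg (0≤pw J) ≤-refl) (S-bound′ x∞ x∞<B)))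
        (≤-reflexive (trans (cong (_+ pw J * C₆) (trans (∑-*ʳ J C₆ p) (cong (_* C₆) (∑-p J)))) (((∀ c w → (1ℚ - w) * c + w * c ≡ c) ∋ solve-∀ ring) C₆ (pw J)))))

      χ-χ₀ : ∀ n → χ₀ n * χ n ≡ χ n
      χ-χ₀ n = by (coprime? n q)
        where
        by : Dec (Coprime n q) → χ₀ n * χ n ≡ χ n
        by (yes cn) = trans (cong (_* χ n) (𝟙-yes (coprime? n q) cn)) (*-identityˡ (χ n))
        by (no ¬cn) = trans (cong (χ₀ n *_) (χ-noncoprime ¬cn)) (trans (*-zeroʳ (χ₀ n)) (sym (χ-noncoprime ¬cn)))

      Mχ-classes : Mχ ≡ ∑ q (λ c → χ c * X c)
      Mχ-classes = sym (trans (∑-cong q (λ c _ → sym (∑-*ˡ x∞ (χ c) (λ n → β c n * w n)))) (trans (∑-swap q x∞ (λ c n → χ c * (β c n * w n))) (∑₁-cong x∞ (λ n _ _ →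
        trans (∑-cong q (λ c _ → ((∀ x i b w → x * (i * b * w) ≡ i * x * (b * w)) ∋ solve-∀ ring) (χ c) (𝟙 (n ≈? c)) (b n) (w n))) (trans (∑-*ʳ q (b n * w n) (λ c → 𝟙 (n ≈? c) * χ c))
          (trans (cong (_* (b n * w n)) (trans (∑-class n χ) (χ-≈ (%-≈ n)))) (trans (((∀ x c l w → x * (c * l * w) ≡ c * x * l * w) ∋ solve-∀ ring) (χ n) (χ₀ n) (Λ n * inv n) (w n)) (cong (λ z → z * (Λ n * inv n) * w n) (χ-χ₀ n)))))))))

      class-bound : ∀ c → Dec (Coprime c q) → Dec (Heavy c) → χ c * X c + X c ≤ χ₀ c * (ι 2 * (σ₀ * K))
      class-bound c (no ¬cc) _ = ≤-trans (≤-reflexive (trans (cong (λ x → χ c * x + x) (X-noncoprime c ¬cc)) (trans (+-identityʳ (χ c * 0ℚ)) (*-zeroʳ (χ c))))) (0≤-* (0≤χ₀ c) (0≤-* (0≤ι 2) (0≤-* 0≤σ₀ 0≤K)))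
      class-bound c (yes cc) (yes H) = ≤-trans (≤-reflexive (trans (cong (λ y → y * X c + X c) (χ-heavy cc H)) (((∀ x → - 1ℚ * x + x ≡ 0ℚ) ∋ solve-∀ ring) (X c)))) (0≤-* (0≤χ₀ c) (0≤-* (0≤ι 2) (0≤-* 0≤σ₀ 0≤K)))
      class-bound c (yes cc) (no ¬H) = ≤-trans (≤-reflexive (trans (cong (λ y → y * X c + X c) (χ-light cc ¬H)) (((∀ x → 1ℚ * x + x ≡ ι 2 * x) ∋ solve-∀ ring) (X c))))
        (≤-trans (0≤ι 2 ·≤ light-upper cc ¬H) (≤-reflexive (sym (trans (cong (_* (ι 2 * (σ₀ * K))) (𝟙-yes (coprime? c q) cc)) (*-identityˡ (ι 2 * (σ₀ * K)))))))

      -- The sum of (χ c + 1) X c loses all heavy classes and doubles the light ones, which are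
      -- small. As Mχ is bounded by C₆, this contradicts F ≥ K / 2.
      M+F : Mχ + F ≤ φ * (ι 2 * (σ₀ * K))
      M+F = ≤-trans (≤-reflexive (trans (cong₂ _+_ Mχ-classes (sym ∑-X)) (sym (∑-+ q (λ c → χ c * X c) X)))) (≤-trans (∑-mono q (λ c _ → class-bound c (coprime? c q) (Heavy? c))) (≤-reflexive (∑-*ʳ q (ι 2 * (σ₀ * K)) χ₀)))

    contradiction : ⊥
    contradiction = absurd (contradiction-arith φ σ₀ K F Mχ C₆ 1≤K F-lower A₄ M+F (≤-trans (-≤abs Mχ) Mχ-bound) h₆)

-- For m = 4 t with t = 64 W, 2^m is a product of four factors 2^t: one dominates 64 W, the others
-- dominate t + 1 each, while m + 1 ≤ 4 (t + 1).
cubic≤exponential : ∀ W → ∃ λ m → W ℕ.* (suc m ℕ.* suc m ℕ.* suc m) ℕ.≤ 2 ℕ.^ m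
cubic≤exponential W = 4 ℕ.* t , (begin
  W ℕ.* (suc (4 ℕ.* t) ℕ.* suc (4 ℕ.* t) ℕ.* suc (4 ℕ.* t))       ≤⟨ ℕₚ.*-monoʳ-≤ W (ℕₚ.*-mono-≤ (ℕₚ.*-mono-≤ s≤ s≤) s≤) ⟩
  W ℕ.* (4 ℕ.* u ℕ.* (4 ℕ.* u) ℕ.* (4 ℕ.* u))                     ≡⟨ ((∀ W u → W ℕ.* (4 ℕ.* u ℕ.* (4 ℕ.* u) ℕ.* (4 ℕ.* u)) ≡ 64 ℕ.* W ℕ.* (u ℕ.* (u ℕ.* u))) ∋ solve-ℕ) W u ⟩
  t ℕ.* (u ℕ.* (u ℕ.* u))                                         ≤⟨ ℕₚ.*-mono-≤ t≤ (ℕₚ.*-mono-≤ u≤ (ℕₚ.*-mono-≤ u≤ u≤)) ⟩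
  2 ℕ.^ t ℕ.* (2 ℕ.^ t ℕ.* (2 ℕ.^ t ℕ.* 2 ℕ.^ t))                 ≡⟨ cong (λ z → 2 ℕ.^ t ℕ.* (2 ℕ.^ t ℕ.* (2 ℕ.^ t ℕ.* z))) (ℕₚ.*-identityʳ (2 ℕ.^ t)) ⟨
  (2 ℕ.^ t) ℕ.^ 4                                                 ≡⟨ ℕₚ.^-*-assoc 2 t 4 ⟩
  2 ℕ.^ (t ℕ.* 4)                                                 ≡⟨ cong (2 ℕ.^_) (ℕₚ.*-comm t 4) ⟩
  2 ℕ.^ (4 ℕ.* t)                                                 ∎)
  where
  open ℕₚ.≤-Reasoning
  t u : ℕ
  t = 64 ℕ.* W
  u = suc t
  s≤ : suc (4 ℕ.* t) ℕ.≤ 4 ℕ.* u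
  s≤ = ℕₚ.≤-trans (ℕₚ.m≤n+m (suc (4 ℕ.* t)) 3) (ℕₚ.≤-reflexive (((∀ t → 3 ℕ.+ suc (4 ℕ.* t) ≡ 4 ℕ.* suc t) ∋ solve-ℕ) t))
  u≤ : u ℕ.≤ 2 ℕ.^ t
  u≤ = n<2^n t
  t≤ : t ℕ.≤ 2 ℕ.^ t
  t≤ = ℕₚ.<⇒≤ u≤

-- Choice of the parameters

private
  undo-R : ∀ R t c K → 0ℚ ≤ t → R * t ≡ 1ℚ → R * c ≤ K → c ≤ t * K
  undo-R R t c K 0≤t e h = lin (0≤t ·≤ h ⊕ c ·≡ sym e) (solve (R ∷ t ∷ c ∷ K ∷ []) ring)

  C₄-arith : ∀ R t c i d y K → 0ℚ ≤ t → 0ℚ ≤ i → 0ℚ ≤ K → R * t ≡ 1ℚ → d * i ≡ 1ℚ → ι 2 * R * c ≤ d → ι 2 * R * y ≤ K → c * i * K + y ≤ t * K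
  C₄-arith R t c i d y K 0≤t 0≤i 0≤K e e′ h h′ = lin (0≤-* 0≤½ 0≤t ·≤ h′ ⊕ 0≤-* (0≤-* (0≤-* 0≤½ 0≤t) 0≤i) 0≤K ·≤ h ⊕ (c * i * K) ·≡ sym e ⊕ y ·≡ sym e ⊕ (½ * t * K) ·≡ e′) (solve (R ∷ t ∷ c ∷ i ∷ d ∷ y ∷ K ∷ []) ring)

  quad-bound : ∀ K m → 0ℚ ≤ K → 0ℚ ≤ m → 1ℚ ≤ K → m * K * (m * K) + ι 2 * (K - 1ℚ) * (m * K) + (K - 1ℚ) * (ι 2 * K - 1ℚ) ≤ ι 2 * ((m + 1ℚ) * (m + 1ℚ)) * (K * K)
  quad-bound K m 0≤K 0≤m 1≤K = lin (0≤-* (0≤-sq m) (0≤-sq K) ⊕ 0≤-* (0≤-* (0≤ι 2) 0≤m) (0≤-sq K) ⊕ 0≤-* (0≤ι 2) (0≤-* 0≤m 0≤K) ⊕ 1≤K ⊕ 0≤-* (0≤ι 2) 0≤K) (solve (K ∷ m ∷ []) ring)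

  second-moment-final : ∀ v t K w c g → 0ℚ ≤ v → v ≤ 1ℚ → 0ℚ ≤ t → 0ℚ ≤ K → w * g ≤ ½ * t * (K * K) → ι 3 * K + c * (K + 1ℚ) ≤ ½ * t * (K * K) →
    ι 2 * v * (K * K) - t * (K * K) ≤ v * ((0ℚ * 0ℚ + ι 2 * (K - 1ℚ) * 0ℚ + (K - 1ℚ) * (ι 2 * K - 1ℚ)) - w * g) - c * (K + 1ℚ)
  second-moment-final v t K w c g 0≤v v≤1 0≤t 0≤K hg hs = lin (0≤v ·≤ hg ⊕ 0≤-* (0≤-* 0≤½ 0≤t) (0≤-sq K) ·≤ v≤1 ⊕ 0≤-* (0≤ι 3) 0≤K ·≤ v≤1 ⊕ hs ⊕ 0≤v) (solve (v ∷ t ∷ K ∷ w ∷ c ∷ g ∷ []) ring)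

  second-moment-arith : ∀ v t K m w c R j → 0ℚ ≤ v → v ≤ 1ℚ → 0ℚ ≤ K → 0ℚ ≤ m → 0ℚ ≤ w → 0ℚ ≤ c → 0ℚ ≤ t → 1ℚ ≤ K → R * t ≡ 1ℚ → j ≡ m * K → ι 4 * ((m + 1ℚ) * (m + 1ℚ)) * w * R ≤ 1ℚ → ι 2 * R * (ι 3 + ι 2 * c) ≤ K →
    ι 2 * v * (K * K) - t * (K * K) ≤ v * ((0ℚ * 0ℚ + ι 2 * (K - 1ℚ) * 0ℚ + (K - 1ℚ) * (ι 2 * K - 1ℚ)) - w * (j * j + ι 2 * (K - 1ℚ) * j + (K - 1ℚ) * (ι 2 * K - 1ℚ))) - c * (K + 1ℚ)
  second-moment-arith v t K m w c R j 0≤v v≤1 0≤K 0≤m 0≤w 0≤c 0≤t 1≤K e refl tl h = second-moment-final v t K w c (m * K * (m * K) + ι 2 * (K - 1ℚ) * (m * K) + (K - 1ℚ) * (ι 2 * K - 1ℚ)) 0≤v v≤1 0≤t 0≤K wq small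
    where
    wq : w * (m * K * (m * K) + ι 2 * (K - 1ℚ) * (m * K) + (K - 1ℚ) * (ι 2 * K - 1ℚ)) ≤ ½ * t * (K * K)
    wq = ≤-trans (0≤w ·≤ quad-bound K m 0≤K 0≤m 1≤K) (scale ((m + 1ℚ) * (m + 1ℚ)) tl)
      where
      scale : ∀ a → ι 4 * a * w * R ≤ 1ℚ → w * (ι 2 * a * (K * K)) ≤ ½ * t * (K * K)
      scale a h = lin (0≤-* (0≤-* 0≤½ 0≤t) (0≤-sq K) ·≤ h ⊕ (ι 2 * w * a * (K * K)) ·≡ sym e) (solve (a ∷ w ∷ R ∷ t ∷ K ∷ []) ring)
    small : ι 3 * K + c * (K + 1ℚ) ≤ ½ * t * (K * K)
    small = lin (0≤-* (0≤-* 0≤½ 0≤t) 0≤K ·≤ h ⊕ ((ι 3 + ι 2 * c) * K) ·≡ sym e ⊕ 0≤c ·≤ 1≤K) (solve (c ∷ R ∷ t ∷ K ∷ []) ring)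

  T₃-arith : ∀ f v x → f * v ≡ 1ℚ → 0ℚ ≤ v → ι 12 * ι 24 * (f * (f * (f * (f * x)))) ≤ 1ℚ → ι 12 * ι 24 * (f * (f * (f * x))) ≤ v
  T₃-arith f v x e 0≤v h = lin (0≤v ·≤ h ⊕ (ι 12 * ι 24 * (f * (f * (f * x)))) ·≡ sym e) (solve (f ∷ v ∷ x ∷ []) ring)

  T₂-arith : ∀ f v y → f * v ≡ 1ℚ → 0ℚ ≤ v → ι 12 * ι 24 * (f * y) ≤ v → ι 12 * ι 24 * y ≤ v * v
  T₂-arith f v y e 0≤v h = lin (0≤v ·≤ h ⊕ (ι 12 * ι 24 * y) ·≡ sym e) (solve (f ∷ v ∷ y ∷ []) ring)

  A₁-arith : ∀ y x₁ x₂ x₃ v f t → y ≡ f * t → y ≤ x₁ → x₁ ≤ x₂ → x₂ ≤ x₃ → 0ℚ ≤ x₃ → ι 12 * ι 24 * x₃ ≤ v → ι 12 * f * t ≤ v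
  A₁-arith y x₁ x₂ x₃ v f t refl h₁ h₂ h₃ h₄ h₅ = lin (0≤ι 12 ·≤ (h₁ ⊕ h₂ ⊕ h₃) ⊕ h₅ ⊕ 0≤ι 12 ·≤ (0≤ι 23 ·≤ h₄)) (solve (x₁ ∷ x₂ ∷ x₃ ∷ v ∷ f ∷ t ∷ []) ring)

  A₂-arith : ∀ f t m w → 0ℚ ≤ f * (f * (m * t)) → t ≤ m * t → f * t ≤ f * (m * t) → m * t ≤ f * (m * t) → f * (m * t) ≤ f * (f * (m * t)) → ι 12 * ι 24 * (f * (f * (m * t))) ≤ w →
    ι 8 * (ι 12 * f * t + ι 4 * t + f * (t + m * (ι 12 * f * t))) ≤ w
  A₂-arith f t m w h₀ h₁ h₂ h₃ h₄ h₅ = lin (ι104 ·≤ h₂ ⊕ 0≤ι 32 ·≤ h₁ ⊕ 0≤ι 32 ·≤ h₃ ⊕ 0≤-+ ι104 (0≤ι 32) ·≤ h₄ ⊕ h₅ ⊕ 0≤ι 56 ·≤ h₀) (solve (f ∷ t ∷ m ∷ w ∷ []) ring)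
    where
    ι104 : 0ℚ ≤ ι 8 * ι 13
    ι104 = 0≤-* (0≤ι 8) (0≤ι 13)

  A₃-arith : ∀ f t m v → 0ℚ ≤ f * (f * (f * (m * t))) → f * t ≤ f * (m * t) → f * (m * t) ≤ f * (f * (m * t)) → f * (f * (m * t)) ≤ f * (f * (f * (m * t))) → ι 12 * ι 24 * (f * (f * (f * (m * t)))) ≤ v →
    ι 2 * f * (ι 4 * t + (t + m * (ι 12 * f * t))) ≤ v
  A₃-arith f t m v h₀ h₁ h₂ h₃ h₄ = lin (0≤ι 10 ·≤ h₁ ⊕ 0≤ι 10 ·≤ h₂ ⊕ 0≤ι 34 ·≤ h₃ ⊕ h₄ ⊕ 0≤-* (0≤ι 2) (0≤ι 127) ·≤ h₀) (solve (f ∷ t ∷ m ∷ v ∷ []) ring)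

module Parameters (q : ℕ) {{q≢0 : ℕ.NonZero q}} (l N : ℕ) where
  open Residues q

  private
    n₁′ = archimedean (ι 12 * ι 24 * (φ * (φ * (φ * φ))))

  n₁ : ℕ
  n₁ = suc (proj₁ n₁′)

  -- ρ τ = 1 / n₁ has to be small against φ^-4, while the tail r^J ≤ 2^-m times quad J, at most 2 M²
  -- K², has to fall below τ K² / 2 = K² / (2 n₁ M). Both hold as soon as 4 n₁ M³ ≤ 2^m with M = m +
  -- 1.
  m M n₂ : ℕ
  m = proj₁ (cubic≤exponential (4 ℕ.* n₁))
  M = suc m
  n₂ = n₁ ℕ.* M

  ρ τ R : ℚ
  ρ = ι M
  τ = inv n₂
  R = ι n₂

  1≤n₂ : 1 ℕ.≤ n₂
  1≤n₂ = 1≤* {n₁} {M} (s≤s z≤n) (s≤s z≤n)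

  Rτ : R * τ ≡ 1ℚ
  Rτ = ι-inv 1≤n₂

  0≤τ : 0ℚ ≤ τ
  0≤τ = 0≤inv n₂

  0≤R : 0ℚ ≤ R
  0≤R = 0≤ι n₂

  1≤ρ : 1ℚ ≤ ρ
  1≤ρ = 1≤ι {M} (s≤s z≤n)

  -- Large enough that the slope error C₄ / D is at most τ / 2; the constant C₄ D + C₅ this creates
  -- is left to k.
  D₀ : ℕ
  D₀ = suc (proj₁ (archimedean (ι 2 * R * C₄)))

  D-large : ι 2 * R * C₄ ≤ ι D₀
  D-large = ≤-trans (proj₂ (archimedean (ι 2 * R * C₄))) (ι-mono (ℕₚ.n≤1+n (proj₁ (archimedean (ι 2 * R * C₄)))))

  c₁ c₂ c₃ c₅ c₆ : ℚ
  c₁ = R * C₁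
  c₂ = ι 2 * R * (C₄ * ι D₀ + C₅)
  c₃ = ι 2 * R * (ι 3 + ι 2 * C₃)
  c₅ = R * (ρ * (ι 32 + ι 4 * ι N))
  c₆ = ι 12 * C₆

  private
    k′ = archimedean (c₁ + c₂ + c₃ + ι 4 + c₅ + c₆)

  -- k is chosen last, above every constant including those depending on D₀ and N. The ratio J / k =
  -- m keeps J + 4 below ρ k.
  k J : ℕ
  k = suc (proj₁ k′)
  J = m ℕ.* k

  1≤k : 1 ℕ.≤ k
  1≤k = s≤s z≤n

  open Geometric k 1≤k public

  K : ℚ
  K = ι k

  private
    0≤c₁ : 0ℚ ≤ c₁
    0≤c₁ = 0≤-* 0≤R 0≤C₁
    0≤c₂ : 0ℚ ≤ c₂
    0≤c₂ = 0≤-* (0≤-* (0≤ι 2) 0≤R) (0≤-+ (0≤-* 0≤C₄ (0≤ι D₀)) 0≤C₅)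
    0≤c₃ : 0ℚ ≤ c₃
    0≤c₃ = 0≤-* (0≤-* (0≤ι 2) 0≤R) (0≤-+ (0≤ι 3) (0≤-* (0≤ι 2) 0≤C₃))
    0≤c₅ : 0ℚ ≤ c₅
    0≤c₅ = 0≤-* 0≤R (0≤-* (0≤ι M) (0≤-+ (0≤ι 32) (0≤-* (0≤ι 4) (0≤ι N))))
    0≤c₆ : 0ℚ ≤ c₆
    0≤c₆ = 0≤-* (0≤ι 12) (0≤-+ (0≤-* (0≤-* (0≤ι 8) (0≤ι z₀)) (0≤-* (0≤ι 38) (0≤ι q))) (0≤-* (0≤ι 4) (0≤ι A₀)))

    sum≤K : c₁ + c₂ + c₃ + ι 4 + c₅ + c₆ ≤ K
    sum≤K = ≤-trans (proj₂ k′) (ι-mono (ℕₚ.n≤1+n (proj₁ k′)))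

    bounds : c₁ ≤ K × c₂ ≤ K × c₃ ≤ K × ι 4 ≤ K × c₅ ≤ K × c₆ ≤ K
    bounds = left 0≤c₂ s₂ , right 0≤c₁ s₂ , right (0≤-+ 0≤c₁ 0≤c₂) s₃ , right (0≤-+ (0≤-+ 0≤c₁ 0≤c₂) 0≤c₃) s₄ ,
      right (0≤-+ (0≤-+ (0≤-+ 0≤c₁ 0≤c₂) 0≤c₃) (0≤ι 4)) s₅ , right (0≤-+ (0≤-+ (0≤-+ (0≤-+ 0≤c₁ 0≤c₂) 0≤c₃) (0≤ι 4)) 0≤c₅) sum≤K
      where
      left : ∀ {a b} → 0ℚ ≤ b → a + b ≤ K → a ≤ K
      left 0≤b = ≤-trans (a≤a+b 0≤b)
      right : ∀ {a b} → 0ℚ ≤ a → a + b ≤ K → b ≤ K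
      right 0≤a = ≤-trans (b≤a+b 0≤a)
      s₅ : c₁ + c₂ + c₃ + ι 4 + c₅ ≤ K
      s₅ = left 0≤c₆ sum≤K
      s₄ : c₁ + c₂ + c₃ + ι 4 ≤ K
      s₄ = left 0≤c₅ s₅
      s₃ : c₁ + c₂ + c₃ ≤ K
      s₃ = left (0≤ι 4) s₄
      s₂ : c₁ + c₂ ≤ K
      s₂ = left 0≤c₃ s₃

  h₁ : C₁ ≤ τ * K
  h₁ = undo-R R τ C₁ K 0≤τ Rτ (proj₁ bounds)

  h₂ : C₄ * inv D₀ * K + (C₄ * ι D₀ + C₅) ≤ τ * K
  h₂ = C₄-arith R τ C₄ (inv D₀) (ι D₀) (C₄ * ι D₀ + C₅) K 0≤τ (0≤inv D₀) (0≤ι k) Rτ (ι-inv {D₀} (s≤s z≤n)) D-large (proj₁ (proj₂ bounds))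

  h₃ : ι 2 * ν * (K * K) - τ * (K * K) ≤ ν * (quad 0ℚ - pw J * quad (ι J)) - C₃ * (K + 1ℚ)
  h₃ = second-moment-arith ν τ K (ι m) (pw J) C₃ R (ι J) 0≤ν ν≤1 (0≤ι k) (0≤ι m) (0≤pw J) 0≤C₃ 0≤τ (1≤ι {k} 1≤k) Rτ (ι-* m k) tail (proj₁ (proj₂ (proj₂ bounds)))
    where
    tail : ι 4 * (ι M * ι M) * pw J * R ≤ 1ℚ
    tail = ≤-trans (≤-reflexive (trans (((∀ c a w r → c * a * w * r ≡ (c * (a * r)) * w) ∋ solve-∀ ring) (ι 4) (ι M * ι M) (pw J) R)
        (cong (_* pw J) (sym (trans (ι-* (4 ℕ.* n₁) (M ℕ.* M ℕ.* M)) (trans (cong₂ _*_ (ι-* 4 n₁) (trans (ι-* (M ℕ.* M) M) (cong (_* ι M) (ι-* M M))))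
          (trans (((∀ c n a → c * n * (a * a * a) ≡ c * (a * a * (n * a))) ∋ solve-∀ ring) (ι 4) (ι n₁) (ι M)) (cong (λ z → ι 4 * (ι M * ι M * z)) (sym (ι-* n₁ M))))))))))
      (≤-trans (*-monoʳ-≤-nonNeg (pw J) {{nonNegative (0≤pw J)}} (ι-mono (proj₂ (cubic≤exponential (4 ℕ.* n₁))))) (pw-tail m))

  h₄ : ι J + ι 4 ≤ ρ * K
  h₄ = ≤-trans (≤-reflexive (cong (_+ ι 4) (ι-* m k))) (lin (proj₁ (proj₂ (proj₂ (proj₂ bounds)))) (((∀ m K → (m + 1ℚ) * K + ι 4 ≡ m * K + ι 4 + K) ∋ solve-∀ ring) (ι m) K))

  h₅ : ρ * (ι 32 + ι 4 * ι N) ≤ τ * K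
  h₅ = undo-R R τ (ρ * (ι 32 + ι 4 * ι N)) K 0≤τ Rτ (proj₁ (proj₂ (proj₂ (proj₂ (proj₂ bounds)))))

  h₆ : ι 12 * C₆ ≤ K
  h₆ = proj₂ (proj₂ (proj₂ (proj₂ (proj₂ bounds))))

  private
    -- With x = m t, all five conditions follow from the chain x ≤ f x ≤ f² x ≤ f³ x ≤ f⁴ x,
    -- dividing by f through v = 1 / f. The constant 12 · 24 of the fourth condition covers the
    -- others.
    small-τ : ∀ f v t m → 1ℚ ≤ f → f * v ≡ 1ℚ → 0ℚ ≤ v → 0ℚ ≤ t → 1ℚ ≤ m → ι 12 * ι 24 * (f * (f * (f * f))) * (m * t) ≤ 1ℚ →
      ι 12 * f * t ≤ v × ι 8 * (ι 12 * f * t + ι 4 * t + f * (t + m * (ι 12 * f * t))) ≤ v * v × ι 2 * f * (ι 4 * t + (t + m * (ι 12 * f * t))) ≤ v × ι 24 * (f * (ι 12 * f * t)) ≤ 1ℚ × ι 4 * t ≤ v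
    small-τ f v t m 1≤f e 0≤v 0≤t 1≤m h =
      chain-A₁ ,
      chain-A₂ ,
      chain-A₃ ,
      chain-A₄ ,
      chain-A₅
      where
      x x₁ x₂ x₃ x₄ : ℚ
      x = m * t
      x₁ = f * x
      x₂ = f * x₁
      x₃ = f * x₂
      x₄ = f * x₃
      up : ∀ {y} → 0ℚ ≤ y → y ≤ f * y
      up {y} h = ≤-trans (≤-reflexive (sym (*-identityˡ y))) (*-monoʳ-≤-nonNeg y {{nonNegative h}} 1≤f)
      0≤f : 0ℚ ≤ f
      0≤f = ≤-trans 0≤1 1≤f
      0≤x : 0ℚ ≤ x
      0≤x = 0≤-* (≤-trans 0≤1 1≤m) 0≤t
      0≤x₁ : 0ℚ ≤ x₁
      0≤x₁ = 0≤-* 0≤f 0≤x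
      0≤x₂ : 0ℚ ≤ x₂
      0≤x₂ = 0≤-* 0≤f 0≤x₁
      0≤x₃ : 0ℚ ≤ x₃
      0≤x₃ = 0≤-* 0≤f 0≤x₂
      x≤ : x ≤ x₁
      x≤ = up 0≤x
      x₁≤ : x₁ ≤ x₂
      x₁≤ = up 0≤x₁
      x₂≤ : x₂ ≤ x₃
      x₂≤ = up 0≤x₂
      x₃≤ : x₃ ≤ x₄
      x₃≤ = up 0≤x₃
      t≤ : t ≤ x
      t≤ = ≤-trans (≤-reflexive (sym (*-identityˡ t))) (*-monoʳ-≤-nonNeg t {{nonNegative 0≤t}} 1≤m)
      ft≤ : f * t ≤ x₁
      ft≤ = 0≤f ·≤ t≤
      T₃ : ι 12 * ι 24 * x₃ ≤ v
      T₃ = T₃-arith f v x e 0≤v (≤-trans (≤-reflexive (((∀ c f x → c * (f * (f * (f * (f * x)))) ≡ c * (f * (f * (f * f))) * x) ∋ solve-∀ ring) (ι 12 * ι 24) f x)) h)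
      T₂ : ι 12 * ι 24 * x₂ ≤ v * v
      T₂ = T₂-arith f v x₂ e 0≤v T₃
      chain-A₁ : ι 12 * f * t ≤ v
      chain-A₁ = A₁-arith (f * t) x₁ x₂ x₃ v f t refl ft≤ x₁≤ x₂≤ 0≤x₃ T₃
      chain-A₂ : ι 8 * (ι 12 * f * t + ι 4 * t + f * (t + m * (ι 12 * f * t))) ≤ v * v
      chain-A₂ = A₂-arith f t m (v * v) 0≤x₂ t≤ ft≤ x≤ x₁≤ T₂
      chain-A₃ : ι 2 * f * (ι 4 * t + (t + m * (ι 12 * f * t))) ≤ v
      chain-A₃ = A₃-arith f t m v 0≤x₃ ft≤ x₁≤ x₂≤ T₃
      chain-A₄ : ι 24 * (f * (ι 12 * f * t)) ≤ 1ℚ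
      chain-A₄ = ≤-trans (≤-reflexive (((∀ a b f t → a * (f * (b * f * t)) ≡ b * a * (f * (f * t))) ∋ solve-∀ ring) (ι 24) (ι 12) f t))
        (≤-trans (0≤-* (0≤ι 12) (0≤ι 24) ·≤ ≤-trans (0≤f ·≤ ft≤) (≤-trans x₂≤ x₃≤)) (≤-trans (≤-reflexive (((∀ c f x → c * (f * (f * (f * (f * x)))) ≡ c * (f * (f * (f * f))) * x) ∋ solve-∀ ring) (ι 12 * ι 24) f x)) h))
      chain-A₅ : ι 4 * t ≤ v
      chain-A₅ = ≤-trans (0≤ι 4 ·≤ ≤-trans (up 0≤t) ft≤) (≤-trans (0≤ι 4 ·≤ ≤-trans x₁≤ x₂≤) (≤-trans (grow 0≤x₃) T₃))
        where
        grow : ∀ {y} → 0ℚ ≤ y → ι 4 * y ≤ ι 12 * ι 24 * y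
        grow {y} h = *-monoʳ-≤-nonNeg y {{nonNegative h}} (≤-trans (ι-mono {4} {12} (s≤s (s≤s (s≤s (s≤s z≤n))))) (≤-trans (≤-reflexive (sym (*-identityʳ (ι 12)))) (0≤ι 12 ·≤ 1≤ι {24} (s≤s z≤n))))

    smallness = small-τ φ ν τ ρ 1≤φ φν 0≤ν 0≤τ 1≤ρ (≤-trans (≤-reflexive (cong (ι 12 * ι 24 * (φ * (φ * (φ * φ))) *_) ρτ)) (≤-trans (*-monoʳ-≤-nonNeg (inv n₁) {{nonNegative (0≤inv n₁)}} (≤-trans (proj₂ n₁′) (ι-mono (ℕₚ.n≤1+n (proj₁ n₁′))))) (≤-reflexive (ι-inv {n₁} (s≤s z≤n)))))
      where
      ρτ : ρ * τ ≡ inv n₁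
      ρτ = trans (cong (ι M *_) (inv-* n₁ M)) (trans (((∀ a i j → a * (i * j) ≡ i * (a * j)) ∋ solve-∀ ring) (ι M) (inv n₁) (inv M)) (trans (cong (inv n₁ *_) (ι-inv {M} (s≤s z≤n))) (*-identityʳ (inv n₁))))

  B : ℕ
  B = suc (2 ℕ.^ J)

  x∞ : ℕ
  x∞ = ℕ.pred (2 ℕ.^ J)

  setup : Setup
  setup = record { log = LogConstruction.log B ; q = q ; k = k ; J = J ; 1≤k = 1≤k ; 2^J<B = ℕₚ.≤-refl }

  no-primes-impossible : Coprime l q → (∀ n → N ℕ.< n → n ℕ.≤ x∞ → Prime n → ¬ n ≈ l) → ⊥
  no-primes-impossible cl none = Contradiction.contradiction setup l N D₀ τ ρ
    ((cl , none) , (s≤s z≤n , 0≤τ , inv≤1 n₂ , 1≤ρ) , (h₁ , h₂ , h₃ , h₄ , h₅ , h₆) ,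
      (proj₁ smallness , proj₁ (proj₂ smallness) , A₃ , proj₁ (proj₂ (proj₂ (proj₂ smallness))) , proj₂ (proj₂ (proj₂ (proj₂ smallness)))))
    where
    A₃ : ι 2 * φ * (ι 4 * τ + (τ + ρ * (ι 12 * φ * τ))) ≤ ν
    A₃ = proj₁ (proj₂ (proj₂ smallness))

-- Kept abstract: the witness is found by a search bounded by an astronomical number.
abstract
  dirichlet : ∀ q {{_ : ℕ.NonZero q}} l N → Coprime l q → ∃ λ p → N ℕ.< p × Prime p × p ℕ.% q ≡ l ℕ.% q
  dirichlet q l N cl = found (ℕₚ.anyUpTo? (λ n → (N ℕₚ.<? n) ×-dec (prime? n ×-dec (n ℕ.% q ℕₚ.≟ l ℕ.% q))) (suc x∞))
    where
    open Parameters q l N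
    found : Dec (∃ λ n → n ℕ.< suc x∞ × N ℕ.< n × Prime n × n ℕ.% q ≡ l ℕ.% q) → ∃ λ p → N ℕ.< p × Prime p × p ℕ.% q ≡ l ℕ.% q
    found (yes (n , _ , h)) = n , h
    found (no none) = ⊥-elim (no-primes-impossible cl (λ n N<n n≤ pr e → none (n , s≤s n≤ , N<n , pr , e)))

-- Powers modulo q and the construction of trees

module PowerResidues (q : ℕ) {{q≢0 : ℕ.NonZero q}} where
  open Residues q

  ≈-^ : ∀ {a b} n → a ≈ b → a ℕ.^ n ≈ b ℕ.^ n
  ≈-^ zero e = refl
  ≈-^ {a} {b} (suc n) e = ≈-* {a} {b} {a ℕ.^ n} {b ℕ.^ n} e (≈-^ {a} {b} n e)

  ≈1-^ : ∀ {a} n → a ≈ 1 → a ℕ.^ n ≈ 1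
  ≈1-^ {a} n e = trans (≈-^ {a} {1} n e) (≈-≡ (ℕₚ.^-zeroˡ n))

  coprime-^ : ∀ {a} n → Coprime a q → Coprime (a ℕ.^ n) q
  coprime-^ zero c = coprime-1
  coprime-^ {a} (suc n) c = coprime-* {a} {a ℕ.^ n} c (coprime-^ {a} n c)

  -- Two of the q + 1 powers l⁰, …, l^q agree modulo q.
  order : ∀ {l} → Coprime l q → ∃ λ e → 1 ℕ.≤ e × l ℕ.^ e ≈ 1
  order {l} c = by (Finₚ.pigeonhole (ℕₚ.n<1+n q) (λ i → Fin.fromℕ< (ℕ÷.m%n<n (l ℕ.^ Fin.toℕ i) q)))
    where
    by : (∃ λ i → ∃ λ j → i Fin.< j × Fin.fromℕ< (ℕ÷.m%n<n (l ℕ.^ Fin.toℕ {suc q} i) q) ≡ Fin.fromℕ< (ℕ÷.m%n<n (l ℕ.^ Fin.toℕ {suc q} j) q)) → ∃ λ e → 1 ℕ.≤ e × l ℕ.^ e ≈ 1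
    by (i , j , i<j , eq) = n ℕ.∸ m , ℕₚ.m<n⇒0<n∸m i<j , trans (unit-solve {proj₁ inverse} {l ℕ.^ m} {l ℕ.^ (n ℕ.∸ m)} {l ℕ.^ m} (proj₂ inverse) same) (proj₂ inverse)
      where
      m n : ℕ
      m = Fin.toℕ i
      n = Fin.toℕ j
      inverse : ∃ λ e → e ℕ.* l ℕ.^ m ≈ 1
      inverse = unit-inverse (coprime-^ {l} m c)
      same : l ℕ.^ m ℕ.* l ℕ.^ (n ℕ.∸ m) ≈ l ℕ.^ m
      same = trans (≈-≡ (trans (sym (ℕₚ.^-distribˡ-+-* l m (n ℕ.∸ m))) (cong (l ℕ.^_) (ℕₚ.m+[n∸m]≡n (ℕₚ.<⇒≤ i<j)))))
        (trans (sym (Finₚ.toℕ-fromℕ< (ℕ÷.m%n<n (l ℕ.^ n) q))) (trans (cong Fin.toℕ (sym eq)) (Finₚ.toℕ-fromℕ< (ℕ÷.m%n<n (l ℕ.^ m) q))))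

  power-≈ : ∀ {l} e {{_ : ℕ.NonZero e}} a → l ℕ.^ e ≈ 1 → a ℕ.% e ≡ 1 ℕ.% e → l ℕ.^ a ≈ l
  power-≈ {l} e a h h′ = trans (reduce a) (trans (≈-≡ (cong (l ℕ.^_) h′)) (trans (sym (reduce 1)) (≈-≡ (ℕₚ.*-identityʳ l))))
    where
    reduce : ∀ a → l ℕ.^ a ≈ l ℕ.^ (a ℕ.% e)
    reduce a = trans (≈-≡ (trans (cong (l ℕ.^_) (ℕ÷.m≡m%n+[m/n]*n a e)) (trans (ℕₚ.^-distribˡ-+-* l (a ℕ.% e) (a ℕ./ e ℕ.* e))
        (cong (λ k → l ℕ.^ (a ℕ.% e) ℕ.* l ℕ.^ k) (ℕₚ.*-comm (a ℕ./ e) e)))))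
      (trans (≈-* {l ℕ.^ (a ℕ.% e)} {l ℕ.^ (a ℕ.% e)} {l ℕ.^ (e ℕ.* (a ℕ./ e))} {1} refl
          (trans (≈-≡ (sym (ℕₚ.^-*-assoc l e (a ℕ./ e)))) (≈1-^ {l ℕ.^ e} (a ℕ./ e) h)))
        (≈-≡ (ℕₚ.*-identityʳ (l ℕ.^ (a ℕ.% e)))))

1≤-^ : ∀ {p} n → 1 ℕ.≤ p → 1 ℕ.≤ p ℕ.^ n
1≤-^ zero _ = s≤s z≤n
1≤-^ (suc n) h = 1≤* h (1≤-^ n h)

-- The size bound b for n is kept apart from the bound c of the factorization: at the root n must
-- exceed an arbitrary N while the primes need only exceed 0; inside a forest both bounds are the
-- preceding prime.
attach : ∀ q {{_ : ℕ.NonZero q}} {b p a s ss l} → Prime p → b ℕ.< p → 1 ℕ.≤ a → IsTreeOf a s →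
  p ℕ.^ a ℕ.% q ≡ l ℕ.% q → (∃ λ m → 1 ℕ.≤ m × m ℕ.% q ≡ 1 ℕ.% q × Factorization m p ss) →
  ∃ λ n → b ℕ.< n × n ℕ.% q ≡ l ℕ.% q × (∀ {c} → c ℕ.< p → Factorization n c (s ∷ ss))
attach q {b} {p} {a} {l = l} pr b<p 1≤a a-tree e (m , 1≤m , m≡1 , m-forest) =
  p ℕ.^ a ℕ.* m ,
  ℕₚ.<-≤-trans b<p (ℕₚ.≤-trans (p≤ a 1≤a) (ℕₚ.m≤m*n (p ℕ.^ a) m {{ℕ.>-nonZero 1≤m}})) ,
  trans (Residues.≈-* q {p ℕ.^ a} {l} {m} {1} e m≡1) (cong (ℕ._% q) (ℕₚ.*-identityʳ l)) ,
  λ c<p → cons pr c<p 1≤a a-tree m-forest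
  where
  p≤ : ∀ a → 1 ℕ.≤ a → p ℕ.≤ p ℕ.^ a
  p≤ (suc a) _ = ℕₚ.m≤m*n p (p ℕ.^ a) {{ℕ.>-nonZero (1≤-^ a (prime≥1 pr))}}

-- The first prime is taken ≡ l and its exponent ≡ 1 modulo the order of l; all other primes are taken ≡ 1.
mutual
  tree-in-class : ∀ t → HasEdge t → ∀ q {{_ : ℕ.NonZero q}} l N → Coprime l q → ∃ λ n → N ℕ.< n × n ℕ.% q ≡ l ℕ.% q × IsTreeOf n t
  tree-in-class (node (s ∷ ss)) _ q l N cl = by-order (PowerResidues.order q cl)
    where
    module _ (e : ℕ) (1≤e : 1 ℕ.≤ e) (l^e≈1 : l ℕ.^ e ℕ.% q ≡ 1 ℕ.% q) where
      instance
        e≢0 : ℕ.NonZero e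
        e≢0 = ℕ.>-nonZero 1≤e
      by-prime : (∃ λ a → 1 ℕ.≤ a × a ℕ.% e ≡ 1 ℕ.% e × IsTreeOf a s) → (∃ λ p → N ℕ.< p × Prime p × p ℕ.% q ≡ l ℕ.% q) →
        ∃ λ n → N ℕ.< n × n ℕ.% q ≡ l ℕ.% q × IsTreeOf n (node (s ∷ ss))
      by-prime (a , 1≤a , a≡1 , a-tree) (p , N<p , pr , p≈l) = conclude (attach q {l = l} pr N<p 1≤a a-tree
          (trans (PowerResidues.≈-^ q {p} {l} a p≈l) (PowerResidues.power-≈ q {l} e a l^e≈1 a≡1)) (forest-in-class ss p q))
        where
        conclude : (∃ λ n → N ℕ.< n × n ℕ.% q ≡ l ℕ.% q × (∀ {c} → c ℕ.< p → Factorization n c (s ∷ ss))) →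
          ∃ λ n → N ℕ.< n × n ℕ.% q ≡ l ℕ.% q × IsTreeOf n (node (s ∷ ss))
        conclude (n , N<n , n≈l , n-forest) = n , N<n , n≈l , tree (n-forest (prime≥1 pr))
    by-order : (∃ λ e → 1 ℕ.≤ e × l ℕ.^ e ℕ.% q ≡ 1 ℕ.% q) → ∃ λ n → N ℕ.< n × n ℕ.% q ≡ l ℕ.% q × IsTreeOf n (node (s ∷ ss))
    by-order (e , 1≤e , l^e≈1) = by-prime e 1≤e l^e≈1 (exponent-in-class s e {{ℕ.>-nonZero 1≤e}}) (dirichlet q l N cl)

  -- A leaf forces the exponent 1, which lies in the class 1 for every modulus; any other child is
  -- the theorem for a smaller tree in that class.
  exponent-in-class : ∀ s e {{_ : ℕ.NonZero e}} → ∃ λ a → 1 ℕ.≤ a × a ℕ.% e ≡ 1 ℕ.% e × IsTreeOf a s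
  exponent-in-class (node []) e = 1 , s≤s z≤n , refl , tree []
  exponent-in-class (node (s ∷ ss)) e = tree-in-class (node (s ∷ ss)) (hasEdge s ss) e 1 0 (Residues.coprime-1 e)

  forest-in-class : ∀ ss b q {{_ : ℕ.NonZero q}} → ∃ λ m → 1 ℕ.≤ m × m ℕ.% q ≡ 1 ℕ.% q × Factorization m b ss
  forest-in-class [] b q = 1 , s≤s z≤n , refl , []
  -- All powers of a prime ≡ 1 are ≡ 1, so the exponent is unconstrained, which is expressed by the
  -- modulus 1.
  forest-in-class (s ∷ ss) b q = by-prime (exponent-in-class s 1) (dirichlet q 1 b (Residues.coprime-1 q))
    where
    by-prime : (∃ λ a → 1 ℕ.≤ a × a ℕ.% 1 ≡ 1 ℕ.% 1 × IsTreeOf a s) → (∃ λ p → b ℕ.< p × Prime p × p ℕ.% q ≡ 1 ℕ.% q) →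
      ∃ λ m → 1 ℕ.≤ m × m ℕ.% q ≡ 1 ℕ.% q × Factorization m b (s ∷ ss)
    by-prime (a , 1≤a , _ , a-tree) (p , b<p , pr , p≡1) = conclude (attach q {l = 1} pr b<p 1≤a a-tree (PowerResidues.≈1-^ q {p} a p≡1) (forest-in-class ss p q))
      where
      conclude : (∃ λ n → b ℕ.< n × n ℕ.% q ≡ 1 ℕ.% q × (∀ {c} → c ℕ.< p → Factorization n c (s ∷ ss))) →
        ∃ λ m → 1 ℕ.≤ m × m ℕ.% q ≡ 1 ℕ.% q × Factorization m b (s ∷ ss)
      conclude (n , b<n , n≡1 , n-forest) = n , ℕₚ.≤-trans (s≤s z≤n) b<n , n≡1 , n-forest b<p

-- From residues of natural numbers to congruences of integers

theorem5 : (t : Tree) → HasEdge t → (q : ℕ) → 1 ℕ.≤ q → (a : ℤ.ℤ) → Coprime q ℤ.∣ a ∣ →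
    (N : ℕ) → Σ ℕ (λ n → N ℕ.< n × (ℤ.+ q ℤ∣.∣ (ℤ.+ n ℤ.- a)) × IsTreeOf n t)
theorem5 t edge q 1≤q a cop N = conclude (tree-in-class t edge q l N coprime-l)
  where
  instance
    q≢0 : ℕ.NonZero q
    q≢0 = ℕ.>-nonZero 1≤q
  l : ℕ
  l = a ℤ÷.%ℕ q
  z : ℤ.ℤ
  z = a ℤ÷./ℕ q
  a≡ : a ≡ ℤ.+ l ℤ.+ z ℤ.* ℤ.+ q
  a≡ = ℤ÷.a≡a%ℕn+[a/ℕn]*n a q
  coprime-l : Coprime l q
  coprime-l {k} (k∣l , k∣q) = cop (k∣q , subst (λ b → ℤ.+ k ℤ∣.∣ b) (sym a≡)
    (ℤ∣ₛ.∣⇒∣ᵤ (ℤ∣ₛ.∣m∣n⇒∣m+n {ℤ.+ k} {ℤ.+ l} {z ℤ.* ℤ.+ q} (ℤ∣ₛ.∣ᵤ⇒∣ k∣l) (ℤ∣ₛ.∣n⇒∣m*n z (ℤ∣ₛ.∣ᵤ⇒∣ k∣q)))))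
  difference : ∀ r y z q → (r ℤ.+ y ℤ.* q) ℤ.- (r ℤ.+ z ℤ.* q) ≡ (y ℤ.- z) ℤ.* q
  difference = ℤ-Solver.solve-∀
  ≡⇒∣ : ∀ n → n ℕ.% q ≡ l ℕ.% q → ℤ.+ q ℤ∣.∣ (ℤ.+ n ℤ.- a)
  ≡⇒∣ n e = ℤ∣ₛ.∣⇒∣ᵤ (ℤ∣ₛ.divides (ℤ.+ (n ℕ./ q) ℤ.- z)
    (trans (cong₂ ℤ._-_ n≡ a≡) (difference (ℤ.+ l) (ℤ.+ (n ℕ./ q)) z (ℤ.+ q))))
    where
    n≡ : ℤ.+ n ≡ ℤ.+ l ℤ.+ ℤ.+ (n ℕ./ q) ℤ.* ℤ.+ q
    n≡ = trans (cong ℤ.+_ (trans (ℕ÷.m≡m%n+[m/n]*n n q) (cong (ℕ._+ n ℕ./ q ℕ.* q) (trans e (ℕ÷.m<n⇒m%n≡m (ℤ÷.n%ℕd<d a q))))))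
      (cong (ℤ._+_ (ℤ.+ l)) (ℤₚ.pos-* (n ℕ./ q) q))
  conclude : (∃ λ n → N ℕ.< n × n ℕ.% q ≡ l ℕ.% q × IsTreeOf n t) → Σ ℕ (λ n → N ℕ.< n × (ℤ.+ q ℤ∣.∣ (ℤ.+ n ℤ.- a)) × IsTreeOf n t)
  conclude (n , N<n , n≡l , n-tree) = n , N<n , ≡⇒∣ n n≡l , n-tree
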